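{- Fix an integer $m\ge 2$. For $n\ge 1$ and a partition $\alpha\vdash n$, let $G_\alpha(m)$ be the number of $m$-tuples $(\pi_1,\dots,\pi_m)$ of permutations in $S_n$ such that $\pi_1\pi_2\cdots\pi_m=\pi$, where $\pi$ is a fixed permutation of cycle type $\alpha$, the group $\langle\pi_1,\dots,\pi_m\rangle$ acts transitively on $\{1,\dots,n\}$, and the total number of cycles of $\pi_1,\dots,\pi_m$ (counting fixed points as cycles) equals $c(\alpha)=(m-1)n-l(\alpha)+2$. Define the formal power series $$G=\sum_{n\ge1}\sum_{\alpha\vdash n}G_\alpha(m)\,\frac{z^n}{n!}\,|\mathcal{C}_\alpha|\,u^{l(\alpha)}\,p_\alpha\,x^{(m-1)n-l(\alpha)+2},$$ let $A(t)=\sum_{i\ge1}\binom{mi-1}{i}u\,p_i\,t^i$, and let $w$ be the unique formal power series in $z$ (with coefficients in $\mathbb{Q}[x,u,p_1,p_2,\dots]$ and zero constant term) satisfying $w=z\,(x+A(w))^{m-1}$. Then $$\left(z\frac{\partial}{\partial z}\right)\left((m-1)z\frac{\partial}{\partial z}+1\right)G=\frac{m}{m-1}\,x\,A(w)+\frac{m}{2(m-1)}A(w)^2,$$ and $$\left(z\frac{\partial}{\partial z}\right)\left(\frac{\partial}{\partial x}\right)G=\frac{m}{m-1}A(w).$$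
   Context: A partition $\alpha=(\alpha_1,\dots,\alpha_k)$ of $n$ (written $\alpha\vdash n$) has $l(\alpha)=k$ parts; $p_\alpha=p_{\alpha_1}\cdots p_{\alpha_k}$ where $p_1,p_2,\dots$ are indeterminates; $\mathcal{C}_\alpha\subseteq S_n$ is the conjugacy class of permutations of cycle type $\alpha$, so $|\mathcal{C}_\alpha|=n!/\prod_{i\ge1}i^{d_i}d_i!$ if $\alpha$ has $d_i$ parts equal to $i$. $z,u,x,p_1,p_2,\dots$ are independent indeterminates. It is known (Bousquet-Mélou and Schaeffer) that $G_\alpha(m)=m\frac{((m-1)n-1)!}{((m-1)n-l(\alpha)+2)!}\prod_{i\ge1}\left(i\binom{mi-1}{i}\right)^{d_i}$. -}

module Defs where

open import Data.Nat as ℕ using (ℕ; zero; suc; _+_; _*_; _∸_; _^_; _!; _≤ᵇ_)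
open import Data.Nat.Base using (_≡ᵇ_)
open import Data.Nat.Combinatorics using (_C_)
open import Data.Integer using (+_)
open import Data.Rational as ℚ using (ℚ; 0ℚ; 1ℚ)
open import Data.Bool using (Bool; true; false; _∧_; if_then_else_)
open import Data.Fin using (Fin; toℕ)
open import Data.Vec using (Vec; []; _∷_; lookup)
open import Data.List as L using (List; []; _∷_; length; upTo; allFin; filterᵇ; concatMap; map)
open import Data.Nat.ListAction using (sum)
open import Data.Bool.ListAction using (and)
open import Data.List.Relation.Unary.Unique.Propositional using (Unique)
open import Data.List.Membership.Propositional using (_∈_)
open import Data.Product using (Σ; ∃; _×_; _,_)
open import Relation.Binary.PropositionalEquality using (_≡_)

ℕtoℚ : ℕ → ℚ
ℕtoℚ k = + k ℚ./ 1

-- frac a b = a / b  (for b ≥ 1; the value at b = 0 is an irrelevant default)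
frac : ℕ → ℕ → ℚ
frac a zero = 0ℚ
frac a (suc b) = + a ℚ./ suc b

sumℚ : List ℚ → ℚ
sumℚ = L.foldr ℚ._+_ 0ℚ

-- Partitions as multiplicity lists:  d = (d₁ , d₂ , … , d_k) where dᵢ is
-- the number of parts equal to i (the list entry at position j is the
-- multiplicity of the part j+1).  Trailing zeros are allowed and harmless.

mult : List ℕ → ℕ → ℕ
mult [] i = 0
mult (k ∷ d) zero = k
mult (k ∷ d) (suc i) = mult d i

nparts : List ℕ → ℕ
nparts = sum

weightFrom : ℕ → List ℕ → ℕ
weightFrom i [] = 0
weightFrom i (k ∷ d) = i * k + weightFrom (suc i) d

weight : List ℕ → ℕ
weight = weightFrom 1

-- Π i^{dᵢ} dᵢ!   (so that |C_α| / n! = 1 / zα d)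
zαFrom : ℕ → List ℕ → ℕ
zαFrom i [] = 1
zαFrom i (k ∷ d) = (i ^ k) * (k !) * zαFrom (suc i) d

zα : List ℕ → ℕ
zα = zαFrom 1

allZero : List ℕ → Bool
allZero [] = true
allZero (k ∷ d) = (k ≡ᵇ 0) ∧ allZero d

-- isE i d : d is the exponent vector of the single variable p_{i+1}
isE : ℕ → List ℕ → Bool
isE i [] = false
isE zero (k ∷ d) = (k ≡ᵇ 1) ∧ allZero d
isE (suc i) (k ∷ d) = (k ≡ᵇ 0) ∧ isE i d

splits : List ℕ → List (List ℕ × List ℕ)
splits [] = ([] , []) ∷ []
splits (k ∷ d) =
  concatMap (λ j → map (λ { (d₁ , d₂) → (j ∷ d₁ , (k ∸ j) ∷ d₂) }) (splits d))
            (upTo (suc k))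

-- Formal power series in z, x, u, p₁, p₂, … with rational coefficients.
-- F n a b d  is the coefficient of  z^n x^a u^b Π_i p_i^{mult d (i-1)}.

Series : Set
Series = ℕ → ℕ → ℕ → List ℕ → ℚ

infix 4 _≈S_
_≈S_ : Series → Series → Set
F ≈S H = ∀ n a b d → F n a b d ≡ H n a b d

infixl 6 _⊕_
_⊕_ : Series → Series → Series
(F ⊕ H) n a b d = F n a b d ℚ.+ H n a b d

scale : ℚ → Series → Series
scale c F n a b d = c ℚ.* F n a b d

infixl 7 _⊛_
_⊛_ : Series → Series → Series
(F ⊛ H) n a b d =
  sumℚ (map (λ n₁ →
  sumℚ (map (λ a₁ →
  sumℚ (map (λ b₁ →
  sumℚ (map (λ { (d₁ , d₂) →
     F n₁ a₁ b₁ d₁ ℚ.* H (n ∸ n₁) (a ∸ a₁) (b ∸ b₁) d₂ })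
     (splits d)))
     (upTo (suc b))))
     (upTo (suc a))))
     (upTo (suc n)))

oneS : Series
oneS n a b d = if (n ≡ᵇ 0) ∧ (a ≡ᵇ 0) ∧ (b ≡ᵇ 0) ∧ allZero d then 1ℚ else 0ℚ

powS : Series → ℕ → Series
powS F zero = oneS
powS F (suc k) = F ⊛ powS F k

zS : Series
zS n a b d = if (n ≡ᵇ 1) ∧ (a ≡ᵇ 0) ∧ (b ≡ᵇ 0) ∧ allZero d then 1ℚ else 0ℚ

xS : Series
xS n a b d = if (n ≡ᵇ 0) ∧ (a ≡ᵇ 1) ∧ (b ≡ᵇ 0) ∧ allZero d then 1ℚ else 0ℚ

uS : Series
uS n a b d = if (n ≡ᵇ 0) ∧ (a ≡ᵇ 0) ∧ (b ≡ᵇ 1) ∧ allZero d then 1ℚ else 0ℚ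

-- pS i = p_{i+1}
pS : ℕ → Series
pS i n a b d = if (n ≡ᵇ 0) ∧ (a ≡ᵇ 0) ∧ (b ≡ᵇ 0) ∧ isE i d then 1ℚ else 0ℚ

θz : Series → Series
θz F n a b d = ℕtoℚ n ℚ.* F n a b d

∂x : Series → Series
∂x F n a b d = ℕtoℚ (suc a) ℚ.* F n (suc a) b d

-- A(w) = Σ_{i≥1} C(mi-1,i) u p_i w^i, substituted into a series w with
-- zero constant term in z: only i ≤ n contributes to the z^n coefficient.
Aof : ℕ → Series → Series
Aof m w n a b d =
  sumℚ (map (λ j → ℕtoℚ ((m * suc j ∸ 1) C suc j) ℚ.*
                    (uS ⊛ pS j ⊛ powS w (suc j)) n a b d)
            (upTo n))

IsPerm : ∀ {n} → Vec (Fin n) n → Set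
IsPerm σ = ∀ i j → lookup σ i ≡ lookup σ j → i ≡ j

iter : ∀ {n} → Vec (Fin n) n → ℕ → Fin n → Fin n
iter σ zero i = i
iter σ (suc k) i = lookup σ (iter σ k i)

isMin : ∀ {n} → Vec (Fin n) n → Fin n → Bool
isMin {n} σ j = and (map (λ k → toℕ j ≤ᵇ toℕ (iter σ k j)) (upTo n))

ncycles : ∀ {n} → Vec (Fin n) n → ℕ
ncycles {n} σ = length (filterᵇ (isMin σ) (allFin n))

firstReturn : ∀ {n} → Vec (Fin n) n → Fin n → List ℕ → ℕ
firstReturn σ j [] = 0
firstReturn σ j (k ∷ ks) =
  if toℕ (iter σ k j) ≡ᵇ toℕ j then k else firstReturn σ j ks

orbitLen : ∀ {n} → Vec (Fin n) n → Fin n → ℕ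
orbitLen {n} σ j = firstReturn σ j (map suc (upTo n))

cyclesOfLen : ∀ {n} → Vec (Fin n) n → ℕ → ℕ
cyclesOfLen {n} σ i =
  length (filterᵇ (λ j → isMin σ j ∧ (orbitLen σ j ≡ᵇ i)) (allFin n))

CycleType : ∀ {n} → Vec (Fin n) n → List ℕ → Set
CycleType σ d = ∀ i → cyclesOfLen σ (suc i) ≡ mult d i

applyAll : ∀ {n m} → Vec (Vec (Fin n) n) m → Fin n → Fin n
applyAll [] i = i
applyAll (σ ∷ t) i = lookup σ (applyAll t i)

applyWord : ∀ {n m} → Vec (Vec (Fin n) n) m → List (Fin m) → Fin n → Fin n
applyWord t [] i = i
applyWord t (k ∷ ws) i = lookup (lookup t k) (applyWord t ws i)

Transitive : ∀ {n m} → Vec (Vec (Fin n) n) m → Set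
Transitive {n} {m} t = ∀ (i j : Fin n) → ∃ λ (ws : List (Fin m)) → applyWord t ws i ≡ j

totalCycles : ∀ {n m} → Vec (Vec (Fin n) n) m → ℕ
totalCycles [] = 0
totalCycles (σ ∷ t) = ncycles σ + totalCycles t

Good : (m n : ℕ) → Vec (Fin n) n → List ℕ → Vec (Vec (Fin n) n) m → Set
Good m n π d t =
  (∀ k → IsPerm (lookup t k)) ×
  (∀ i → applyAll t i ≡ lookup π i) ×
  Transitive t ×
  (totalCycles t ≡ (m ∸ 1) * n ∸ nparts d + 2)

IsCount : {A : Set} → (A → Set) → ℕ → Set
IsCount {A} P k =
  Σ (List A) λ xs → Unique xs × (∀ t → (t ∈ xs → P t) × (P t → t ∈ xs)) × length xs ≡ k

GCounts : ℕ → (ℕ → List ℕ → ℕ) → Set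
GCounts m g = ∀ n d (π : Vec (Fin n) n) → 1 ℕ.≤ n → IsPerm π → CycleType π d →
  IsCount (Good m n π d) (g n d)

GS : ℕ → (ℕ → List ℕ → ℕ) → Series
GS m g n a b d =
  if (1 ≤ᵇ n) ∧ (weight d ≡ᵇ n) ∧ (b ≡ᵇ nparts d) ∧ (a ≡ᵇ ((m ∸ 1) * n ∸ nparts d + 2))
  then ℕtoℚ (g n d) ℚ.* frac 1 (zα d)
  else 0ℚ

{-# OPTIONS --safe #-}
-- Fix a point e and count the planar factorizations of a permutation whose factors of index ≥ k fix e. Going from k to
-- k + 1, multiply the factor of index k by the transposition that makes it fix e: the product either gains a merged
-- cycle, or its cycle through e is split and, the genus being 0, the factorization falls apart into two independent
-- ones. As functions of the lengths of the other cycles these numbers form a shuffle algebra, in which they satisfy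
--   x_{k+1}(a) = x_k(a) + Σ_b p_b x_k(a + b) + Σ_{i<a} x_k(i) t(a - i),   x_m(a) = t(a + 1).
-- The recurrence is solved by polynomials in an auxiliary variable: the transfer operator is, up to a correction that
-- vanishes in the limit, multiplication by an explicit series ρ, provided that w = c^(m-1) with c = 1 + A(w). This makes
-- θ_z G a polynomial in c and two coefficients r1, r2 of ρ, with c = 1 + (m - 1) r1, and the derivations θ_z and x ∂_x
-- eliminate r2. Everything being homogeneous, the two scalar identities with x = z = u = 1 are the theorem.
module Submission where

-- The recurrence is nonlinear, since its kernel `t` is the final row `x_m`; the kernel is therefore
-- guessed and the closing condition verified. A row (x_k(a))_a is read as the expansion at s = 1 of
-- one function in the local parameter 1/Y = (s - 1)/s^m. A step of the recurrence is then a
-- Toeplitz operator with symbol 1 + Σ p_b Y^b + Σ t(j) Y^(-j), up to a rescaling by powers of w.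
-- The guess: choose the part in negative powers of Y such that the symbol becomes s ρ(1/s) with an
-- invertible series ρ, in the manner of a Wiener-Hopf factorization. The k-th iterate divided by
-- the k-th power of the symbol converges, and a commutation relation passed to the limit yields one
-- equation for two errors, that of the closing condition and that of a generating function
-- identity. To lowest order in the number of parts their supports in s are disjoint, so both vanish
-- degree by degree. The identity then expresses the numbers x_k(0) by ρ, and x_2(0) - 1 is θ_z G
-- with x = z = u = 1.

module Rings where

  open import Level using (0ℓ)
  open import Algebra.Bundles using (CommutativeRing)
  open import Data.Nat as ℕ using (ℕ; zero; suc)
  open import Data.Integer as ℤ using (ℤ; +_; -[1+_])
  import Data.Integer.Properties as ℤP
  open import Data.List using (List; []; _∷_)
  open import Data.Product using (_,_)
  open import Data.Maybe using (Maybe; just; nothing)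
  open import Relation.Nullary using (yes; no)
  open import Relation.Binary.PropositionalEquality as ≡ using (_≡_)

  -- Integer constants in ring solvers, shuffle rings and power series rings.

  module IntegerSolver (R : CommutativeRing 0ℓ 0ℓ) where
    open CommutativeRing R
    open import Algebra.Properties.Ring ring
      using (-‿distribˡ-*; -‿distribʳ-*; -0#≈0#; -‿involutive; -‿+-comm)
    open import Algebra.Properties.Semiring.Mult.TCOptimised semiring
      using (×-homo-+; ×1-homo-*) renaming (_×_ to _⋆_)
    open import Relation.Binary.Reasoning.Setoid setoid
    open import Algebra.Solver.Ring.AlmostCommutativeRing
      using (fromCommutativeRing; _-Raw-AlmostCommutative⟶_; Induced-equivalence)

    -- The optimised multiples reduce `⟦ + 1 ⟧ℤ` to `1#` itself, so that constants in solver
    -- equations match those of the goals definitionally.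
    ⟦_⟧ℤ : ℤ → Carrier
    ⟦ + n ⟧ℤ = n ⋆ 1#
    ⟦ -[1+ n ] ⟧ℤ = - (suc n ⋆ 1#)

    private
      suc⋆ : ∀ n → suc n ⋆ 1# ≈ 1# + n ⋆ 1#
      suc⋆ n = ×-homo-+ 1# 1 n

      cancel : ∀ a b → (1# + a) - (1# + b) ≈ a - b
      cancel a b = begin
        (1# + a) - (1# + b)        ≈⟨ +-congˡ (sym (-‿+-comm 1# b)) ⟩
        (1# + a) + (- 1# + - b)    ≈⟨ +-congʳ (+-comm 1# a) ⟩
        (a + 1#) + (- 1# + - b)    ≈⟨ +-assoc a 1# _ ⟩
        a + (1# + (- 1# + - b))    ≈⟨ +-congˡ (sym (+-assoc 1# (- 1#) (- b))) ⟩
        a + ((1# + - 1#) + - b)    ≈⟨ +-congˡ (+-congʳ (-‿inverseʳ 1#)) ⟩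
        a + (0# + - b)             ≈⟨ +-congˡ (+-identityˡ _) ⟩
        a - b                      ∎

      ⊖-homo : ∀ m n → ⟦ m ℤ.⊖ n ⟧ℤ ≈ m ⋆ 1# - n ⋆ 1#
      ⊖-homo m zero = sym (trans (+-congˡ -0#≈0#) (+-identityʳ _))
      ⊖-homo zero (suc n) = sym (+-identityˡ _)
      ⊖-homo (suc m) (suc n) = begin
        ⟦ suc m ℤ.⊖ suc n ⟧ℤ            ≈⟨ reflexive (≡.cong ⟦_⟧ℤ (ℤP.[1+m]⊖[1+n]≡m⊖n m n)) ⟩
        ⟦ m ℤ.⊖ n ⟧ℤ                    ≈⟨ ⊖-homo m n ⟩
        m ⋆ 1# - n ⋆ 1#                 ≈⟨ cancel _ _ ⟨
        (1# + m ⋆ 1#) - (1# + n ⋆ 1#)   ≈⟨ +-cong (suc⋆ m) (-‿cong (suc⋆ n)) ⟨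
        suc m ⋆ 1# - suc n ⋆ 1#         ∎

      +-homo : ∀ i j → ⟦ i ℤ.+ j ⟧ℤ ≈ ⟦ i ⟧ℤ + ⟦ j ⟧ℤ
      +-homo (+ m) (+ n) = ×-homo-+ 1# m n
      +-homo (+ m) -[1+ n ] = ⊖-homo m (suc n)
      +-homo -[1+ m ] (+ n) = trans (⊖-homo n (suc m)) (+-comm _ _)
      +-homo -[1+ m ] -[1+ n ] = begin
        - (suc (suc (m ℕ.+ n)) ⋆ 1#)      ≈⟨ -‿cong (reflexive (≡.cong (_⋆ 1#) (≡.cong suc (≡.sym (ℕ-lemma m n))))) ⟩
        - ((suc m ℕ.+ suc n) ⋆ 1#)        ≈⟨ -‿cong (×-homo-+ 1# (suc m) (suc n)) ⟩
        - (suc m ⋆ 1# + suc n ⋆ 1#)       ≈⟨ -‿+-comm _ _ ⟨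
        - (suc m ⋆ 1#) + - (suc n ⋆ 1#)   ∎
        where
        open import Data.Nat.Properties using (+-suc)
        ℕ-lemma : ∀ m n → m ℕ.+ suc n ≡ suc (m ℕ.+ n)
        ℕ-lemma m n = +-suc m n

      neg-homo : ∀ i → ⟦ ℤ.- i ⟧ℤ ≈ - ⟦ i ⟧ℤ
      neg-homo (+ zero) = sym -0#≈0#
      neg-homo (+ suc n) = refl
      neg-homo -[1+ n ] = sym (-‿involutive _)

      *-homo⁺ : ∀ m j → ⟦ + m ℤ.* j ⟧ℤ ≈ ⟦ + m ⟧ℤ * ⟦ j ⟧ℤ
      *-homo⁺ m (+ n) = trans (reflexive (≡.cong ⟦_⟧ℤ (≡.sym (ℤP.pos-* m n)))) (×1-homo-* m n)
      *-homo⁺ m -[1+ n ] = begin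
        ⟦ + m ℤ.* -[1+ n ] ⟧ℤ       ≈⟨ reflexive (≡.cong ⟦_⟧ℤ (≡.sym (ℤP.neg-distribʳ-* (+ m) (+ suc n)))) ⟩
        ⟦ ℤ.- (+ m ℤ.* + suc n) ⟧ℤ  ≈⟨ neg-homo (+ m ℤ.* + suc n) ⟩
        - ⟦ + m ℤ.* + suc n ⟧ℤ      ≈⟨ -‿cong (*-homo⁺ m (+ suc n)) ⟩
        - (⟦ + m ⟧ℤ * ⟦ + suc n ⟧ℤ) ≈⟨ -‿distribʳ-* _ _ ⟩
        ⟦ + m ⟧ℤ * - ⟦ + suc n ⟧ℤ   ∎

      *-homo : ∀ i j → ⟦ i ℤ.* j ⟧ℤ ≈ ⟦ i ⟧ℤ * ⟦ j ⟧ℤ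
      *-homo (+ m) j = *-homo⁺ m j
      *-homo -[1+ m ] j = begin
        ⟦ -[1+ m ] ℤ.* j ⟧ℤ         ≈⟨ reflexive (≡.cong ⟦_⟧ℤ (≡.sym (ℤP.neg-distribˡ-* (+ suc m) j))) ⟩
        ⟦ ℤ.- (+ suc m ℤ.* j) ⟧ℤ    ≈⟨ neg-homo (+ suc m ℤ.* j) ⟩
        - ⟦ + suc m ℤ.* j ⟧ℤ        ≈⟨ -‿cong (*-homo⁺ (suc m) j) ⟩
        - (⟦ + suc m ⟧ℤ * ⟦ j ⟧ℤ)   ≈⟨ -‿distribˡ-* _ _ ⟩
        - ⟦ + suc m ⟧ℤ * ⟦ j ⟧ℤ     ∎

      homomorphism : ℤ.+-*-rawRing -Raw-AlmostCommutative⟶ fromCommutativeRing R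
      homomorphism = record
        { ⟦_⟧ = ⟦_⟧ℤ ; +-homo = +-homo ; *-homo = *-homo ; -‿homo = neg-homo
        ; 0-homo = refl ; 1-homo = refl }

      dec : ∀ i j → Maybe (⟦ i ⟧ℤ ≈ ⟦ j ⟧ℤ)
      dec i j with i ℤ.≟ j
      ... | yes p = just (reflexive (≡.cong ⟦_⟧ℤ p))
      ... | no _ = nothing

    open import Algebra.Solver.Ring ℤ.+-*-rawRing (fromCommutativeRing R) homomorphism dec public
      using (Polynomial; solve; _:=_; _:+_; _:*_; _:-_; :-_; con; _:^_)

  -- Only one-sided axioms are asked for; commutativity of both operations supplies the other sides.
  -- The shuffle ring and the ring of power series are both obtained from it.
  record RingData : Set₁ where
    field
      Carrier : Set
      _≈_ : Carrier → Carrier → Set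
      _+_ _*_ : Carrier → Carrier → Carrier
      -_ : Carrier → Carrier
      0# 1# : Carrier
      ≈-refl : ∀ {x} → x ≈ x
      ≈-sym : ∀ {x y} → x ≈ y → y ≈ x
      ≈-trans : ∀ {x y z} → x ≈ y → y ≈ z → x ≈ z
      +-cong : ∀ {x y u v} → x ≈ y → u ≈ v → (x + u) ≈ (y + v)
      *-cong : ∀ {x y u v} → x ≈ y → u ≈ v → (x * u) ≈ (y * v)
      -‿cong : ∀ {x y} → x ≈ y → (- x) ≈ (- y)
      +-assoc : ∀ x y z → ((x + y) + z) ≈ (x + (y + z))
      +-comm : ∀ x y → (x + y) ≈ (y + x)
      +-idˡ : ∀ x → (0# + x) ≈ x
      +-invˡ : ∀ x → ((- x) + x) ≈ 0#
      *-assoc : ∀ x y z → ((x * y) * z) ≈ (x * (y * z))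
      *-comm : ∀ x y → (x * y) ≈ (y * x)
      *-idˡ : ∀ x → (1# * x) ≈ x
      distribʳ : ∀ x y z → ((y + z) * x) ≈ ((y * x) + (z * x))

    commutativeRing : CommutativeRing 0ℓ 0ℓ
    commutativeRing = record
      { Carrier = Carrier ; _≈_ = _≈_ ; _+_ = _+_ ; _*_ = _*_ ; -_ = -_ ; 0# = 0# ; 1# = 1#
      ; isCommutativeRing = record
        { isRing = record
          { +-isAbelianGroup = record
            { isGroup = record
              { isMonoid = record
                { isSemigroup = record
                  { isMagma = record
                    { isEquivalence = record { refl = ≈-refl ; sym = ≈-sym ; trans = ≈-trans }
                    ; ∙-cong = +-cong }
                  ; assoc = +-assoc }
                ; identity = +-idˡ , λ x → ≈-trans (+-comm x 0#) (+-idˡ x) }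
              ; inverse = +-invˡ , (λ x → ≈-trans (+-comm x (- x)) (+-invˡ x))
              ; ⁻¹-cong = -‿cong }
            ; comm = +-comm }
          ; *-cong = *-cong
          ; *-assoc = *-assoc
          ; *-identity = *-idˡ , λ x → ≈-trans (*-comm x 1#) (*-idˡ x)
          ; distrib = (λ x y z → ≈-trans (*-comm x (y + z))
                         (≈-trans (distribʳ x y z) (+-cong (*-comm y x) (*-comm z x))))
                    , distribʳ }
        ; *-comm = *-comm } }

  -- A symmetric f encodes the series Σ_β f(β) p_β / Π_b (b^{d_b} d_b!) over partitions β, d_b the multiplicity of b;
  -- products of series become shuffle products.
  module Shuffle (K : CommutativeRing 0ℓ 0ℓ) where
    private module K = CommutativeRing K
    open IntegerSolver K

    Sh : Set
    Sh = List ℕ → K.Carrier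

    infixl 8 _∂_
    infixl 7 _⊠_
    infixl 6 _⊞_
    -- In the encoding with weights 1/z_β, prepending a part b is the derivation b ∂/∂p_b, which
    -- removes one factor b d_b from z_β. The recursive clause of `_⊠_` is its Leibniz rule.
    _∂_ : Sh → ℕ → Sh
    (f ∂ b) β = f (b ∷ β)

    zer one : Sh
    zer _ = K.0#
    one [] = K.1#
    one (_ ∷ _) = K.0#

    -- Shuffling is commutative and associative on all functions of words, so the ring laws hold
    -- without any hypothesis of symmetry.
    _⊞_ _⊠_ : Sh → Sh → Sh
    (f ⊞ g) β = f β K.+ g β
    (f ⊠ g) [] = f [] K.* g []
    (f ⊠ g) (b ∷ β) = (f ∂ b ⊠ g) β K.+ (f ⊠ g ∂ b) β

    neg : Sh → Sh
    neg f β = K.- f β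

    private
      _≋_ : Sh → Sh → Set
      f ≋ g = ∀ β → f β K.≈ g β

      ⊠-cong : ∀ {f f′ g g′} → f ≋ f′ → g ≋ g′ → (f ⊠ g) ≋ (f′ ⊠ g′)
      ⊠-cong p q [] = K.*-cong (p []) (q [])
      ⊠-cong p q (b ∷ β) =
        K.+-cong (⊠-cong (λ γ → p (b ∷ γ)) q β) (⊠-cong p (λ γ → q (b ∷ γ)) β)

      ⊠-comm : ∀ f g → (f ⊠ g) ≋ (g ⊠ f)
      ⊠-comm f g [] = K.*-comm _ _
      ⊠-comm f g (b ∷ β) =
        K.trans (K.+-cong (⊠-comm (f ∂ b) g β) (⊠-comm f (g ∂ b) β)) (K.+-comm _ _)

      ⊠-distribʳ : ∀ h f g → ((f ⊞ g) ⊠ h) ≋ ((f ⊠ h) ⊞ (g ⊠ h))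
      ⊠-distribʳ h f g [] = K.distribʳ _ _ _
      ⊠-distribʳ h f g (b ∷ β) =
        K.trans (K.+-cong (⊠-distribʳ h (f ∂ b) (g ∂ b) β) (⊠-distribʳ (h ∂ b) f g β))
          (solve 4 (λ x y z w → (x :+ y) :+ (z :+ w) := (x :+ z) :+ (y :+ w)) K.refl _ _ _ _)

      ⊠-zeroˡ : ∀ g → (zer ⊠ g) ≋ zer
      ⊠-zeroˡ g [] = K.zeroˡ _
      ⊠-zeroˡ g (b ∷ β) =
        K.trans (K.+-cong (⊠-zeroˡ g β) (⊠-zeroˡ (g ∂ b) β)) (K.+-identityˡ _)

      ⊠-identityˡ : ∀ g → (one ⊠ g) ≋ g
      ⊠-identityˡ g [] = K.*-identityˡ _
      ⊠-identityˡ g (b ∷ β) =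
        K.trans (K.+-cong (⊠-zeroˡ g β) (⊠-identityˡ (g ∂ b) β)) (K.+-identityˡ _)

      ⊠-assoc : ∀ f g h → ((f ⊠ g) ⊠ h) ≋ (f ⊠ (g ⊠ h))
      ⊠-assoc f g h [] = K.*-assoc _ _ _
      ⊠-assoc f g h (b ∷ β) =
        K.trans (K.+-cong (⊠-distribʳ h (f ∂ b ⊠ g) (f ⊠ g ∂ b) β) K.refl)
        (K.trans (K.+-cong (K.+-cong (⊠-assoc (f ∂ b) g h β) (⊠-assoc f (g ∂ b) h β))
                           (⊠-assoc f g (h ∂ b) β))
        (K.trans (K.+-assoc _ _ _)
          (K.+-cong K.refl (K.trans (K.sym (⊠-distribʳ′ (g ∂ b ⊠ h) (g ⊠ h ∂ b) β)) K.refl))))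
        where
        ⊠-distribʳ′ : ∀ x y → (f ⊠ (x ⊞ y)) ≋ ((f ⊠ x) ⊞ (f ⊠ y))
        ⊠-distribʳ′ x y γ = K.trans (⊠-comm f (x ⊞ y) γ)
          (K.trans (⊠-distribʳ f x y γ) (K.+-cong (⊠-comm x f γ) (⊠-comm y f γ)))

    ring : CommutativeRing 0ℓ 0ℓ
    ring = RingData.commutativeRing record
      { Carrier = Sh ; _≈_ = _≋_ ; _+_ = _⊞_ ; _*_ = _⊠_ ; -_ = neg ; 0# = zer ; 1# = one
      ; ≈-refl = λ _ → K.refl ; ≈-sym = λ p β → K.sym (p β)
      ; ≈-trans = λ p q β → K.trans (p β) (q β)
      ; +-cong = λ p q β → K.+-cong (p β) (q β) ; *-cong = ⊠-cong
      ; -‿cong = λ p β → K.-‿cong (p β)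
      ; +-assoc = λ f g h β → K.+-assoc _ _ _ ; +-comm = λ f g β → K.+-comm _ _
      ; +-idˡ = λ f β → K.+-identityˡ _ ; +-invˡ = λ f β → K.-‿inverseˡ _
      ; *-assoc = ⊠-assoc ; *-comm = ⊠-comm ; *-idˡ = ⊠-identityˡ ; distribʳ = ⊠-distribʳ }

  module PowerSeries (R : CommutativeRing 0ℓ 0ℓ) where
    private module R = CommutativeRing R
    open IntegerSolver R

    PS : Set
    PS = ℕ → R.Carrier

    tail : PS → PS
    tail a i = a (suc i)

    _⊗_ : PS → PS → PS
    (a ⊗ b) zero = a 0 R.* b 0
    (a ⊗ b) (suc n) = a 0 R.* b (suc n) R.+ (tail a ⊗ b) n

    const : R.Carrier → PS
    const r zero = r
    const r (suc _) = R.0#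

    private
      _≋_ : PS → PS → Set
      a ≋ b = ∀ n → a n R.≈ b n

    ⊗-cong : ∀ {a a′ b b′} → a ≋ a′ → b ≋ b′ → (a ⊗ b) ≋ (a′ ⊗ b′)
    ⊗-cong p q zero = R.*-cong (p 0) (q 0)
    ⊗-cong p q (suc n) = R.+-cong (R.*-cong (p 0) (q (suc n))) (⊗-cong (λ i → p (suc i)) q n)

    -- The defining recursion peels the left factor; peeling the right factor instead is what
    -- commutativity needs.
    ⊗-sucʳ : ∀ a b n → (a ⊗ b) (suc n) R.≈ (a ⊗ tail b) n R.+ a (suc n) R.* b 0
    ⊗-sucʳ a b zero = R.refl
    ⊗-sucʳ a b (suc n) = R.trans (R.+-cong R.refl (⊗-sucʳ (tail a) b n)) (R.sym (R.+-assoc _ _ _))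

    private
      ⊗-comm : ∀ a b → (a ⊗ b) ≋ (b ⊗ a)
      ⊗-comm a b zero = R.*-comm _ _
      ⊗-comm a b (suc n) = R.trans (R.+-cong (R.*-comm _ _) (⊗-comm (tail a) b n))
        (R.trans (R.+-comm _ _) (R.sym (⊗-sucʳ b a n)))

      ⊗-distribʳ : ∀ c a b → ((λ i → a i R.+ b i) ⊗ c) ≋ (λ i → (a ⊗ c) i R.+ (b ⊗ c) i)
      ⊗-distribʳ c a b zero = R.distribʳ _ _ _
      ⊗-distribʳ c a b (suc n) =
        R.trans (R.+-cong (R.distribʳ _ _ _) (⊗-distribʳ c (tail a) (tail b) n))
          (solve 4 (λ x y z w → (x :+ y) :+ (z :+ w) := (x :+ z) :+ (y :+ w)) R.refl _ _ _ _)

      ⊗-scale : ∀ r a b → ((λ i → r R.* a i) ⊗ b) ≋ (λ i → r R.* (a ⊗ b) i)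
      ⊗-scale r a b zero = R.*-assoc _ _ _
      ⊗-scale r a b (suc n) = R.trans (R.+-cong (R.*-assoc _ _ _) (⊗-scale r (tail a) b n))
        (R.sym (R.distribˡ _ _ _))

      ⊗-zeroˡ : ∀ b → ((λ _ → R.0#) ⊗ b) ≋ (λ _ → R.0#)
      ⊗-zeroˡ b zero = R.zeroˡ _
      ⊗-zeroˡ b (suc n) = R.trans (R.+-cong (R.zeroˡ _) (⊗-zeroˡ b n)) (R.+-identityˡ _)

      ⊗-identityˡ : ∀ b → (const R.1# ⊗ b) ≋ b
      ⊗-identityˡ b zero = R.*-identityˡ _
      ⊗-identityˡ b (suc n) =
        R.trans (R.+-cong (R.*-identityˡ _) (⊗-zeroˡ b n)) (R.+-identityʳ _)

      ⊗-assoc : ∀ a b c → ((a ⊗ b) ⊗ c) ≋ (a ⊗ (b ⊗ c))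
      ⊗-assoc a b c zero = R.*-assoc _ _ _
      ⊗-assoc a b c (suc n) =
        R.trans (R.+-cong (R.*-assoc _ _ _)
          (R.trans (⊗-distribʳ c (λ i → a 0 R.* b (suc i)) (tail a ⊗ b) n)
                   (R.+-cong (⊗-scale (a 0) (tail b) c n) (⊗-assoc (tail a) b c n))))
        (R.trans (R.sym (R.+-assoc _ _ _)) (R.+-cong (R.sym (R.distribˡ _ _ _)) R.refl))

    ring : CommutativeRing 0ℓ 0ℓ
    ring = RingData.commutativeRing record
      { Carrier = PS ; _≈_ = _≋_ ; _+_ = λ a b i → a i R.+ b i ; _*_ = _⊗_
      ; -_ = λ a i → R.- a i ; 0# = λ _ → R.0# ; 1# = const R.1#
      ; ≈-refl = λ _ → R.refl ; ≈-sym = λ p β → R.sym (p β)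
      ; ≈-trans = λ p q β → R.trans (p β) (q β)
      ; +-cong = λ p q β → R.+-cong (p β) (q β) ; *-cong = ⊗-cong
      ; -‿cong = λ p β → R.-‿cong (p β)
      ; +-assoc = λ f g h β → R.+-assoc _ _ _ ; +-comm = λ f g β → R.+-comm _ _
      ; +-idˡ = λ f β → R.+-identityˡ _ ; +-invˡ = λ f β → R.-‿inverseˡ _
      ; *-assoc = ⊗-assoc ; *-comm = ⊗-comm ; *-idˡ = ⊗-identityˡ ; distribʳ = ⊗-distribʳ }

-- Separated filtrations and coefficientwise calculus of power series.

module Filtrations where

  open import Level using (0ℓ)
  open import Algebra.Bundles using (CommutativeRing)
  open import Data.Nat as ℕ using (ℕ; zero; suc; _≤_; _<_; z≤n; s≤s)
  import Data.Nat.Properties as ℕP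
  open import Relation.Binary.PropositionalEquality as ≡ using (_≡_)
  open import Relation.Nullary using (yes; no)
  open import Data.Empty using (⊥-elim)
  open Rings

  -- A decreasing filtration with trivial intersection. The degree will count parts, so that every
  -- variable p_b lies in `F 1`, and `F-sep` closes the inductions on the degree.
  record Filtration (R : CommutativeRing 0ℓ 0ℓ) : Set₁ where
    open CommutativeRing R
    field
      F : ℕ → Carrier → Set
      resp : ∀ {n x y} → x ≈ y → F n x → F n y
      F-0 : ∀ {n} → F n 0#
      F-+ : ∀ {n x y} → F n x → F n y → F n (x + y)
      F-neg : ∀ {n x} → F n x → F n (- x)
      F-* : ∀ {i j x y} → F i x → F j y → F (i ℕ.+ j) (x * y)
      F-all : ∀ x → F 0 x
      F-anti : ∀ {n x} → F (suc n) x → F n x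
      F-sep : ∀ {x} → (∀ n → F n x) → x ≈ 0#

  module Coefficients (R : CommutativeRing 0ℓ 0ℓ) where
    module R = CommutativeRing R
    open PowerSeries R using (PS; tail; _⊗_; const; ⊗-cong; ⊗-sucʳ) public
    P : CommutativeRing 0ℓ 0ℓ
    P = PowerSeries.ring R
    open CommutativeRing P public
    open import Algebra.Properties.Semiring.Exp semiring public using (_^_; ^-homo-*; ^-congˡ)
    open IntegerSolver P public
    module RS = IntegerSolver R
    open import Algebra.Properties.Ring ring public
      using (-‿distribˡ-*; -‿distribʳ-*; -0#≈0#; -‿+-comm; x∙y⁻¹≈ε⇒x≈y)

    ⊗-ind : (Q : R.Carrier → Set) → (∀ {x y} → Q x → Q y → Q (x R.+ y)) →
            ∀ a b i → (∀ j k → j ℕ.+ k ≡ i → Q (a j R.* b k)) → Q ((a * b) i)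
    ⊗-ind Q Q+ a b zero h = h 0 0 ≡.refl
    ⊗-ind Q Q+ a b (suc i) h =
      Q+ (h 0 (suc i) ≡.refl) (⊗-ind Q Q+ (tail a) b i λ j k e → h (suc j) k (≡.cong suc e))

    ⊗-vanish : ∀ a b i → (∀ j k → j ℕ.+ k ≡ i → a j R.* b k R.≈ R.0#) → (a * b) i R.≈ R.0#
    ⊗-vanish = ⊗-ind (R._≈ R.0#) (λ p q → R.trans (R.+-cong p q) (R.+-identityˡ _))

    ⊗-cong≤ : ∀ {a a′ b b′} i → (∀ j → j ≤ i → a j R.≈ a′ j) → (∀ j → j ≤ i → b j R.≈ b′ j) →
              (a * b) i R.≈ (a′ * b′) i
    ⊗-cong≤ zero p q = R.*-cong (p 0 z≤n) (q 0 z≤n)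
    ⊗-cong≤ {a} {a′} (suc i) p q =
      R.+-cong (R.*-cong (p 0 z≤n) (q (suc i) ℕP.≤-refl))
        (⊗-cong≤ {tail a} {tail a′} i (λ j h → p (suc j) (s≤s h)) (λ j h → q j (ℕP.m≤n⇒m≤1+n h)))

    -- `σ` is the variable and `y` is 1/(1 - σ): multiplication by `y` forms partial sums.
    σ y : PS
    σ zero = R.0#
    σ (suc n) = const R.1# n
    y _ = R.1#

    σ-0 : ∀ a → (σ * a) 0 R.≈ R.0#
    σ-0 a = R.zeroˡ _

    σ-suc : ∀ a n → (σ * a) (suc n) R.≈ a n
    σ-suc a n = R.trans (R.+-cong (R.zeroˡ _) (*-identityˡ a n)) (R.+-identityˡ _)

    const-* : ∀ r a i → (const r * a) i R.≈ r R.* a i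
    const-* r a zero = R.refl
    const-* r a (suc i) = R.trans (R.+-cong R.refl
      (⊗-vanish (tail (const r)) a i (λ _ _ _ → R.zeroˡ _))) (R.+-identityʳ _)

    const-cong : ∀ {r s} → r R.≈ s → const r ≈ const s
    const-cong p zero = p
    const-cong p (suc i) = R.refl

    const-+ : ∀ r s → const (r R.+ s) ≈ const r + const s
    const-+ r s zero = R.refl
    const-+ r s (suc i) = R.sym (R.+-identityˡ _)

    const-mul : ∀ r s → const (r R.* s) ≈ const r * const s
    const-mul r s zero = R.refl
    const-mul r s (suc i) = R.sym (R.trans (const-* r (const s) (suc i)) (R.zeroʳ _))

    const-0 : const R.0# ≈ 0#
    const-0 zero = R.refl
    const-0 (suc i) = R.refl

    y-eq : y ≈ 1# + σ * y
    y-eq zero = R.sym (R.trans (R.+-cong R.refl (σ-0 y)) (R.+-identityʳ _))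
    y-eq (suc i) = R.sym (R.trans (R.+-cong R.refl (σ-suc y i)) (R.+-identityˡ _))

    y-suc : ∀ a i → (y * a) (suc i) R.≈ (y * a) i R.+ a (suc i)
    y-suc a i = R.trans (*-comm y a (suc i)) (R.trans (⊗-sucʳ a y i)
      (R.+-cong (*-comm a y i) (R.*-identityʳ _)))

    shift-lo : ∀ k a i → i < k → (σ ^ k * a) i R.≈ R.0#
    shift-lo (suc k) a zero _ = R.trans (*-assoc σ (σ ^ k) a 0) (σ-0 (σ ^ k * a))
    shift-lo (suc k) a (suc i) (s≤s h) =
      R.trans (*-assoc σ (σ ^ k) a (suc i)) (R.trans (σ-suc (σ ^ k * a) i) (shift-lo k a i h))

    shift-hi : ∀ k a i → (σ ^ k * a) (k ℕ.+ i) R.≈ a i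
    shift-hi zero a i = *-identityˡ a i
    shift-hi (suc k) a i =
      R.trans (*-assoc σ (σ ^ k) a (suc (k ℕ.+ i))) (R.trans (σ-suc (σ ^ k * a) (k ℕ.+ i)) (shift-hi k a i))

    σ-cancel : ∀ k a b → σ ^ k * a ≈ σ ^ k * b → a ≈ b
    σ-cancel k a b p i = R.trans (R.sym (shift-hi k a i)) (R.trans (p (k ℕ.+ i)) (shift-hi k b i))

    -- For a polynomial in s stored with bound B, index i belongs to s^(B - i). So `Lo (B + 1)` says
    -- that it is a polynomial at all, and `Lo (B + 1 - k)` that it is divisible by s^k.
    Lo : ℕ → PS → Set
    Lo n a = ∀ i → n ≤ i → a i R.≈ R.0#

    Lo-cong : ∀ {n a b} → a ≈ b → Lo n a → Lo n b
    Lo-cong p l i h = R.trans (R.sym (p i)) (l i h)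

    Lo-+ : ∀ {n a b} → Lo n a → Lo n b → Lo n (a + b)
    Lo-+ p q i h = R.trans (R.+-cong (p i h) (q i h)) (R.+-identityˡ _)

    Lo-0 : ∀ {n} → Lo n 0#
    Lo-0 i h = R.refl

    Lo-mono : ∀ {n n′ a} → n ≤ n′ → Lo n a → Lo n′ a
    Lo-mono p l i h = l i (ℕP.≤-trans p h)

    Lo-const : ∀ {n a} r → Lo n a → Lo n (const r * a)
    Lo-const {a = a} r l i h = R.trans (const-* r a i) (R.trans (R.*-cong R.refl (l i h)) (R.zeroʳ _))

    Lo-shift : ∀ {n a} k → Lo n a → Lo (k ℕ.+ n) (σ ^ k * a)
    Lo-shift zero l = Lo-cong (sym (*-identityˡ _)) l
    Lo-shift {n} {a} (suc k) l (suc i) (s≤s h) =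
      R.trans (*-assoc σ (σ ^ k) a (suc i)) (R.trans (σ-suc (σ ^ k * a) i) (Lo-shift k l i h))

    Lo-* : ∀ {n k a b} → Lo (suc n) a → Lo k b → Lo (n ℕ.+ k) (a * b)
    Lo-* {n} {k} {a} {b} p q i h = ⊗-vanish a b i go
      where
      go : ∀ j l → j ℕ.+ l ≡ i → a j R.* b l R.≈ R.0#
      go j l e with suc n ℕ.≤? j | k ℕ.≤? l
      ... | yes n<j | _ = R.trans (R.*-cong (p j n<j) R.refl) (R.zeroˡ _)
      ... | no _ | yes k≤l = R.trans (R.*-cong R.refl (q l k≤l)) (R.zeroʳ _)
      ... | no n≮j | no k≰l = ⊥-elim (ℕP.<-irrefl e (ℕP.<-≤-trans
            (ℕP.+-mono-≤-< (ℕP.≤-pred (ℕP.≰⇒> n≮j)) (ℕP.≰⇒> k≰l)) h))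

    ∑ : ℕ → (ℕ → PS) → PS
    ∑ zero f = 0#
    ∑ (suc n) f = f n + ∑ n f

    ∑R : ℕ → (ℕ → R.Carrier) → R.Carrier
    ∑R zero f = R.0#
    ∑R (suc n) f = f n R.+ ∑R n f

    ∑-cong : ∀ n {f g} → (∀ j → j < n → f j ≈ g j) → ∑ n f ≈ ∑ n g
    ∑-cong zero h = refl
    ∑-cong (suc n) h = +-cong (h n ℕP.≤-refl) (∑-cong n λ j l → h j (ℕP.m≤n⇒m≤1+n l))

    ∑R-cong : ∀ n {f g} → (∀ j → j < n → f j R.≈ g j) → ∑R n f R.≈ ∑R n g
    ∑R-cong zero h = R.refl
    ∑R-cong (suc n) h = R.+-cong (h n ℕP.≤-refl) (∑R-cong n λ j l → h j (ℕP.m≤n⇒m≤1+n l))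

    ∑-+ : ∀ n f g → ∑ n (λ j → f j + g j) ≈ ∑ n f + ∑ n g
    ∑-+ zero f g = sym (+-identityˡ _)
    ∑-+ (suc n) f g = trans (+-cong refl (∑-+ n f g))
      (solve 4 (λ a b c d → (a :+ b) :+ (c :+ d) := (a :+ c) :+ (b :+ d)) refl _ _ _ _)

    ∑-* : ∀ n a f → ∑ n (λ j → a * f j) ≈ a * ∑ n f
    ∑-* zero a f = sym (zeroʳ a)
    ∑-* (suc n) a f = trans (+-cong refl (∑-* n a f)) (sym (distribˡ a _ _))

    ∑-lin : ∀ n (φ : PS → R.Carrier) → φ 0# R.≈ R.0# → (∀ a b → φ (a + b) R.≈ φ a R.+ φ b) →
            ∀ f → φ (∑ n f) R.≈ ∑R n (λ j → φ (f j))
    ∑-lin zero φ φ0 φ+ f = φ0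
    ∑-lin (suc n) φ φ0 φ+ f = R.trans (φ+ _ _) (R.+-cong R.refl (∑-lin n φ φ0 φ+ f))

    Lo-∑ : ∀ n {k f} → (∀ j → j < n → Lo k (f j)) → Lo k (∑ n f)
    Lo-∑ zero h = Lo-0
    Lo-∑ (suc n) h = Lo-+ (h n ℕP.≤-refl) (Lo-∑ n λ j l → h j (ℕP.m≤n⇒m≤1+n l))

    module _ (Φ : Filtration R) where
      open Filtration Φ

      FP : ℕ → PS → Set
      FP n a = ∀ i → F n (a i)

      FP-cong : ∀ {n a b} → a ≈ b → FP n a → FP n b
      FP-cong p h i = resp (p i) (h i)

      FP-* : ∀ {n k a b} → FP n a → FP k b → FP (n ℕ.+ k) (a * b)
      FP-* {a = a} {b} p q i = ⊗-ind (F _) F-+ a b i λ j l _ → F-* (p j) (q l)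

      FP-+ : ∀ {n a b} → FP n a → FP n b → FP n (a + b)
      FP-+ p q i = F-+ (p i) (q i)

      FP-neg : ∀ {n a} → FP n a → FP n (- a)
      FP-neg p i = F-neg (p i)

      FP-all : ∀ a → FP 0 a
      FP-all a i = F-all (a i)

      FP-*ʳ : ∀ {n} a {b} → FP n b → FP n (a * b)
      FP-*ʳ a q = FP-* (FP-all a) q

      FP-const : ∀ {n r} → F n r → FP n (const r)
      FP-const h zero = h
      FP-const h (suc i) = F-0

      FP-∑ : ∀ n {k f} → (∀ j → FP k (f j)) → FP k (∑ n f)
      FP-∑ zero h i = F-0
      FP-∑ (suc n) h = FP-+ (h n) (FP-∑ n h)

      FP-unshift : ∀ {n} k a → FP n (σ ^ k * a) → FP n a
      FP-unshift k a h i = resp (shift-hi k a i) (h (k ℕ.+ i))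

-- Evaluation at s = 1 and the backward shift on polynomials in s.

module Shifts where

  open import Level using (0ℓ)
  open import Algebra.Bundles using (CommutativeRing)
  open import Data.Nat as ℕ using (ℕ; zero; suc; _≤_; s≤s; _∸_)
  import Data.Nat.Properties as ℕP
  open import Data.Nat.Solver using (module +-*-Solver)
  open import Data.Product using (_,_)
  open import Relation.Binary.PropositionalEquality as ≡ using (_≡_)
  open Rings
  open Filtrations

  -- Polynomials in s of degree ≤ B are stored as power series in σ = 1/s, multiplied by σ^B.
  -- With t = s - 1 and Y = s^m / t (m = suc N), y is σ^N Y; ε evaluates at t = 0 and
  -- S f = Y (f - f(0)) is the backward shift in the variable 1/Y.
  module Shift (R : CommutativeRing 0ℓ 0ℓ) (N : ℕ) where
    open Coefficients R public

    ⟨_⟩ : R.Carrier → PS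
    ⟨ r ⟩ = const r

    -- At s = 1 a polynomial takes the sum of its coefficients, and partial sums are the
    -- coefficients of `y * a`.
    ε : ℕ → PS → R.Carrier
    ε B a = (y * a) B

    S : ℕ → PS → PS
    S B a = y * (a - ⟨ ε B a ⟩ * σ ^ B)

    Sit : ℕ → ℕ → PS → PS
    Sit zero B a = a
    Sit (suc b) B a = Sit b (N ℕ.+ B) (S B a)

    -- The coefficient of Y^(-b) in the expansion at s = 1. Since Y has degree N at infinity, each
    -- shift raises the degree bound by N.
    es : ℕ → ℕ → PS → R.Carrier
    es zero B a = ε B a
    es (suc b) B a = es b (N ℕ.+ B) (S B a)

    ε-cong : ∀ B {a b} → a ≈ b → ε B a R.≈ ε B b
    ε-cong B p = *-cong (refl {y}) p B

    ε-+ : ∀ B a b → ε B (a + b) R.≈ ε B a R.+ ε B b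
    ε-+ B a b = distribˡ y a b B

    ε-scale : ∀ B r a → ε B (⟨ r ⟩ * a) R.≈ r R.* ε B a
    ε-scale B r a = R.trans (solve 3 (λ y r a → y :* (r :* a) := r :* (y :* a)) refl y ⟨ r ⟩ a B)
      (const-* r (y * a) B)

    -- Multiplication by σ^k with the bound raised by k changes the stored series but not the
    -- polynomial; the same remark is behind the other shift lemmas below.
    ε-shift : ∀ k B a → ε (k ℕ.+ B) (σ ^ k * a) R.≈ ε B a
    ε-shift k B a = R.trans
      (solve 3 (λ y r a → y :* (r :* a) := r :* (y :* a)) refl y (σ ^ k) a (k ℕ.+ B))
      (shift-hi k (y * a) B)

    ε-0 : ∀ B → ε B 0# R.≈ R.0#
    ε-0 B = zeroʳ y B

    ε-σ : ∀ B → ε B (σ ^ B) R.≈ R.1#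
    ε-σ B = R.trans (ε-cong B (sym (*-identityʳ _)))
      (R.trans (R.reflexive (≡.cong (λ i → ε i (σ ^ B * 1#)) (≡.sym (ℕP.+-identityʳ B))))
        (R.trans (ε-shift B 0 1#) (R.*-identityˡ _)))

    ε-- : ∀ B a b → ε B (a - b) R.≈ ε B a R.- ε B b
    ε-- B a b = (trans (distribˡ y a (- b)) (+-cong refl (sym (-‿distribʳ-* y b)))) B

    S-cong : ∀ B {a b} → a ≈ b → S B a ≈ S B b
    S-cong B p = *-cong refl (+-cong p (-‿cong (*-cong (const-cong (ε-cong B p)) refl)))

    S-+ : ∀ B a b → S B (a + b) ≈ S B a + S B b
    S-+ B a b = trans (*-cong refl (+-cong refl (-‿cong (*-cong
        (trans (const-cong (ε-+ B a b)) (const-+ _ _)) refl))))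
      (solve 6 (λ y a b e f s → y :* (a :+ b :- (e :+ f) :* s)
         := y :* (a :- e :* s) :+ y :* (b :- f :* s)) refl y a b ⟨ ε B a ⟩ ⟨ ε B b ⟩ (σ ^ B))

    S-scale : ∀ B r a → S B (⟨ r ⟩ * a) ≈ ⟨ r ⟩ * S B a
    S-scale B r a = trans (*-cong refl (+-cong refl (-‿cong (*-cong
        (trans (const-cong (ε-scale B r a)) (const-mul _ _)) refl))))
      (solve 5 (λ y a e r s → y :* (r :* a :- (r :* e) :* s)
         := r :* (y :* (a :- e :* s))) refl y a ⟨ ε B a ⟩ ⟨ r ⟩ (σ ^ B))

    S-shift : ∀ k B a → S (k ℕ.+ B) (σ ^ k * a) ≈ σ ^ k * S B a
    S-shift k B a = trans (*-cong refl (+-cong refl (-‿cong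
        (*-cong (const-cong (ε-shift k B a)) (^-homo-* σ k B)))))
      (solve 5 (λ y a e r s → y :* (r :* a :- e :* (r :* s))
         := r :* (y :* (a :- e :* s))) refl y a ⟨ ε B a ⟩ (σ ^ k) (σ ^ B))

    S-0 : ∀ B → S B 0# ≈ 0#
    S-0 B = trans (*-cong refl (trans (+-cong refl (-‿cong (trans (*-cong
        (trans (const-cong (ε-0 B)) const-0) refl) (zeroˡ _)))) (-‿inverseʳ 0#))) (zeroʳ y)

    S-ker : ∀ B {a} → ε B a R.≈ R.0# → S B a ≈ y * a
    S-ker B p = *-cong refl (trans (+-cong refl (trans (-‿cong (trans (*-cong
        (trans (const-cong p) const-0) refl) (zeroˡ _))) -0#≈0#)) (+-identityʳ _))

    private
      idx : ∀ {A B} (b : ℕ) a → A ≡ B → Sit b A a ≈ Sit b B a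
      idx b a p = reflexive (≡.cong (λ i → Sit b i a) p)

      idxe : ∀ {A B} (b : ℕ) a → A ≡ B → es b A a R.≈ es b B a
      idxe b a p = R.reflexive (≡.cong (λ i → es b i a) p)

      swapℕ : ∀ a b c → a ℕ.+ (b ℕ.+ c) ≡ b ℕ.+ (a ℕ.+ c)
      swapℕ = +-*-Solver.solve 3 (λ a b c → a :+ₙ (b :+ₙ c) :=ₙ b :+ₙ (a :+ₙ c)) ≡.refl
        where open +-*-Solver renaming (_:+_ to _:+ₙ_; _:=_ to _:=ₙ_)

    Sit-cong : ∀ b B {a a′} → a ≈ a′ → Sit b B a ≈ Sit b B a′
    Sit-cong zero B p = p
    Sit-cong (suc b) B p = Sit-cong b _ (S-cong B p)

    Sit-+ : ∀ b B a a′ → Sit b B (a + a′) ≈ Sit b B a + Sit b B a′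
    Sit-+ zero B a a′ = refl
    Sit-+ (suc b) B a a′ = trans (Sit-cong b _ (S-+ B a a′)) (Sit-+ b _ _ _)

    Sit-scale : ∀ b B r a → Sit b B (⟨ r ⟩ * a) ≈ ⟨ r ⟩ * Sit b B a
    Sit-scale zero B r a = refl
    Sit-scale (suc b) B r a = trans (Sit-cong b _ (S-scale B r a)) (Sit-scale b _ _ _)

    Sit-shift : ∀ b k B a → Sit b (k ℕ.+ B) (σ ^ k * a) ≈ σ ^ k * Sit b B a
    Sit-shift zero k B a = refl
    Sit-shift (suc b) k B a = trans (Sit-cong b _ (S-shift k B a))
      (trans (idx b _ (swapℕ N k B)) (Sit-shift b k (N ℕ.+ B) _))

    es-cong : ∀ b B {a a′} → a ≈ a′ → es b B a R.≈ es b B a′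
    es-cong zero B p = ε-cong B p
    es-cong (suc b) B p = es-cong b _ (S-cong B p)

    es-+ : ∀ b B a a′ → es b B (a + a′) R.≈ es b B a R.+ es b B a′
    es-+ zero B a a′ = ε-+ B a a′
    es-+ (suc b) B a a′ = R.trans (es-cong b _ (S-+ B a a′)) (es-+ b _ _ _)

    es-scale : ∀ b B r a → es b B (⟨ r ⟩ * a) R.≈ r R.* es b B a
    es-scale zero B r a = ε-scale B r a
    es-scale (suc b) B r a = R.trans (es-cong b _ (S-scale B r a)) (es-scale b _ _ _)

    es-shift : ∀ b k B a → es b (k ℕ.+ B) (σ ^ k * a) R.≈ es b B a
    es-shift zero k B a = ε-shift k B a
    es-shift (suc b) k B a = R.trans (es-cong b _ (S-shift k B a))
      (R.trans (idxe b _ (swapℕ N k B)) (es-shift b k (N ℕ.+ B) _))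

    es-0 : ∀ b B → es b B 0# R.≈ R.0#
    es-0 zero B = ε-0 B
    es-0 (suc b) B = R.trans (es-cong b _ (S-0 B)) (es-0 b _)

    -- `Sit` applies its next shift innermost; as all shifts are the same operator up to their
    -- bounds, one of them may be moved to the outside.
    SitS : ∀ b B a → S (b ℕ.* N ℕ.+ B) (Sit b B a) ≈ Sit b (N ℕ.+ B) (S B a)
    SitS zero B a = refl
    SitS (suc b) B a = trans
      (reflexive (≡.cong (λ i → S i (Sit b (N ℕ.+ B) (S B a))) (eq N (b ℕ.* N) B)))
      (SitS b (N ℕ.+ B) (S B a))
      where
      eq : ∀ n x B → n ℕ.+ x ℕ.+ B ≡ x ℕ.+ (n ℕ.+ B)
      eq = +-*-Solver.solve 3 (λ a b c → a :+ₙ b :+ₙ c :=ₙ b :+ₙ (a :+ₙ c)) ≡.refl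
        where open +-*-Solver renaming (_:+_ to _:+ₙ_; _:=_ to _:=ₙ_)

    ε-Sit : ∀ b B a → ε (b ℕ.* N ℕ.+ B) (Sit b B a) R.≈ es b B a
    ε-Sit zero B a = R.refl
    ε-Sit (suc b) B a = R.trans
      (R.reflexive (≡.cong (λ i → ε i (Sit b (N ℕ.+ B) (S B a))) (eq N (b ℕ.* N) B)))
      (ε-Sit b (N ℕ.+ B) (S B a))
      where
      eq : ∀ n x B → n ℕ.+ x ℕ.+ B ≡ x ℕ.+ (n ℕ.+ B)
      eq = +-*-Solver.solve 3 (λ a b c → a :+ₙ b :+ₙ c :=ₙ b :+ₙ (a :+ₙ c)) ≡.refl
        where open +-*-Solver renaming (_:+_ to _:+ₙ_; _:=_ to _:=ₙ_)

    -- A polynomial with value 0 at s = 1 is divisible by s - 1. In coefficients: the partial sums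
    -- of `g` are constant once `g` has ended, and the constant is `ε B g`.
    y-Lo : ∀ {B g} → Lo (suc B) g → ε B g R.≈ R.0# → Lo B (y * g)
    y-Lo {B} {g} l e i h = R.trans (R.reflexive (≡.cong (y * g) (≡.sym (ℕP.m+[n∸m]≡n h)))) (go (i ∸ B))
      where
      go : ∀ j → (y * g) (B ℕ.+ j) R.≈ R.0#
      go zero = R.trans (R.reflexive (≡.cong (y * g) (ℕP.+-identityʳ B))) e
      go (suc j) = R.trans (R.reflexive (≡.cong (y * g) (ℕP.+-suc B j)))
        (R.trans (y-suc g (B ℕ.+ j)) (R.trans (R.+-cong (go j) (l _ (s≤s (ℕP.m≤m+n B j))))
          (R.+-identityˡ _)))

    Lo-1 : Lo 1 1#
    Lo-1 (suc i) _ = R.refl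

    Lo-σ : ∀ B → Lo (suc B) (σ ^ B)
    Lo-σ B = Lo-cong (*-identityʳ _) (≡.subst (λ i → Lo i (σ ^ B * 1#)) (ℕP.+-comm B 1) (Lo-shift B Lo-1))

    Lo-neg : ∀ {n a} → Lo n a → Lo n (- a)
    Lo-neg l i h = R.trans (R.-‿cong (l i h)) RP.-0#≈0#
      where
      import Algebra.Properties.Ring R.ring as RP

    -- The difference in `S` vanishes at s = 1, so the factor 1/(s - 1) of Y keeps it a polynomial,
    -- and the factor s^m leaves the result divisible by s^m.
    S-Lo : ∀ {B a} → Lo (suc B) a → Lo B (S B a)
    S-Lo {B} {a} l = y-Lo (Lo-+ l (Lo-neg (Lo-const _ (Lo-σ B))))
      (R.trans (ε-- B _ _) (R.trans (R.+-cong R.refl (R.-‿cong (R.trans (ε-scale B _ _)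
        (R.trans (R.*-cong R.refl (ε-σ B)) (R.*-identityʳ _))))) (R.-‿inverseʳ _)))

    Sit-Lo : ∀ b {B a} → Lo (suc B) a → Lo (suc (b ℕ.* N ℕ.+ B)) (Sit b B a)
    Sit-Lo zero l = l
    Sit-Lo (suc b) {B} {a} l = Lo-mono (s≤s (ℕP.≤-trans (ℕP.m≤n+m _ N)
      (ℕP.≤-reflexive (≡.sym (ℕP.+-assoc N (b ℕ.* N) B)))))
      (Lo-cong (SitS b B a) (Lo-mono (ℕP.n≤1+n _) (S-Lo (Sit-Lo b l))))

    Sit-Lo′ : ∀ b {B a} → Lo (suc B) a → Lo (b ℕ.* N ℕ.+ B) (Sit (suc b) B a)
    Sit-Lo′ b {B} {a} l = Lo-cong (SitS b B a) (S-Lo (Sit-Lo b l))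

    trunc : ℕ → PS → PS
    trunc zero a i = R.0#
    trunc (suc k) a zero = a 0
    trunc (suc k) a (suc i) = trunc k (tail a) i

    drop : ℕ → PS → PS
    drop k a i = a (k ℕ.+ i)

    trunc-drop : ∀ k a → a ≈ trunc k a + σ ^ k * drop k a
    trunc-drop zero a i = R.sym (R.trans (R.+-identityˡ _) (*-identityˡ a i))
    trunc-drop (suc k) a zero = R.sym (R.trans (R.+-cong R.refl
      (R.trans (*-assoc σ (σ ^ k) (drop (suc k) a) 0) (σ-0 (σ ^ k * drop (suc k) a)))) (R.+-identityʳ _))
    trunc-drop (suc k) a (suc i) = R.trans (trunc-drop k (tail a) i) (R.+-cong R.refl
      (R.sym (R.trans (*-assoc σ (σ ^ k) (drop (suc k) a) (suc i)) (σ-suc (σ ^ k * drop (suc k) a) i))))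

    trunc-Lo : ∀ k a → Lo k (trunc k a)
    trunc-Lo zero a i h = R.refl
    trunc-Lo (suc k) a (suc i) (s≤s h) = trunc-Lo k (tail a) i h

    -- Y^(j+1) is s^((j+1) N) times `y ^ suc j`. Hence `Tr j` holds its positive powers of s, and
    -- `Tl j` holds the powers s^0, s^(-1) and so on.
    Tr Tl : ℕ → PS
    Tr j = trunc (suc j ℕ.* N) (y ^ suc j)
    Tl j = drop (suc j ℕ.* N) (y ^ suc j)

-- The Toeplitz operator of one step of the recurrence.

module ToeplitzOperators where

  open import Level using (0ℓ)
  open import Algebra.Bundles using (CommutativeRing)
  open import Data.Nat as ℕ using (ℕ; zero; suc; _≤_; _<_; _∸_)
  import Data.Nat.Properties as ℕP
  open import Data.Nat.Solver using (module +-*-Solver)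
  open import Relation.Binary.PropositionalEquality as ≡ using (_≡_)
  open Rings
  open Filtrations
  open Shifts

  module Toeplitz (R : CommutativeRing 0ℓ 0ℓ) (N D : ℕ)
    (pt : ℕ → CommutativeRing.Carrier R) (c : CommutativeRing.Carrier R) where
    open Shift R N public

    -- Each Y^(j+1) with j < D has degree at most `M` in s; one more degree leaves room for the term
    -- c s of `n̂`.
    M M1 : ℕ
    M = D ℕ.* N
    M1 = suc M

    ex : ℕ → ℕ
    ex j = M1 ∸ suc j ℕ.* N

    jN≤M : ∀ {j} → j < D → suc j ℕ.* N ≤ M
    jN≤M h = ℕP.*-monoˡ-≤ N h

    ex+ : ∀ {j} → j < D → ex j ℕ.+ suc j ℕ.* N ≡ M1
    ex+ h = ℕP.m∸n+n≡m (ℕP.m≤n⇒m≤1+n (jN≤M h))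

    σ-≡ : ∀ {i j} → i ≡ j → σ ^ i ≈ σ ^ j
    σ-≡ p = reflexive (≡.cong (σ ^_) p)

    -- With bound `M1`, `n̂` is c s minus the positive powers of s in Σ pt_j Y^(j+1), and `ν` is
    -- `n̂` - 1. The remaining powers of s, divided by s, form `ρ` together with c.
    n̂ ν ρ : PS
    n̂ = ⟨ c ⟩ * σ ^ M - ∑ D (λ j → ⟨ pt j ⟩ * (σ ^ ex j * Tr j))
    ν = n̂ - σ ^ M1
    ρ = ⟨ c ⟩ + ∑ D (λ j → ⟨ pt j ⟩ * (σ * Tl j))

    -- On expansions in 1/Y the shift S^(j+1) multiplies by Y^(j+1) and discards the positive powers
    -- of Y, so this is the Toeplitz operator with symbol `n̂` + Σ pt_j Y^(j+1).
    V : ℕ → PS → PS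
    V B a = n̂ * a + ∑ D (λ j → ⟨ pt j ⟩ * (σ ^ ex j * Sit (suc j) B a))

    -- The positive powers of s cancel by the choice of `n̂`, except c s. What is left is s ρ, which
    -- with bound `M1` is stored as σ^M ρ.
    n̂+∑ : n̂ + ∑ D (λ j → ⟨ pt j ⟩ * (σ ^ ex j * y ^ suc j)) ≈ σ ^ M * ρ
    n̂+∑ = trans (+-cong refl (∑-cong D (λ j h → step j h)))
      (trans (+-cong refl (trans (∑-+ D _ _) (+-cong refl (∑-* D (σ ^ M) _))))
        (solve 4 (λ c s t u → (c :* s :- t) :+ (t :+ s :* u) := s :* (c :+ u)) refl
          ⟨ c ⟩ (σ ^ M) (∑ D (λ j → ⟨ pt j ⟩ * (σ ^ ex j * Tr j))) (∑ D (λ j → ⟨ pt j ⟩ * (σ * Tl j)))))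
      where
      step : ∀ j → j < D → ⟨ pt j ⟩ * (σ ^ ex j * y ^ suc j) ≈
             ⟨ pt j ⟩ * (σ ^ ex j * Tr j) + σ ^ M * (⟨ pt j ⟩ * (σ * Tl j))
      step j h = trans (*-cong refl (*-cong refl (trunc-drop (suc j ℕ.* N) (y ^ suc j))))
        (trans (solve 5 (λ p e t s l → p :* (e :* (t :+ s :* l)) := p :* (e :* t) :+ (e :* s) :* (p :* l))
                  refl ⟨ pt j ⟩ (σ ^ ex j) (Tr j) (σ ^ (suc j ℕ.* N)) (Tl j))
          (+-cong refl (trans (*-cong (trans (sym (^-homo-* σ (ex j) (suc j ℕ.* N))) (σ-≡ (ex+ h))) refl)
            (solve 4 (λ s m p l → (s :* m) :* (p :* l) := m :* (p :* (s :* l))) refl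
              σ (σ ^ M) ⟨ pt j ⟩ (Tl j)))))

    V-cong : ∀ B {a b} → a ≈ b → V B a ≈ V B b
    V-cong B p = +-cong (*-cong refl p)
      (∑-cong D λ j _ → *-cong refl (*-cong refl (Sit-cong (suc j) B p)))

    V-+ : ∀ B a b → V B (a + b) ≈ V B a + V B b
    V-+ B a b = trans (+-cong (distribˡ n̂ a b) (trans (∑-cong D λ j _ →
        trans (*-cong refl (*-cong refl (Sit-+ (suc j) B a b)))
          (solve 4 (λ p e u v → p :* (e :* (u :+ v)) := p :* (e :* u) :+ p :* (e :* v)) refl
            ⟨ pt j ⟩ (σ ^ ex j) (Sit (suc j) B a) (Sit (suc j) B b))) (∑-+ D _ _)))
      (solve 4 (λ a b c d → (a :+ b) :+ (c :+ d) := (a :+ c) :+ (b :+ d)) refl _ _ _ _)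

    private
      ∑-pull : ∀ x (g : ℕ → PS) a →
        n̂ * (x * a) + ∑ D (λ j → ⟨ pt j ⟩ * (σ ^ ex j * (x * g j))) ≈
        x * (n̂ * a + ∑ D (λ j → ⟨ pt j ⟩ * (σ ^ ex j * g j)))
      ∑-pull x g a = trans (+-cong refl (trans (∑-cong D λ j _ →
          solve 4 (λ p e x g → p :* (e :* (x :* g)) := x :* (p :* (e :* g))) refl
            ⟨ pt j ⟩ (σ ^ ex j) x (g j)) (∑-* D x _)))
        (solve 4 (λ n x a s → n :* (x :* a) :+ x :* s := x :* (n :* a :+ s)) refl n̂ x a _)

    V-scale : ∀ B r a → V B (⟨ r ⟩ * a) ≈ ⟨ r ⟩ * V B a
    V-scale B r a = trans (+-cong refl (∑-cong D λ j _ →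
        *-cong refl (*-cong refl (Sit-scale (suc j) B r a))))
      (∑-pull ⟨ r ⟩ (λ j → Sit (suc j) B a) a)

    V-shift : ∀ k B a → V (k ℕ.+ B) (σ ^ k * a) ≈ σ ^ k * V B a
    V-shift k B a = trans (+-cong refl (∑-cong D λ j _ →
        *-cong refl (*-cong refl (Sit-shift (suc j) k B a))))
      (∑-pull (σ ^ k) (λ j → Sit (suc j) B a) a)

    V-≡ : ∀ {A B} a → A ≡ B → V A a ≈ V B a
    V-≡ a p = reflexive (≡.cong (λ i → V i a) p)

    Lo-n̂ : Lo M1 n̂
    Lo-n̂ = Lo-+ (Lo-const c (Lo-σ M)) (Lo-neg (Lo-∑ D λ j h → Lo-const (pt j)
      (≡.subst (λ i → Lo i (σ ^ ex j * Tr j)) (ex+ h) (Lo-shift (ex j) (trunc-Lo (suc j ℕ.* N) (y ^ suc j))))))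

    Lo-ν : Lo (suc M1) ν
    Lo-ν = Lo-+ (Lo-mono (ℕP.n≤1+n _) Lo-n̂) (Lo-neg (Lo-σ M1))

    V-Lo : ∀ {B a} → Lo (suc B) a → Lo (suc (M1 ℕ.+ B)) (V B a)
    V-Lo {B} {a} l = Lo-+ (Lo-mono (ℕP.≤-trans (ℕP.≤-reflexive (ℕP.+-suc M B)) (ℕP.n≤1+n _)) (Lo-* Lo-n̂ l))
      (Lo-∑ D λ j h → Lo-const (pt j) (≡.subst (λ i → Lo i (σ ^ ex j * Sit (suc j) B a))
        (≡.trans (ℕP.+-suc (ex j) _) (≡.cong suc (≡.trans (≡.sym (ℕP.+-assoc (ex j) (suc j ℕ.* N) B))
          (≡.cong (ℕ._+ B) (ex+ h)))))
        (Lo-shift (ex j) (Sit-Lo (suc j) l))))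

    exB : ∀ {j} B → j < D → ex j ℕ.+ (suc j ℕ.* N ℕ.+ B) ≡ M1 ℕ.+ B
    exB {j} B h = ≡.trans (≡.sym (ℕP.+-assoc (ex j) (suc j ℕ.* N) B)) (≡.cong (ℕ._+ B) (ex+ h))

    conv : (ℕ → R.Carrier) → (ℕ → R.Carrier) → ℕ → R.Carrier
    conv x t zero = R.0#
    conv x t (suc a) = x 0 R.* t (suc a) R.+ conv (λ i → x (suc i)) t a

    conv-cong : ∀ {x x′ t t′} a → (∀ i → x i R.≈ x′ i) → (∀ i → t i R.≈ t′ i) → conv x t a R.≈ conv x′ t′ a
    conv-cong zero p q = R.refl
    conv-cong (suc a) p q = R.+-cong (R.*-cong (p 0) (q (suc a))) (conv-cong a (λ i → p (suc i)) q)

    -- The guessed kernel: the expansion in 1/Y of the analytic part of the symbol, in the scaling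
    -- in which p_b is multiplied by w^b.
    tν : ℕ → R.Carrier
    tν a = es a M1 ν

    -- `hc` normalises `n̂` to the value 1 at s = 1, so that the expansion of `ν` starts with Y^(-1)
    -- and the diagonal term of the recurrence has coefficient 1.
    module Normalised (hc : c R.≈ R.1# R.+ ∑R D (λ j → pt j R.* ε (suc j ℕ.* N) (Tr j))) where

      private
        εn̂ : ε M1 n̂ R.≈ R.1#
        εn̂ = R.trans (ε-- M1 _ _) (R.trans (R.+-cong
            (R.trans (ε-scale M1 c (σ ^ M)) (R.trans (R.*-cong R.refl εσ) (R.*-identityʳ c)))
            (R.-‿cong (R.trans (∑-lin D (ε M1) (ε-0 M1) (ε-+ M1) _)
              (∑R-cong D λ j h → R.trans (ε-scale M1 _ _) (R.*-cong R.refl (R.trans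
                (R.reflexive (≡.cong (λ i → ε i (σ ^ ex j * Tr j)) (≡.sym (ex+ h))))
                (ε-shift (ex j) (suc j ℕ.* N) (Tr j))))))))
          (R.trans (R.+-cong hc R.refl)
            (RS.solve 2 (λ a b → (a RS.:+ b) RS.:- b RS.:= a) R.refl R.1# _)))
          where
          εσ : ε M1 (σ ^ M) R.≈ R.1#
          εσ = R.trans (ε-cong M1 (sym (*-identityʳ _))) (R.trans
            (R.reflexive (≡.cong (λ i → ε i (σ ^ M * 1#)) (≡.sym (ℕP.+-comm M 1))))
            (R.trans (ε-shift M 1 1#) (*-identityʳ y 1)))

      εν : ε M1 ν R.≈ R.0#
      εν = R.trans (ε-- M1 n̂ _) (R.trans (R.+-cong εn̂ (R.-‿cong (ε-σ M1))) (R.-‿inverseʳ _))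

      Lo-yν : Lo M1 (y * ν)
      Lo-yν = y-Lo Lo-ν εν

      private
        n̂-ν : ∀ a → n̂ * a ≈ σ ^ M1 * a + ν * a
        n̂-ν a = solve 3 (λ n s a → n :* a := s :* a :+ (n :- s) :* a) refl n̂ (σ ^ M1) a

        ε-ν* : ∀ {B a} → Lo (suc B) a → ε (M1 ℕ.+ B) (ν * a) R.≈ R.0#
        ε-ν* {B} {a} l = R.trans (sym (*-assoc y ν a) (M1 ℕ.+ B))
          (Lo-* Lo-yν l (M1 ℕ.+ B) (ℕP.≤-reflexive (ℕP.+-suc M B)))

      ε-V : ∀ {B a} → Lo (suc B) a →
            ε (M1 ℕ.+ B) (V B a) R.≈ ε B a R.+ ∑R D (λ j → pt j R.* es (suc j) B a)
      ε-V {B} {a} l = R.trans (ε-+ (M1 ℕ.+ B) _ _) (R.+-cong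
        (R.trans (ε-cong (M1 ℕ.+ B) (n̂-ν a)) (R.trans (ε-+ (M1 ℕ.+ B) _ _)
          (R.trans (R.+-cong (ε-shift M1 B a) (ε-ν* l)) (R.+-identityʳ _))))
        (R.trans (∑-lin D (ε (M1 ℕ.+ B)) (ε-0 (M1 ℕ.+ B)) (ε-+ (M1 ℕ.+ B)) _) (∑R-cong D λ j h →
          R.trans (ε-scale (M1 ℕ.+ B) _ _) (R.*-cong R.refl (R.trans
            (R.reflexive (≡.cong (λ i → ε i (σ ^ ex j * Sit (suc j) B a)) (≡.sym (exB B h))))
            (R.trans (ε-shift (ex j) (suc j ℕ.* N ℕ.+ B) (Sit (suc j) B a)) (ε-Sit (suc j) B a)))))))

      private
        S-∑ : ∀ B n f → S B (∑ n f) ≈ ∑ n (λ j → S B (f j))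
        S-∑ B zero f = S-0 B
        S-∑ B (suc n) f = trans (S-+ B _ _) (+-cong refl (S-∑ B n f))

      -- `S` and `V` fail to commute only through `ν`: as `ν` vanishes at s = 1, S (ν a) is Y ν a,
      -- whereas ν S a is Y ν (a - a(1)). The defect has rank one.
      S-V : ∀ {B a} → Lo (suc B) a →
            S (M1 ℕ.+ B) (V B a) ≈ V (N ℕ.+ B) (S B a) + ⟨ ε B a ⟩ * (σ ^ B * (y * ν))
      S-V {B} {a} l = trans (S-+ (M1 ℕ.+ B) _ _) (trans (+-cong
          (trans (S-cong (M1 ℕ.+ B) (n̂-ν a)) (trans (S-+ (M1 ℕ.+ B) _ _) (+-cong (S-shift M1 B a) (S-ker (M1 ℕ.+ B) (ε-ν* l)))))
          (trans (S-∑ (M1 ℕ.+ B) D _) (∑-cong D λ j h → trans (S-scale (M1 ℕ.+ B) (pt j) _) (*-cong refl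
            (trans (reflexive (≡.cong (λ i → S i (σ ^ ex j * Sit (suc j) B a)) (≡.sym (exB B h))))
              (trans (S-shift (ex j) (suc j ℕ.* N ℕ.+ B) (Sit (suc j) B a))
                (*-cong refl (SitS (suc j) B a))))))))
        (solve 7 (λ s y a e b n u →
            (s :* (y :* (a :- e :* b)) :+ y :* ((n :- s) :* a)) :+ u
            := (n :* (y :* (a :- e :* b)) :+ u) :+ e :* (b :* (y :* (n :- s)))) refl
          (σ ^ M1) y a ⟨ ε B a ⟩ (σ ^ B) n̂ _))

      -- Moving the shifts past `V` one by one leaves a trail of rank-one defects; the coefficients
      -- of Y ν = S ν in them are the kernel of the convolution.
      es-V : ∀ a B f → Lo (suc B) f → es a (M1 ℕ.+ B) (V B f) R.≈
             (es a B f R.+ ∑R D (λ j → pt j R.* es (a ℕ.+ suc j) B f)) R.+ conv (λ i → es i B f) tν a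
      es-V zero B f l = R.trans (ε-V l) (R.sym (R.+-identityʳ _))
      es-V (suc a) B f l = R.trans (es-cong a (N ℕ.+ (M1 ℕ.+ B)) (S-V l)) (R.trans (es-+ a (N ℕ.+ (M1 ℕ.+ B)) _ _) (R.trans (R.+-cong
          (R.trans (R.reflexive (≡.cong (λ i → es a i (V (N ℕ.+ B) (S B f))) (swapℕ N M1 B)))
            (es-V a (N ℕ.+ B) (S B f) (Lo-mono (ℕP.≤-trans (ℕP.m≤n+m B N) (ℕP.n≤1+n _)) (S-Lo l))))
          (R.trans (es-scale a (N ℕ.+ (M1 ℕ.+ B)) _ _) (R.*-cong R.refl (R.trans
            (R.reflexive (≡.cong (λ i → es a i (σ ^ B * (y * ν))) (swap2 N M1 B)))
            (R.trans (es-shift a B (N ℕ.+ M1) (y * ν)) (es-cong a (N ℕ.+ M1) (sym (S-ker M1 εν))))))))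
        (RS.solve 3 (λ u v w → (u RS.:+ v) RS.:+ w RS.:= u RS.:+ (w RS.:+ v)) R.refl _ _ _)))
        where
        open +-*-Solver renaming (_:+_ to _:+ₙ_; _:=_ to _:=ₙ_; solve to solveₙ)
        swapℕ : ∀ a b c → a ℕ.+ (b ℕ.+ c) ≡ b ℕ.+ (a ℕ.+ c)
        swapℕ = solveₙ 3 (λ a b c → a :+ₙ (b :+ₙ c) :=ₙ b :+ₙ (a :+ₙ c)) ≡.refl
        swap2 : ∀ a b c → a ℕ.+ (b ℕ.+ c) ≡ c ℕ.+ (a ℕ.+ b)
        swap2 = solveₙ 3 (λ a b c → a :+ₙ (b :+ₙ c) :=ₙ c :+ₙ (a :+ₙ b)) ≡.refl

-- Comparison of iterates with powers of the symbol.

module OperatorInverses where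

  open import Level using (0ℓ)
  open import Algebra.Bundles using (CommutativeRing)
  open import Data.Nat as ℕ using (ℕ; zero; suc; _≤_; _<_; s≤s; _∸_)
  import Data.Nat.Properties as ℕP
  open import Data.Nat.Solver using (module +-*-Solver)
  open import Relation.Nullary using (yes; no)
  open import Relation.Binary.PropositionalEquality as ≡ using (_≡_)
  open Rings
  open Filtrations
  open Shifts
  open ToeplitzOperators

  module Inverse (R : CommutativeRing 0ℓ 0ℓ) (N D : ℕ)
    (pt : ℕ → CommutativeRing.Carrier R) (c c′ : CommutativeRing.Carrier R)
    (hinv : CommutativeRing._≈_ R (CommutativeRing._*_ R c c′) (CommutativeRing.1# R)) where
    open Toeplitz R N D pt c public

    τ : PS
    τ = ∑ D (λ j → ⟨ pt j ⟩ * Tl j)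

    ρ-τ : ρ ≈ ⟨ c ⟩ + σ * τ
    ρ-τ = +-cong refl (trans (∑-cong D λ j _ →
      solve 3 (λ p s t → p :* (s :* t) := s :* (p :* t)) refl ⟨ pt j ⟩ σ (Tl j)) (∑-* D σ _))

    -- Fixed-point iteration for 1/ρ: the map a ↦ c′ (1 - σ τ a) settles one more coefficient at
    -- each step, so the diagonal `ι` is the inverse.
    ιk : ℕ → PS
    ιk zero = ⟨ c′ ⟩
    ιk (suc k) = ⟨ c′ ⟩ * (1# - σ * (τ * ιk k))

    ι : PS
    ι i = ιk i i

    private
      σ-cong≤ : ∀ i {a b} → (∀ j → j < i → a j R.≈ b j) → (σ * a) i R.≈ (σ * b) i
      σ-cong≤ zero {a} {b} h = R.trans (σ-0 a) (R.sym (σ-0 b))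
      σ-cong≤ (suc i) {a} {b} h = R.trans (σ-suc a i) (R.trans (h i ℕP.≤-refl) (R.sym (σ-suc b i)))

      step-cong : ∀ i {a b} → (∀ j → j < i → a j R.≈ b j) →
        (⟨ c′ ⟩ * (1# - σ * (τ * a))) i R.≈ (⟨ c′ ⟩ * (1# - σ * (τ * b))) i
      step-cong i {a} {b} h = R.trans (const-* c′ (1# - σ * (τ * a)) i) (R.trans (R.*-cong R.refl (R.+-cong R.refl
        (R.-‿cong (σ-cong≤ i {τ * a} {τ * b} λ j l →
          ⊗-cong≤ {τ} {τ} {a} {b} j (λ _ _ → R.refl) (λ k m → h k (ℕP.≤-<-trans m l))))))
        (R.sym (const-* c′ (1# - σ * (τ * b)) i)))

      stable : ∀ k i → i ≤ k → ιk (suc k) i R.≈ ιk k i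
      stable zero zero _ = R.trans (const-* c′ (1# - σ * (τ * ιk 0)) 0) (R.trans (R.*-cong R.refl
        (R.trans (R.+-cong R.refl (R.trans (R.-‿cong (σ-0 (τ * ιk 0))) RP.-0#≈0#)) (R.+-identityʳ R.1#)))
        (R.*-identityʳ c′))
        where import Algebra.Properties.Ring R.ring as RP
      stable (suc k) i h = step-cong i {ιk (suc k)} {ιk k} λ j l → stable k j (ℕP.≤-pred (ℕP.≤-trans l h))

      lim : ∀ k i → i ≤ k → ιk k i R.≈ ι i
      lim zero zero _ = R.refl
      lim (suc k) i h with i ℕ.≟ suc k
      ... | yes ≡.refl = R.refl
      ... | no ne = R.trans (stable k i (ℕP.≤-pred (ℕP.≤∧≢⇒< h ne))) (lim k i (ℕP.≤-pred (ℕP.≤∧≢⇒< h ne)))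

    ι-eq : ι ≈ ⟨ c′ ⟩ * (1# - σ * (τ * ι))
    ι-eq i = R.trans (R.sym (lim (suc i) i (ℕP.n≤1+n i))) (step-cong i {ιk i} {ι} λ j l → lim i j (ℕP.<⇒≤ l))

    ρι : ρ * ι ≈ 1#
    ρι = trans (*-cong ρ-τ refl) (trans (distribʳ ι ⟨ c ⟩ (σ * τ))
      (trans (+-cong (trans (*-cong refl ι-eq) (trans (sym (*-assoc _ _ _))
          (*-cong (trans (sym (const-mul c c′)) (const-cong hinv)) refl))) refl)
        (trans (+-cong (*-identityˡ _) (*-assoc σ τ ι))
          (solve 2 (λ o x → (o :- x) :+ x := o) refl 1# (σ * (τ * ι))))))

    ρι^ : ∀ k → ρ ^ k * ι ^ k ≈ 1#
    ρι^ zero = *-identityˡ 1#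
    ρι^ (suc k) = trans (solve 4 (λ r p i q → (r :* p) :* (i :* q) := (r :* i) :* (p :* q)) refl ρ (ρ ^ k) ι (ι ^ k))
      (trans (*-cong ρι (ρι^ k)) (*-identityˡ 1#))

    ρσ-cancel : ∀ l k a b → σ ^ l * (ρ ^ k * a) ≈ σ ^ l * (ρ ^ k * b) → a ≈ b
    ρσ-cancel l k a b p = trans (sym (kill a)) (trans (*-cong refl (σ-cancel l _ _ p)) (kill b))
      where
      kill : ∀ a → ι ^ k * (ρ ^ k * a) ≈ a
      kill a = trans (solve 3 (λ i r a → i :* (r :* a) := (r :* i) :* a) refl (ι ^ k) (ρ ^ k) a)
        (trans (*-cong (ρι^ k) refl) (*-identityˡ a))

    -- The part of Y^b a with positive powers of Y, which b backward shifts discard: a_0 Y^b + ... +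
    -- a_(b-1) Y, where the a_i are the coefficients of the expansion in 1/Y.
    Qp : ℕ → ℕ → PS → PS
    Qp zero B a = 0#
    Qp (suc b) B a = ⟨ ε B a ⟩ * y ^ suc b + σ ^ N * Qp b (N ℕ.+ B) (S B a)

    Sit-Q : ∀ b B a → Sit b B a ≈ y ^ b * a - σ ^ B * Qp b B a
    Sit-Q zero B a = sym (trans (+-cong (*-identityˡ a) (trans (-‿cong (zeroʳ _)) -0#≈0#)) (+-identityʳ a))
    Sit-Q (suc b) B a = trans (Sit-Q b (N ℕ.+ B) (S B a)) (trans
      (+-cong refl (-‿cong (*-cong (^-homo-* σ N B) refl)))
      (solve 7 (λ p y a e s t q → p :* (y :* (a :- e :* s)) :- (t :* s) :* q :=
          (y :* p) :* a :- s :* (e :* (y :* p) :+ t :* q)) refl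
        (y ^ b) y a ⟨ ε B a ⟩ (σ ^ B) (σ ^ N) (Qp b (N ℕ.+ B) (S B a))))

    q : ℕ → PS → PS
    q B a = ∑ D (λ j → ⟨ pt j ⟩ * (σ ^ (M ∸ suc j ℕ.* N) * Qp (suc j) B a))

    -- The discarded parts are polynomials in Y of degree at most D, hence of degree at most M in s
    -- whatever the bound B. Relative to the new bound M1 + B they begin only at σ^(B + 1), so on
    -- high powers of s the operator is mere multiplication by s ρ.
    V-Q : ∀ B a → V B a ≈ σ ^ M * (ρ * a) - σ ^ suc B * q B a
    V-Q B a = trans (+-cong refl (trans (∑-cong D step) (trans (∑-+ D _ _) (+-cong (∑-* D a _)
        (∑-* D (- (σ ^ suc B)) _)))))
      (trans (solve 5 (λ n a u s q → n :* a :+ (a :* u :+ (:- s) :* q) := (n :+ u) :* a :- s :* q) refl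
          n̂ a _ (σ ^ suc B) _)
        (+-cong (trans (*-cong n̂+∑ refl) (*-assoc _ _ _)) refl))
      where
      step : ∀ j → j < D → ⟨ pt j ⟩ * (σ ^ ex j * Sit (suc j) B a) ≈
        a * (⟨ pt j ⟩ * (σ ^ ex j * y ^ suc j)) +
        (- (σ ^ suc B)) * (⟨ pt j ⟩ * (σ ^ (M ∸ suc j ℕ.* N) * Qp (suc j) B a))
      step j h = trans (*-cong refl (*-cong refl (Sit-Q (suc j) B a))) (trans
        (solve 6 (λ p e y a s q → p :* (e :* (y :* a :- s :* q)) := a :* (p :* (e :* y)) :+ (:- (s :* (e :* (p :* q))))) refl
          ⟨ pt j ⟩ (σ ^ ex j) (y ^ suc j) a (σ ^ B) (Qp (suc j) B a))
        (+-cong refl (trans (-‿cong (*-cong refl (*-cong (σ-≡ (ℕP.+-∸-assoc 1 (jN≤M h))) refl)))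
          (solve 5 (λ p e o s q → :- (s :* ((o :* e) :* (p :* q))) := (:- (o :* s)) :* (p :* (e :* q))) refl
          ⟨ pt j ⟩ (σ ^ (M ∸ suc j ℕ.* N)) σ (σ ^ B) (Qp (suc j) B a)))))

    Vit : ℕ → ℕ → PS → PS
    Vit zero B a = a
    Vit (suc k) B a = V (k ℕ.* M1 ℕ.+ B) (Vit k B a)

    Vit-cong : ∀ k B {a b} → a ≈ b → Vit k B a ≈ Vit k B b
    Vit-cong zero B p = p
    Vit-cong (suc k) B p = V-cong _ (Vit-cong k B p)

    Vit-+ : ∀ k B a b → Vit k B (a + b) ≈ Vit k B a + Vit k B b
    Vit-+ zero B a b = refl
    Vit-+ (suc k) B a b = trans (V-cong _ (Vit-+ k B a b)) (V-+ _ _ _)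

    Vit-Lo : ∀ k {B a} → Lo (suc B) a → Lo (suc (k ℕ.* M1 ℕ.+ B)) (Vit k B a)
    Vit-Lo zero l = l
    Vit-Lo (suc k) {B} {a} l = ≡.subst (λ i → Lo (suc i) (Vit (suc k) B a)) (≡.sym (ℕP.+-assoc M1 (k ℕ.* M1) B))
      (V-Lo (Vit-Lo k l))

    -- V^k a divided by the k-th power of the symbol, as for a wave operator in scattering theory.
    -- Each new correction carries σ^(k+1), so the coefficients stabilise, to those of `Λ∞`.
    Lam : ℕ → PS → ℕ → PS
    Lam C a zero = a
    Lam C a (suc k) = Lam C a k -
      σ ^ suc k * (ι ^ suc k * (σ ^ C * q (k ℕ.* M1 ℕ.+ (C ℕ.+ M)) (Vit k (C ℕ.+ M) a)))

    -- The starting bound is padded by M: after division by σ^((k+1) M) the factor σ^(B + 1) of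
    -- `V-Q` must still leave σ^(k+1).
    Vit-Lam : ∀ C a k → Vit k (C ℕ.+ M) a ≈ σ ^ (k ℕ.* M) * (ρ ^ k * Lam C a k)
    Vit-Lam C a zero = sym (trans (*-identityˡ _) (*-identityˡ _))
    Vit-Lam C a (suc k) = trans (V-Q B z) (trans (+-cong (*-cong refl (*-cong refl (Vit-Lam C a k)))
        (-‿cong (*-cong (trans (σ-≡ ix) (trans (^-homo-* σ (suc k ℕ.* M) (suc k ℕ.+ C))
          (*-cong refl (^-homo-* σ (suc k) C)))) refl)))
      (trans (+-cong refl (-‿cong (trans (*-cong (*-cong (^-homo-* σ M (k ℕ.* M)) refl) (sym (*-identityˡ _)))
          (*-cong refl (*-cong (sym (ρι^ (suc k))) refl)))))
      (trans (solve 9 (λ m r x p l s t i g →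
          m :* (r :* (x :* (p :* l))) :- ((m :* x) :* (s :* t)) :* ((r :* p :* i) :* g)
          := (m :* x) :* (r :* p :* (l :- s :* (i :* (t :* g))))) refl
        (σ ^ M) ρ (σ ^ (k ℕ.* M)) (ρ ^ k) (Lam C a k) (σ ^ suc k) (σ ^ C) (ι ^ suc k) (q B z))
        (*-cong (sym (^-homo-* σ M (k ℕ.* M))) refl))))
      where
      B = k ℕ.* M1 ℕ.+ (C ℕ.+ M)
      z = Vit k (C ℕ.+ M) a
      ix : suc B ≡ suc k ℕ.* M ℕ.+ (suc k ℕ.+ C)
      ix = solveₙ 3 (λ k C M → conₙ 1 :+ₙ (k :*ₙ (conₙ 1 :+ₙ M) :+ₙ (C :+ₙ M)) :=ₙ
             (conₙ 1 :+ₙ k) :*ₙ M :+ₙ ((conₙ 1 :+ₙ k) :+ₙ C)) ≡.refl k C M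
        where open +-*-Solver renaming (_:+_ to _:+ₙ_; _:*_ to _:*ₙ_; _:=_ to _:=ₙ_; solve to solveₙ; con to conₙ)

    Lam-stable : ∀ C a k i → i ≤ k → Lam C a (suc k) i R.≈ Lam C a k i
    Lam-stable C a k i h = R.trans (R.+-cong R.refl (R.trans (R.-‿cong (shift-lo (suc k) _ i (s≤s h))) RP.-0#≈0#))
      (R.+-identityʳ _)
      where import Algebra.Properties.Ring R.ring as RP

    Λ∞ : ℕ → PS → PS
    Λ∞ C a i = Lam C a i i

    Lam-lim : ∀ C a k i → i ≤ k → Lam C a k i R.≈ Λ∞ C a i
    Lam-lim C a zero zero _ = R.refl
    Lam-lim C a (suc k) i h with i ℕ.≟ suc k
    ... | yes ≡.refl = R.refl
    ... | no ne = R.trans (Lam-stable C a k i l) (Lam-lim C a k i l)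
      where l = ℕP.≤-pred (ℕP.≤∧≢⇒< h ne)

-- A commutation relation in the limit of infinitely many steps.

module OperatorLimits where

  open import Level using (0ℓ)
  open import Algebra.Bundles using (CommutativeRing)
  open import Data.Nat as ℕ using (ℕ; zero; suc; _≤_; _<_; s≤s; _∸_)
  import Data.Nat.Properties as ℕP
  open import Data.Nat.Solver using (module +-*-Solver)
  open import Relation.Nullary using (yes; no)
  open import Relation.Binary.PropositionalEquality as ≡ using (_≡_)
  open Rings
  open Filtrations
  open Shifts
  open ToeplitzOperators
  open OperatorInverses

  module Limit (R : CommutativeRing 0ℓ 0ℓ) (N D : ℕ)
    (pt : ℕ → CommutativeRing.Carrier R) (c c′ w : CommutativeRing.Carrier R)
    (hinv : CommutativeRing._≈_ R (CommutativeRing._*_ R c c′) (CommutativeRing.1# R))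
    (hc : CommutativeRing._≈_ R c (CommutativeRing._+_ R (CommutativeRing.1# R)
            (Shift.∑R R N D (λ j → CommutativeRing._*_ R (pt j) (Shift.ε R N (suc j ℕ.* N) (Shift.Tr R N j)))))) where
    open Inverse R N D pt c c′ hinv public
    open Normalised hc public

    open +-*-Solver using () renaming (_:+_ to _:+ₙ_; _:*_ to _:*ₙ_; _:=_ to _:=ₙ_; solve to solveₙ; con to conₙ)

    -- The constant 1, stored with the padded bound M, and its images under `V`. Their expansions in
    -- 1/Y are the rows x_k of the recurrence.
    U : ℕ → PS
    U k = Vit k M (σ ^ M)

    e : ℕ → R.Carrier
    e k = ε (k ℕ.* M1 ℕ.+ M) (U k)

    U-Lo : ∀ k → Lo (suc (k ℕ.* M1 ℕ.+ M)) (U k)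
    U-Lo k = Vit-Lo k (Lo-σ M)

    m : ℕ
    m = suc N

    -- w S ν, with σ^(m M) bringing it to the bound of `U m`: this is what the closing condition
    -- demands `U m` to be.
    z₁ : PS
    z₁ = ⟨ w ⟩ * (σ ^ (m ℕ.* M) * (y * ν))

    -- The convolution Σ e(k-1-l) z(l); the powers of σ bring the summands to one common bound.
    cv : (ℕ → PS) → ℕ → PS
    cv z zero = 0#
    cv z (suc k) = ⟨ e k ⟩ * (σ ^ (k ℕ.* M1) * z 0) + cv (λ l → z (suc l)) k

    V-0 : ∀ B → V B 0# ≈ 0#
    V-0 B = trans (V-cong B (sym (zeroʳ ⟨ R.0# ⟩))) (trans (V-scale B R.0# 0#)
      (trans (*-cong const-0 refl) (zeroˡ _)))

    V-cv : ∀ k B z → (∀ l → V (l ℕ.* M1 ℕ.+ B) (z l) ≈ z (suc l)) →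
           V (k ℕ.* M1 ℕ.+ B) (cv z (suc k)) ≈ cv (λ l → z (suc l)) (suc k)
    V-cv k B z h = trans (V-+ _ _ _) (+-cong
        (trans (V-scale _ _ _) (*-cong refl (trans (V-shift (k ℕ.* M1) B (z 0)) (*-cong refl (h 0)))))
        (rest k))
      where
      ix : ∀ l → suc l ℕ.* M1 ℕ.+ B ≡ l ℕ.* M1 ℕ.+ (M1 ℕ.+ B)
      ix l = solveₙ 3 (λ l s B → (conₙ 1 :+ₙ l) :*ₙ s :+ₙ B :=ₙ l :*ₙ s :+ₙ (s :+ₙ B)) ≡.refl l M1 B
      rest : ∀ k → V (k ℕ.* M1 ℕ.+ B) (cv (λ l → z (suc l)) k) ≈ cv (λ l → z (suc (suc l))) k
      rest zero = V-0 _
      rest (suc k) = trans (V-≡ _ (ix k)) (V-cv k (M1 ℕ.+ B) (λ l → z (suc l)) λ l →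
        trans (V-≡ (z (suc l)) (≡.sym (ix l))) (h (suc l)))

    W : ℕ → PS
    W k = ⟨ w ⟩ * (σ ^ (N ℕ.* M) * S (k ℕ.* M1 ℕ.+ M) (U k))

    z : ℕ → PS
    z l = Vit l (m ℕ.* M1 ℕ.+ M) z₁

    private
      W-suc : ∀ k → W (suc k) ≈ V (N ℕ.* M ℕ.+ (N ℕ.+ (k ℕ.* M1 ℕ.+ M))) (W k) + ⟨ e k ⟩ * (σ ^ (k ℕ.* M1) * z₁)
      W-suc k = trans (*-cong refl (*-cong refl (trans
          (reflexive (≡.cong (λ i → S i (U (suc k))) (ℕP.+-assoc M1 (k ℕ.* M1) M)))
          (S-V (U-Lo k)))))
        (trans (solve 6 (λ w s v e t y → w :* (s :* (v :+ e :* (t :* y))) :=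
            w :* (s :* v) :+ e :* (w :* ((s :* t) :* y))) refl
            ⟨ w ⟩ (σ ^ (N ℕ.* M)) _ ⟨ e k ⟩ (σ ^ (k ℕ.* M1 ℕ.+ M)) (y * ν))
          (+-cong (sym (trans (V-scale _ w _) (*-cong refl (V-shift (N ℕ.* M) (N ℕ.+ (k ℕ.* M1 ℕ.+ M)) _))))
            (*-cong refl (trans (*-cong refl (*-cong exps refl))
              (solve 4 (λ w s t x → w :* ((s :* t) :* x) := s :* (w :* (t :* x))) refl
                ⟨ w ⟩ (σ ^ (k ℕ.* M1)) (σ ^ (m ℕ.* M)) (y * ν))))))
        where
        exps : σ ^ (N ℕ.* M) * σ ^ (k ℕ.* M1 ℕ.+ M) ≈ σ ^ (k ℕ.* M1) * σ ^ (m ℕ.* M)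
        exps = trans (sym (^-homo-* σ (N ℕ.* M) _)) (trans (σ-≡
          (solveₙ 3 (λ a b M → a :+ₙ (b :+ₙ M) :=ₙ b :+ₙ (M :+ₙ a)) ≡.refl (N ℕ.* M) (k ℕ.* M1) M))
          (^-homo-* σ (k ℕ.* M1) (m ℕ.* M)))

    -- Duhamel's formula: in passing through V^k, S leaves one rank-one defect at each factor, and
    -- at the end it annihilates the constant 1.
    W-cv : ∀ k → W k ≈ cv z k
    W-cv zero = trans (*-cong refl (trans (*-cong refl (*-cong refl (trans (+-cong refl (-‿cong
        (trans (*-cong (const-cong (ε-σ M)) refl) (*-identityˡ _)))) (-‿inverseʳ _))))
        (solve 2 (λ s y → s :* (y :* con (+ 0)) := con (+ 0)) refl (σ ^ (N ℕ.* M)) y))) (zeroʳ _)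
      where open import Data.Integer using (+_)
    W-cv (suc zero) = trans (W-suc 0) (trans (+-cong (trans (V-cong _ (W-cv 0)) (V-0 _)) refl) (+-comm _ _))
    W-cv (suc (suc k)) = trans (W-suc (suc k)) (trans (+-cong (trans (V-cong _ (W-cv (suc k)))
        (trans (V-≡ (cv z (suc k)) ix) (V-cv k (m ℕ.* M1 ℕ.+ M) z (λ l → refl)))) refl) (+-comm _ _))
      where
      ix : N ℕ.* M ℕ.+ (N ℕ.+ (suc k ℕ.* M1 ℕ.+ M)) ≡ k ℕ.* M1 ℕ.+ (m ℕ.* M1 ℕ.+ M)
      ix = solveₙ 3 (λ N M k → N :*ₙ M :+ₙ (N :+ₙ ((conₙ 1 :+ₙ k) :*ₙ (conₙ 1 :+ₙ M) :+ₙ M)) :=ₙ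
        k :*ₙ (conₙ 1 :+ₙ M) :+ₙ ((conₙ 1 :+ₙ N) :*ₙ (conₙ 1 :+ₙ M) :+ₙ M)) ≡.refl N M k

    cz : (ℕ → PS) → ℕ → PS
    cz Z zero = 0#
    cz Z (suc k) = ⟨ e k ⟩ * (σ ^ k * (ι ^ suc k * Z 0)) + cz (λ l → Z (suc l)) k

    cv-cz : ∀ k o z Z → (∀ l → z l ≈ σ ^ ((l ℕ.+ o) ℕ.* M) * (ρ ^ (l ℕ.+ o) * Z l)) →
            σ ^ M * cv z k ≈ σ ^ ((k ℕ.+ o) ℕ.* M) * (ρ ^ (k ℕ.+ o) * cz Z k)
    cv-cz zero o z Z h = trans (zeroʳ _) (sym (trans (*-cong refl (zeroʳ _)) (zeroʳ _)))
    cv-cz (suc k) o z Z h = trans (distribˡ _ _ _) (trans (+-cong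
        (trans (*-cong refl (*-cong refl (*-cong refl (h 0))))
          (trans (solve 6 (λ m e k o r Z → m :* (e :* (k :* (o :* (r :* Z)))) := (m :* (k :* o)) :* (e :* (r :* Z))) refl
              (σ ^ M) ⟨ e k ⟩ (σ ^ (k ℕ.* M1)) (σ ^ (o ℕ.* M)) (ρ ^ o) (Z 0))
            (trans (*-cong exps (*-cong refl (trans (sym (*-identityˡ _)) (*-cong (sym (ρι^ (suc k))) refl))))
              (trans (solve 7 (λ s t r i o e Z → (s :* t) :* (e :* ((r :* i) :* (o :* Z)))
                  := s :* ((r :* o) :* (e :* (t :* (i :* Z))))) refl
                  (σ ^ ((suc k ℕ.+ o) ℕ.* M)) (σ ^ k) (ρ ^ suc k) (ι ^ suc k) (ρ ^ o) ⟨ e k ⟩ (Z 0))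
                (*-cong refl (*-cong (sym (^-homo-* ρ (suc k) o)) refl))))))
        (trans (cv-cz k (suc o) _ _ (λ l → trans (h (suc l)) (*-cong (σ-≡ (≡.cong (ℕ._* M) (≡.sym (ℕP.+-suc l o))))
            (*-cong (reflexive (≡.cong (ρ ^_) (≡.sym (ℕP.+-suc l o)))) refl))))
          (*-cong (σ-≡ (≡.cong (ℕ._* M) (ℕP.+-suc k o))) (*-cong (reflexive (≡.cong (ρ ^_) (ℕP.+-suc k o))) refl))))
      (trans (sym (distribˡ _ _ _)) (*-cong refl (sym (distribˡ _ _ _)))))
      where
      exps : σ ^ M * (σ ^ (k ℕ.* M1) * σ ^ (o ℕ.* M)) ≈ σ ^ ((suc k ℕ.+ o) ℕ.* M) * σ ^ k
      exps = trans (*-cong refl (sym (^-homo-* σ (k ℕ.* M1) (o ℕ.* M)))) (trans (sym (^-homo-* σ M _))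
        (trans (σ-≡ (solveₙ 3 (λ M k o → M :+ₙ (k :*ₙ (conₙ 1 :+ₙ M) :+ₙ o :*ₙ M) :=ₙ
            ((conₙ 1 :+ₙ k) :+ₙ o) :*ₙ M :+ₙ k) ≡.refl M k o)) (^-homo-* σ ((suc k ℕ.+ o) ℕ.* M) k)))

    ΛU : ℕ → PS
    ΛU = Lam 0 (σ ^ M)

    Z : ℕ → PS
    Z = Lam (m ℕ.* M1) z₁

    U-ΛU : ∀ k → U k ≈ σ ^ (k ℕ.* M) * (ρ ^ k * ΛU k)
    U-ΛU k = Vit-Lam 0 (σ ^ M) k

    -- Duhamel's formula divided by the k-th power of the symbol, the form in which both sides
    -- converge.
    finite : ∀ k → ⟨ w ⟩ * (σ ^ (m ℕ.* M) * (y * (ΛU k - ⟨ e k ⟩ * (ι ^ k * σ ^ (k ℕ.+ M))))) ≈ cz Z k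
    finite k = ρσ-cancel (k ℕ.* M) k _ _ (trans lhs (trans (*-cong refl (W-cv k)) (trans
      (cv-cz k 0 z Z λ l → trans (Vit-Lam (m ℕ.* M1) z₁ l)
        (*-cong (σ-≡ (≡.cong (ℕ._* M) (≡.sym (ℕP.+-identityʳ l)))) (*-cong (reflexive (≡.cong (ρ ^_) (≡.sym (ℕP.+-identityʳ l)))) refl)))
      (*-cong (σ-≡ (≡.cong (ℕ._* M) (ℕP.+-identityʳ k))) (*-cong (reflexive (≡.cong (ρ ^_) (ℕP.+-identityʳ k))) refl)))))
      where
      lhs : σ ^ (k ℕ.* M) * (ρ ^ k * (⟨ w ⟩ * (σ ^ (m ℕ.* M) * (y * (ΛU k - ⟨ e k ⟩ * (ι ^ k * σ ^ (k ℕ.+ M)))))))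
            ≈ σ ^ M * W k
      lhs = trans (*-cong refl (*-cong refl (*-cong refl (*-cong (^-homo-* σ M (N ℕ.* M)) refl))))
        (trans (solve 11 (λ a r w m n y l e i s o → a :* (r :* (w :* ((m :* n) :* (y :* (l :- e :* (i :* s))))))
            := m :* (w :* (n :* (y :* (a :* (r :* l) :- e :* ((r :* i) :* (a :* s))))))) refl
            (σ ^ (k ℕ.* M)) (ρ ^ k) ⟨ w ⟩ (σ ^ M) (σ ^ (N ℕ.* M)) y (ΛU k) ⟨ e k ⟩ (ι ^ k) (σ ^ (k ℕ.+ M)) 0#)
          (*-cong refl (*-cong refl (*-cong refl (*-cong refl (+-cong (sym (U-ΛU k)) (-‿cong (*-cong refl
            (trans (*-cong (ρι^ k) (trans (sym (^-homo-* σ (k ℕ.* M) (k ℕ.+ M)))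
              (σ-≡ (solveₙ 2 (λ k M → k :*ₙ M :+ₙ (k :+ₙ M) :=ₙ k :*ₙ (conₙ 1 :+ₙ M) :+ₙ M) ≡.refl k M))))
              (*-identityˡ _))))))))))

    -- Partial sums of Σ e(k) σ^k/ρ^(k+1), which is the generating series of the numbers x_k(0) at
    -- the inverse of the symbol, divided by ρ. It converges σ-adically, to `Ê`.
    Es : ℕ → PS
    Es zero = 0#
    Es (suc k) = ⟨ e k ⟩ * (σ ^ k * ι ^ suc k) + Es k

    Ê : PS
    Ê i = Es (suc i) i

    private
      const-lo : ∀ r {a} i → a i R.≈ R.0# → (⟨ r ⟩ * a) i R.≈ R.0#
      const-lo r {a} i h = R.trans (const-* r a i) (R.trans (R.*-cong R.refl h) (R.zeroʳ r))

    Es-lim : ∀ k i → i < k → Es k i R.≈ Ê i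
    Es-lim (suc k) i h with i ℕ.≟ k
    ... | yes ≡.refl = R.refl
    ... | no ne = R.trans (R.+-cong (const-lo (e k) {σ ^ k * ι ^ suc k} i (shift-lo k _ i l)) R.refl)
                    (R.trans (R.+-identityˡ _) (Es-lim k i l))
      where l = ℕP.≤∧≢⇒< (ℕP.≤-pred h) ne

    shift-cong : ∀ k i {a b} → (∀ j → k ℕ.+ j ≤ i → a j R.≈ b j) → (σ ^ k * a) i R.≈ (σ ^ k * b) i
    shift-cong k i {a} {b} h with i ℕ.<? k
    ... | yes i<k = R.trans (shift-lo k a i i<k) (R.sym (shift-lo k b i i<k))
    ... | no i≮k = ≡.subst (λ i → (σ ^ k * a) i R.≈ (σ ^ k * b) i) eq
          (R.trans (shift-hi k a (i ∸ k)) (R.trans (h (i ∸ k) (ℕP.≤-reflexive eq)) (R.sym (shift-hi k b (i ∸ k)))))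
      where eq = ℕP.m+[n∸m]≡n (ℕP.≮⇒≥ i≮k)

    cz-lim : ∀ k o (Z : ℕ → PS) Z∞ → (∀ l i → i ≤ l ℕ.+ o → Z l i R.≈ Z∞ i) →
             ∀ i → i < k ℕ.+ o → cz Z k i R.≈ (Es k * Z∞) i
    cz-lim zero o Z Z∞ h i l = R.sym (zeroˡ Z∞ i)
    cz-lim (suc k) o Z Z∞ h i l = R.trans (R.+-cong
        (R.trans (const-* (e k) _ i) (R.trans (R.*-cong R.refl (shift-cong k i λ j kj →
            ⊗-cong≤ {ι ^ suc k} {ι ^ suc k} {Z 0} {Z∞} j (λ _ _ → R.refl) λ j′ j′≤j → h 0 j′
              (ℕP.≤-trans j′≤j (ℕP.+-cancelˡ-≤ k j o (ℕP.≤-trans kj (ℕP.≤-pred l))))))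
          (R.sym (const-* (e k) (σ ^ k * (ι ^ suc k * Z∞)) i))))
        (cz-lim k (suc o) (λ l → Z (suc l)) Z∞ (λ l i p → h (suc l) i (≡.subst (i ≤_) (ℕP.+-suc l o) p)) i
          (≡.subst (i <_) (≡.sym (ℕP.+-suc k o)) l)))
      (solve 5 (λ e s i Z E → e :* (s :* (i :* Z)) :+ E :* Z := (e :* (s :* i) :+ E) :* Z) refl
        ⟨ e k ⟩ (σ ^ k) (ι ^ suc k) Z∞ (Es k) i)

    LΛ LZ : PS
    LΛ = Λ∞ 0 (σ ^ M)
    LZ = Λ∞ (m ℕ.* M1) z₁

    -- The subtracted value e(k) carries σ^(k + M) and disappears in the limit, and the convolution
    -- becomes the product of the limits of its two factors.
    limit : ⟨ w ⟩ * (σ ^ (m ℕ.* M) * (y * LΛ)) ≈ Ê * LZ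
    limit i = R.trans (R.sym (R.trans
        (reassoc (ΛU k - ⟨ e k ⟩ * (ι ^ k * σ ^ (k ℕ.+ M))))
        (R.trans (⊗-cong≤ {pre} {pre} {ΛU k - ⟨ e k ⟩ * (ι ^ k * σ ^ (k ℕ.+ M))} {LΛ} i (λ _ _ → R.refl) small) (R.sym (reassoc LΛ)))))
      (R.trans (finite k i) (R.trans
        (cz-lim k 0 Z LZ (λ l j p → Lam-lim (m ℕ.* M1) z₁ l j (≡.subst (j ≤_) (ℕP.+-identityʳ l) p)) i
          (s≤s (ℕP.≤-reflexive (≡.sym (ℕP.+-identityʳ i)))))
        (⊗-cong≤ {Es k} {Ê} {LZ} {LZ} i (λ j l → Es-lim k j (s≤s l)) (λ _ _ → R.refl))))
      where
      -- For the coefficient of index i everything has stabilised after i + 1 steps.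
      k = suc i
      pre = ⟨ w ⟩ * (σ ^ (m ℕ.* M) * y)
      reassoc : ∀ x → (⟨ w ⟩ * (σ ^ (m ℕ.* M) * (y * x))) i R.≈ (pre * x) i
      reassoc x = solve 4 (λ w s y x → w :* (s :* (y :* x)) := (w :* (s :* y)) :* x) refl ⟨ w ⟩ (σ ^ (m ℕ.* M)) y x i
      small : ∀ j → j ≤ i → (ΛU k - ⟨ e k ⟩ * (ι ^ k * σ ^ (k ℕ.+ M))) j R.≈ LΛ j
      small j l = R.trans (R.+-cong (Lam-lim 0 (σ ^ M) k j (ℕP.m≤n⇒m≤1+n l)) (R.trans (R.-‿cong
          (const-lo (e k) {ι ^ k * σ ^ (k ℕ.+ M)} j (R.trans
            (trans (*-cong refl (^-homo-* σ k M)) (solve 3 (λ i s m → i :* (s :* m) := s :* (i :* m)) refl (ι ^ k) (σ ^ k) (σ ^ M)) j)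
            (shift-lo k _ j (s≤s l))))) RP.-0#≈0#)) (R.+-identityʳ _)
        where import Algebra.Properties.Ring R.ring as RP

-- Verification of the closing condition.

module SolvedRecurrence where

  open import Level using (0ℓ)
  open import Algebra.Bundles using (CommutativeRing)
  import Algebra.Properties.Semiring.Exp as Exp
  open import Data.Nat as ℕ using (ℕ; zero; suc; _≤_; _<_; s≤s)
  import Data.Nat.Properties as ℕP
  open import Data.Nat.Solver using (module +-*-Solver)
  open import Data.Integer using (+_)
  open import Relation.Nullary using (yes; no)
  open import Relation.Binary.PropositionalEquality as ≡ using (_≡_)
  open Rings
  open Filtrations
  open Shifts
  open ToeplitzOperators
  open OperatorInverses
  open OperatorLimits

  module Solved (R : CommutativeRing 0ℓ 0ℓ) (Φ : Filtration R) (N D : ℕ)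
    (pt : ℕ → CommutativeRing.Carrier R) (c c′ w : CommutativeRing.Carrier R)
    (hinv : CommutativeRing._≈_ R (CommutativeRing._*_ R c c′) (CommutativeRing.1# R))
    (hc : CommutativeRing._≈_ R c (CommutativeRing._+_ R (CommutativeRing.1# R)
            (Shift.∑R R N D (λ j → CommutativeRing._*_ R (pt j) (Shift.ε R N (suc j ℕ.* N) (Shift.Tr R N j))))))
    (hpt : ∀ j → Filtration.F Φ 1 (pt j))
    (hw : CommutativeRing._≈_ R w (Exp._^_ (CommutativeRing.semiring R) c N)) where
    open Limit R N D pt c c′ w hinv hc public
    open Filtration Φ
    private
      module RE = Exp R.semiring
      import Algebra.Properties.Ring R.ring as RP
      FPn : ℕ → PS → Set
      FPn = FP Φ

    open +-*-Solver using () renaming (_:+_ to _:+ₙ_; _:*_ to _:*ₙ_; _:=_ to _:=ₙ_; solve to solveₙ; con to conₙ)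

    FP-anti : ∀ {n a} → FPn (suc n) a → FPn n a
    FP-anti h i = F-anti (h i)

    FP-anti* : ∀ {n} k {a} → FPn (k ℕ.+ n) a → FPn n a
    FP-anti* zero h = h
    FP-anti* (suc k) h = FP-anti* k (FP-anti h)

    F-ε : ∀ {n a} B → FPn n a → F n (ε B a)
    F-ε B h = FP-*ʳ Φ y h B

    FP-- : ∀ {n a b} → FPn n a → FPn n b → FPn n (a - b)
    FP-- p q = FP-+ Φ p (FP-neg Φ q)

    FP-*ˡ : ∀ {n a} b → FPn n a → FPn n (a * b)
    FP-*ˡ {a = a} b p = FP-cong Φ (*-comm b a) (FP-*ʳ Φ b p)

    FP-S : ∀ {n a} B → FPn n a → FPn n (S B a)
    FP-S B h = FP-*ʳ Φ y (FP-- h (FP-*ˡ _ (FP-const Φ (F-ε B h))))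

    FP-Sit : ∀ {n a} b B → FPn n a → FPn n (Sit b B a)
    FP-Sit zero B h = h
    FP-Sit (suc b) B h = FP-Sit b _ (FP-S B h)

    FP-Qp : ∀ {n a} b B → FPn n a → FPn n (Qp b B a)
    FP-Qp zero B h i = F-0
    FP-Qp (suc b) B h = FP-+ Φ (FP-*ˡ _ (FP-const Φ (F-ε B h))) (FP-*ʳ Φ _ (FP-Qp b _ (FP-S B h)))

    FP-pt : ∀ {n a} j → FPn n a → FPn (suc n) (⟨ pt j ⟩ * a)
    FP-pt j h = FP-* Φ (FP-const Φ (hpt j)) h

    -- Every discarded part carries a factor `pt j` and so costs one degree. For this reason `Λ∞` is
    -- the identity to lowest order.
    FP-q : ∀ {n a} B → FPn n a → FPn (suc n) (q B a)
    FP-q B h = FP-∑ Φ D λ j → FP-pt j (FP-*ʳ Φ _ (FP-Qp (suc j) B h))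

    FP-V : ∀ {n a} B → FPn n a → FPn n (V B a)
    FP-V B h = FP-+ Φ (FP-*ʳ Φ _ h) (FP-∑ Φ D λ j → FP-*ʳ Φ _ (FP-*ʳ Φ _ (FP-Sit (suc j) B h)))

    FP-Vit : ∀ {n a} k B → FPn n a → FPn n (Vit k B a)
    FP-Vit zero B h = h
    FP-Vit (suc k) B h = FP-V _ (FP-Vit k B h)

    FP-Lam : ∀ {n a} C k → FPn n a → FPn (suc n) (Lam C a k - a)
    FP-Lam {a = a} C zero h = FP-cong Φ (sym (-‿inverseʳ a)) (λ i → F-0)
    FP-Lam {a = a} C (suc k) h = FP-cong Φ
      (solve 3 (λ l a x → (l :- a) :- x := (l :- x) :- a) refl (Lam C a k) a _)
      (FP-- (FP-Lam C k h) (FP-*ʳ Φ _ (FP-*ʳ Φ _ (FP-*ʳ Φ _ (FP-q _ (FP-Vit k _ h))))))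

    FP-Λ∞ : ∀ {n a} C → FPn n a → FPn (suc n) (Λ∞ C a - a)
    FP-Λ∞ C h i = FP-Lam C i h i

    F-∑R : ∀ {n} k {f} → (∀ j → F n (f j)) → F n (∑R k f)
    F-∑R zero h = F-0
    F-∑R (suc k) h = F-+ (h k) (F-∑R k h)

    private
      F-≡1 : ∀ {x z} → x R.≈ R.1# R.+ z → F 1 z → F 1 (x R.- R.1#)
      F-≡1 p h = resp (R.sym (R.trans (R.+-cong p R.refl) (RS.solve 2 (λ o z → (o RS.:+ z) RS.:- o RS.:= z) R.refl R.1# _))) h

      F-pt* : ∀ j x → F 1 (pt j R.* x)
      F-pt* j x = F-* (hpt j) (F-all x)

    ρ-1 : FPn 1 (ρ - 1#)
    ρ-1 = FP-cong Φ (solve 3 (λ c s o → (c :- o) :+ s := (c :+ s) :- o) refl ⟨ c ⟩ _ 1#)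
      (FP-+ Φ (FP-cong Φ c1 (FP-const Φ (F-≡1 hc (F-∑R D λ j → F-pt* j _)))) (FP-∑ Φ D λ j → FP-pt j (FP-all Φ _)))
      where
      c1 : ⟨ c R.- R.1# ⟩ ≈ ⟨ c ⟩ - 1#
      c1 zero = R.refl
      c1 (suc i) = R.sym (R.-‿inverseʳ R.0#)

    ι-1 : FPn 1 (ι - 1#)
    ι-1 = FP-cong Φ (trans (distribˡ ι 1# (- ρ)) (+-cong (*-identityʳ ι)
            (trans (sym (-‿distribʳ-* ι ρ)) (-‿cong (trans (*-comm ι ρ) ρι)))))
          (FP-*ʳ Φ ι (FP-cong Φ (solve 2 (λ r o → :- (r :- o) := o :- r) refl ρ 1#) (FP-neg Φ ρ-1)))

    ι^-1 : ∀ k → FPn 1 (ι ^ k - 1#)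
    ι^-1 zero = FP-cong Φ (sym (-‿inverseʳ 1#)) (λ i → F-0)
    ι^-1 (suc k) = FP-cong Φ (trans (+-cong (distribˡ ι (ι ^ k) (- 1#)) refl)
        (trans (+-cong (+-cong refl (trans (sym (-‿distribʳ-* ι 1#)) (-‿cong (*-identityʳ ι)))) refl)
          (solve 3 (λ a i o → (a :- i) :+ (i :- o) := a :- o) refl (ι * ι ^ k) ι 1#)))
      (FP-+ Φ (FP-*ʳ Φ ι (ι^-1 k)) ι-1)

    x : ℕ → ℕ → R.Carrier
    x k a = es a (k ℕ.* M1 ℕ.+ M) (U k)

    x-00 : x 0 0 R.≈ R.1#
    x-00 = ε-σ M

    x-0 : ∀ a → x 0 (suc a) R.≈ R.0#
    x-0 a = R.trans (es-cong a (N ℕ.+ M) (trans (*-cong refl (trans (+-cong refl (-‿cong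
      (trans (*-cong (const-cong (ε-σ M)) refl) (*-identityˡ _)))) (-‿inverseʳ _))) (zeroʳ y))) (es-0 a (N ℕ.+ M))

    x-suc : ∀ k a → x (suc k) a R.≈
      (x k a R.+ ∑R D (λ j → pt j R.* x k (a ℕ.+ suc j))) R.+ conv (x k) tν a
    x-suc k a = R.trans (R.reflexive (≡.cong (λ i → es a i (U (suc k))) (ℕP.+-assoc M1 (k ℕ.* M1) M)))
      (es-V a (k ℕ.* M1 ℕ.+ M) (U k) (U-Lo k))

    e-1 : ∀ k → F 1 (e k R.- R.1#)
    e-1 zero = F-≡1 (R.trans x-00 (R.sym (R.+-identityʳ _))) F-0
    e-1 (suc k) = resp (R.trans (RS.solve 3 (λ a o s → (a RS.:- o) RS.:+ s RS.:= ((a RS.:+ s) RS.:+ RS.con (+ 0)) RS.:- o) R.refl (e k) R.1# _)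
        (R.+-cong (R.sym (x-suc k 0)) R.refl))
      (F-+ (e-1 k) (F-∑R D λ j → F-pt* j _))

    Ys : ℕ → PS
    Ys zero = 0#
    Ys (suc k) = σ ^ k + Ys k

    y-Ys : ∀ k → y ≈ Ys k + σ ^ k * y
    y-Ys zero = sym (trans (+-identityˡ _) (*-identityˡ y))
    y-Ys (suc k) = trans (y-Ys k) (trans (+-cong refl (*-cong refl y-eq))
      (trans (+-cong refl (trans (distribˡ _ 1# _) (+-cong (*-identityʳ _) refl)))
      (solve 4 (λ Y s o y → Y :+ (s :+ s :* (o :* y)) := (s :+ Y) :+ (o :* s) :* y) refl (Ys k) (σ ^ k) σ y)))

    private
      const-- : ∀ r → ⟨ r R.- R.1# ⟩ ≈ ⟨ r ⟩ - 1#
      const-- r zero = R.refl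
      const-- r (suc i) = R.sym (R.-‿inverseʳ R.0#)

    Es-Ys : ∀ k → FPn 1 (Es k - Ys k)
    Es-Ys zero = FP-cong Φ (sym (-‿inverseʳ 0#)) (λ i → F-0)
    Es-Ys (suc k) = FP-cong Φ
      (trans (+-cong (*-cong refl (+-cong (*-cong (const-- (e k)) refl) refl)) refl)
        (trans (solve 6 (λ s e o i E Y → s :* ((e :- o) :* i :+ (i :- o)) :+ (E :- Y) :=
            (e :* (s :* i) :+ s :* (i :- o :* i) :+ E) :- (s :* o :+ Y)) refl
            (σ ^ k) ⟨ e k ⟩ 1# (ι ^ suc k) (Es k) (Ys k))
          (+-cong (+-cong (trans (+-cong refl (trans (*-cong refl (trans (+-cong refl (-‿cong (*-identityˡ _))) (-‿inverseʳ _))) (zeroʳ _))) (+-identityʳ _)) refl)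
            (-‿cong (+-cong (*-identityʳ _) refl)))))
      (FP-+ Φ (FP-*ʳ Φ _ (FP-+ Φ (FP-*ˡ _ (FP-const Φ (e-1 k))) (ι^-1 (suc k)))) (Es-Ys k))

    -- To lowest order every e(k) and ρ are 1, and the series becomes Σ σ^k.
    Ê-y : FPn 1 (Ê - y)
    Ê-y i = resp (R.+-cong R.refl (R.-‿cong (R.sym (R.trans (y-Ys (suc i) i)
      (R.trans (R.+-cong R.refl (shift-lo (suc i) y i ℕP.≤-refl)) (R.+-identityʳ _)))))) (Es-Ys (suc i) i)

    -- The error in the closing condition.
    δ : PS
    δ = z₁ - U m

    private
      U-m : ∀ l → Vit l (m ℕ.* M1 ℕ.+ M) (U m) ≈ U (l ℕ.+ m)
      U-m zero = refl
      U-m (suc l) = trans (V-cong _ (U-m l)) (V-≡ _ (solveₙ 4 (λ l m s M → l :*ₙ s :+ₙ (m :*ₙ s :+ₙ M) :=ₙ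
        (l :+ₙ m) :*ₙ s :+ₙ M) ≡.refl l m M1 M))

      δB : (l : ℕ) → Vit l (m ℕ.* M1 ℕ.+ M) δ ≈ σ ^ (l ℕ.* M) * (ρ ^ l * Lam (m ℕ.* M1) δ l)
      δB l = Vit-Lam (m ℕ.* M1) δ l

    Z-split : ∀ l → Z l ≈ σ ^ (m ℕ.* M) * (ρ ^ m * ΛU (l ℕ.+ m)) + Lam (m ℕ.* M1) δ l
    Z-split l = ρσ-cancel (l ℕ.* M) l _ _ (trans (sym (Vit-Lam (m ℕ.* M1) z₁ l)) (trans
      (Vit-cong l _ (solve 2 (λ z u → z := u :+ (z :- u)) refl z₁ (U m)))
      (trans (Vit-+ l _ _ _) (trans (+-cong (trans (U-m l) (trans (U-ΛU (l ℕ.+ m)) (*-cong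
          (trans (σ-≡ (ℕP.*-distribʳ-+ M l m)) (^-homo-* σ (l ℕ.* M) (m ℕ.* M))) (*-cong (^-homo-* ρ l m) refl)))) (δB l))
        (solve 6 (λ a b r s L D → (a :* b) :* ((r :* s) :* L) :+ a :* (r :* D) := a :* (r :* (b :* (s :* L) :+ D))) refl
          (σ ^ (l ℕ.* M)) (σ ^ (m ℕ.* M)) (ρ ^ l) (ρ ^ m) (ΛU (l ℕ.+ m)) (Lam (m ℕ.* M1) δ l))))))

    LD : PS
    LD = Λ∞ (m ℕ.* M1) δ

    -- The limit operator turns `V` into multiplication by s ρ. Since `U m` lies on the orbit of 1
    -- itself, its limit is the m-th power of the symbol times that of 1.
    LZ-split : LZ ≈ σ ^ (m ℕ.* M) * (ρ ^ m * LΛ) + LD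
    LZ-split i = R.trans (Z-split i i) (R.+-cong (R.trans (sym (*-assoc _ _ (ΛU (i ℕ.+ m))) i)
      (R.trans (⊗-cong≤ {σ ^ (m ℕ.* M) * ρ ^ m} {σ ^ (m ℕ.* M) * ρ ^ m} {ΛU (i ℕ.+ m)} {LΛ} i (λ _ _ → R.refl)
        λ j l → Lam-lim 0 (σ ^ M) (i ℕ.+ m) j (ℕP.≤-trans l (ℕP.m≤m+n i m)))
        (*-assoc _ _ LΛ i))) R.refl)

    Θ : PS
    Θ = ⟨ w ⟩ * y - ρ ^ m * Ê

    -- One equation couples the two errors `Θ` and `δ`. To lowest order it reads σ^((m+1) M) Θ = y
    -- δ, and it separates because the left side begins after index (m+1) M, while `δ` ends there.
    key : σ ^ (m ℕ.* M) * (Θ * LΛ) ≈ Ê * LD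
    key = trans (solve 6 (λ s w y r E L → s :* ((w :* y :- r :* E) :* L) := w :* (s :* (y :* L)) :- E :* (s :* (r :* L))) refl
        (σ ^ (m ℕ.* M)) ⟨ w ⟩ y (ρ ^ m) Ê LΛ)
      (trans (+-cong (trans limit (*-cong refl LZ-split)) refl)
        (solve 3 (λ E a d → E :* (a :+ d) :- E :* a := E :* d) refl Ê _ LD))

    ρ0 : ρ 0 R.≈ c
    ρ0 = R.trans (ρ-τ 0) (R.trans (R.+-cong R.refl (σ-0 τ)) (R.+-identityʳ c))

    pow-0 : ∀ a k → (a ^ k) 0 R.≈ a 0 RE.^ k
    pow-0 a zero = R.refl
    pow-0 a (suc k) = R.*-cong R.refl (pow-0 a k)

    Ê0 : Ê 0 R.≈ c′
    Ê0 = R.trans (R.+-identityʳ _) (R.trans (const-* (e 0) (σ ^ 0 * ι ^ 1) 0) (R.trans (R.*-cong x-00 R.refl)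
      (R.trans (R.*-identityˡ _) (R.trans (*-identityˡ (ι ^ 1) 0) (*-identityʳ ι 0)))))

    -- Here the choice w = c^N is needed: the constant terms w and c^m c^(-1) must agree, so that
    -- the left side of the lowest-order equation begins strictly after index (m+1) M.
    Θ0 : Θ 0 R.≈ R.0#
    Θ0 = R.trans (R.+-cong (R.trans (const-* w y 0) (R.*-identityʳ w)) (R.-‿cong (R.*-cong
        (R.*-cong ρ0 (R.trans (pow-0 ρ N) (R.trans (RE.^-congˡ N ρ0) (R.sym hw)))) Ê0)))
      (R.trans (R.+-cong R.refl (R.-‿cong (R.trans (RS.solve 3 (λ c w d → (c RS.:* w) RS.:* d RS.:= (c RS.:* d) RS.:* w) R.refl c w c′)
        (R.trans (R.*-cong hinv R.refl) (R.*-identityˡ w))))) (R.-‿inverseʳ w))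

    -- `n̂` is divisible by s and every image of `S` by s^m. Each step from 1 therefore gains one
    -- factor s, as long as at most m factors are asked for. At k = m this is the divisibility by
    -- s^m that `z₁`, an image of `S`, has as well.
    U-div : ∀ k → k ≤ m → Lo (suc (suc k ℕ.* M)) (U k)
    U-div zero _ = ≡.subst (λ i → Lo (suc i) (σ ^ M)) (≡.sym (ℕP.+-identityʳ M)) (Lo-σ M)
    U-div (suc k) (s≤s k≤N) = Lo-+ (≡.subst (λ i → Lo i (n̂ * U k)) (ℕP.+-suc M _) (Lo-* Lo-n̂ (U-div k (ℕP.m≤n⇒m≤1+n k≤N))))
      (Lo-∑ D λ j h → Lo-const (pt j) (Lo-mono (bound j h) (Lo-shift (ex j) (Sit-Lo′ j (U-Lo k)))))
      where
      bound : ∀ j → j < D → ex j ℕ.+ (j ℕ.* N ℕ.+ (k ℕ.* M1 ℕ.+ M)) ≤ suc (suc (suc k) ℕ.* M)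
      bound j h = ℕP.+-cancelʳ-≤ N _ _ (ℕP.≤-trans (ℕP.≤-reflexive (≡.trans
          (solveₙ 4 (λ e a B N → (e :+ₙ (a :+ₙ B)) :+ₙ N :=ₙ e :+ₙ ((N :+ₙ a) :+ₙ B)) ≡.refl (ex j) (j ℕ.* N) (k ℕ.* M1 ℕ.+ M) N)
          (≡.trans (exB (k ℕ.* M1 ℕ.+ M) h)
            (solveₙ 2 (λ k M → (conₙ 1 :+ₙ M) :+ₙ (k :*ₙ (conₙ 1 :+ₙ M) :+ₙ M) :=ₙ
               (conₙ 1 :+ₙ (conₙ 2 :+ₙ k) :*ₙ M) :+ₙ k) ≡.refl k M))))
        (ℕP.+-monoʳ-≤ (suc (suc (suc k) ℕ.* M)) k≤N))

    δ-div : Lo (suc (suc m ℕ.* M)) δ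
    δ-div = Lo-+ (Lo-const w (≡.subst (λ i → Lo i (σ ^ (m ℕ.* M) * (y * ν))) ix (Lo-shift (m ℕ.* M) Lo-yν)))
      (Lo-neg (U-div m ℕP.≤-refl))
      where
      ix : m ℕ.* M ℕ.+ M1 ≡ suc (suc m ℕ.* M)
      ix = solveₙ 2 (λ a M → a :+ₙ (conₙ 1 :+ₙ M) :=ₙ conₙ 1 :+ₙ (M :+ₙ a)) ≡.refl (m ℕ.* M) M

    private
      λ₁ : FPn 1 (LΛ - σ ^ M)
      λ₁ = FP-Λ∞ 0 (FP-all Φ _)

      module Step (n : ℕ) (h : FPn n δ) where
        LD-δ : FPn (suc n) (LD - δ)
        LD-δ = FP-Λ∞ (m ℕ.* M1) h

        LDn : FPn n LD
        LDn = FP-cong Φ (solve 2 (λ a b → (a :- b) :+ b := a) refl LD δ) (FP-+ Φ (FP-anti LD-δ) h)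

        shifted : σ ^ (m ℕ.* M) * (σ ^ M * Θ) ≈ Ê * LD - σ ^ (m ℕ.* M) * (Θ * (LΛ - σ ^ M))
        shifted = trans (solve 4 (λ s t h L → s :* (t :* h) := s :* (h :* L) :- s :* (h :* (L :- t))) refl
          (σ ^ (m ℕ.* M)) (σ ^ M) Θ LΛ) (+-cong key refl)

        -- A bootstrap: the error term of the shifted equation is `Θ` times a series of degree 1, so
        -- the degree of `Θ` rises by one at each pass until the degree of `LD` stops it.
        Θj : ∀ j k → j ℕ.+ k ≡ n → FPn j Θ
        Θj zero k p = FP-all Φ Θ
        Θj (suc j) k p = FP-unshift Φ M Θ (FP-unshift Φ (m ℕ.* M) _ (FP-cong Φ (sym shifted)
          (FP-- (FP-anti* k (FP-*ʳ Φ Ê (≡.subst (λ i → FPn i LD) (≡.trans (≡.sym p) (ℕP.+-comm (suc j) k)) LDn)))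
            (FP-*ʳ Φ _ (FP-cong Φ (*-comm (LΛ - σ ^ M) Θ) (FP-* Φ λ₁ (Θj j (suc k) (≡.trans (ℕP.+-suc j k) p))))))))

        -- The three factors `Ê`, `LD` and `LΛ` may be replaced by their lowest-order values `y`,
        -- `δ` and σ^M, as each replacement costs one degree.
        main : FPn (suc n) (σ ^ (m ℕ.* M) * (σ ^ M * Θ) - y * δ)
        main = FP-cong Φ (sym (trans (+-cong shifted refl)
            (solve 5 (λ E D t y d → (E :* D :- t) :- y :* d := (E :* (D :- d) :+ (E :- y) :* d) :- t) refl Ê LD _ y δ)))
          (FP-- (FP-+ Φ (FP-*ʳ Φ Ê LD-δ) (FP-* Φ Ê-y h))
            (FP-*ʳ Φ _ (FP-cong Φ (*-comm (LΛ - σ ^ M) Θ) (FP-* Φ λ₁ (Θj n 0 (ℕP.+-identityʳ n))))))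

        low : ∀ i → i ≤ suc m ℕ.* M → (σ ^ (m ℕ.* M) * (σ ^ M * Θ)) i R.≈ R.0#
        low i l with i ℕ.≟ suc m ℕ.* M
        ... | yes ≡.refl = R.trans (combine i) (R.trans (R.reflexive (≡.cong (σ ^ (suc m ℕ.* M) * Θ) (≡.sym (ℕP.+-identityʳ (suc m ℕ.* M)))))
                (R.trans (shift-hi (suc m ℕ.* M) Θ 0) Θ0))
          where
          combine : ∀ i → (σ ^ (m ℕ.* M) * (σ ^ M * Θ)) i R.≈ (σ ^ (suc m ℕ.* M) * Θ) i
          combine i = trans (solve 3 (λ a b c → a :* (b :* c) := (b :* a) :* c) refl (σ ^ (m ℕ.* M)) (σ ^ M) Θ)
            (*-cong (sym (^-homo-* σ M (m ℕ.* M))) refl) i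
        ... | no ne = R.trans (trans (solve 3 (λ a b c → a :* (b :* c) := (b :* a) :* c) refl (σ ^ (m ℕ.* M)) (σ ^ M) Θ)
                (*-cong (sym (^-homo-* σ M (m ℕ.* M))) refl) i) (shift-lo (suc m ℕ.* M) Θ i (ℕP.≤∧≢⇒< l ne))

        yδ : ∀ i → i ≤ suc m ℕ.* M → F (suc n) ((y * δ) i)
        yδ i l = resp (R.trans (R.-‿cong (R.trans (R.+-cong (low i l) R.refl) (R.+-identityˡ _))) (RP.-‿involutive _)) (F-neg (main i))

        -- The coefficients of `y * δ` are partial sums of `δ`. They vanish to the next order up to
        -- the last index that `δ` can occupy, so their differences do.
        next : FPn (suc n) δ
        next i with i ℕ.≤? suc m ℕ.* M
        next i | no i≰ = resp (R.sym (δ-div i (ℕP.≰⇒> i≰))) F-0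
        next zero | yes l = resp (R.*-identityˡ _) (yδ 0 l)
        next (suc i) | yes l = resp (R.trans (R.+-cong (y-suc δ i) R.refl)
            (RS.solve 2 (λ a b → (a RS.:+ b) RS.:- a RS.:= b) R.refl ((y * δ) i) (δ (suc i))))
          (F-+ (yδ (suc i) l) (F-neg (yδ i (ℕP.≤-trans (ℕP.n≤1+n i) l))))

      FP-δ : ∀ n → FPn n δ
      FP-δ zero = FP-all Φ δ
      FP-δ (suc n) = Step.next n (FP-δ n)

    δ≈0 : δ ≈ 0#
    δ≈0 i = F-sep λ n → FP-δ n i

    U-closed : U m ≈ z₁
    U-closed = sym (x∙y⁻¹≈ε⇒x≈y z₁ (U m) δ≈0)

    Θ≈0 : Θ ≈ 0#
    Θ≈0 i = F-sep λ n → Step.Θj n (FP-δ n) n 0 (ℕP.+-identityʳ n) i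

    -- The second outcome of the separation. As `Ê` is Σ e(k) σ^k/ρ^(k+1), this determines every
    -- x_k(0) from ρ alone.
    wy : ⟨ w ⟩ * y ≈ ρ ^ m * Ê
    wy = x∙y⁻¹≈ε⇒x≈y _ _ Θ≈0

    -- `z₁` is w S ν, and a backward shift moves the index of the expansion by one.
    x-m : ∀ a → x m a R.≈ w R.* tν (suc a)
    x-m a = R.trans (es-cong a (m ℕ.* M1 ℕ.+ M) U-closed) (R.trans (es-scale a (m ℕ.* M1 ℕ.+ M) w _) (R.*-cong R.refl
      (R.trans (R.reflexive (≡.cong (λ i → es a i (σ ^ (m ℕ.* M) * (y * ν))) ix))
        (R.trans (es-shift a (m ℕ.* M) (N ℕ.+ M1) (y * ν)) (es-cong a (N ℕ.+ M1) (sym (S-ker M1 εν)))))))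
      where
      ix : m ℕ.* M1 ℕ.+ M ≡ m ℕ.* M ℕ.+ (N ℕ.+ M1)
      ix = solveₙ 2 (λ N M → (conₙ 1 :+ₙ N) :*ₙ (conₙ 1 :+ₙ M) :+ₙ M :=ₙ
        (conₙ 1 :+ₙ N) :*ₙ M :+ₙ (N :+ₙ (conₙ 1 :+ₙ M))) ≡.refl N M

-- The first three coefficients of the generating function identity.

module QuadraticRelation where

  open import Level using (0ℓ)
  open import Algebra.Bundles using (CommutativeRing)
  import Algebra.Properties.Semiring.Exp as Exp
  open import Data.Nat as ℕ using (ℕ; zero; suc; _<_; z≤n; s≤s)
  import Data.Nat.Properties as ℕP
  open import Data.Integer using (+_)
  open Rings
  open Filtrations
  open Shifts
  open SolvedRecurrence

  module Quadratic (R : CommutativeRing 0ℓ 0ℓ) (Φ : Filtration R) (N D : ℕ)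
    (pt : ℕ → CommutativeRing.Carrier R) (c c′ w : CommutativeRing.Carrier R)
    (hinv : CommutativeRing._≈_ R (CommutativeRing._*_ R c c′) (CommutativeRing.1# R))
    (hc : CommutativeRing._≈_ R c (CommutativeRing._+_ R (CommutativeRing.1# R)
            (Shift.∑R R N D (λ j → CommutativeRing._*_ R (pt j) (Shift.ε R N (suc j ℕ.* N) (Shift.Tr R N j))))))
    (hpt : ∀ j → Filtration.F Φ 1 (pt j))
    (hw : CommutativeRing._≈_ R w (Exp._^_ (CommutativeRing.semiring R) c N)) where
    open Solved R Φ N D pt c c′ w hinv hc hpt hw public
    private
      module RE = Exp R.semiring

    nat : ℕ → R.Carrier
    nat zero = R.0#
    nat (suc n) = R.1# R.+ nat n

    r0 r1 r2 : R.Carrier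
    r0 = ρ 0
    r1 = ρ 1
    r2 = ρ 2

    open RS using () renaming (solve to solveR; _:=_ to _:=R_; _:+_ to _:+R_; _:*_ to _:*R_; _:-_ to _:-R_; con to conR)

    two : R.Carrier
    two = R.1# R.+ R.1#

    pow-1 : ∀ k → r0 R.* (ρ ^ k) 1 R.≈ nat k R.* (r1 R.* (ρ ^ k) 0)
    pow-1 zero = R.trans (R.zeroʳ _) (R.sym (R.zeroˡ _))
    pow-1 (suc k) = R.trans (solveR 4 (λ c A1 r A0 → c :*R (c :*R A1 :+R r :*R A0) :=R c :*R (c :*R A1) :+R r :*R (c :*R A0)) R.refl
        r0 ((ρ ^ k) 1) r1 ((ρ ^ k) 0))
      (R.trans (R.+-cong (R.*-cong R.refl (pow-1 k)) R.refl)
        (solveR 4 (λ c n r A0 → c :*R (n :*R (r :*R A0)) :+R r :*R (c :*R A0) :=R (conR (+ 1) :+R n) :*R (r :*R (c :*R A0))) R.refl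
          r0 (nat k) r1 ((ρ ^ k) 0)))

    -- The coefficient k r0^(k-1) r2 + C(k,2) r0^(k-2) r1^2, cleared of the denominator 2 and of
    -- negative exponents by the factor 2 r0^2.
    pow-2 : ∀ k → two R.* ((r0 R.* r0) R.* (ρ ^ k) 2) R.≈
      (ρ ^ k) 0 R.* (two R.* (nat k R.* (r0 R.* r2)) R.+ (nat k R.* nat k R.- nat k) R.* (r1 R.* r1))
    pow-2 zero = solveR 3 (λ c r1 r2 → (conR (+ 1) :+R conR (+ 1)) :*R ((c :*R c) :*R conR (+ 0)) :=R
      conR (+ 1) :*R ((conR (+ 1) :+R conR (+ 1)) :*R (conR (+ 0) :*R (c :*R r2)) :+R
        (conR (+ 0) :*R conR (+ 0) :-R conR (+ 0)) :*R (r1 :*R r1))) R.refl r0 r1 r2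
    pow-2 (suc k) = R.trans
      (solveR 6 (λ c A2 r1 A1 r2 A0 → (conR (+ 1) :+R conR (+ 1)) :*R ((c :*R c) :*R (c :*R A2 :+R (r1 :*R A1 :+R r2 :*R A0))) :=R
        c :*R ((conR (+ 1) :+R conR (+ 1)) :*R ((c :*R c) :*R A2)) :+R
        ((conR (+ 2) :*R (c :*R r1)) :*R (c :*R A1) :+R conR (+ 2) :*R ((c :*R c) :*R (r2 :*R A0)))) R.refl
        r0 ((ρ ^ k) 2) r1 ((ρ ^ k) 1) r2 ((ρ ^ k) 0))
      (R.trans (R.+-cong (R.*-cong R.refl (pow-2 k)) (R.+-cong (R.*-cong R.refl (pow-1 k)) R.refl))
        (solveR 5 (λ c r1 r2 A0 n → c :*R (A0 :*R ((conR (+ 1) :+R conR (+ 1)) :*R (n :*R (c :*R r2)) :+R (n :*R n :-R n) :*R (r1 :*R r1))) :+R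
            ((conR (+ 2) :*R (c :*R r1)) :*R (n :*R (r1 :*R A0)) :+R conR (+ 2) :*R ((c :*R c) :*R (r2 :*R A0))) :=R
            (c :*R A0) :*R ((conR (+ 1) :+R conR (+ 1)) :*R ((conR (+ 1) :+R n) :*R (c :*R r2)) :+R
              ((conR (+ 1) :+R n) :*R (conR (+ 1) :+R n) :-R (conR (+ 1) :+R n)) :*R (r1 :*R r1))) R.refl
          r0 r1 r2 ((ρ ^ k) 0) (nat k)))

    -- The terms up to σ^2 of ρ^2 Σ e(k) (σ/ρ)^k; the factor ρ^2 removes all inverses of ρ.
    X : PS
    X = ⟨ e 2 ⟩ * σ ^ 2 + (⟨ e 1 ⟩ * (σ * ρ) + ρ * ρ)

    private
      LHS RHS : PS
      LHS = ⟨ w ⟩ * (y * (ρ * ρ))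
      RHS = ρ ^ N * X

      Ê-3 : ∀ i → i < 3 → (ρ ^ m * Ê * (ρ * ρ)) i R.≈ (ρ ^ N * X) i
      Ê-3 i l = R.trans (*-comm (ρ ^ m * Ê) (ρ * ρ) i) (R.trans (sym (*-assoc (ρ * ρ) (ρ ^ m) Ê) i)
        (R.trans (⊗-cong≤ {ρ * ρ * ρ ^ m} {ρ * ρ * ρ ^ m} {Ê} {Es 3} i (λ _ _ → R.refl)
            (λ j h → R.sym (Es-lim 3 j (ℕP.≤-<-trans h l))))
          (R.trans (*-cong refl (+-cong refl (+-cong refl (trans (+-identityʳ _) (trans (*-cong
              (trans (const-cong x-00) refl) refl) (*-identityˡ _))))) i)
            (R.trans (solve 8 (λ r A e2 s e1 i o z → (r :* r :* (r :* A)) :* (e2 :* ((s :* (s :* o)) :* (i :* (i :* (i :* o)))) :+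
                 (e1 :* ((s :* o) :* (i :* (i :* o))) :+ o :* (i :* o)))
               := A :* (e2 :* ((s :* (s :* o)) :* (((r :* i) :* (r :* i) :* (r :* i)) :* o)) :+
                 (e1 :* ((s :* r) :* ((r :* i) :* (r :* i) :* (o :* o))) :+ (r :* r) :* ((r :* i) :* (o :* o))))) refl
                ρ (ρ ^ N) ⟨ e 2 ⟩ σ ⟨ e 1 ⟩ ι 1# 0# i)
              (*-cong refl (+-cong (*-cong refl (trans (*-cong refl (trans (*-cong (trans (*-cong (*-cong ρι ρι) ρι) ones) refl) (*-identityˡ 1#))) (*-identityʳ _)))
                (+-cong (*-cong refl (trans (*-cong refl (trans (*-cong (trans (*-cong ρι ρι) (*-identityˡ 1#)) (*-identityˡ 1#)) (*-identityˡ 1#))) (*-identityʳ _)))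
                  (trans (*-cong refl (trans (*-cong ρι (*-identityˡ 1#)) (*-identityˡ 1#))) (*-identityʳ _)))) i)))))
        where
        ones : 1# * 1# * 1# ≈ 1#
        ones = trans (*-cong (*-identityˡ 1#) refl) (*-identityˡ 1#)

      equal : ∀ i → i < 3 → LHS i R.≈ RHS i
      equal i l = R.trans (sym (*-assoc ⟨ w ⟩ y (ρ * ρ)) i)
        (R.trans (*-cong wy (refl {ρ * ρ}) i) (Ê-3 i l))

      lhs : ∀ i → LHS i R.≈ w R.* (y * (ρ * ρ)) i
      lhs i = const-* w (y * (ρ * ρ)) i

      coeff : ∀ e a → (const e * a) 0 R.≈ e R.* a 0
      coeff e a = const-* e a 0

      A : ℕ → R.Carrier
      A = ρ ^ N

      A0≈w : A 0 R.≈ w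
      A0≈w = R.trans (pow-0 ρ N) (R.trans (RE.^-congˡ N ρ0) (R.sym hw))

      X0 : X 0 R.≈ r0 R.* r0
      X0 = R.trans (R.+-cong (R.trans (const-* (e 2) (σ ^ 2) 0) (R.trans (R.*-cong R.refl (R.zeroˡ _)) (R.zeroʳ _)))
        (R.+-cong (R.trans (const-* (e 1) (σ * ρ) 0) (R.trans (R.*-cong R.refl (σ-0 ρ)) (R.zeroʳ _))) R.refl))
        (solveR 1 (λ a → conR (+ 0) :+R (conR (+ 0) :+R a) :=R a) R.refl _)

      X1 : X 1 R.≈ e 1 R.* r0 R.+ (r0 R.* r1 R.+ r1 R.* r0)
      X1 = R.trans (R.+-cong (R.trans (const-* (e 2) (σ ^ 2) 1) (R.trans (R.*-cong R.refl
          (R.trans (σ-suc (σ ^ 1) 0) (R.zeroˡ _))) (R.zeroʳ _)))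
        (R.+-cong (R.trans (const-* (e 1) (σ * ρ) 1) (R.*-cong R.refl (σ-suc ρ 0))) R.refl))
        (R.+-identityˡ _)

      X2 : X 2 R.≈ e 2 R.+ (e 1 R.* r1 R.+ (r0 R.* r2 R.+ (r1 R.* r1 R.+ r2 R.* r0)))
      X2 = R.+-cong (R.trans (const-* (e 2) (σ ^ 2) 2) (R.trans (R.*-cong R.refl
          (R.trans (σ-suc (σ ^ 1) 1) (R.trans (σ-suc 1# 0) R.refl))) (R.*-identityʳ _)))
        (R.+-cong (R.trans (const-* (e 1) (σ * ρ) 2) (R.*-cong R.refl (σ-suc ρ 1))) R.refl)

      w′ : R.Carrier
      w′ = c′ RE.^ N

      ww′ : w′ R.* w R.≈ R.1#
      ww′ = R.trans (R.*-cong R.refl hw) (go N)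
        where
        go : ∀ n → c′ RE.^ n R.* c RE.^ n R.≈ R.1#
        go zero = R.*-identityˡ _
        go (suc n) = R.trans (solveR 4 (λ a b c d → (a :*R b) :*R (c :*R d) :=R (c :*R a) :*R (b :*R d)) R.refl c′ _ c _)
          (R.trans (R.*-cong hinv (go n)) (R.*-identityˡ _))

      cancel : R.1# R.≈ w′ R.* w → ∀ {a b} → w R.* a R.≈ w R.* b → a R.≈ b
      cancel p {a} {b} q = R.trans (R.sym (R.*-identityˡ a)) (R.trans (R.*-cong p R.refl) (R.trans (R.*-assoc w′ w a)
        (R.trans (R.*-cong R.refl q) (R.trans (R.sym (R.*-assoc w′ w b)) (R.trans (R.*-cong (R.sym p) R.refl) (R.*-identityˡ b))))))

      w-cancel : ∀ {a b} → w R.* a R.≈ w R.* b → a R.≈ b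
      w-cancel = cancel (R.sym ww′)

      c-cancel : ∀ {a b} → r0 R.* a R.≈ r0 R.* b → a R.≈ b
      c-cancel {a} {b} q = R.trans (s a) (R.trans (R.*-cong R.refl q) (R.sym (s b)))
        where
        s : ∀ a → a R.≈ c′ R.* (r0 R.* a)
        s a = R.sym (R.trans (R.sym (R.*-assoc c′ r0 a)) (R.trans (R.*-cong (R.trans (R.*-comm c′ r0)
          (R.trans (R.*-cong ρ0 R.refl) hinv)) R.refl) (R.*-identityˡ a)))

    e1 : e 1 R.≈ R.1#
    e1 = R.trans (x-suc 0 0) (R.trans (R.+-identityʳ _) (R.trans (R.+-cong x-00 (zeros D))
      (R.+-identityʳ _)))
      where
      zeros : ∀ k → ∑R k (λ j → pt j R.* x 0 (suc j)) R.≈ R.0#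
      zeros zero = R.refl
      zeros (suc k) = R.trans (R.+-cong (R.trans (R.*-cong R.refl (x-0 k)) (R.zeroʳ _)) (zeros k)) (R.+-identityˡ _)

    -- The coefficient of σ: the terms 2 r0 r1 from ρ^2 occur on both sides, and w r0 can be
    -- cancelled from the rest.
    c-r1 : r0 R.≈ R.1# R.+ nat N R.* r1
    c-r1 = c-cancel (w-cancel (begin
      w R.* (r0 R.* r0)
        ≈⟨ solveR 3 (λ w c r → w :*R (c :*R c) :=R w :*R (conR (+ 1) :*R (c :*R c) :+R ((c :*R r :+R r :*R c))) :-R w :*R (c :*R r :+R r :*R c)) R.refl w r0 r1 ⟩
      w R.* (R.1# R.* (r0 R.* r0) R.+ (r0 R.* r1 R.+ r1 R.* r0)) R.- w R.* (r0 R.* r1 R.+ r1 R.* r0)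
        ≈⟨ R.+-cong (R.trans (R.*-cong R.refl (solveR 2 (λ c r → conR (+ 1) :*R (c :*R c) :+R (c :*R r :+R r :*R c) :=R
               conR (+ 1) :*R (c :*R r :+R r :*R c) :+R conR (+ 1) :*R (c :*R c)) R.refl r0 r1))
             (R.trans (R.sym (lhs 1)) (equal 1 (s≤s (s≤s z≤n))))) R.refl ⟩
      (A 0 R.* X 1 R.+ A 1 R.* X 0) R.- w R.* (r0 R.* r1 R.+ r1 R.* r0)
        ≈⟨ R.+-cong (R.+-cong (R.*-cong A0≈w (R.trans X1 (R.+-cong (R.trans (R.*-cong e1 R.refl) (R.*-identityˡ _)) R.refl)))
             (R.trans (R.*-cong R.refl X0) (R.trans (solveR 2 (λ a c → a :*R (c :*R c) :=R c :*R (c :*R a)) R.refl (A 1) r0)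
               (R.*-cong R.refl (R.trans (pow-1 N) (R.*-cong R.refl (R.*-cong R.refl A0≈w))))))) R.refl ⟩
      (w R.* (r0 R.+ (r0 R.* r1 R.+ r1 R.* r0)) R.+ r0 R.* (nat N R.* (r1 R.* w))) R.- w R.* (r0 R.* r1 R.+ r1 R.* r0)
        ≈⟨ solveR 4 (λ w c r n → (w :*R (c :+R (c :*R r :+R r :*R c)) :+R c :*R (n :*R (r :*R w))) :-R w :*R (c :*R r :+R r :*R c) :=R
             w :*R (c :*R (conR (+ 1) :+R n :*R r))) R.refl w r0 r1 (nat N) ⟩
      w R.* (r0 R.* (R.1# R.+ nat N R.* r1)) ∎))
      where open import Relation.Binary.Reasoning.Setoid R.setoid

    -- The coefficient of σ^2, doubled because of C(N,2). Replacing r0 by 1 + N r1 in the single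
    -- product r0 r1 makes the unwanted multiples of N r1^2 cancel.
    e2 : two R.* e 2 R.≈ (two R.* (r0 R.* r0) R.+ two R.* r1) R.-
      (two R.* (nat N R.* r1) R.+ (two R.* (nat N R.* (r0 R.* r2)) R.+ (nat N R.* nat N R.- nat N) R.* (r1 R.* r1)))
    e2 = w-cancel (begin
      w R.* (two R.* e 2)
        ≈⟨ solveR 5 (λ w e r2 r1 c → w :*R (T :*R e) :=R T :*R (w :*R (e :+R (r1 :+R (c :*R r2 :+R (r1 :*R r1 :+R r2 :*R c)))))
             :-R T :*R (w :*R (r1 :+R (c :*R r2 :+R (r1 :*R r1 :+R r2 :*R c))))) R.refl w (e 2) r2 r1 r0 ⟩
      two R.* (w R.* E2) R.- two R.* (w R.* G)
        ≈⟨ R.+-cong (R.*-cong R.refl wE2) R.refl ⟩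
      two R.* (w R.* sum3 R.- (A 1 R.* X 1 R.+ A 2 R.* X 0)) R.- two R.* (w R.* G)
        ≈⟨ solveR 6 (λ w s a x1 b g → T :*R (w :*R s :-R (a :*R x1 :+R b)) :-R T :*R (w :*R g) :=R
              w :*R (T :*R s :-R T :*R g) :-R ((T :*R (a :*R x1)) :+R T :*R b)) R.refl w sum3 (A 1) (X 1) (A 2 R.* X 0) G ⟩
      w R.* (two R.* sum3 R.- two R.* G) R.- (two R.* (A 1 R.* X 1) R.+ two R.* (A 2 R.* X 0))
        ≈⟨ R.+-cong R.refl (R.-‿cong (R.+-cong (R.*-cong R.refl A1X1) A2X0)) ⟩
      w R.* (two R.* sum3 R.- two R.* G) R.- (two R.* ((nat N R.* (r1 R.* w)) R.* (R.1# R.+ two R.* r1)) R.+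
        w R.* (two R.* (nat N R.* (r0 R.* r2)) R.+ (nat N R.* nat N R.- nat N) R.* (r1 R.* r1)))
        ≈⟨ solveR 6 (λ w c r1 r2 n q →
             w :*R (T :*R (c :*R c :+R (c :*R r1 :+R r1 :*R c) :+R (c :*R r2 :+R (r1 :*R r1 :+R r2 :*R c))) :-R
                    T :*R (r1 :+R (c :*R r2 :+R (r1 :*R r1 :+R r2 :*R c))))
             :-R (T :*R ((n :*R (r1 :*R w)) :*R (conR (+ 1) :+R T :*R r1)) :+R w :*R (T :*R (n :*R (c :*R r2)) :+R q)) :=R
             w :*R (((T :*R (c :*R c) :+R T :*R (T :*R (c :*R r1))) :-R T :*R r1) :-R
               ((T :*R (n :*R r1) :+R T :*R (T :*R (n :*R (r1 :*R r1)))) :+R (T :*R (n :*R (c :*R r2)) :+R q)))) R.refl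
             w r0 r1 r2 (nat N) ((nat N R.* nat N R.- nat N) R.* (r1 R.* r1)) ⟩
      w R.* (((two R.* (r0 R.* r0) R.+ two R.* (two R.* (r0 R.* r1))) R.- two R.* r1) R.-
        ((two R.* (nat N R.* r1) R.+ two R.* (two R.* (nat N R.* (r1 R.* r1)))) R.+
          (two R.* (nat N R.* (r0 R.* r2)) R.+ (nat N R.* nat N R.- nat N) R.* (r1 R.* r1))))
        ≈⟨ R.*-cong R.refl (R.+-cong (R.+-cong (R.+-cong R.refl (R.*-cong R.refl (R.*-cong R.refl (R.*-cong c-r1 R.refl)))) R.refl) R.refl) ⟩
      w R.* (((two R.* (r0 R.* r0) R.+ two R.* (two R.* ((R.1# R.+ nat N R.* r1) R.* r1))) R.- two R.* r1) R.-
        ((two R.* (nat N R.* r1) R.+ two R.* (two R.* (nat N R.* (r1 R.* r1)))) R.+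
          (two R.* (nat N R.* (r0 R.* r2)) R.+ (nat N R.* nat N R.- nat N) R.* (r1 R.* r1))))
        ≈⟨ R.*-cong R.refl (solveR 4 (λ c r1 n q → ((T :*R (c :*R c) :+R T :*R (T :*R ((conR (+ 1) :+R n :*R r1) :*R r1))) :-R T :*R r1) :-R
            ((T :*R (n :*R r1) :+R T :*R (T :*R (n :*R (r1 :*R r1)))) :+R q) :=R
            (T :*R (c :*R c) :+R T :*R r1) :-R (T :*R (n :*R r1) :+R q)) R.refl r0 r1 (nat N) _) ⟩
      w R.* ((two R.* (r0 R.* r0) R.+ two R.* r1) R.-
        (two R.* (nat N R.* r1) R.+ (two R.* (nat N R.* (r0 R.* r2)) R.+ (nat N R.* nat N R.- nat N) R.* (r1 R.* r1)))) ∎)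
      where
      open import Relation.Binary.Reasoning.Setoid R.setoid
      T : ∀ {n} → RS.Polynomial n
      T = conR (+ 1) :+R conR (+ 1)
      G E2 sum3 : R.Carrier
      G = r1 R.+ (r0 R.* r2 R.+ (r1 R.* r1 R.+ r2 R.* r0))
      E2 = e 2 R.+ G
      sum3 = (r0 R.* r0 R.+ (r0 R.* r1 R.+ r1 R.* r0)) R.+ (r0 R.* r2 R.+ (r1 R.* r1 R.+ r2 R.* r0))
      wE2 : w R.* E2 R.≈ w R.* sum3 R.- (A 1 R.* X 1 R.+ A 2 R.* X 0)
      wE2 = R.trans (R.*-cong (R.sym A0≈w) (R.sym (R.trans X2 (R.+-cong R.refl (R.+-cong (R.trans (R.*-cong e1 R.refl) (R.*-identityˡ _)) R.refl)))))
        (R.trans (solveR 2 (λ a b → a :=R (a :+R b) :-R b) R.refl (A 0 R.* X 2) _)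
          (R.+-cong (R.trans (R.sym (equal 2 (s≤s (s≤s (s≤s z≤n))))) (R.trans (lhs 2) (R.*-cong R.refl
            (solveR 3 (λ a b c → conR (+ 1) :*R c :+R (conR (+ 1) :*R b :+R conR (+ 1) :*R a) :=R (a :+R b) :+R c) R.refl _ _ _)))) R.refl))
      A1X1 : A 1 R.* X 1 R.≈ (nat N R.* (r1 R.* w)) R.* (R.1# R.+ two R.* r1)
      A1X1 = R.trans (R.*-cong R.refl (R.trans X1 (R.+-cong (R.trans (R.*-cong e1 R.refl) (R.*-identityˡ _)) R.refl)))
        (R.trans (solveR 3 (λ a c r → a :*R (c :+R (c :*R r :+R r :*R c)) :=R (c :*R a) :*R (conR (+ 1) :+R T :*R r)) R.refl (A 1) r0 r1)
          (R.*-cong (R.trans (pow-1 N) (R.*-cong R.refl (R.*-cong R.refl A0≈w))) R.refl))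
      A2X0 : two R.* (A 2 R.* X 0) R.≈ w R.* (two R.* (nat N R.* (r0 R.* r2)) R.+ (nat N R.* nat N R.- nat N) R.* (r1 R.* r1))
      A2X0 = R.trans (R.*-cong R.refl (R.trans (R.*-cong R.refl X0) (R.*-comm _ _))) (R.trans (pow-2 N) (R.*-cong A0≈w R.refl))

    -- The first step from the row 1, 0, 0, ... gives 1 followed by the kernel, and the second step
    -- at a = 0 pairs this row with the variables.
    e2-tν : e 2 R.≈ R.1# R.+ ∑R D (λ j → pt j R.* tν (suc j))
    e2-tν = R.trans (x-suc 1 0) (R.trans (R.+-identityʳ _) (R.+-cong e1 (∑R-cong D λ j _ → R.*-cong R.refl (x1 j))))
      where
      conv0 : ∀ a t (z : ℕ → R.Carrier) → (∀ i → z i R.≈ R.0#) → conv z t a R.≈ R.0#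
      conv0 zero t z h = R.refl
      conv0 (suc a) t z h = R.trans (R.+-cong (R.trans (R.*-cong (h 0) R.refl) (R.zeroˡ _)) (conv0 a t _ λ i → h (suc i))) (R.+-identityˡ _)
      zeros : ∀ k a → ∑R k (λ j → pt j R.* x 0 (suc a ℕ.+ suc j)) R.≈ R.0#
      zeros zero a = R.refl
      zeros (suc k) a = R.trans (R.+-cong (R.trans (R.*-cong R.refl (x-0 (a ℕ.+ suc k))) (R.zeroʳ _)) (zeros k a)) (R.+-identityˡ _)
      x1 : ∀ j → x 1 (suc j) R.≈ tν (suc j)
      x1 j = R.trans (x-suc 0 (suc j)) (R.trans (R.+-cong (R.trans (R.+-cong (x-0 j) (zeros D j)) (R.+-identityˡ _))
          (R.+-cong (R.trans (R.*-cong x-00 R.refl) (R.*-identityˡ _)) (conv0 j tν _ λ i → x-0 i)))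
        (R.trans (R.+-identityˡ _) (R.+-identityʳ _)))

-- Binomial coefficients; filtration, fixed points and derivations of the shuffle ring.

module ShuffleAlgebra where

  open import Level using (0ℓ)
  open import Algebra.Bundles using (CommutativeRing)
  open import Data.Nat as ℕ using (ℕ; zero; suc; _<_; z≤n; s≤s; _∸_; _!)
  import Data.Nat.Properties as ℕP
  import Data.Nat.Combinatorics as C
  open import Data.Nat.Combinatorics using (_C_)
  open import Data.Nat.DivMod using (m/n*n≡m)
  open import Data.Integer using (+_)
  open import Data.List using (List; []; _∷_; length)
  open import Relation.Nullary using (yes; no)
  open import Relation.Binary.PropositionalEquality as ≡ using (_≡_)
  open Rings
  open Filtrations
  open Shifts

  -- Multiplied by j! i!, both sides are (j + i + 1)!. The identity will link the coefficients of σ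
  -- and σ^2 in ρ.
  absorb : ∀ i j → suc i ℕ.* (suc (j ℕ.+ i) C j) ≡ suc (j ℕ.+ i) ℕ.* ((j ℕ.+ i) C j)
  absorb i j = ℕP.*-cancelʳ-≡ _ _ (j ! ℕ.* i !) {{(ℕP._!*_!≢0) j i}} (begin
    suc i ℕ.* (suc (j ℕ.+ i) C j) ℕ.* (j ! ℕ.* i !)    ≡⟨ lem₁ (suc i) (suc (j ℕ.+ i) C j) (j !) (i !) ⟩
    (suc (j ℕ.+ i) C j) ℕ.* (j ! ℕ.* (suc i) !)        ≡⟨ ≡.cong (λ k → (k C j) ℕ.* (j ! ℕ.* (suc i) !)) (≡.sym (ℕP.+-suc j i)) ⟩
    ((j ℕ.+ suc i) C j) ℕ.* (j ! ℕ.* (suc i) !)        ≡⟨ fact j (suc i) ⟩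
    (j ℕ.+ suc i) !                                    ≡⟨ ≡.cong _! (ℕP.+-suc j i) ⟩
    suc (j ℕ.+ i) ℕ.* (j ℕ.+ i) !                      ≡⟨ ≡.cong (suc (j ℕ.+ i) ℕ.*_) (≡.sym (fact j i)) ⟩
    suc (j ℕ.+ i) ℕ.* (((j ℕ.+ i) C j) ℕ.* (j ! ℕ.* i !)) ≡⟨ ≡.sym (ℕP.*-assoc (suc (j ℕ.+ i)) ((j ℕ.+ i) C j) (j ! ℕ.* i !)) ⟩
    suc (j ℕ.+ i) ℕ.* ((j ℕ.+ i) C j) ℕ.* (j ! ℕ.* i !) ∎)
    where
    open ≡.≡-Reasoning
    open import Data.Nat.Solver using (module +-*-Solver)
    open +-*-Solver
    lem₁ : ∀ s c a b → s ℕ.* c ℕ.* (a ℕ.* b) ≡ c ℕ.* (a ℕ.* (s ℕ.* b))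
    lem₁ = solve 4 (λ s c a b → s :* c :* (a :* b) := c :* (a :* (s :* b))) ≡.refl
    fact : ∀ j i → ((j ℕ.+ i) C j) ℕ.* (j ! ℕ.* i !) ≡ (j ℕ.+ i) !
    fact j i = ≡.trans (≡.cong (λ l → ((j ℕ.+ i) C j) ℕ.* (j ! ℕ.* l !)) (≡.sym (ℕP.m+n∸m≡n j i)))
      (≡.trans (≡.cong (ℕ._* (j ! ℕ.* (j ℕ.+ i ∸ j) !)) (C.nCk≡n!/k![n-k]! (ℕP.m≤m+n j i)))
        (m/n*n≡m {{(ℕP._!*_!≢0) j (j ℕ.+ i ∸ j)}} (C.k![n∸k]!∣n! (ℕP.m≤m+n j i))))

  module Binomials (R : CommutativeRing 0ℓ 0ℓ) (N′ : ℕ) where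
    N : ℕ
    N = suc N′
    open Shift R N

    nat : ℕ → R.Carrier
    nat zero = R.0#
    nat (suc n) = R.1# R.+ nat n

    nat-+ : ∀ a b → nat (a ℕ.+ b) R.≈ nat a R.+ nat b
    nat-+ zero b = R.sym (R.+-identityˡ _)
    nat-+ (suc a) b = R.trans (R.+-cong R.refl (nat-+ a b)) (R.sym (R.+-assoc _ _ _))

    nat-* : ∀ a b → nat (a ℕ.* b) R.≈ nat a R.* nat b
    nat-* zero b = R.sym (R.zeroˡ _)
    nat-* (suc a) b = R.trans (nat-+ b (a ℕ.* b)) (R.trans (R.+-cong (R.sym (R.*-identityˡ _)) (nat-* a b)) (R.sym (R.distribʳ _ _ _)))

    y^-coeff : ∀ j i → (y ^ suc j) i R.≈ nat ((j ℕ.+ i) C j)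
    y^-coeff zero i = R.trans (*-identityʳ y i) (R.sym (R.trans (R.reflexive (≡.cong nat (≡.trans (C.nCk≡nC[n∸k] {0} {i} z≤n) (C.nCn≡1 i)))) (R.+-identityʳ _)))
    y^-coeff (suc j) zero = R.trans (R.*-identityˡ _) (R.trans (y^-coeff j 0) (R.reflexive (≡.cong nat
      (≡.trans (≡.cong (_C j) (ℕP.+-identityʳ j)) (≡.trans (C.nCn≡1 j) (≡.sym (≡.trans (≡.cong (_C suc j) (ℕP.+-identityʳ (suc j))) (C.nCn≡1 (suc j)))))))))
    y^-coeff (suc j) (suc i) = R.trans (y-suc (y ^ suc j) i) (R.trans (R.+-cong (y^-coeff (suc j) i) (y^-coeff j (suc i)))
      (R.trans (R.sym (nat-+ (suc (j ℕ.+ i) C suc j) ((j ℕ.+ suc i) C j))) (R.reflexive (≡.cong nat (≡.trans (≡.cong (suc (j ℕ.+ i) C suc j ℕ.+_) (≡.cong (_C j) (ℕP.+-suc j i)))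
        (≡.trans (ℕP.+-comm (suc (j ℕ.+ i) C suc j) _) (≡.trans (C.nCk+nC[k+1]≡[n+1]C[k+1] (suc (j ℕ.+ i)) j)
          (≡.cong (λ l → suc l C suc j) (≡.sym (ℕP.+-suc j i))))))))))

    trunc-< : ∀ k a i → i < k → trunc k a i R.≈ a i
    trunc-< (suc k) a zero _ = R.refl
    trunc-< (suc k) a (suc i) (s≤s h) = trunc-< k (tail a) i h

    -- Summing the first coefficients of y^(j+1) gives a coefficient of y^(j+2). With b = j + 1 it
    -- is C(m b - 1, b), so the normalisation of `n̂` is what produces the coefficients of A(w).
    ε-Tr : ∀ j → ε (suc j ℕ.* N) (Tr j) R.≈ nat ((j ℕ.+ suc j ℕ.* N) C suc j)
    ε-Tr j = R.trans (y-suc (Tr j) K) (R.trans (R.+-cong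
        (R.trans (⊗-cong≤ {y} {y} {Tr j} {y ^ suc j} K (λ _ _ → R.refl) λ i l → trunc-< (suc K) (y ^ suc j) i (s≤s l)) (y^-coeff (suc j) K))
        (trunc-Lo (suc K) (y ^ suc j) (suc K) ℕP.≤-refl)) (R.trans (R.+-identityʳ _)
        (R.reflexive (≡.cong (λ l → nat (l C suc j)) (≡.sym (ℕP.+-suc j K))))))
      where K = N′ ℕ.+ j ℕ.* N

  module ShuffleTools (K : CommutativeRing 0ℓ 0ℓ) where
    module K = CommutativeRing K
    open Shuffle K using (Sh; _∂_; _⊠_; _⊞_; zer; one) public
    R : CommutativeRing 0ℓ 0ℓ
    R = Shuffle.ring K
    module R = CommutativeRing R
    module KS = IntegerSolver K
    module RS = IntegerSolver R
    open KS using () renaming (solve to solveK; _:=_ to _:=K_; _:+_ to _:+K_; _:*_ to _:*K_; _:-_ to _:-K_; con to conK)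

    sc : K.Carrier → Sh
    sc r [] = r
    sc r (_ ∷ _) = K.0#

    zero-⊠ : ∀ g β → (zer ⊠ g) β K.≈ K.0#
    zero-⊠ g β = R.zeroˡ g β

    sc-⊠ : ∀ r g β → (sc r ⊠ g) β K.≈ r K.* g β
    sc-⊠ r g [] = K.refl
    sc-⊠ r g (b ∷ β) = K.trans (K.+-cong (zero-⊠ g β) (sc-⊠ r (g ∂ b) β)) (K.+-identityˡ _)

    scale-⊠ : ∀ r f g β → ((λ γ → r K.* f γ) ⊠ g) β K.≈ r K.* (f ⊠ g) β
    scale-⊠ r f g β = K.trans (R.*-cong {y = sc r ⊠ f} {u = g} {v = g} (λ γ → K.sym (sc-⊠ r f γ)) (λ _ → K.refl) β)
      (K.trans (R.*-assoc (sc r) f g β) (sc-⊠ r (f ⊠ g) β))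

    F : ℕ → Sh → Set
    F n f = ∀ β → length β < n → f β K.≈ K.0#

    F-* : ∀ i j f g → F i f → F j g → F (i ℕ.+ j) (f ⊠ g)
    F-* zero zero f g p q [] ()
    F-* zero (suc j) f g p q [] _ = K.trans (K.*-cong K.refl (q [] (s≤s z≤n))) (K.zeroʳ _)
    F-* (suc i) j f g p q [] _ = K.trans (K.*-cong (p [] (s≤s z≤n)) K.refl) (K.zeroˡ _)
    F-* zero (suc j) f g p q (b ∷ β) (s≤s h) = K.trans (K.+-cong
      (F-* 0 (suc j) (f ∂ b) g (λ _ ()) q β (ℕP.m≤n⇒m≤1+n h))
      (F-* 0 j f (g ∂ b) (λ _ ()) (λ γ l → q (b ∷ γ) (s≤s l)) β h)) (K.+-identityˡ _)
    F-* (suc i) zero f g p q (b ∷ β) (s≤s h) = K.trans (K.+-cong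
      (F-* i 0 (f ∂ b) g (λ γ l → p (b ∷ γ) (s≤s l)) q β h)
      (F-* (suc i) 0 f (g ∂ b) p (λ _ ()) β (ℕP.m≤n⇒m≤1+n h))) (K.+-identityˡ _)
    F-* (suc i) (suc j) f g p q (b ∷ β) (s≤s h) = K.trans (K.+-cong
      (F-* i (suc j) (f ∂ b) g (λ γ l → p (b ∷ γ) (s≤s l)) q β h)
      (F-* (suc i) j f (g ∂ b) p (λ γ l → q (b ∷ γ) (s≤s l)) β (≡.subst (length β <_) (ℕP.+-suc i j) h))) (K.+-identityˡ _)

    private module KP where
      open import Algebra.Properties.Ring K.ring public using (-0#≈0#)

    filtration : Filtration R
    filtration = record
      { F = F
      ; resp = λ p h β l → K.trans (K.sym (p β)) (h β l)
      ; F-0 = λ β l → K.refl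
      ; F-+ = λ p q β l → K.trans (K.+-cong (p β l) (q β l)) (K.+-identityˡ _)
      ; F-neg = λ p β l → K.trans (K.-‿cong (p β l)) KP.-0#≈0#
      ; F-* = λ {i} {j} {f} {g} → F-* i j f g
      ; F-all = λ f β ()
      ; F-anti = λ h β l → h β (ℕP.m≤n⇒m≤1+n l)
      ; F-sep = λ h β → h (suc (length β)) β ℕP.≤-refl }

    iter : ℕ → (Sh → Sh) → Sh
    iter zero G = zer
    iter (suc k) G = G (iter k G)

    -- A contraction computes the value on a list from values on strictly shorter lists, so length +
    -- 1 iterations from zero reach the fixed point there.
    fix : (Sh → Sh) → Sh
    fix G β = iter (suc (length β)) G β

    Agree : ℕ → Sh → Sh → Set
    Agree n f g = ∀ β → length β < n → f β K.≈ g β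

    Contracting : (Sh → Sh) → Set
    Contracting G = ∀ n f g → Agree n f g → Agree (suc n) (G f) (G g)

    private
      iter-stable : ∀ G → Contracting G → ∀ k → Agree k (iter k G) (iter (suc k) G)
      iter-stable G h zero β ()
      iter-stable G h (suc k) = h k _ _ (iter-stable G h k)

      iter-fix : ∀ G → Contracting G → ∀ k → Agree k (iter k G) (fix G)
      iter-fix G h (suc k) β l with length β ℕ.≟ k
      ... | yes ≡.refl = K.refl
      ... | no ne = K.trans (K.sym (iter-stable G h k β l′)) (iter-fix G h k β l′)
        where l′ = ℕP.≤∧≢⇒< (ℕP.≤-pred l) ne

    fix-eq : ∀ G → Contracting G → fix G R.≈ G (fix G)
    fix-eq G h β = h (length β) _ _ (iter-fix G h (length β)) β ℕP.≤-refl

    Agree→F : ∀ {n f g} → Agree n f g → F n (f R.- g)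
    Agree→F h β l = K.trans (K.+-cong (h β l) K.refl) (K.-‿inverseʳ _)

    F→Agree : ∀ {n f g} → F n (f R.- g) → Agree n f g
    F→Agree {f = f} {g} h β l = KP′.x∙y⁻¹≈ε⇒x≈y (f β) (g β) (h β l)
      where
      module KP′ where
        open import Algebra.Properties.Ring K.ring public using (x∙y⁻¹≈ε⇒x≈y)

    ωs : (ℕ → K.Carrier) → List ℕ → K.Carrier
    ωs ω [] = K.0#
    ωs ω (b ∷ β) = ω b K.+ ωs ω β

    -- The derivation with p_b ↦ ω(b) p_b: weights add up along the parts of a monomial.
    Der : (ℕ → K.Carrier) → Sh → Sh
    Der ω f β = ωs ω β K.* f β

    Der-cong : ∀ ω {f g} → f R.≈ g → Der ω f R.≈ Der ω g
    Der-cong ω p β = K.*-cong K.refl (p β)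

    Der-+ : ∀ ω f g → Der ω (f R.+ g) R.≈ Der ω f R.+ Der ω g
    Der-+ ω f g β = K.distribˡ _ _ _

    Der-neg : ∀ ω f → Der ω (R.- f) R.≈ R.- Der ω f
    Der-neg ω f β = solveK 2 (λ w f → w :*K (KS.:- f) :=K KS.:- (w :*K f)) K.refl _ _

    Der-* : ∀ ω f g → Der ω (f ⊠ g) R.≈ (Der ω f ⊠ g) ⊞ (f ⊠ Der ω g)
    Der-* ω f g [] = solveK 2 (λ a b → conK (+ 0) :*K (a :*K b) :=K (conK (+ 0) :*K a) :*K b :+K a :*K (conK (+ 0) :*K b)) K.refl _ _
    Der-* ω f g (b ∷ β) = K.sym (K.trans (K.+-cong
        (K.+-cong (expand f g) K.refl)
        (K.+-cong K.refl (K.trans (R.*-comm f (Der ω g ∂ b) β) (K.trans (expand g f) (K.+-cong (K.*-cong K.refl (R.*-comm (g ∂ b) f β)) (R.*-comm (Der ω (g ∂ b)) f β))))))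
      (K.trans (solveK 7 (λ w A D1 D2 D3 B D4 → ((w :*K A :+K D1) :+K D2) :+K (D3 :+K (w :*K B :+K D4)) :=K
          w :*K (A :+K B) :+K ((D1 :+K D3) :+K (D2 :+K D4))) K.refl (ω b) _ _ _ _ _ _)
        (K.trans (K.+-cong K.refl (K.+-cong (K.sym (Der-* ω (f ∂ b) g β)) (K.sym (Der-* ω f (g ∂ b) β))))
          (solveK 4 (λ w s A B → w :*K (A :+K B) :+K (s :*K A :+K s :*K B) :=K (w :+K s) :*K (A :+K B)) K.refl (ω b) _ _ _))))
      where
      expand : ∀ f g → ((Der ω f ∂ b) ⊠ g) β K.≈ ω b K.* (f ∂ b ⊠ g) β K.+ (Der ω (f ∂ b) ⊠ g) β
      expand f g = K.trans (R.*-cong {y = (λ γ → ω b K.* (f ∂ b) γ) ⊞ Der ω (f ∂ b)} {u = g} {v = g} (λ γ → K.distribʳ _ _ _) (λ _ → K.refl) β)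
        (K.trans (R.distribʳ g (λ γ → ω b K.* (f ∂ b) γ) (Der ω (f ∂ b)) β) (K.+-cong (scale-⊠ (ω b) (f ∂ b) g β) K.refl))

    Der-sc : ∀ ω r → Der ω (sc r) R.≈ zer
    Der-sc ω r [] = K.zeroˡ r
    Der-sc ω r (b ∷ β) = K.zeroʳ _

    Der-one : ∀ ω → Der ω one R.≈ zer
    Der-one ω [] = K.zeroˡ _
    Der-one ω (b ∷ β) = K.zeroʳ _

-- The concrete solution of the recurrence and its two differential equations.

module RecurrenceModel where

  open import Level using (0ℓ)
  open import Algebra.Bundles using (CommutativeRing)
  import Algebra.Properties.Semiring.Exp as Exp
  open import Data.Bool using (if_then_else_)
  open import Data.Nat as ℕ using (ℕ; zero; suc; s≤s; _≡ᵇ_)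
  import Data.Nat.Properties as ℕP
  open import Data.Nat.Combinatorics using (_C_)
  open import Data.Nat.Solver using (module +-*-Solver)
  open import Data.Integer using (+_)
  open import Data.List using ([]; _∷_)
  open import Data.Bool using (true; false)
  open import Relation.Binary.PropositionalEquality as ≡ using (_≡_)
  open Rings
  open Filtrations
  open Shifts
  open QuadraticRelation
  open ShuffleAlgebra

  module Model (K : CommutativeRing 0ℓ 0ℓ) (N′ D : ℕ) where
    open ShuffleTools K public hiding (module RS)
    module B = Binomials R N′
    N : ℕ
    N = suc N′
    open Shift R N using (∑R; ∑R-cong; ε; Tr; Tl)
    module RE = Exp R.semiring
    open B using (nat; nat-+; nat-*)

    natK : ℕ → K.Carrier
    natK zero = K.0#
    natK (suc n) = K.1# K.+ natK n

    nat-sc : ∀ n → nat n R.≈ sc (natK n)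
    nat-sc zero [] = K.refl
    nat-sc zero (b ∷ β) = K.refl
    nat-sc (suc n) [] = K.+-cong K.refl (nat-sc n [])
    nat-sc (suc n) (b ∷ β) = K.trans (K.+-identityˡ _) (nat-sc n (b ∷ β))

    nat-⊠ : ∀ n g β → (nat n ⊠ g) β K.≈ natK n K.* g β
    nat-⊠ n g β = K.trans (R.*-cong {u = g} {v = g} (nat-sc n) (λ _ → K.refl) β) (sc-⊠ (natK n) g β)

    -- The variable p_(j+1). Its value is j + 1 and not 1 because the encoding divides a single part
    -- b by b.
    p : ℕ → Sh
    p j [] = K.0#
    p j (b ∷ []) = if b ≡ᵇ suc j then natK (suc j) else K.0#
    p j (_ ∷ _ ∷ _) = K.0#

    p-F : ∀ j → F 1 (p j)
    p-F j [] _ = K.refl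
    p-F j (b ∷ β) (s≤s ())

    open Filtration filtration using (resp; F-0; F-+; F-neg; F-all; F-anti)

    -- With b = j + 1 and m = N + 1 these are C(m b - 1, b), C(m b - 1, b - 1) and C(m b, b - 1):
    -- the coefficients of p_b w^b in c, `r1` and `r2`.
    fC f1 f2 : ℕ → ℕ
    fC j = (j ℕ.+ suc j ℕ.* N) C suc j
    f1 j = (j ℕ.+ suc j ℕ.* N) C j
    f2 j = suc (j ℕ.+ suc j ℕ.* N) C j

    -- Its fixed point is c = 1 + A(w) with w = c^N, at x = z = u = 1 and with only the variables
    -- p_1, ..., p_D. Every term involving the argument has a factor p_b, hence the contraction.
    G : Sh → Sh
    G f = R.1# R.+ ∑R D (λ j → (p j R.* (f RE.^ N) RE.^ suc j) R.* nat (fC j))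

    open IntegerSolver R using () renaming (solve to solveR; _:=_ to _:=R_; _:+_ to _:+R_; _:*_ to _:*R_; _:-_ to _:-R_; :-_ to :-R_; con to conR)

    F-*ʳ : ∀ {n} a {b} → F n b → F n (a R.* b)
    F-*ʳ {n} a {b} h = F-* 0 n a b (F-all a) h

    F-*ˡ : ∀ {n} a {b} → F n b → F n (b R.* a)
    F-*ˡ {n} a {b} h = resp {n} (R.*-comm a b) (F-*ʳ a h)

    pow-F : ∀ {n} f g k → F n (f R.- g) → F n (f RE.^ k R.- g RE.^ k)
    pow-F {n} f g zero h = resp {n} (R.sym (R.-‿inverseʳ R.1#)) (F-0 {n})
    pow-F {n} f g (suc k) h = resp {n} (solveR 4 (λ f g a b → f :*R (a :-R b) :+R (f :-R g) :*R b :=R f :*R a :-R g :*R b) R.refl f g (f RE.^ k) (g RE.^ k))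
      (F-+ {n} (F-*ʳ f (pow-F f g k h)) (F-*ˡ (g RE.^ k) h))

    G-contract : Contracting G
    G-contract n f g h = F→Agree {suc n} (resp {suc n} (solveR 3 (λ o a b → a :-R b :=R (o :+R a) :-R (o :+R b)) R.refl R.1# _ _) (sums D))
      where
      sums : ∀ D → F (suc n) (∑R D (λ j → (p j R.* (f RE.^ N) RE.^ suc j) R.* nat (fC j)) R.- ∑R D (λ j → (p j R.* (g RE.^ N) RE.^ suc j) R.* nat (fC j)))
      sums zero = resp {suc n} (R.sym (R.-‿inverseʳ R.0#)) (F-0 {suc n})
      sums (suc D) = resp {suc n} (solveR 6 (λ p a b n s t → (p :*R (a :-R b)) :*R n :+R (s :-R t) :=R (((p :*R a) :*R n) :+R s) :-R (((p :*R b) :*R n) :+R t)) R.refl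
          (p D) ((f RE.^ N) RE.^ suc D) ((g RE.^ N) RE.^ suc D) (nat (fC D)) _ _)
        (F-+ {suc n} (F-*ˡ (nat (fC D)) (F-* 1 n (p D) _ (p-F D) (pow-F {n} _ _ (suc D) (pow-F {n} f g N (Agree→F h))))) (sums D))

    c w : Sh
    c = fix G
    w = c RE.^ N

    c-eq : c R.≈ G c
    c-eq = fix-eq G G-contract

    pt : ℕ → Sh
    pt j = p j R.* w RE.^ suc j

    hc : c R.≈ R.1# R.+ ∑R D (λ j → pt j R.* ε (suc j ℕ.* N) (Tr j))
    hc = R.trans c-eq (R.+-cong R.refl (∑R-cong D λ j _ → R.*-cong {x = pt j} R.refl (R.sym (B.ε-Tr j))))

    hpt : ∀ j → F 1 (pt j)
    hpt j = F-*ˡ (w RE.^ suc j) (p-F j)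

    c-1 : F 1 (c R.- R.1#)
    c-1 = resp {1} (R.sym (R.trans (R.+-cong c-eq R.refl) (solveR 2 (λ o z → (o :+R z) :-R o :=R z) R.refl R.1# _))) (sums D)
      where
      sums : ∀ D → F 1 (∑R D (λ j → pt j R.* nat (fC j)))
      sums zero = F-0 {1}
      sums (suc D) = F-+ {1} (F-*ˡ (nat (fC D)) (hpt D)) (sums D)

    -- The inverse of c as a fixed point, contracting because c - 1 has degree 1.
    G′ : Sh → Sh
    G′ u = R.1# R.- (c R.- R.1#) R.* u

    c′ : Sh
    c′ = fix G′

    hinv : c R.* c′ R.≈ R.1#
    hinv = R.trans (solveR 3 (λ c u o → c :*R u :=R ((c :-R o) :*R u :+R o :*R u)) R.refl c c′ R.1#)
      (R.trans (R.+-cong R.refl (R.trans (R.*-identityˡ c′) (fix-eq G′ contract)))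
        (solveR 2 (λ x o → x :+R (o :-R x) :=R o) R.refl ((c R.- R.1#) R.* c′) R.1#))
      where
      contract : Contracting G′
      contract n f g h = F→Agree {suc n} (resp {suc n} (solveR 4 (λ o c f g → :-R (c :*R (f :-R g)) :=R (o :-R c :*R f) :-R (o :-R c :*R g)) R.refl R.1# (c R.- R.1#) f g)
        (F-neg {suc n} (F-* 1 n (c R.- R.1#) (f R.- g) c-1 (Agree→F h))))

    open Quadratic R filtration N D pt c c′ w hinv hc hpt R.refl public
      using (x; tν; conv; x-00; x-0; x-suc; x-m; e; e2; e2-tν; r0; r1; r2; c-r1; two; ρ0; ρ-τ; σ-suc; const-*; τ; m)
      renaming (nat to natQ)
    open Quadratic R filtration N D pt c c′ w hinv hc hpt R.refl using (∑; ∑-lin; const; ⟨_⟩; conv-cong; σ; ρ)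

    natQ≡ : ∀ n → natQ n ≡ nat n
    natQ≡ zero = ≡.refl
    natQ≡ (suc n) = ≡.cong (R.1# R.+_) (natQ≡ n)

    -- Undoes the rescaling: the power w^a turns the variables p_b w^b of the solved recurrence back
    -- into p_b, and the closing condition x_m(a) = w tν(a + 1) into one without w.
    H : ℕ → ℕ → Sh
    H k a = w RE.^ a R.* x k a

    T : ℕ → Sh
    T a = w RE.^ a R.* tν a

    private
      conv-scale : ∀ a o (z : ℕ → Sh) → conv (λ i → w RE.^ (o ℕ.+ i) R.* z i) T a R.≈ w RE.^ (o ℕ.+ a) R.* conv z tν a
      conv-scale zero o z = R.sym (R.zeroʳ _)
      conv-scale (suc a) o z = R.trans (R.+-cong
          (R.trans (R.*-cong (R.*-cong (R.reflexive (≡.cong (w RE.^_) (ℕP.+-identityʳ o))) R.refl) R.refl)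
            (R.trans (solveR 4 (λ a b c d → (a :*R b) :*R (c :*R d) :=R (a :*R c) :*R (b :*R d)) R.refl (w RE.^ o) (z 0) (w RE.^ suc a) (tν (suc a)))
              (R.*-cong (R.sym (RE.^-homo-* w o (suc a))) R.refl)))
          (R.trans (conv-cong a (λ i → R.*-cong (R.reflexive (≡.cong (w RE.^_) (ℕP.+-suc o i))) R.refl) (λ i → R.refl))
            (R.trans (conv-scale a (suc o) (λ i → z (suc i))) (R.*-cong (R.reflexive (≡.cong (w RE.^_) (≡.sym (ℕP.+-suc o a)))) R.refl))))
        (R.sym (R.distribˡ _ _ _))

      ∑R-scale : ∀ n a f → ∑R n (λ j → a R.* f j) R.≈ a R.* ∑R n f
      ∑R-scale zero a f = R.sym (R.zeroʳ a)
      ∑R-scale (suc n) a f = R.trans (R.+-cong R.refl (∑R-scale n a f)) (R.sym (R.distribˡ a _ _))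

    H-suc : ∀ k a → H (suc k) a R.≈ (H k a R.+ ∑R D (λ j → p j R.* H k (a ℕ.+ suc j))) R.+ conv (H k) T a
    H-suc k a = R.trans (R.*-cong R.refl (x-suc k a)) (R.trans (R.distribˡ _ _ _) (R.+-cong
      (R.trans (R.distribˡ _ _ _) (R.+-cong R.refl (R.trans (R.sym (∑R-scale D (w RE.^ a) _)) (∑R-cong D λ j _ →
        R.trans (solveR 4 (λ a p b x → a :*R ((p :*R b) :*R x) :=R p :*R ((a :*R b) :*R x)) R.refl (w RE.^ a) (p j) (w RE.^ suc j) _)
          (R.*-cong R.refl (R.*-cong (R.sym (RE.^-homo-* w a (suc j))) R.refl))))))
      (R.sym (conv-scale a 0 (x k)))))

    H-m : ∀ a → H (suc N) a R.≈ T (suc a)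
    H-m a = R.trans (R.*-cong R.refl (x-m a)) (solveR 3 (λ a w t → a :*R (w :*R t) :=R (w :*R a) :*R t) R.refl (w RE.^ a) w _)

    H-00 : H 0 0 R.≈ R.1#
    H-00 = R.trans (R.*-identityˡ _) x-00

    H-0 : ∀ a → H 0 (suc a) R.≈ R.0#
    H-0 a = R.trans (R.*-cong R.refl (x-0 a)) (R.zeroʳ _)

    -- τR is θ_z G with x = z = 1.
    τR : Sh
    τR = ∑R D (λ j → p j R.* T (suc j))

    Fs : (ℕ → ℕ) → Sh
    Fs f = ∑R D (λ j → pt j R.* nat (f j))

    r-coeff : ∀ i → ρ (suc i) R.≈ ∑R D (λ j → pt j R.* Tl j i)
    r-coeff i = R.trans (ρ-τ (suc i)) (R.trans (R.+-identityˡ _) (R.trans (σ-suc τ i)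
      (R.trans (∑-lin D (λ a → a i) R.refl (λ a b → R.refl) _) (∑R-cong D λ j _ → const-* (pt j) (Tl j) i))))

    r1-eq : r1 R.≈ Fs f1
    r1-eq = R.trans (r-coeff 0) (∑R-cong D λ j _ → R.*-cong {x = pt j} R.refl (R.trans (B.y^-coeff j (suc j ℕ.* N ℕ.+ 0))
      (R.reflexive (≡.cong (λ l → nat ((j ℕ.+ l) C j)) (ℕP.+-identityʳ (suc j ℕ.* N))))))

    r2-eq : r2 R.≈ Fs f2
    r2-eq = R.trans (r-coeff 1) (∑R-cong D λ j _ → R.*-cong {x = pt j} R.refl (R.trans (B.y^-coeff j (suc j ℕ.* N ℕ.+ 1))
      (R.reflexive (≡.cong (λ l → nat (l C j)) (≡.trans (≡.cong (j ℕ.+_) (ℕP.+-comm (suc j ℕ.* N) 1)) (ℕP.+-suc j (suc j ℕ.* N)))))))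

    Fs-rel : nat N R.* Fs (λ j → suc j ℕ.* f2 j) R.+ Fs f2 R.≈ nat (suc N) R.* Fs (λ j → suc j ℕ.* f1 j)
    Fs-rel = go D
      where
      open +-*-Solver using () renaming (_:+_ to _:+ₙ_; _:*_ to _:*ₙ_; _:=_ to _:=ₙ_; solve to solveₙ; con to conₙ)
      term : ∀ j → nat N R.* nat (suc j ℕ.* f2 j) R.+ nat (f2 j) R.≈ nat (suc N) R.* nat (suc j ℕ.* f1 j)
      term j = R.trans (R.+-cong (R.sym (nat-* N (suc j ℕ.* f2 j))) R.refl) (R.trans (R.sym (nat-+ (N ℕ.* (suc j ℕ.* f2 j)) (f2 j)))
        (R.trans (R.reflexive (≡.cong nat (≡.trans
            (solveₙ 3 (λ N j f → N :*ₙ (j :*ₙ f) :+ₙ f :=ₙ (conₙ 1 :+ₙ j :*ₙ N) :*ₙ f) ≡.refl N (suc j) (f2 j))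
            (≡.trans (absorb (suc j ℕ.* N) j)
              (solveₙ 3 (λ N j f → (conₙ 1 :+ₙ (j :+ₙ (conₙ 1 :+ₙ j) :*ₙ N)) :*ₙ f :=ₙ (conₙ 1 :+ₙ N) :*ₙ ((conₙ 1 :+ₙ j) :*ₙ f)) ≡.refl N j (f1 j))))))
          (nat-* (suc N) (suc j ℕ.* f1 j))))
      go : ∀ D → nat N R.* ∑R D (λ j → pt j R.* nat (suc j ℕ.* f2 j)) R.+ ∑R D (λ j → pt j R.* nat (f2 j)) R.≈
                 nat (suc N) R.* ∑R D (λ j → pt j R.* nat (suc j ℕ.* f1 j))
      go zero = solveR 2 (λ a b → a :*R conR (+ 0) :+R conR (+ 0) :=R b :*R conR (+ 0)) R.refl (nat N) (nat (suc N))
      go (suc D) = R.trans (solveR 6 (λ n q a s b t → n :*R (q :*R a :+R s) :+R (q :*R b :+R t) :=R q :*R (n :*R a :+R b) :+R (n :*R s :+R t)) R.refl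
          (nat N) (pt D) (nat (suc D ℕ.* f2 D)) _ (nat (f2 D)) _)
        (R.trans (R.+-cong (R.*-cong {x = pt D} R.refl (term D)) (go D))
          (solveR 4 (λ n q a s → q :*R (n :*R a) :+R n :*R s :=R n :*R (q :*R a :+R s)) R.refl (nat (suc N)) (pt D) (nat (suc D ℕ.* f1 D)) _))

    -- Both derivations have weights α b - β₀. The case α = 1, β₀ = 0 is θ_z, and α = N, β₀ = 1 is x
    -- ∂_x up to the x-degree of the constant term.
    module Derivation (ω : ℕ → K.Carrier) (α β₀ : Sh) (hω : ∀ j → sc (ω (suc j)) R.≈ α R.* nat (suc j) R.- β₀) where
      d : Sh → Sh
      d = Der ω

      d-nat : ∀ n → d (nat n) R.≈ R.0#
      d-nat n = R.trans (Der-cong ω (nat-sc n)) (Der-sc ω (natK n))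

      d-* : ∀ f g → d (f R.* g) R.≈ d f R.* g R.+ f R.* d g
      d-* = Der-* ω

      d-nat* : ∀ n f → d (nat n R.* f) R.≈ nat n R.* d f
      d-nat* n f = R.trans (d-* (nat n) f) (R.trans (R.+-cong (R.trans (R.*-cong (d-nat n) R.refl) (R.zeroˡ f)) R.refl) (R.+-identityˡ _))

      d-p : ∀ j → d (p j) R.≈ sc (ω (suc j)) R.* p j
      d-p j β = K.trans (go β) (K.sym (sc-⊠ (ω (suc j)) (p j) β))
        where
        go : ∀ β → d (p j) β K.≈ ω (suc j) K.* p j β
        go [] = K.trans (K.zeroʳ _) (K.sym (K.zeroʳ _))
        go (b ∷ []) with b ≡ᵇ suc j in eq
        ... | false = K.trans (K.zeroʳ _) (K.sym (K.zeroʳ _))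
        ... | true = K.*-cong (K.trans (K.+-identityʳ _) (K.reflexive (≡.cong ω (ℕP.≡ᵇ⇒≡ b (suc j) (≡.subst (λ z → Data.Bool.T z) (≡.sym eq) _))))) K.refl
          where import Data.Bool
        go (_ ∷ _ ∷ _) = K.trans (K.zeroʳ _) (K.sym (K.zeroʳ _))

      d-c^ : ∀ k → c R.* d (c RE.^ k) R.≈ nat k R.* (c RE.^ k R.* d c)
      d-c^ zero = R.trans (R.*-cong R.refl (Der-one ω)) (R.trans (R.zeroʳ c) (R.sym (R.zeroˡ _)))
      d-c^ (suc k) = R.trans (R.*-cong R.refl (d-* c (c RE.^ k))) (R.trans
        (solveR 4 (λ c dc ck dk → c :*R (dc :*R ck :+R c :*R dk) :=R c :*R (ck :*R dc) :+R c :*R (c :*R dk)) R.refl c (d c) (c RE.^ k) (d (c RE.^ k)))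
        (R.trans (R.+-cong R.refl (R.*-cong R.refl (d-c^ k)))
          (solveR 4 (λ c n ck dc → c :*R (ck :*R dc) :+R c :*R (n :*R (ck :*R dc)) :=R (conR (+ 1) :+R n) :*R ((c :*R ck) :*R dc)) R.refl c (nat k) (c RE.^ k) (d c))))

      d-w^ : ∀ k → c R.* d (w RE.^ k) R.≈ nat k R.* (nat N R.* (w RE.^ k R.* d c))
      d-w^ zero = R.trans (R.*-cong R.refl (Der-one ω)) (R.trans (R.zeroʳ c) (R.sym (R.zeroˡ _)))
      d-w^ (suc k) = R.trans (R.*-cong R.refl (d-* w (w RE.^ k))) (R.trans
        (solveR 5 (λ c dw wk w dk → c :*R (dw :*R wk :+R w :*R dk) :=R (c :*R dw) :*R wk :+R w :*R (c :*R dk)) R.refl c (d w) (w RE.^ k) w (d (w RE.^ k)))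
        (R.trans (R.+-cong (R.*-cong (d-c^ N) R.refl) (R.*-cong R.refl (d-w^ k)))
          (solveR 5 (λ N w n wk dc → (N :*R (w :*R dc)) :*R wk :+R w :*R (n :*R (N :*R (wk :*R dc))) :=R (conR (+ 1) :+R n) :*R (N :*R ((w :*R wk) :*R dc))) R.refl (nat N) w (nat k) (w RE.^ k) (d c))))

      Q : Sh
      Q = α R.* c R.+ nat N R.* d c

      -- A derivation with these weights multiplies p_b w^b by α b - β₀ + b N (d c)/c. The factor c
      -- clears the denominator, and after adding β₀ everything is proportional to b.
      d-Fs : ∀ f → c R.* (d (Fs f) R.+ β₀ R.* Fs f) R.≈ Q R.* Fs (λ j → suc j ℕ.* f j)
      d-Fs f = go D
        where
        term : ∀ j → c R.* (d (pt j R.* nat (f j)) R.+ β₀ R.* (pt j R.* nat (f j))) R.≈ Q R.* (pt j R.* nat (suc j ℕ.* f j))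
        term j = R.trans (R.*-cong R.refl (R.+-cong (R.trans (d-* (pt j) (nat (f j))) (R.trans (R.+-cong
              (R.*-cong (R.trans (d-* (p j) (w RE.^ suc j)) (R.+-cong (R.*-cong (R.trans (d-p j) (R.*-cong {u = p j} (hω j) R.refl)) R.refl) R.refl)) R.refl)
              (R.trans (R.*-cong {x = pt j} R.refl (d-nat (f j))) (R.zeroʳ (pt j)))) (R.+-identityʳ _))) R.refl))
          (R.trans (solveR 8 (λ c a n b p w dw f → c :*R ((((a :*R n :-R b) :*R p) :*R w :+R p :*R dw) :*R f :+R b :*R ((p :*R w) :*R f)) :=R
                (c :*R (a :*R n)) :*R ((p :*R w) :*R f) :+R (p :*R (c :*R dw)) :*R f) R.refl c α (nat (suc j)) β₀ (p j) (w RE.^ suc j) (d (w RE.^ suc j)) (nat (f j)))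
            (R.trans (R.+-cong R.refl (R.*-cong (R.*-cong {x = p j} R.refl (d-w^ (suc j))) R.refl))
              (R.trans (solveR 8 (λ c a n p w f N dc → (c :*R (a :*R n)) :*R ((p :*R w) :*R f) :+R (p :*R (n :*R (N :*R (w :*R dc)))) :*R f :=R
                  (a :*R c :+R N :*R dc) :*R ((p :*R w) :*R (n :*R f))) R.refl c α (nat (suc j)) (p j) (w RE.^ suc j) (nat (f j)) (nat N) (d c))
                (R.*-cong R.refl (R.*-cong {x = pt j} R.refl (R.sym (nat-* (suc j) (f j))))))))
        go : ∀ D → c R.* (d (∑R D (λ j → pt j R.* nat (f j))) R.+ β₀ R.* ∑R D (λ j → pt j R.* nat (f j))) R.≈ Q R.* ∑R D (λ j → pt j R.* nat (suc j ℕ.* f j))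
        go zero = R.trans (R.*-cong R.refl (R.+-cong (d-nat 0) R.refl)) (solveR 3 (λ c b q → c :*R (conR (+ 0) :+R b :*R conR (+ 0)) :=R q :*R conR (+ 0)) R.refl c β₀ Q)
        go (suc D) = R.trans (R.*-cong R.refl (R.+-cong (Der-+ ω _ _) R.refl)) (R.trans
          (solveR 6 (λ c da ds b a s → c :*R ((da :+R ds) :+R b :*R (a :+R s)) :=R c :*R (da :+R b :*R a) :+R c :*R (ds :+R b :*R s)) R.refl c _ _ β₀ _ _)
          (R.trans (R.+-cong (term D) (go D)) (R.sym (R.distribˡ Q _ _))))

      dr1 dr2 : Sh
      dr1 = d r1 R.+ β₀ R.* r1
      dr2 = d r2 R.+ β₀ R.* r2

      private
        lift : ∀ {r} f → r R.≈ Fs f → c R.* (d r R.+ β₀ R.* r) R.≈ Q R.* Fs (λ j → suc j ℕ.* f j)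
        lift {r} f h = R.trans (R.*-cong R.refl (R.+-cong (Der-cong ω h) (R.*-cong R.refl h))) (d-Fs f)

      -- The relation (N b + 1) C(m b, b - 1) = m b C(m b - 1, b - 1) eliminates the second coefficient.
      r-rel : nat N R.* (c R.* dr2) R.≈ nat (suc N) R.* (c R.* dr1) R.- Q R.* r2
      r-rel = R.trans (R.*-cong R.refl (lift f2 r2-eq)) (R.trans
        (solveR 4 (λ n q b r → n :*R (q :*R b) :=R q :*R (n :*R b :+R r) :-R q :*R r) R.refl (nat N) Q _ (Fs f2))
        (R.+-cong (R.trans (R.*-cong R.refl Fs-rel) (R.trans
            (solveR 3 (λ q m b → q :*R (m :*R b) :=R m :*R (q :*R b)) R.refl Q (nat (suc N)) _)
            (R.*-cong R.refl (R.sym (lift f1 r1-eq)))))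
          (R.-‿cong (R.*-cong R.refl (R.sym r2-eq)))))

      dc-r1 : d c R.≈ nat N R.* d r1
      dc-r1 = R.trans (Der-cong ω c-r1′) (R.trans (Der-+ ω R.1# (nat N R.* r1)) (R.trans (R.+-cong (Der-one ω) (d-nat* N r1)) (R.+-identityˡ _)))
        where
        c-r1′ : c R.≈ R.1# R.+ nat N R.* r1
        c-r1′ = R.trans (R.sym ρ0) (R.trans c-r1 (R.+-cong R.refl (R.*-cong (R.reflexive (natQ≡ N)) R.refl)))

      d-two : ∀ f → d (two R.* f) R.≈ two R.* d f
      d-two f = R.trans (Der-cong ω (solveR 1 (λ f → (conR (+ 1) :+R conR (+ 1)) :*R f :=R f :+R f) R.refl f))
        (R.trans (Der-+ ω f f) (solveR 1 (λ f → f :+R f :=R (conR (+ 1) :+R conR (+ 1)) :*R f) R.refl (d f)))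

      d-nats* : ∀ f → d ((nat N R.* nat N R.- nat N) R.* f) R.≈ (nat N R.* nat N R.- nat N) R.* d f
      d-nats* f = R.trans (Der-cong ω (solveR 2 (λ n f → (n :*R n :-R n) :*R f :=R n :*R (n :*R f) :-R n :*R f) R.refl (nat N) f))
        (R.trans (Der-+ ω _ _) (R.trans (R.+-cong (R.trans (d-nat* N (nat N R.* f)) (R.*-cong R.refl (d-nat* N f)))
            (R.trans (Der-neg ω _) (R.-‿cong (d-nat* N f))))
          (solveR 2 (λ n f → n :*R (n :*R f) :-R n :*R f :=R (n :*R n :-R n) :*R f) R.refl (nat N) (d f))))

    private
      nN = nat N

    -- Twice x_2(0) - 1, as a polynomial in c, `r1` and `r2`.
    E : Sh
    E = ((two R.* (c R.* c) R.+ two R.* r1) R.- (two R.* (nN R.* r1) R.+ (two R.* (nN R.* (c R.* r2)) R.+ (nN R.* nN R.- nN) R.* (r1 R.* r1)))) R.- two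

    c-r1′ : c R.≈ R.1# R.+ nN R.* r1
    c-r1′ = R.trans (R.sym ρ0) (R.trans c-r1 (R.+-cong R.refl (R.*-cong (R.reflexive (natQ≡ N)) R.refl)))

    τR-tν : ∑R D (λ j → pt j R.* tν (suc j)) R.≈ τR
    τR-tν = ∑R-cong D λ j _ → R.*-assoc (p j) (w RE.^ suc j) (tν (suc j))

    τR-E : two R.* τR R.≈ E
    τR-E = R.trans (solveR 2 (λ o t → (o :+R o) :*R t :=R (o :+R o) :*R (conR (+ 1) :+R t) :-R (o :+R o) :*R conR (+ 1)) R.refl R.1# τR)
      (R.+-cong (R.trans (R.*-cong R.refl (R.sym (R.trans e2-tν (R.+-cong R.refl τR-tν))))
        (R.trans e2 (R.+-cong (R.+-cong (R.*-cong R.refl (R.*-cong ρ0 ρ0)) R.refl) (R.-‿cong (R.+-cong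
            (R.*-cong R.refl (R.*-cong nq R.refl))
            (R.+-cong (R.*-cong R.refl (R.*-cong nq (R.*-cong ρ0 R.refl))) (R.*-cong (R.+-cong (R.*-cong nq nq) (R.-‿cong nq)) R.refl)))))))
        (R.-‿cong (R.*-identityʳ _)))
      where
      nq : natQ N R.≈ nN
      nq = R.reflexive (natQ≡ N)

    module DE (ω : ℕ → K.Carrier) (α β₀ : Sh) (hω : ∀ j → sc (ω (suc j)) R.≈ α R.* nat (suc j) R.- β₀) where
      open Derivation ω α β₀ hω public

      dE : Sh
      dE = (two R.* (d c R.* c R.+ c R.* d c) R.+ two R.* d r1) R.-
        (two R.* (nN R.* d r1) R.+ (two R.* (nN R.* (d c R.* r2 R.+ c R.* d r2)) R.+ (nN R.* nN R.- nN) R.* (d r1 R.* r1 R.+ r1 R.* d r1)))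

      d-E : d E R.≈ dE
      d-E = R.trans (minus _ two) (R.trans (R.+-cong (R.trans (minus _ _) (R.+-cong
          (R.trans (Der-+ ω _ _) (R.+-cong (R.trans (d-two _) (R.*-cong R.refl (d-* c c))) (d-two r1)))
          (R.-‿cong (R.trans (Der-+ ω _ _) (R.+-cong (R.trans (d-two _) (R.*-cong R.refl (d-nat* N r1)))
            (R.trans (Der-+ ω _ _) (R.+-cong (R.trans (d-two _) (R.*-cong R.refl (R.trans (d-nat* N _) (R.*-cong R.refl (d-* c r2)))))
              (R.trans (d-nats* _) (R.*-cong R.refl (d-* r1 r1)))))))))) (R.-‿cong dtwo))
        (R.trans (R.+-cong R.refl N0.-0#≈0#) (R.+-identityʳ _)))
        where
        module N0 where
          open import Algebra.Properties.Ring R.ring public using (-0#≈0#)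
        minus : ∀ f g → d (f R.- g) R.≈ d f R.- d g
        minus f g = R.trans (Der-+ ω f (R.- g)) (R.+-cong R.refl (Der-neg ω g))
        dtwo : d two R.≈ R.0#
        dtwo = R.trans (Der-+ ω R.1# R.1#) (R.trans (R.+-cong (Der-one ω) (Der-one ω)) (R.+-identityˡ _))

    private
      T2 : ∀ {n} → IntegerSolver.Polynomial R n
      T2 = conR (+ 1) :+R conR (+ 1)

    ωx ωz : ℕ → K.Carrier
    ωx b = natK N K.* natK b K.- K.1#
    ωz b = natK b

    hωx : ∀ j → sc (ωx (suc j)) R.≈ nN R.* nat (suc j) R.- R.1#
    hωx j [] = K.+-cong (K.*-cong (K.sym (nat-sc N [])) (K.sym (nat-sc (suc j) []))) K.refl
    hωx j (b ∷ β) = K.sym (K.trans (K.+-cong (K.trans (nat-⊠ N (nat (suc j)) (b ∷ β)) (K.trans (K.*-cong K.refl (nat-sc (suc j) (b ∷ β))) (K.zeroʳ _))) K.refl) (K.-‿inverseʳ K.0#))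

    hωz : ∀ j → sc (ωz (suc j)) R.≈ R.1# R.* nat (suc j) R.- R.0#
    hωz j β = K.trans (K.sym (nat-sc (suc j) β))
      (R.sym (R.trans (R.+-cong (R.*-identityˡ (nat (suc j))) R.refl) (solveR 1 (λ a → a :-R conR (+ 0) :=R a) R.refl (nat (suc j)))) β)

    module Dx = DE ωx nN R.1# hωx
    module Dz = DE ωz R.1# R.0# hωz

    -- (x∂_x - 2)τ is the derivation Dx.d, and x∂_x θ_z G = m r1.
    x-equation : Dx.d (two R.* τR) R.+ two R.* (two R.* τR) R.≈ two R.* (nat (suc N) R.* r1)
    x-equation = R.trans (R.+-cong (R.trans (Der-cong ωx τR-E) d-E) (R.*-cong R.refl τR-E))
      -- All occurrences of `r2` and its derivative are grouped into N c (d r2 + r2) and Q r2. Then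
      -- `r-rel` applies, the terms Q r2 cancel, and c = 1 + N r1 leaves an identity in `r1` and its
      -- derivative.
      (R.trans (solveR 7 (λ c dc r dr r2 dr2 n →
          ((T2 :*R (dc :*R c :+R c :*R dc) :+R T2 :*R dr) :-R (T2 :*R (n :*R dr) :+R (T2 :*R (n :*R (dc :*R r2 :+R c :*R dr2)) :+R (n :*R n :-R n) :*R (dr :*R r :+R r :*R dr)))) :+R
          T2 :*R (((T2 :*R (c :*R c) :+R T2 :*R r) :-R (T2 :*R (n :*R r) :+R (T2 :*R (n :*R (c :*R r2)) :+R (n :*R n :-R n) :*R (r :*R r)))) :-R T2) :=R
          (((T2 :*R (dc :*R c :+R c :*R dc) :+R T2 :*R dr) :-R (T2 :*R (n :*R dr) :+R (n :*R n :-R n) :*R (dr :*R r :+R r :*R dr))) :+R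
          (T2 :*R ((T2 :*R (c :*R c) :+R T2 :*R r) :-R (T2 :*R (n :*R r) :+R (n :*R n :-R n) :*R (r :*R r)) :-R T2)) :-R T2 :*R ((n :*R c :+R n :*R dc) :*R r2))
          :-R T2 :*R (n :*R (c :*R (dr2 :+R conR (+ 1) :*R r2)))) R.refl c (d c) r1 (d r1) r2 (d r2) nN)
      (R.trans (R.+-cong R.refl (R.-‿cong (R.*-cong R.refl r-rel)))
      (R.trans (solveR 6 (λ c dc r dr r2 n →
          (((T2 :*R (dc :*R c :+R c :*R dc) :+R T2 :*R dr) :-R (T2 :*R (n :*R dr) :+R (n :*R n :-R n) :*R (dr :*R r :+R r :*R dr))) :+R
          (T2 :*R ((T2 :*R (c :*R c) :+R T2 :*R r) :-R (T2 :*R (n :*R r) :+R (n :*R n :-R n) :*R (r :*R r)) :-R T2)) :-R T2 :*R ((n :*R c :+R n :*R dc) :*R r2))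
          :-R T2 :*R ((conR (+ 1) :+R n) :*R (c :*R (dr :+R conR (+ 1) :*R r)) :-R (n :*R c :+R n :*R dc) :*R r2) :=R
          ((T2 :*R (dc :*R c :+R c :*R dc) :+R T2 :*R dr) :-R (T2 :*R (n :*R dr) :+R (n :*R n :-R n) :*R (dr :*R r :+R r :*R dr))) :+R
          (T2 :*R ((T2 :*R (c :*R c) :+R T2 :*R r) :-R (T2 :*R (n :*R r) :+R (n :*R n :-R n) :*R (r :*R r)) :-R T2))
          :-R T2 :*R ((conR (+ 1) :+R n) :*R (c :*R (dr :+R r)))) R.refl c (d c) r1 (d r1) r2 nN)
      (R.trans (R.+-cong (R.+-cong (R.+-cong (R.+-cong (R.*-cong R.refl (R.+-cong (R.*-cong dc-r1 c-r1′) (R.*-cong c-r1′ dc-r1))) R.refl) R.refl)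
          (R.*-cong R.refl (R.+-cong (R.+-cong (R.+-cong (R.*-cong R.refl (R.*-cong c-r1′ c-r1′)) R.refl) R.refl) R.refl)))
          (R.-‿cong (R.*-cong R.refl (R.*-cong R.refl (R.*-cong c-r1′ R.refl)))))
        (solveR 3 (λ r dr n → ((T2 :*R ((n :*R dr) :*R (conR (+ 1) :+R n :*R r) :+R (conR (+ 1) :+R n :*R r) :*R (n :*R dr)) :+R T2 :*R dr) :-R (T2 :*R (n :*R dr) :+R (n :*R n :-R n) :*R (dr :*R r :+R r :*R dr))) :+R
          (T2 :*R ((T2 :*R ((conR (+ 1) :+R n :*R r) :*R (conR (+ 1) :+R n :*R r)) :+R T2 :*R r) :-R (T2 :*R (n :*R r) :+R (n :*R n :-R n) :*R (r :*R r)) :-R T2))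
          :-R T2 :*R ((conR (+ 1) :+R n) :*R ((conR (+ 1) :+R n :*R r) :*R (dr :+R r))) :=R T2 :*R ((conR (+ 1) :+R n) :*R r)) R.refl r1 (d r1) nN)))))
      where open Dx

    -- The same elimination with α = 1 and β₀ = 0. As A(w) is N r1, the right side is (m/N)(2 A +
    -- A^2), twice that of the theorem at x = 1.
    z-equation : nN R.* Dz.d (two R.* τR) R.+ two R.* τR R.≈ nat (suc N) R.* (two R.* r1 R.+ nN R.* (r1 R.* r1))
    z-equation = R.trans (R.+-cong (R.*-cong R.refl (R.trans (Der-cong ωz τR-E) d-E)) τR-E)
      (R.trans (solveR 7 (λ c dc r dr r2 dr2 n →
          n :*R ((T2 :*R (dc :*R c :+R c :*R dc) :+R T2 :*R dr) :-R (T2 :*R (n :*R dr) :+R (T2 :*R (n :*R (dc :*R r2 :+R c :*R dr2)) :+R (n :*R n :-R n) :*R (dr :*R r :+R r :*R dr)))) :+R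
          (((T2 :*R (c :*R c) :+R T2 :*R r) :-R (T2 :*R (n :*R r) :+R (T2 :*R (n :*R (c :*R r2)) :+R (n :*R n :-R n) :*R (r :*R r)))) :-R T2) :=R
          ((n :*R ((T2 :*R (dc :*R c :+R c :*R dc) :+R T2 :*R dr) :-R (T2 :*R (n :*R dr) :+R (n :*R n :-R n) :*R (dr :*R r :+R r :*R dr))) :+R
          ((T2 :*R (c :*R c) :+R T2 :*R r) :-R (T2 :*R (n :*R r) :+R (n :*R n :-R n) :*R (r :*R r)) :-R T2)) :-R T2 :*R (n :*R ((conR (+ 1) :*R c :+R n :*R dc) :*R r2)))
          :-R T2 :*R (n :*R (n :*R (c :*R (dr2 :+R conR (+ 0) :*R r2))))) R.refl c (d c) r1 (d r1) r2 (d r2) nN)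
      (R.trans (R.+-cong R.refl (R.-‿cong (R.*-cong R.refl (R.*-cong R.refl r-rel))))
      (R.trans (solveR 6 (λ c dc r dr r2 n →
          ((n :*R ((T2 :*R (dc :*R c :+R c :*R dc) :+R T2 :*R dr) :-R (T2 :*R (n :*R dr) :+R (n :*R n :-R n) :*R (dr :*R r :+R r :*R dr))) :+R
          ((T2 :*R (c :*R c) :+R T2 :*R r) :-R (T2 :*R (n :*R r) :+R (n :*R n :-R n) :*R (r :*R r)) :-R T2)) :-R T2 :*R (n :*R ((conR (+ 1) :*R c :+R n :*R dc) :*R r2)))
          :-R T2 :*R (n :*R ((conR (+ 1) :+R n) :*R (c :*R (dr :+R conR (+ 0) :*R r)) :-R (conR (+ 1) :*R c :+R n :*R dc) :*R r2)) :=R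
          (n :*R ((T2 :*R (dc :*R c :+R c :*R dc) :+R T2 :*R dr) :-R (T2 :*R (n :*R dr) :+R (n :*R n :-R n) :*R (dr :*R r :+R r :*R dr))) :+R
          ((T2 :*R (c :*R c) :+R T2 :*R r) :-R (T2 :*R (n :*R r) :+R (n :*R n :-R n) :*R (r :*R r)) :-R T2))
          :-R T2 :*R (n :*R ((conR (+ 1) :+R n) :*R (c :*R dr)))) R.refl c (d c) r1 (d r1) r2 nN)
      (R.trans (R.+-cong (R.+-cong (R.*-cong R.refl (R.+-cong (R.+-cong (R.*-cong R.refl (R.+-cong (R.*-cong dc-r1 c-r1′) (R.*-cong c-r1′ dc-r1))) R.refl) R.refl))
          (R.+-cong (R.+-cong (R.+-cong (R.*-cong R.refl (R.*-cong c-r1′ c-r1′)) R.refl) R.refl) R.refl))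
          (R.-‿cong (R.*-cong R.refl (R.*-cong R.refl (R.*-cong R.refl (R.*-cong c-r1′ R.refl))))))
        (solveR 3 (λ r dr n → (n :*R ((T2 :*R ((n :*R dr) :*R (conR (+ 1) :+R n :*R r) :+R (conR (+ 1) :+R n :*R r) :*R (n :*R dr)) :+R T2 :*R dr) :-R (T2 :*R (n :*R dr) :+R (n :*R n :-R n) :*R (dr :*R r :+R r :*R dr))) :+R
          ((T2 :*R ((conR (+ 1) :+R n :*R r) :*R (conR (+ 1) :+R n :*R r)) :+R T2 :*R r) :-R (T2 :*R (n :*R r) :+R (n :*R n :-R n) :*R (r :*R r)) :-R T2))
          :-R T2 :*R (n :*R ((conR (+ 1) :+R n) :*R ((conR (+ 1) :+R n :*R r) :*R dr))) :=R (conR (+ 1) :+R n) :*R (T2 :*R r :+R n :*R (r :*R r))) R.refl r1 (d r1) nN)))))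
      where open Dz

-- Cycle decompositions under multiplication by a transposition.

module CycleDecompositions where

  open import Data.List using (List; []; _∷_; _++_; concat)
  import Data.List.Properties as LP
  open import Data.List.Membership.Propositional using (_∈_; _∉_)
  open import Data.List.Membership.Propositional.Properties using (∈-++⁺ˡ; ∈-++⁺ʳ; ∈-++⁻)
  open import Data.List.Relation.Unary.Any using (here; there)
  open import Data.List.Relation.Unary.All as All using (All; []; _∷_)
  import Data.List.Relation.Unary.All.Properties as AllP
  open import Data.List.Relation.Unary.AllPairs using ([]; _∷_)
  open import Data.List.Relation.Unary.Unique.Propositional using (Unique)
  open import Data.List.Relation.Binary.Permutation.Propositional using (_↭_; prep; swap; ↭-sym; ↭-reflexive; module PermutationReasoning) renaming (refl to ↭r; trans to ↭t)
  import Data.List.Relation.Binary.Permutation.Propositional.Properties as ↭P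
  open import Data.Product using (_×_; _,_; proj₁; proj₂)
  open import Data.Sum using (inj₁; inj₂)
  open import Data.Empty using (⊥; ⊥-elim)
  open import Relation.Nullary using (Dec; yes; no)
  open import Relation.Binary.PropositionalEquality using (_≡_; _≢_; refl; sym; trans; cong; subst)

  module _ {A : Set} where

    Unique-↭ : {xs ys : List A} → xs ↭ ys → Unique xs → Unique ys
    Unique-↭ ↭r u = u
    Unique-↭ (prep x p) (a ∷ u) = ↭P.All-resp-↭ p a ∷ Unique-↭ p u
    Unique-↭ (swap x y p) ((x≢y ∷ a) ∷ (b ∷ u)) =
      ((λ e → x≢y (sym e)) ∷ ↭P.All-resp-↭ p b) ∷ (↭P.All-resp-↭ p a ∷ Unique-↭ p u)
    Unique-↭ (↭t p q) u = Unique-↭ q (Unique-↭ p u)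

    ∉-head : {x : A} {xs : List A} → Unique (x ∷ xs) → x ∉ xs
    ∉-head (a ∷ _) h = All.lookup a h refl

    Unique-++ : ∀ (xs : List A) {ys} → Unique (xs ++ ys) →
                Unique xs × Unique ys × (∀ {z} → z ∈ xs → z ∉ ys)
    Unique-++ [] u = [] , u , λ ()
    Unique-++ (x ∷ xs) (a ∷ u) with Unique-++ xs u
    ... | ux , uy , d = (AllP.++⁻ˡ xs a ∷ ux) , uy ,
      λ { (here refl) z∈ys → All.lookup (AllP.++⁻ʳ xs a) z∈ys refl ; (there z∈xs) → d z∈xs }

    ++-Unique : ∀ (xs : List A) {ys} → Unique xs → Unique ys → (∀ {z} → z ∈ xs → z ∉ ys) → Unique (xs ++ ys)
    ++-Unique [] _ u _ = u
    ++-Unique (x ∷ xs) (a ∷ ux) uy d =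
      AllP.++⁺ a (All.tabulate λ z∈ys e → d (here refl) (subst (_∈ _) (sym e) z∈ys)) ∷ ++-Unique xs ux uy (λ h → d (there h))

    concat-↭ : {cs ds : List (List A)} → cs ↭ ds → concat cs ↭ concat ds
    concat-↭ ↭r = ↭r
    concat-↭ (prep c p) = ↭P.++⁺ˡ c (concat-↭ p)
    concat-↭ (swap c d p) = ↭t (↭P.shifts c d) (↭P.++⁺ˡ d (↭P.++⁺ˡ c (concat-↭ p)))
    concat-↭ (↭t p q) = ↭t (concat-↭ p) (concat-↭ q)

    Path : (A → A) → A → List A → A → Set
    Path f x [] z = f x ≡ z
    Path f x (y ∷ ys) z = f x ≡ y × Path f y ys z

    Cyc : (A → A) → List A → Set
    Cyc f [] = ⊥
    Cyc f (x ∷ xs) = Path f x xs x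

    -- Points outside the lists are fixed, but fixed points may also be listed as cycles of length
    -- 1. The listed points can thus be any chosen support, not just the moved points.
    record Decomp (f : A → A) (cs : List (List A)) : Set where
      constructor decomp
      field
        cycles : All (Cyc f) cs
        unique : Unique (concat cs)
        fixed : ∀ x → x ∉ concat cs → f x ≡ x

    Decomp-↭ : ∀ {f cs ds} → cs ↭ ds → Decomp f cs → Decomp f ds
    Decomp-↭ p (decomp c u h) = decomp (↭P.All-resp-↭ p c) (Unique-↭ (concat-↭ p) u)
      (λ x n → h x λ m → n (↭P.∈-resp-↭ (concat-↭ p) m))

    Path-++ : ∀ {f} x ys {y zs z} → Path f x ys y → Path f y zs z → Path f x (ys ++ y ∷ zs) z
    Path-++ x [] p q = p , q
    Path-++ x (w ∷ ys) (e , p) q = e , Path-++ w ys p q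

    Path-split : ∀ {f} x ys {y zs z} → Path f x (ys ++ y ∷ zs) z → Path f x ys y × Path f y zs z
    Path-split x [] (p , q) = p , q
    Path-split x (w ∷ ys) (e , p) with Path-split w ys p
    ... | a , b = (e , a) , b

    Path-cong : ∀ {f g} x xs {z} → (∀ u → u ∈ x ∷ xs → g u ≡ f u) → Path f x xs z → Path g x xs z
    Path-cong x [] h p = trans (h x (here refl)) p
    Path-cong x (y ∷ ys) h (e , p) = trans (h x (here refl)) e , Path-cong y ys (λ u m → h u (there m)) p

    Path-head : ∀ {f g} x x′ xs {z} → g x′ ≡ f x → (∀ u → u ∈ xs → g u ≡ f u) → Path f x xs z → Path g x′ xs z
    Path-head x x′ [] e h p = trans e p
    Path-head x x′ (y ∷ ys) e h (e′ , p) = trans e e′ , Path-cong y ys h p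

    Cyc-rotate : ∀ {f} c₁ j c₂ → Cyc f (c₁ ++ j ∷ c₂) → Path f j (c₂ ++ c₁) j
    Cyc-rotate {f} [] j c₂ p = subst (λ l → Path f j l j) (sym (LP.++-identityʳ c₂)) p
    Cyc-rotate (d ∷ ds) j c₂ p with Path-split d ds p
    ... | a , b = Path-++ j c₂ b a

    Path-closed : ∀ {f} x xs {z} → Path f x xs z → ∀ u → u ∈ x ∷ xs → f u ∈ xs ++ z ∷ []
    Path-closed x [] p u (here refl) = here p
    Path-closed x (y ∷ ys) (e , p) u (here refl) = here e
    Path-closed x (y ∷ ys) (e , p) u (there m) = there (Path-closed y ys p u m)

    Cyc-closed : ∀ {f} c u → Cyc f c → u ∈ c → f u ∈ c
    Cyc-closed (x ∷ xs) u p m with ∈-++⁻ xs (Path-closed x xs p u m)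
    ... | inj₁ h = there h
    ... | inj₂ (here e) = here e

  module Transpositions {A : Set} (_≟_ : (x y : A) → Dec (x ≡ y)) where

    τ : A → A → A → A
    τ e j x with x ≟ e
    ... | yes _ = j
    ... | no _ with x ≟ j
    ... | yes _ = e
    ... | no _ = x

    τ-e : ∀ e j → τ e j e ≡ j
    τ-e e j with e ≟ e
    ... | yes _ = refl
    ... | no n = ⊥-elim (n refl)

    τ-j : ∀ e j → τ e j j ≡ e
    τ-j e j with j ≟ e
    ... | yes p = p
    ... | no _ with j ≟ j
    ... | yes _ = refl
    ... | no n = ⊥-elim (n refl)

    τ-other : ∀ e j x → x ≢ e → x ≢ j → τ e j x ≡ x
    τ-other e j x p q with x ≟ e
    ... | yes r = ⊥-elim (p r)
    ... | no _ with x ≟ j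
    ... | yes r = ⊥-elim (q r)
    ... | no _ = refl

    data Pos (e j x : A) : Set where
      at-e : x ≡ e → Pos e j x
      at-j : x ≡ j → Pos e j x
      off : x ≢ e → x ≢ j → Pos e j x

    pos : ∀ e j x → Pos e j x
    pos e j x with x ≟ e
    ... | yes p = at-e p
    ... | no p with x ≟ j
    ... | yes q = at-j q
    ... | no q = off p q

    τ-inv : ∀ e j x → τ e j (τ e j x) ≡ x
    τ-inv e j x with pos e j x
    ... | at-e refl = trans (cong (τ e j) (τ-e e j)) (τ-j e j)
    ... | at-j refl = trans (cong (τ e j) (τ-j e j)) (τ-e e j)
    ... | off p q = trans (cong (τ e j) (τ-other e j x p q)) (τ-other e j x p q)

    module _ {f : A → A} where

      private
        off-cycles : ∀ e j cs → e ∉ concat cs → j ∉ concat cs → All (Cyc f) cs → All (Cyc (λ x → f (τ e j x))) cs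
        off-cycles e j [] _ _ [] = []
        off-cycles e j ((x ∷ xs) ∷ cs) ne nj (p ∷ ps) =
          Path-cong x xs (λ u m → cong f (τ-other e j u
              (λ { refl → ne (∈-++⁺ˡ m) }) (λ { refl → nj (∈-++⁺ˡ m) }))) p
          ∷ off-cycles e j cs (λ m → ne (∈-++⁺ʳ (x ∷ xs) m)) (λ m → nj (∈-++⁺ʳ (x ∷ xs) m)) ps

        rest-fixed : ∀ {e j S S′} → e ∈ S → j ∈ S → (∀ {x} → x ∈ S → x ∈ S′) → (∀ x → x ∉ S → f x ≡ x) →
                     ∀ x → x ∉ S′ → f (τ e j x) ≡ x
        rest-fixed {e} {j} e∈ j∈ inc h x n = trans (cong f (τ-other e j x
          (λ { refl → n (inc e∈) }) (λ { refl → n (inc j∈) }))) (h x λ m → n (inc m))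

      merge-↭ : ∀ (e : A) xs c₁ j c₂ cs →
        concat ((e ∷ xs) ∷ (c₁ ++ j ∷ c₂) ∷ cs) ↭ concat ((e ∷ (c₂ ++ c₁) ++ j ∷ xs) ∷ cs)
      merge-↭ e xs c₁ j c₂ cs = prep e (begin
        xs ++ (c₁ ++ j ∷ c₂) ++ concat cs           ≡⟨ LP.++-assoc xs _ _ ⟨
        (xs ++ c₁ ++ j ∷ c₂) ++ concat cs           ↭⟨ ↭P.++⁺ʳ (concat cs) inner ⟩
        ((c₂ ++ c₁) ++ j ∷ xs) ++ concat cs         ∎)
        where
        open PermutationReasoning
        inner : xs ++ c₁ ++ j ∷ c₂ ↭ (c₂ ++ c₁) ++ j ∷ xs
        inner = begin
          xs ++ c₁ ++ j ∷ c₂     ↭⟨ ↭P.++-comm xs _ ⟩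
          (c₁ ++ j ∷ c₂) ++ xs   ↭⟨ ↭P.++⁺ʳ xs (↭P.shift j c₁ c₂) ⟩
          (j ∷ c₁ ++ c₂) ++ xs   ↭⟨ prep j (↭P.++⁺ʳ xs (↭P.++-comm c₁ c₂)) ⟩
          j ∷ (c₂ ++ c₁) ++ xs   ↭⟨ ↭-sym (↭P.shift j (c₂ ++ c₁) xs) ⟩
          (c₂ ++ c₁) ++ j ∷ xs   ∎

      -- Precomposition with the transposition of e and j exchanges the successors of e and j. From
      -- e the new cycle enters the old cycle of j just after j, runs through it to j, and continues
      -- as e did.
      merge : ∀ {e xs} c₁ j c₂ {cs} → Decomp f ((e ∷ xs) ∷ (c₁ ++ j ∷ c₂) ∷ cs) →
              Decomp (λ x → f (τ e j x)) ((e ∷ (c₂ ++ c₁) ++ j ∷ xs) ∷ cs)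
      merge {e} {xs} c₁ j c₂ {cs} (decomp (p ∷ q ∷ ps) u h) = decomp
        (Path-++ e (c₂ ++ c₁)
           (Path-head j e (c₂ ++ c₁) (cong f (τ-e e j)) (λ v m → cong f (τ-other e j v
              (λ { refl → ∉-head u (∈-++⁺ʳ xs (∈-++⁺ˡ (swap∈ m))) })
              (λ { refl → proj₂ (proj₂ (Unique-++ (c₂ ++ c₁) uc)) m (here refl) })))
             (Cyc-rotate c₁ j c₂ q))
           (Path-head e j xs (cong f (τ-j e j)) (λ v m → cong f (τ-other e j v
              (λ { refl → ∉-head u (∈-++⁺ˡ m) })
              (λ { refl → proj₂ (proj₂ (Unique-++ (e ∷ xs) u)) (there m) (∈-++⁺ˡ (∈-++⁺ʳ c₁ (here refl))) }))) p)
          ∷ off-cycles e j cs (λ m → ∉-head u (∈-++⁺ʳ xs (∈-++⁺ʳ (c₁ ++ j ∷ c₂) m)))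
              (λ m → proj₂ (proj₂ (Unique-++ (c₁ ++ j ∷ c₂) (proj₁ (proj₂ (Unique-++ (e ∷ xs) u))))) (∈-++⁺ʳ c₁ (here refl)) m) ps)
        (Unique-↭ (merge-↭ e xs c₁ j c₂ cs) u)
        (rest-fixed (here refl) (there (∈-++⁺ʳ xs (∈-++⁺ˡ (∈-++⁺ʳ c₁ (here refl)))))
          (↭P.∈-resp-↭ (merge-↭ e xs c₁ j c₂ cs)) h)
        where
        swap∈ : ∀ {v} → v ∈ c₂ ++ c₁ → v ∈ c₁ ++ j ∷ c₂
        swap∈ m with ∈-++⁻ c₂ m
        ... | inj₁ a = ∈-++⁺ʳ c₁ (there a)
        ... | inj₂ b = ∈-++⁺ˡ b
        uc : Unique ((c₂ ++ c₁) ++ j ∷ [])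
        uc = Unique-↭ (↭t (↭P.shift j c₁ c₂) (↭t (prep j (↭P.++-comm c₁ c₂)) (↭-sym (↭t (↭P.shift j (c₂ ++ c₁) []) (↭-reflexive (cong (j ∷_) (LP.++-identityʳ _)))))))
          (proj₁ (Unique-++ (c₁ ++ j ∷ c₂) (proj₁ (proj₂ (Unique-++ (e ∷ xs) u)))))

      split-↭ : ∀ (e : A) ys j zs cs →
        concat ((e ∷ ys ++ j ∷ zs) ∷ cs) ↭ concat ((e ∷ zs) ∷ (j ∷ ys) ∷ cs)
      split-↭ e ys j zs cs = prep e (begin
        (ys ++ j ∷ zs) ++ concat cs      ↭⟨ ↭P.++⁺ʳ (concat cs) (↭P.++-comm ys (j ∷ zs)) ⟩
        (j ∷ zs ++ ys) ++ concat cs      ↭⟨ ↭P.++⁺ʳ (concat cs) (↭-sym (↭P.shift j zs ys)) ⟩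
        (zs ++ j ∷ ys) ++ concat cs      ≡⟨ LP.++-assoc zs (j ∷ ys) (concat cs) ⟩
        zs ++ j ∷ ys ++ concat cs        ∎)
        where open PermutationReasoning

      -- The same exchange inside one cycle: e now jumps to the points after j, and j to the points
      -- between e and itself.
      split : ∀ {e} ys j zs {cs} → Decomp f ((e ∷ ys ++ j ∷ zs) ∷ cs) →
              Decomp (λ x → f (τ e j x)) ((e ∷ zs) ∷ (j ∷ ys) ∷ cs)
      split {e} ys j zs {cs} (decomp (p ∷ ps) u h) with Path-split e ys p
      ... | a , b = decomp
        (Path-head j e zs (cong f (τ-e e j)) (λ v m → cong f (τ-other e j v
            (λ { refl → ∉-head u (∈-++⁺ˡ (∈-++⁺ʳ ys (there m))) }) (λ { refl → ∉-head (proj₁ (proj₂ (Unique-++ ys uy))) m }))) b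
         ∷ Path-head e j ys (cong f (τ-j e j)) (λ v m → cong f (τ-other e j v
            (λ { refl → ∉-head u (∈-++⁺ˡ (∈-++⁺ˡ m)) }) (λ { refl → proj₂ (proj₂ (Unique-++ ys uy)) m (here refl) }))) a
         ∷ off-cycles e j cs (λ m → ∉-head u (∈-++⁺ʳ (ys ++ j ∷ zs) m))
             (λ m → proj₂ (proj₂ (Unique-++ (e ∷ ys ++ j ∷ zs) u)) (there (∈-++⁺ʳ ys (here refl))) m) ps)
        (Unique-↭ (split-↭ e ys j zs cs) u)
        (rest-fixed (here refl) (there (∈-++⁺ˡ (∈-++⁺ʳ ys (here refl)))) (↭P.∈-resp-↭ (split-↭ e ys j zs cs)) h)
        where
        uy : Unique (ys ++ j ∷ zs)
        uy with Unique-++ (e ∷ ys ++ j ∷ zs) u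
        ... | (_ ∷ w) , _ = w

-- Connectivity of finite graphs and counting.

module GraphsAndCounts where

  open import Defs
  open import Data.Nat using (ℕ; suc; _≤_; z≤n; s≤s; _+_; _*_)
  import Data.Nat.Properties as ℕP
  open import Data.Integer using (+_)
  import Data.Integer.Properties as ℤP
  open import Data.Rational as ℚ using (ℚ; 0ℚ; 1ℚ)
  import Data.Rational.Properties as ℚP
  import Data.Rational.Unnormalised as ℚᵘ
  import Data.Rational.Unnormalised.Properties as ℚᵘP
  open import Data.List using (List; []; _∷_; _++_; length; map; cartesianProduct)
  import Data.List.Properties as LP
  open import Data.List.Membership.Propositional using (_∈_)
  open import Data.List.Membership.Propositional.Properties using (∈-++⁺ˡ; ∈-++⁺ʳ; ∈-++⁻; ∈-∃++; ∈-map⁺; ∈-map⁻; ∈-cartesianProduct⁺; ∈-cartesianProduct⁻)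
  open import Data.List.Relation.Unary.Any using (here; there)
  open import Data.List.Relation.Unary.All as All using (All; []; _∷_)
  open import Data.List.Relation.Unary.AllPairs using ([]; _∷_)
  open import Data.List.Relation.Unary.Unique.Propositional using (Unique)
  import Data.List.Relation.Unary.Unique.Propositional.Properties as UP
  import Data.List.Relation.Binary.Permutation.Propositional.Properties as ↭P
  open import Data.Product using (Σ; ∃; _×_; _,_; proj₁; proj₂)
  open import Data.Sum using (_⊎_; inj₁; inj₂)
  open import Data.Empty using (⊥; ⊥-elim)
  open import Relation.Nullary using (¬_; Dec)
  open import Relation.Nullary.Decidable using (_⊎-dec_; _×-dec_)
  open import Relation.Binary.PropositionalEquality using (_≡_; refl; sym; trans; cong; subst; cong₂)
  open CycleDecompositions

  -- Connectivity of a finite graph given by its list of edges, by inserting the edges one at a time.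
  module Connectivity {A : Set} (_≟_ : (x y : A) → Dec (x ≡ y)) where

    -- A path needs the newly inserted edge at most once, in one of its two directions. The
    -- recursive form makes connectivity decidable at once.
    conn : List (A × A) → A → A → Set
    conn [] x y = x ≡ y
    conn ((a , b) ∷ es) x y = conn es x y ⊎ (conn es x a × conn es b y) ⊎ (conn es x b × conn es a y)

    conn? : ∀ es x y → Dec (conn es x y)
    conn? [] x y = x ≟ y
    conn? ((a , b) ∷ es) x y =
      conn? es x y ⊎-dec ((conn? es x a ×-dec conn? es b y) ⊎-dec (conn? es x b ×-dec conn? es a y))

    conn-refl : ∀ es {x} → conn es x x
    conn-refl [] = refl
    conn-refl (_ ∷ es) = inj₁ (conn-refl es)

    conn-sym : ∀ es {x y} → conn es x y → conn es y x
    conn-sym [] e = sym e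
    conn-sym (_ ∷ es) (inj₁ p) = inj₁ (conn-sym es p)
    conn-sym (_ ∷ es) (inj₂ (inj₁ (p , q))) = inj₂ (inj₂ (conn-sym es q , conn-sym es p))
    conn-sym (_ ∷ es) (inj₂ (inj₂ (p , q))) = inj₂ (inj₁ (conn-sym es q , conn-sym es p))

    conn-trans : ∀ es {x y z} → conn es x y → conn es y z → conn es x z
    conn-trans [] p q = trans p q
    conn-trans (_ ∷ es) (inj₁ p) (inj₁ q) = inj₁ (conn-trans es p q)
    conn-trans (_ ∷ es) (inj₁ p) (inj₂ (inj₁ (q , r))) = inj₂ (inj₁ (conn-trans es p q , r))
    conn-trans (_ ∷ es) (inj₁ p) (inj₂ (inj₂ (q , r))) = inj₂ (inj₂ (conn-trans es p q , r))
    conn-trans (_ ∷ es) (inj₂ (inj₁ (p , q))) (inj₁ r) = inj₂ (inj₁ (p , conn-trans es q r))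
    conn-trans (_ ∷ es) (inj₂ (inj₂ (p , q))) (inj₁ r) = inj₂ (inj₂ (p , conn-trans es q r))
    conn-trans (_ ∷ es) (inj₂ (inj₁ (p , q))) (inj₂ (inj₁ (_ , s))) = inj₂ (inj₁ (p , s))
    conn-trans (_ ∷ es) (inj₂ (inj₁ (p , q))) (inj₂ (inj₂ (_ , s))) = inj₁ (conn-trans es p s)
    conn-trans (_ ∷ es) (inj₂ (inj₂ (p , q))) (inj₂ (inj₁ (_ , s))) = inj₁ (conn-trans es p s)
    conn-trans (_ ∷ es) (inj₂ (inj₂ (p , q))) (inj₂ (inj₂ (_ , s))) = inj₂ (inj₂ (p , s))

    conn-edge : ∀ es {a b} → (a , b) ∈ es → conn es a b
    conn-edge (_ ∷ es) (here refl) = inj₂ (inj₁ (conn-refl es , conn-refl es))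
    conn-edge (_ ∷ es) (there m) = inj₁ (conn-edge es m)

    record Equiv (R : A → A → Set) : Set where
      field
        rfl : ∀ {x} → R x x
        sm : ∀ {x y} → R x y → R y x
        tr : ∀ {x y z} → R x y → R y z → R x z

    -- Connectivity is the least equivalence containing the edges. All invariance arguments below
    -- choose a suitable relation and check it on the edges only.
    conn-min : ∀ {R} → Equiv R → ∀ es → (∀ {a b} → (a , b) ∈ es → R a b) → ∀ {x y} → conn es x y → R x y
    conn-min E [] h refl = Equiv.rfl E
    conn-min E (_ ∷ es) h (inj₁ p) = conn-min E es (λ m → h (there m)) p
    conn-min E (_ ∷ es) h (inj₂ (inj₁ (p , q))) = Equiv.tr E (conn-min E es (λ m → h (there m)) p)
      (Equiv.tr E (h (here refl)) (conn-min E es (λ m → h (there m)) q))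
    conn-min E (_ ∷ es) h (inj₂ (inj₂ (p , q))) = Equiv.tr E (conn-min E es (λ m → h (there m)) p)
      (Equiv.tr E (Equiv.sm E (h (here refl))) (conn-min E es (λ m → h (there m)) q))

    conn-Equiv : ∀ es → Equiv (conn es)
    conn-Equiv es = record { rfl = conn-refl es ; sm = conn-sym es ; tr = conn-trans es }

  ℕtoℚ-+ : ∀ a b → ℕtoℚ (a + b) ≡ ℕtoℚ a ℚ.+ ℕtoℚ b
  ℕtoℚ-+ a b = ℚP.toℚᵘ-injective (ℚᵘP.≃-trans (ℚP.toℚᵘ-fromℚᵘ (ℚᵘ.mkℚᵘ (+ (a + b)) 0))
    (ℚᵘP.≃-trans (ℚᵘ.*≡* (cong (Data.Integer._* + 1) (cong₂ Data.Integer._+_ (sym (ℤP.*-identityʳ (+ a))) (sym (ℤP.*-identityʳ (+ b))))))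
      (ℚᵘP.≃-trans (ℚᵘP.+-cong (ℚᵘP.≃-sym (ℚP.toℚᵘ-fromℚᵘ (ℚᵘ.mkℚᵘ (+ a) 0))) (ℚᵘP.≃-sym (ℚP.toℚᵘ-fromℚᵘ (ℚᵘ.mkℚᵘ (+ b) 0))))
        (ℚᵘP.≃-sym (ℚP.toℚᵘ-homo-+ (ℕtoℚ a) (ℕtoℚ b))))))
    where import Data.Integer

  ℕtoℚ-* : ∀ a b → ℕtoℚ (a * b) ≡ ℕtoℚ a ℚ.* ℕtoℚ b
  ℕtoℚ-* a b = ℚP.toℚᵘ-injective (ℚᵘP.≃-trans (ℚP.toℚᵘ-fromℚᵘ (ℚᵘ.mkℚᵘ (+ (a * b)) 0))
    (ℚᵘP.≃-trans (ℚᵘ.*≡* (cong (Data.Integer._* + 1) (ℤP.pos-* a b)))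
      (ℚᵘP.≃-trans (ℚᵘP.*-cong (ℚᵘP.≃-sym (ℚP.toℚᵘ-fromℚᵘ (ℚᵘ.mkℚᵘ (+ a) 0))) (ℚᵘP.≃-sym (ℚP.toℚᵘ-fromℚᵘ (ℚᵘ.mkℚᵘ (+ b) 0))))
        (ℚᵘP.≃-sym (ℚP.toℚᵘ-homo-* (ℕtoℚ a) (ℕtoℚ b))))))
    where import Data.Integer

  -- The recurrence is solved in a ring over the rationals; this form lets its values serve as
  -- cardinalities without a separate proof of integrality.
  Count : {A : Set} → (A → Set) → ℚ → Set
  Count P q = Σ ℕ λ k → IsCount P k × ℕtoℚ k ≡ q

  module _ {A : Set} where

    count-resp : {P Q : A → Set} {q : ℚ} → (∀ t → P t → Q t) → (∀ t → Q t → P t) → Count P q → Count Q q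
    count-resp f g (k , (xs , u , h , l) , e) =
      k , (xs , u , (λ t → (λ m → f t (proj₁ (h t) m)) , λ q → proj₂ (h t) (g t q)) , l) , e

    count-none : {P : A → Set} → (∀ t → ¬ P t) → Count P 0ℚ
    count-none h = 0 , ([] , [] , (λ t → (λ ()) , λ p → ⊥-elim (h t p)) , refl) , refl

    count-one : {P : A → Set} (a : A) → P a → (∀ t → P t → t ≡ a) → Count P 1ℚ
    count-one a p h = 1 , (a ∷ [] , [] ∷ [] , (λ t → (λ { (here refl) → p }) , λ q → here (h t q)) , refl) , refl

    count-⊎ : {P Q : A → Set} {q r : ℚ} → (∀ t → P t → ¬ Q t) → Count P q → Count Q r →
              Count (λ t → P t ⊎ Q t) (q ℚ.+ r)
    count-⊎ d (k , (xs , u , h , l) , e) (k′ , (ys , u′ , h′ , l′) , e′) =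
      k + k′ , (xs ++ ys , ++-Unique xs u u′ (λ {z} m n → d z (proj₁ (h z) m) (proj₁ (h′ z) n)) ,
        (λ t → (λ m → Data.Sum.map (proj₁ (h t)) (proj₁ (h′ t)) (∈-++⁻ xs m)) ,
               λ { (inj₁ p) → ∈-++⁺ˡ (proj₂ (h t) p) ; (inj₂ p) → ∈-++⁺ʳ xs (proj₂ (h′ t) p) }) ,
        trans (LP.length-++ xs) (cong₂ _+_ l l′)) , trans (ℕtoℚ-+ k k′) (cong₂ ℚ._+_ e e′)
      where import Data.Sum

    private
      Unique-map : {B : Set} {P : A → Set} (f : A → B) (xs : List A) → (∀ a → a ∈ xs → P a) →
        (∀ a b → P a → P b → f a ≡ f b → a ≡ b) → Unique xs → Unique (map f xs)
      Unique-map f [] h inj [] = []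
      Unique-map {P = P} f (x ∷ xs) h inj (a ∷ u) =
        All.tabulate (λ {y} m e → helper m e) ∷ Unique-map {P = P} f xs (λ a m → h a (there m)) inj u
        where
        helper : ∀ {y} → y ∈ map f xs → f x ≡ y → ⊥
        helper m e with ∈-map⁻ f m
        ... | z , z∈ , refl = All.lookup a z∈ (inj x z (h x (here refl)) (h z (there z∈)) e)

    count-map : {B : Set} {P : A → Set} {Q : B → Set} {q : ℚ} (f : A → B) →
      (∀ a b → P a → P b → f a ≡ f b → a ≡ b) → (∀ a → P a → Q (f a)) → (∀ b → Q b → Σ A λ a → P a × f a ≡ b) →
      Count P q → Count Q q
    count-map {P = P} f inj to from (k , (xs , u , h , l) , e) =
      k , (map f xs , Unique-map {P = P} f xs (λ a m → proj₁ (h a) m) inj u ,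
        (λ t → (λ m → back t (∈-map⁻ f m)) , λ q → forth t (from t q)) ,
        trans (LP.length-map f xs) l) , e
      where
      back : ∀ t → (∃ λ a → a ∈ xs × t ≡ f a) → _
      back _ (a , m , refl) = to a (proj₁ (h a) m)
      forth : ∀ t → (Σ A λ a → P a × f a ≡ t) → t ∈ map f xs
      forth _ (a , p , refl) = ∈-map⁺ f (proj₂ (h a) p)

    Unique-⊆ : (xs ys : List A) → Unique xs → (∀ {z} → z ∈ xs → z ∈ ys) → length xs ≤ length ys
    Unique-⊆ [] ys u s = z≤n
    Unique-⊆ (x ∷ xs) ys (a ∷ u) s with ∈-∃++ (s (here refl))
    ... | ys₁ , ys₂ , refl = subst (suc (length xs) ≤_) (sym (↭P.↭-length (↭P.shift x ys₁ ys₂)))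
      (s≤s (Unique-⊆ xs (ys₁ ++ ys₂) u λ m → drop m (∈-++⁻ ys₁ (s (there m)))))
      where
      drop : ∀ {z} → z ∈ xs → z ∈ ys₁ ⊎ z ∈ x ∷ ys₂ → z ∈ ys₁ ++ ys₂
      drop m (inj₁ p) = ∈-++⁺ˡ p
      drop m (inj₂ (here refl)) = ⊥-elim (All.lookup a m refl)
      drop m (inj₂ (there p)) = ∈-++⁺ʳ ys₁ p

    IsCount-unique : {P : A → Set} {k k′ : ℕ} → IsCount P k → IsCount P k′ → k ≡ k′
    IsCount-unique (xs , u , h , l) (ys , u′ , h′ , l′) = trans (sym l) (trans (ℕP.≤-antisym
      (Unique-⊆ xs ys u λ {z} m → proj₂ (h′ z) (proj₁ (h z) m))
      (Unique-⊆ ys xs u′ λ {z} m → proj₂ (h z) (proj₁ (h′ z) m))) l′)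

  count-× : {A B : Set} {P : A → Set} {Q : B → Set} {q r : ℚ} → Count P q → Count Q r →
            Count (λ (t : A × B) → P (proj₁ t) × Q (proj₂ t)) (q ℚ.* r)
  count-× {A} {B} {P} {Q} (k , (xs , u , h , l) , e) (k′ , (ys , u′ , h′ , l′) , e′) =
    k * k′ , (cartesianProduct xs ys , UP.cartesianProduct⁺ u u′ ,
      (λ { (a , b) → (λ m → let (p , q) = ∈-cartesianProduct⁻ xs ys m in proj₁ (h a) p , proj₁ (h′ b) q) ,
        λ { (p , q) → ∈-cartesianProduct⁺ (proj₂ (h a) p) (proj₂ (h′ b) q) } }) ,
      trans (len xs) (cong₂ _*_ l l′)) , trans (ℕtoℚ-* k k′) (cong₂ ℚ._*_ e e′)
    where
    len : ∀ xs → length (cartesianProduct xs ys) ≡ length xs * length ys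
    len [] = refl
    len (x ∷ xs) = trans (LP.length-++ (map (x ,_) ys)) (cong₂ _+_ (LP.length-map (x ,_) ys) (len xs))

-- Cycle numbers and cycle lengths from a decomposition.

module CycleCounts where

  open import Defs
  open import Data.Bool using (Bool; true; false; _∧_; if_then_else_; T)
  import Data.Bool.Properties as BP
  open import Data.Bool.ListAction using (and)
  open import Data.Nat using (ℕ; zero; suc; _≤_; _<_; z≤n; s≤s; _+_; _≤ᵇ_; _≡ᵇ_)
  import Data.Nat.Properties as ℕP
  open import Data.Fin using (Fin; toℕ; punchOut)
  import Data.Fin.Properties as FP
  open import Data.Fin.Properties using (_≟_)
  open import Data.Vec using (Vec; lookup; tabulate)
  open import Data.List using (List; []; _∷_; _++_; length; concat; map; upTo; allFin; applyUpTo; filterᵇ)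
  import Data.List.Properties as LP
  open import Data.List.Membership.Propositional using (_∈_; _∉_)
  open import Data.List.Membership.Propositional.Properties using (∈-++⁺ˡ; ∈-++⁺ʳ; ∈-++⁻; ∈-∃++; ∈-concat⁻′; ∈-allFin; ∈-upTo⁺)
  open import Data.List.Membership.DecPropositional using () renaming (_∈?_ to mem?)
  open import Data.List.Relation.Unary.Any using (here; there)
  open import Data.List.Relation.Unary.All as All using (All; []; _∷_)
  open import Data.List.Relation.Unary.AllPairs using ([]; _∷_)
  open import Data.List.Relation.Unary.Unique.Propositional using (Unique)
  import Data.List.Relation.Unary.Unique.Propositional.Properties as UP
  open import Data.List.Relation.Binary.Permutation.Propositional using (_↭_; prep; ↭-sym) renaming (refl to ↭r; trans to ↭t)
  import Data.List.Relation.Binary.Permutation.Propositional.Properties as ↭P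
  open import Data.Product using (∃; ∃₂; _×_; _,_; proj₁; proj₂)
  open import Data.Sum using (_⊎_; inj₁; inj₂)
  open import Data.Empty using (⊥-elim)
  open import Function using (_∘_; id)
  open import Relation.Nullary using (yes; no)
  open import Relation.Binary.PropositionalEquality using (_≡_; _≢_; refl; sym; trans; cong; subst; cong₂; module ≡-Reasoning)
  open CycleDecompositions
  open GraphsAndCounts

  private
    variable
      n : ℕ

  Inj : (Fin n → Fin n) → Set
  Inj f = ∀ i j → f i ≡ f j → i ≡ j

  surjective : (f : Fin n → Fin n) → Inj f → ∀ y → ∃ λ x → f x ≡ y
  surjective {suc n} f inj y with FP.any? (λ x → f x ≟ y)
  ... | yes p = p
  ... | no ¬p with FP.pigeonhole (ℕP.n<1+n n) (λ i → punchOut {i = y} {j = f i} (λ e → ¬p (i , sym e)))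
  ... | i , j , i<j , e = ⊥-elim (ℕP.<⇒≢ i<j (cong toℕ (inj i j (FP.punchOut-injective (λ q → ¬p (i , sym q)) (λ q → ¬p (j , sym q)) e))))

  find-cycle : {A : Set} {j : A} (cs : List (List A)) → j ∈ concat cs →
    ∃₂ λ d₁ d₂ → ∃₂ λ c₁ c₂ → cs ≡ d₁ ++ (c₁ ++ j ∷ c₂) ∷ d₂
  find-cycle cs m with ∈-concat⁻′ cs m
  ... | c , j∈c , c∈cs with ∈-∃++ c∈cs | ∈-∃++ j∈c
  ... | d₁ , d₂ , refl | c₁ , c₂ , refl = d₁ , d₂ , c₁ , c₂ , refl

  module _ {n : ℕ} where
    open Transpositions (_≟_ {n}) public

  Decomp-cong : {f g : Fin n → Fin n} {cs : List (List (Fin n))} → (∀ x → g x ≡ f x) → Decomp f cs → Decomp g cs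
  Decomp-cong {f = f} {g} h (decomp c u fx) = decomp (All.map (λ {c} → cyc c) c) u (λ x m → trans (h x) (fx x m))
    where
    cyc : ∀ c → Cyc f c → Cyc g c
    cyc (x ∷ xs) p = Path-cong x xs (λ u _ → h u) p

  τ-Inj : {f : Fin n → Fin n} → Inj f → ∀ e j → Inj (λ x → f (τ e j x))
  τ-Inj inj e j x y p = trans (sym (τ-inv e j x)) (trans (cong (τ e j) (inj _ _ p)) (τ-inv e j y))

  -- Induction on the support. For f j = e the permutation precomposed with the transposition of e
  -- and j fixes e, so it is supported on the tail; merging e back into the cycle of j restores f.
  decomposition : ∀ L → Unique L → (f : Fin n → Fin n) → Inj f → (∀ x → x ∉ L → f x ≡ x) →
    ∃ λ cs → Decomp f cs × concat cs ↭ L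
  decomposition [] u f inj h = [] , decomp [] [] (λ x _ → h x λ ()) , ↭r
  decomposition (e ∷ L) (a ∷ u) f inj h with surjective f inj e
  ... | j , fj with j ≟ e
  ... | yes refl with decomposition L u f inj (λ x n → case x n)
    where
    case : ∀ x → x ∉ L → f x ≡ x
    case x n with x ≟ e
    ... | yes refl = fj
    ... | no x≢e = h x λ { (here p) → x≢e p ; (there m) → n m }
  ... | cs , decomp cy un fx , p = (e ∷ []) ∷ cs ,
    decomp (fj ∷ cy) (All.tabulate (λ m q → All.lookup a (↭P.∈-resp-↭ p m) q) ∷ un)
      (λ x n → fx x (λ m → n (there m))) , prep e p
  decomposition (e ∷ L) (a ∷ u) f inj h | j , fj | no j≢e
    with decomposition L u (λ x → f (τ e j x)) (τ-Inj inj e j) out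
    where
    out : ∀ x → x ∉ L → f (τ e j x) ≡ x
    out x n with pos e j x
    ... | at-e refl = trans (cong f (τ-e e j)) fj
    ... | at-j refl = ⊥-elim (j≢e (trans (sym (h j λ { (here p) → j≢e p ; (there m) → n m })) fj))
    ... | off p q = trans (cong f (τ-other e j x p q)) (h x λ { (here r) → p r ; (there m) → n m })
  ... | cs , decomp cy un fx , p with find-cycle cs (↭P.∈-resp-↭ (↭-sym p) j∈L)
    where
    j∈L : j ∈ L
    j∈L with mem? _≟_ j (e ∷ L)
    ... | yes (here q) = ⊥-elim (j≢e q)
    ... | yes (there m) = m
    ... | no n = ⊥-elim (j≢e (trans (sym (h j n)) fj))
  ... | d₁ , d₂ , c₁ , c₂ , refl = (e ∷ (c₂ ++ c₁) ++ j ∷ []) ∷ d₁ ++ d₂ ,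
    Decomp-cong (λ x → cong f (sym (τ-inv e j x))) (merge c₁ j c₂ front) ,
    ↭t (↭-sym (merge-↭ {f = f} e [] c₁ j c₂ (d₁ ++ d₂))) (prep e (↭t (concat-↭ (↭-sym (↭P.shift (c₁ ++ j ∷ c₂) d₁ d₂))) p))
    where
    f′ : _ → _
    f′ x = f (τ e j x)
    front : Decomp f′ ((e ∷ []) ∷ (c₁ ++ j ∷ c₂) ∷ d₁ ++ d₂)
    front with Decomp-↭ (↭P.shift (c₁ ++ j ∷ c₂) d₁ d₂) (decomp cy un fx)
    ... | decomp cy′ un′ fx′ = decomp (trans (cong f (τ-e e j)) fj ∷ cy′)
      (All.tabulate (λ m q → All.lookup a (↭P.∈-resp-↭ (↭t (concat-↭ (↭-sym (↭P.shift (c₁ ++ j ∷ c₂) d₁ d₂))) p) m) q) ∷ un′)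
      (λ x n → fx′ x λ m → n (there m))

  complement : {A : Set} (xs ys : List A) → Unique xs → (∀ {z} → z ∈ xs → z ∈ ys) → ∃ λ rest → ys ↭ xs ++ rest
  complement [] ys u s = ys , ↭r
  complement (x ∷ xs) ys (a ∷ u) s with ∈-∃++ (s (here refl))
  ... | y₁ , y₂ , refl with complement xs (y₁ ++ y₂) u (λ m → drop m (∈-++⁻ y₁ (s (there m))))
    where
    drop : ∀ {z} → z ∈ xs → z ∈ y₁ ⊎ z ∈ x ∷ y₂ → z ∈ y₁ ++ y₂
    drop m (inj₁ p) = ∈-++⁺ˡ p
    drop m (inj₂ (here refl)) = ⊥-elim (All.lookup a m refl)
    drop m (inj₂ (there p)) = ∈-++⁺ʳ y₁ p
  ... | rest , p = rest , ↭t (↭P.shift x y₁ y₂) (prep x p)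

  cnt : {A : Set} → (A → Bool) → List A → ℕ
  cnt p xs = length (filterᵇ p xs)

  module _ {A : Set} (p : A → Bool) where

    cnt-true : ∀ {x} xs → p x ≡ true → cnt p (x ∷ xs) ≡ suc (cnt p xs)
    cnt-true {x} xs e with p x
    ... | true = refl

    cnt-false : ∀ {x} xs → p x ≡ false → cnt p (x ∷ xs) ≡ cnt p xs
    cnt-false {x} xs e with p x
    ... | false = refl

    cnt-++ : ∀ xs ys → cnt p (xs ++ ys) ≡ cnt p xs + cnt p ys
    cnt-++ xs ys = trans (cong length (LP.filter-++ (BP.T? ∘ p) xs ys)) (LP.length-++ (filterᵇ p xs))

    cnt-↭ : ∀ {xs ys} → xs ↭ ys → cnt p xs ≡ cnt p ys
    cnt-↭ q = ↭P.↭-length (↭P.filter-↭ (BP.T? ∘ p) q)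

    cnt-none : ∀ xs → (∀ x → x ∈ xs → p x ≡ false) → cnt p xs ≡ 0
    cnt-none [] h = refl
    cnt-none (x ∷ xs) h = trans (cnt-false xs (h x (here refl))) (cnt-none xs λ x m → h x (there m))

    cnt-all : ∀ xs → (∀ x → x ∈ xs → p x ≡ true) → cnt p xs ≡ length xs
    cnt-all [] h = refl
    cnt-all (x ∷ xs) h = trans (cnt-true xs (h x (here refl))) (cong suc (cnt-all xs λ x m → h x (there m)))

  module _ (f : Vec (Fin n) n) where

    iter-shift : ∀ k z → iter f (suc k) z ≡ iter f k (lookup f z)
    iter-shift zero z = refl
    iter-shift (suc k) z = cong (lookup f) (iter-shift k z)

    path-iter : ∀ z ws {z′} → Path (lookup f) z ws z′ →
      (∀ k → k < length ws → iter f (suc k) z ∈ ws) × iter f (suc (length ws)) z ≡ z′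
    path-iter z [] p = (λ k ()) , p
    path-iter z (w ∷ ws) (refl , p) with path-iter w ws p
    ... | a , b = (λ { zero _ → here refl ; (suc k) (s≤s l) → there (subst (_∈ ws) (sym (iter-shift (suc k) z)) (a k l)) })
                , trans (iter-shift (suc (length ws)) z) b

    path-reach : ∀ z ws {z′} → Path (lookup f) z ws z′ → ∀ y → y ∈ z ∷ ws → ∃ λ k → k ≤ length ws × iter f k z ≡ y
    path-reach z ws p y (here refl) = 0 , z≤n , refl
    path-reach z (w ∷ ws) (refl , p) y (there m) with path-reach w ws p y m
    ... | k , l , e = suc k , s≤s l , trans (iter-shift k z) e

    iter-closed : ∀ c → Cyc (lookup f) c → ∀ z → z ∈ c → ∀ k → iter f k z ∈ c
    iter-closed c p z m zero = m
    iter-closed c p z m (suc k) = Cyc-closed c _ p (iter-closed c p z m k)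

    and-true : ∀ {A : Set} (g : A → Bool) xs → (∀ x → x ∈ xs → g x ≡ true) → and (map g xs) ≡ true
    and-true g [] h = refl
    and-true g (x ∷ xs) h rewrite h x (here refl) = and-true g xs λ x m → h x (there m)

    true-and : ∀ {A : Set} (g : A → Bool) xs → and (map g xs) ≡ true → ∀ x → x ∈ xs → g x ≡ true
    true-and g (y ∷ ys) e x m with g y in eq
    true-and g (y ∷ ys) e x (here refl) | true = eq
    true-and g (y ∷ ys) e x (there m) | true = true-and g ys e x m

    private
      ≤ᵇ-true : ∀ {a b} → a ≤ b → (a ≤ᵇ b) ≡ true
      ≤ᵇ-true {a} {b} l with a ≤ᵇ b | ℕP.≤⇒≤ᵇ l
      ... | true | _ = refl

      true-≤ᵇ : ∀ {a b} → (a ≤ᵇ b) ≡ true → a ≤ b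
      true-≤ᵇ {a} {b} e = ℕP.≤ᵇ⇒≤ a b (subst T (sym e) _)

      ≡ᵇ-true : ∀ {a b} → a ≡ b → (a ≡ᵇ b) ≡ true
      ≡ᵇ-true {a} {b} l with a ≡ᵇ b | ℕP.≡⇒≡ᵇ a b l
      ... | true | _ = refl

      ≡ᵇ-false : ∀ {a b} → a ≢ b → (a ≡ᵇ b) ≡ false
      ≡ᵇ-false {a} {b} l with a ≡ᵇ b in eq
      ... | false = refl
      ... | true = ⊥-elim (l (ℕP.≡ᵇ⇒≡ a b (subst T (sym eq) _)))

    length≤n : (c : List (Fin n)) → Unique c → length c ≤ n
    length≤n c u = subst (length c ≤_) (LP.length-tabulate {n = n} id) (Unique-⊆ c (allFin n) u (λ {z} _ → ∈-allFin z))

    -- `isMin` tests only n iterates. This suffices because a cycle has at most n points, so each of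
    -- them is among the iterates tested.
    isMin-least : ∀ c → Unique c → Cyc (lookup f) c → ∀ z → z ∈ c → isMin f z ≡ true → ∀ y → y ∈ c → toℕ z ≤ toℕ y
    isMin-least c u p z m e y y∈ with ∈-∃++ m
    ... | c₁ , c₂ , refl with path-reach z (c₂ ++ c₁) (Cyc-rotate c₁ z c₂ p) y (rot y∈)
      where
      rot : y ∈ c₁ ++ z ∷ c₂ → y ∈ z ∷ c₂ ++ c₁
      rot m = ↭P.∈-resp-↭ (↭P.++-comm c₁ (z ∷ c₂)) m
    ... | k , l , refl = true-≤ᵇ (true-and _ (upTo n) e k (∈-upTo⁺ (ℕP.<-≤-trans (s≤s l)
          (ℕP.≤-trans (ℕP.≤-reflexive (sym (↭P.↭-length (↭P.++-comm c₁ (z ∷ c₂))))) (length≤n _ u)))))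

    least-isMin : ∀ c → Cyc (lookup f) c → ∀ z → z ∈ c → (∀ y → y ∈ c → toℕ z ≤ toℕ y) → isMin f z ≡ true
    least-isMin c p z m h = and-true _ (upTo n) λ k _ → ≤ᵇ-true (h _ (iter-closed c p z m k))

    minimum : (x : Fin n) (xs : List (Fin n)) → ∃ λ z → z ∈ x ∷ xs × (∀ y → y ∈ x ∷ xs → toℕ z ≤ toℕ y)
    minimum x [] = x , here refl , λ { y (here refl) → ℕP.≤-refl }
    minimum x (y ∷ ys) with minimum y ys
    ... | z , m , h with ℕP.≤-total (toℕ x) (toℕ z)
    ... | inj₁ l = x , here refl , λ { w (here refl) → ℕP.≤-refl ; w (there k) → ℕP.≤-trans l (h w k) }
    ... | inj₂ l = z , there m , λ { w (here refl) → l ; w (there k) → h w k }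

    -- `isMin` marks exactly one point of a cycle, its least one, so marked points count cycles.
    cnt-cycle : ∀ c → Unique c → Cyc (lookup f) c → ∀ (p : Fin n → Bool) b → (∀ z → z ∈ c → p z ≡ (isMin f z ∧ b)) →
      cnt p c ≡ (if b then 1 else 0)
    cnt-cycle (x ∷ xs) u cy p false h = cnt-none p (x ∷ xs) λ z m → trans (h z m) (BP.∧-zeroʳ _)
    cnt-cycle c@(x ∷ xs) u cy p true h with minimum x xs
    ... | z , m , l with ∈-∃++ m
    ... | c₁ , c₂ , eq = begin
        cnt p c                           ≡⟨ cong (cnt p) eq ⟩
        cnt p (c₁ ++ z ∷ c₂)              ≡⟨ cnt-↭ p (↭P.shift z c₁ c₂) ⟩
        cnt p (z ∷ c₁ ++ c₂)              ≡⟨ cnt-true p (c₁ ++ c₂) (trans (h z m) (trans (BP.∧-identityʳ _) (least-isMin c cy z m l))) ⟩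
        suc (cnt p (c₁ ++ c₂))            ≡⟨ cong suc (cnt-none p (c₁ ++ c₂) others) ⟩
        1 ∎
      where
      open ≡-Reasoning
      u′ : Unique (z ∷ c₁ ++ c₂)
      u′ = Unique-↭ (↭P.shift z c₁ c₂) (subst Unique eq u)
      inc : ∀ {y} → y ∈ c₁ ++ c₂ → y ∈ c
      inc m′ = subst (_ ∈_) (sym eq) (↭P.∈-resp-↭ (↭-sym (↭P.shift z c₁ c₂)) (there m′))
      others : ∀ y → y ∈ c₁ ++ c₂ → p y ≡ false
      others y m′ with p y in py
      ... | false = refl
      ... | true = ⊥-elim (∉-head u′ (subst (_∈ c₁ ++ c₂) (FP.toℕ-injective (ℕP.≤-antisym
            (isMin-least c u cy y (inc m′) (trans (sym (BP.∧-identityʳ _)) (trans (sym (h y (inc m′))) py)) z m)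
            (l y (inc m′)))) m′))

    private
      first : ∀ (g : ℕ → ℕ) z l N → l < N → (∀ k → k < l → iter f (g k) z ≢ z) → iter f (g l) z ≡ z →
              firstReturn f z (applyUpTo g N) ≡ g l
      first g z zero (suc N) _ _ e rewrite e | ≡ᵇ-true {toℕ z} refl = refl
      first g z (suc l) (suc N) (s≤s h) d e rewrite ≡ᵇ-false {toℕ (iter f (g 0) z)} {toℕ z} (λ q → d 0 (s≤s z≤n) (FP.toℕ-injective q)) =
        first (g ∘ suc) z l N h (λ k q → d (suc k) (s≤s q)) e

    orbitLen-cycle : ∀ c → Unique c → Cyc (lookup f) c → ∀ z → z ∈ c → orbitLen f z ≡ length c
    orbitLen-cycle c u p z m with ∈-∃++ m
    ... | c₁ , c₂ , refl = trans (cong (firstReturn f z) (LP.map-upTo suc n)) (trans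
          (first suc z (length ws) n bound (λ k l e → ∉-head u′ (subst (_∈ ws) e (proj₁ pi k l))) (proj₂ pi))
          (sym len))
      where
      ws = c₂ ++ c₁
      pi = path-iter z ws (Cyc-rotate c₁ z c₂ p)
      u′ : Unique (z ∷ ws)
      u′ = Unique-↭ (↭P.++-comm c₁ (z ∷ c₂)) u
      len : length (c₁ ++ z ∷ c₂) ≡ suc (length ws)
      len = ↭P.↭-length (↭P.++-comm c₁ (z ∷ c₂))
      bound : length ws < n
      bound = length≤n _ u′

    cnt-cycles : ∀ cs → Unique (concat cs) → All (Cyc (lookup f)) cs → ∀ (p : Fin n → Bool) (b : List (Fin n) → Bool) →
      (∀ c → c ∈ cs → ∀ z → z ∈ c → p z ≡ (isMin f z ∧ b c)) → cnt p (concat cs) ≡ cnt b cs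
    cnt-cycles [] u [] p b h = refl
    cnt-cycles (c ∷ cs) u (cy ∷ cys) p b h = trans (cnt-++ p c (concat cs)) (trans (cong₂ _+_
        (cnt-cycle c (proj₁ (Unique-++ c u)) cy p (b c) (h c (here refl)))
        (cnt-cycles cs (proj₁ (proj₂ (Unique-++ c u))) cys p b (λ d m → h d (there m)))) (step (b c) refl))
      where
      step : ∀ v → b c ≡ v → (if v then 1 else 0) + cnt b cs ≡ cnt b (c ∷ cs)
      step true e = sym (cnt-true b cs e)
      step false e = sym (cnt-false b cs e)

    iter-fixed : ∀ x → lookup f x ≡ x → ∀ k → iter f k x ≡ x
    iter-fixed x e zero = refl
    iter-fixed x e (suc k) = trans (cong (lookup f) (iter-fixed x e k)) e

    -- The points outside the lists are fixed, and each of them is a further cycle. Writing the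
    -- relation additively avoids subtraction.
    ncycles-Decomp : ∀ cs → Decomp (lookup f) cs → ncycles f + length (concat cs) ≡ length cs + n
    ncycles-Decomp cs (decomp cy u fx) with complement (concat cs) (allFin n) u (λ {z} _ → ∈-allFin z)
    ... | rest , p = begin
        ncycles f + length (concat cs)
          ≡⟨ cong (_+ length (concat cs)) (trans (cnt-↭ (isMin f) p) (trans (cnt-++ (isMin f) (concat cs) rest)
               (cong₂ _+_ (trans (cnt-cycles cs u cy (isMin f) (λ _ → true) (λ c _ z _ → sym (BP.∧-identityʳ _))) (cnt-all _ cs λ _ _ → refl))
                 (cnt-all (isMin f) rest min)))) ⟩
        length cs + length rest + length (concat cs)
          ≡⟨ trans (ℕP.+-assoc (length cs) (length rest) _) (cong (length cs +_) (trans (ℕP.+-comm (length rest) _)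
               (trans (sym (LP.length-++ (concat cs))) (trans (sym (↭P.↭-length p)) (LP.length-tabulate {n = n} id))))) ⟩
        length cs + n ∎
      where
      open ≡-Reasoning
      min : ∀ x → x ∈ rest → isMin f x ≡ true
      min x m = and-true _ (upTo n) λ k _ → ≤ᵇ-true (ℕP.≤-reflexive (cong toℕ (sym (iter-fixed x
        (fx x λ x∈ → proj₂ (proj₂ (Unique-++ (concat cs) (Unique-↭ p (UP.allFin⁺ n)))) x∈ m) k))))

    cyclesOfLen-Decomp : ∀ cs → Decomp (lookup f) cs → concat cs ↭ allFin n → ∀ i →
      cyclesOfLen f i ≡ cnt (λ c → length c ≡ᵇ i) cs
    cyclesOfLen-Decomp cs (decomp cy u fx) p i = trans (cnt-↭ _ (↭-sym p)) (cnt-cycles cs u cy _ _ λ c m z z∈ →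
      cong (λ l → isMin f z ∧ (l ≡ᵇ i)) (orbitLen-cycle c (sub c m cs u) (All.lookup cy m) z z∈))
      where
      sub : ∀ c {cs} → c ∈ cs → ∀ cs′ → Unique (concat cs) → Unique c
      sub c (here refl) cs′ u = proj₁ (Unique-++ c u)
      sub c {d ∷ _} (there m) cs′ u = sub c m cs′ (proj₁ (proj₂ (Unique-++ d u)))

-- Changing one factor by a transposition.

module Factorizations where

  open import Defs
  open import Data.Nat using (ℕ; zero; suc; _≤_; _<_; z≤n; s≤s; _+_)
  import Data.Nat.Properties as ℕP
  open import Data.Nat.Solver using (module +-*-Solver)
  open import Data.Fin using (Fin; toℕ; zero; suc)
  import Data.Fin.Properties as FP
  open import Data.Fin.Properties using (_≟_)
  open import Data.Vec using (Vec; []; _∷_; lookup; tabulate; _[_]≔_)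
  import Data.Vec.Properties as VP
  open import Data.List using (List; []; _∷_; _++_; length; concat; map; allFin)
  open import Data.List.Membership.Propositional using (_∈_; _∉_)
  open import Data.List.Membership.Propositional.Properties using (∈-++⁺ˡ; ∈-++⁺ʳ; ∈-++⁻; ∈-map⁺; ∈-map⁻; ∈-allFin)
  open import Data.List.Membership.DecPropositional using () renaming (_∈?_ to mem?)
  open import Data.List.Relation.Unary.Any using (here; there)
  open import Data.List.Relation.Unary.All using ([]; _∷_)
  open import Data.List.Relation.Unary.AllPairs using ([]; _∷_)
  import Data.List.Relation.Unary.Unique.Propositional.Properties as UP
  open import Data.List.Relation.Binary.Permutation.Propositional using (_↭_; prep; ↭-sym) renaming (trans to ↭t)
  import Data.List.Relation.Binary.Permutation.Propositional.Properties as ↭P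
  open import Data.Product using (∃; _×_; _,_; proj₁)
  open import Data.Sum using (inj₁; inj₂)
  open import Data.Empty using (⊥-elim)
  open import Function using (_∘_; id)
  open import Relation.Nullary using (yes; no)
  open import Relation.Binary.PropositionalEquality using (_≡_; _≢_; refl; sym; trans; cong; subst; cong₂; module ≡-Reasoning)
  open CycleDecompositions
  open GraphsAndCounts
  open CycleCounts

  private
    variable
      n m : ℕ

  Tuple : ℕ → ℕ → Set
  Tuple n m = Vec (Vec (Fin n) n) m

  vec-ext : {f g : Vec (Fin n) n} → (∀ x → lookup f x ≡ lookup g x) → f ≡ g
  vec-ext {f = f} {g} h = trans (sym (VP.tabulate∘lookup f)) (trans (VP.tabulate-cong h) (VP.tabulate∘lookup g))

  comp : Vec (Fin n) n → Fin n → Fin n → Vec (Fin n) n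
  comp f e j = tabulate (λ x → lookup f (τ e j x))

  lookup-comp : ∀ (f : Vec (Fin n) n) e j x → lookup (comp f e j) x ≡ lookup f (τ e j x)
  lookup-comp f e j x = VP.lookup∘tabulate _ x

  comp-comp : ∀ (f : Vec (Fin n) n) e j → comp (comp f e j) e j ≡ f
  comp-comp f e j = vec-ext λ x → trans (lookup-comp (comp f e j) e j x)
    (trans (lookup-comp f e j _) (cong (lookup f) (τ-inv e j x)))

  comp-Perm : ∀ (f : Vec (Fin n) n) e j → IsPerm f → IsPerm (comp f e j)
  comp-Perm f e j p x y q = τ-Inj p e j x y (trans (sym (lookup-comp f e j x)) (trans q (lookup-comp f e j y)))

  -- The fixed point e is a cycle by itself, and the transposition merges it into the cycle of j.
  ncycles-comp : ∀ (f : Vec (Fin n) n) e j → IsPerm f → lookup f e ≡ e → j ≢ e → ncycles f ≡ suc (ncycles (comp f e j))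
  ncycles-comp {n} f e j p fe j≢e with decomposition (allFin n) (UP.allFin⁺ n) (lookup f) p (λ x h → ⊥-elim (h (∈-allFin x)))
  ... | cs , dec , cs↭ with find-cycle cs (↭P.∈-resp-↭ (↭-sym cs↭) (∈-allFin e))
  ... | d₁ , d₂ , c₁ , c₂ , refl with Decomp-↭ (↭P.shift (c₁ ++ e ∷ c₂) d₁ d₂) dec
  ... | decomp (cy ∷ cys) u fx with c₂ ++ c₁ in eq | Cyc-rotate c₁ e c₂ cy
  ... | w ∷ ws | (a , _) = ⊥-elim (∉-head (Unique-↭ (↭P.++-comm c₁ (e ∷ c₂)) (proj₁ (Unique-++ (c₁ ++ e ∷ c₂) u)))
          (subst (e ∈_) (sym eq) (here (trans (sym fe) a))))
  ... | [] | _ with c₂ | c₁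
  ... | [] | [] with find-cycle (d₁ ++ d₂) j∈
    where
    j∈ : j ∈ concat (d₁ ++ d₂)
    j∈ with ↭P.∈-resp-↭ (↭t (↭-sym cs↭) (concat-↭ (↭P.shift (e ∷ []) d₁ d₂))) (∈-allFin j)
    ... | here q = ⊥-elim (j≢e q)
    ... | there m = m
  ... | g₁ , g₂ , a₁ , a₂ , geq = ℕP.+-cancelʳ-≡ L _ _ (begin
      ncycles f + L                       ≡⟨ ncycles-Decomp f _ dec′ ⟩
      suc (suc (length (g₁ ++ g₂))) + n   ≡⟨ cong suc (sym (ncycles-Decomp (comp f e j) _ merged)) ⟩
      suc (ncycles (comp f e j) + length (concat new))  ≡⟨ cong (λ l → suc (ncycles (comp f e j) + l))
          (sym (↭P.↭-length (merge-↭ {f = lookup f} e [] a₁ j a₂ (g₁ ++ g₂)))) ⟩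
      suc (ncycles (comp f e j)) + L      ∎)
    where
    open ≡-Reasoning
    old new : List (List _)
    old = (e ∷ []) ∷ (a₁ ++ j ∷ a₂) ∷ g₁ ++ g₂
    new = (e ∷ (a₂ ++ a₁) ++ j ∷ []) ∷ g₁ ++ g₂
    L = length (concat old)
    dec′ : Decomp (lookup f) old
    dec′ = Decomp-↭ (prep (e ∷ []) (subst (_↭ (a₁ ++ j ∷ a₂) ∷ g₁ ++ g₂) (sym geq) (↭P.shift (a₁ ++ j ∷ a₂) g₁ g₂))) (decomp (cy ∷ cys) u fx)
    merged : Decomp (lookup (comp f e j)) new
    merged = Decomp-cong (lookup-comp f e j) (merge a₁ j a₂ dec′)

  edgesOf : Tuple n m → List (Fin n × Fin n)
  edgesOf [] = []
  edgesOf {n} (σ ∷ t) = map (λ x → x , lookup σ x) (allFin n) ++ edgesOf t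

  edge∈ : ∀ (t : Tuple n m) l x → (x , lookup (lookup t l) x) ∈ edgesOf t
  edge∈ (σ ∷ t) zero x = ∈-++⁺ˡ (∈-map⁺ _ (∈-allFin x))
  edge∈ {n} (σ ∷ t) (suc l) x = ∈-++⁺ʳ (map (λ x → x , lookup σ x) (allFin n)) (edge∈ t l x)

  edge-inv : ∀ (t : Tuple n m) {a b} → (a , b) ∈ edgesOf t → ∃ λ l → b ≡ lookup (lookup t l) a
  edge-inv {n} (σ ∷ t) h with ∈-++⁻ (map (λ x → x , lookup σ x) (allFin n)) h
  ... | inj₂ h′ with edge-inv t h′
  ... | l , e = suc l , e
  edge-inv {n} (σ ∷ t) h | inj₁ h′ with ∈-map⁻ _ h′
  ... | x , _ , refl = zero , refl

  -- The product of the factors behind position l, which act before the factor at l.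
  tp : Tuple n m → Fin m → Fin n → Fin n
  tp (σ ∷ t) zero x = applyAll t x
  tp (σ ∷ t) (suc l) x = tp t l x

  module _ {n : ℕ} where
    open Connectivity (_≟_ {n}) public

    applyAll-rel : ∀ {m R} → Equiv R → (t : Tuple n m) → (∀ l x → R x (lookup (lookup t l) x)) → ∀ x → R x (applyAll t x)
    applyAll-rel E [] h x = Equiv.rfl E
    applyAll-rel E (σ ∷ t) h x = Equiv.tr E (applyAll-rel E t (λ l → h (suc l)) x) (h zero _)

    tp-rel : ∀ {m R} → Equiv R → (t : Tuple n m) (l : Fin m) → (∀ l′ → toℕ l < toℕ l′ → ∀ x → R x (lookup (lookup t l′) x)) → ∀ x → R x (tp t l x)
    tp-rel E (σ ∷ t) zero h x = applyAll-rel E t (λ l → h (suc l) (s≤s z≤n)) x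
    tp-rel E (σ ∷ t) (suc l) h x = tp-rel E t l (λ l′ q → h (suc l′) (s≤s q)) x

  applyAll-Inj : (t : Tuple n m) → (∀ l → IsPerm (lookup t l)) → Inj (applyAll t)
  applyAll-Inj [] h x y p = p
  applyAll-Inj (σ ∷ t) h x y p = applyAll-Inj t (λ l → h (suc l)) x y (h zero _ _ p)

  applyAll-fix : ∀ (t : Tuple n m) e → (∀ l → lookup (lookup t l) e ≡ e) → applyAll t e ≡ e
  applyAll-fix [] e h = refl
  applyAll-fix (σ ∷ t) e h = trans (cong (lookup σ) (applyAll-fix t e λ l → h (suc l))) (h zero)

  tp-Inj : (t : Tuple n m) (l : Fin m) → (∀ l → IsPerm (lookup t l)) → Inj (tp t l)
  tp-Inj (σ ∷ t) zero h = applyAll-Inj t λ l → h (suc l)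
  tp-Inj (σ ∷ t) (suc l) h = tp-Inj t l λ l → h (suc l)

  tp-fix : ∀ (t : Tuple n m) l e → (∀ l′ → toℕ l < toℕ l′ → lookup (lookup t l′) e ≡ e) → tp t l e ≡ e
  tp-fix (σ ∷ t) zero e h = applyAll-fix t e λ l → h (suc l) (s≤s z≤n)
  tp-fix (σ ∷ t) (suc l) e h = tp-fix t l e λ l′ q → h (suc l′) (s≤s q)

  tp-upd : ∀ (t : Tuple n m) l g x → tp (t [ l ]≔ g) l x ≡ tp t l x
  tp-upd (σ ∷ t) zero g x = refl
  tp-upd (σ ∷ t) (suc l) g x = tp-upd t l g x

  -- Conjugation by X carries the transposition of e and i to that of e and X i, as X fixes e. A
  -- transposition put into one factor thereby acts on the whole product from the right.
  τ-conj : (X : Fin n → Fin n) → Inj X → ∀ e i → X e ≡ e → ∀ x → τ e (X i) (X x) ≡ X (τ e i x)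
  τ-conj X inj e i Xe x with pos e i x
  ... | at-e refl = trans (cong (τ e (X i)) Xe) (trans (τ-e e (X i)) (cong X (sym (τ-e e i))))
  ... | at-j refl = trans (τ-j e (X i)) (trans (sym Xe) (cong X (sym (τ-j e i))))
  ... | off p q = trans (τ-other e (X i) (X x) (λ r → p (inj _ _ (trans r (sym Xe)))) (λ r → q (inj _ _ r)))
        (cong X (sym (τ-other e i x p q)))

  prod-upd : ∀ (t : Tuple n m) l e i → tp t l e ≡ e → Inj (tp t l) → ∀ x →
    applyAll (t [ l ]≔ comp (lookup t l) e (tp t l i)) x ≡ applyAll t (τ e i x)
  prod-upd (σ ∷ t) zero e i Xe inj x = trans (lookup-comp σ e (applyAll t i) _)
    (cong (lookup σ) (τ-conj (applyAll t) inj e i Xe x))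
  prod-upd (σ ∷ t) (suc l) e i Xe inj x = cong (lookup σ) (prod-upd t l e i Xe inj x)

  totalCycles-upd : ∀ (t : Tuple n m) l g → totalCycles (t [ l ]≔ g) + ncycles (lookup t l) ≡ totalCycles t + ncycles g
  totalCycles-upd (σ ∷ t) zero g = solve 3 (λ a b c → a :+ b :+ c := c :+ b :+ a) refl (ncycles g) (totalCycles t) (ncycles σ)
    where open +-*-Solver
  totalCycles-upd (σ ∷ t) (suc l) g = trans (ℕP.+-assoc (ncycles σ) _ _) (trans (cong (ncycles σ +_) (totalCycles-upd t l g))
    (sym (ℕP.+-assoc (ncycles σ) _ _)))

  -- The point i is measured at the far right of the product, so that it indexes the transposition
  -- by which the product changes. As `tp t l` does not involve the factor at l, the map is an
  -- involution.
  Φ : Fin n → Fin m → Fin n → Tuple n m → Tuple n m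
  Φ e l i t = t [ l ]≔ comp (lookup t l) e (tp t l i)

  Φ-lookup : ∀ (e : Fin n) (l : Fin m) i t → lookup (Φ e l i t) l ≡ comp (lookup t l) e (tp t l i)
  Φ-lookup e l i t = VP.lookup∘update l t _

  Φ-other : ∀ (e : Fin n) (l l′ : Fin m) i t → l′ ≢ l → lookup (Φ e l i t) l′ ≡ lookup t l′
  Φ-other e l l′ i t h = VP.lookup∘update′ h t _

  Φ-inv : ∀ (e : Fin n) (l : Fin m) i t → Φ e l i (Φ e l i t) ≡ t
  Φ-inv e l i t = begin
    (t [ l ]≔ g) [ l ]≔ comp (lookup (t [ l ]≔ g) l) e (tp (t [ l ]≔ g) l i)
      ≡⟨ cong₂ (λ f j → (t [ l ]≔ g) [ l ]≔ comp f e j) (VP.lookup∘update l t g) (tp-upd t l g i) ⟩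
    (t [ l ]≔ g) [ l ]≔ comp g e (tp t l i)
      ≡⟨ cong ((t [ l ]≔ g) [ l ]≔_) (comp-comp (lookup t l) e (tp t l i)) ⟩
    (t [ l ]≔ g) [ l ]≔ lookup t l
      ≡⟨ VP.[]≔-idempotent t l ⟩
    t [ l ]≔ lookup t l
      ≡⟨ VP.[]≔-lookup t l ⟩
    t ∎
    where
    open ≡-Reasoning
    g = comp (lookup t l) e (tp t l i)

  -- The extra edges ex only count for the connectivity of S.
  record Sys (k : ℕ) (e : Fin n) (S : List (Fin n)) (ρ : Fin n → Fin n) (ex : List (Fin n × Fin n)) (t : Tuple n m) : Set where
    field
      perm : ∀ l → IsPerm (lookup t l)
      supp : ∀ l x → x ∉ S → lookup (lookup t l) x ≡ x
      prod : ∀ x → applyAll t x ≡ ρ x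
      conn-S : ∀ x → x ∈ S → conn (ex ++ edgesOf t) e x
      fixe : ∀ l → k ≤ toℕ l → lookup (lookup t l) e ≡ e

  stays : (f : Vec (Fin n) n) (S : List (Fin n)) → IsPerm f → (∀ x → x ∉ S → lookup f x ≡ x) → ∀ x → x ∈ S → lookup f x ∈ S
  stays {n} f S p h x x∈ with mem? _≟_ (lookup f x) S
  ... | yes q = q
  ... | no q = subst (_∈ S) (sym (p (lookup f x) x (h _ q))) x∈

  module Step {n m : ℕ} (e : Fin n) (l : Fin m) (i : Fin n) (S : List (Fin n)) (e∈S : e ∈ S) (i∈S : i ∈ S) where

    private
      lk : ∀ t x → lookup (lookup (Φ e l i t) l) x ≡ lookup (lookup t l) (τ e (tp t l i) x)
      lk t x = trans (cong (λ f → lookup f x) (Φ-lookup e l i t)) (lookup-comp (lookup t l) e (tp t l i) x)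

      lk′ : ∀ t l′ → l′ ≢ l → ∀ x → lookup (lookup (Φ e l i t) l′) x ≡ lookup (lookup t l′) x
      lk′ t l′ h x = cong (λ f → lookup f x) (Φ-other e l l′ i t h)

    module _ {k : ℕ} (l≡k : toℕ l ≡ k) where

      private
        tail-e : ∀ {k′ ρ ex} (t : Tuple n m) → k′ ≤ suc k → Sys k′ e S ρ ex t → tp t l e ≡ e
        tail-e t h s = tp-fix t l e λ l′ q → Sys.fixe s l′ (ℕP.≤-trans h (subst (λ k → suc k ≤ toℕ l′) l≡k q))

        tail∈ : ∀ {k′ ρ ex} (t : Tuple n m) → Sys k′ e S ρ ex t → tp t l i ∈ S
        tail∈ t s = tp-rel {R = λ x y → (x ∈ S → y ∈ S) × (y ∈ S → x ∈ S)}
          (record { rfl = id , id ; sm = λ (a , b) → b , a ; tr = λ (a , b) (c , d) → c ∘ a , b ∘ d }) t l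
          (λ l′ _ x → stays (lookup t l′) S (Sys.perm s l′) (Sys.supp s l′) x , λ h → back l′ x h) i .proj₁ i∈S
          where
          back : ∀ l′ x → lookup (lookup t l′) x ∈ S → x ∈ S
          back l′ x h with mem? _≟_ x S
          ... | yes q = q
          ... | no q = subst (_∈ S) (Sys.supp s l′ x q) h

        common : ∀ {k′ ρ ex} (t : Tuple n m) → k′ ≤ suc k → (s : Sys k′ e S ρ ex t) →
          (∀ l′ → IsPerm (lookup (Φ e l i t) l′)) × (∀ l′ x → x ∉ S → lookup (lookup (Φ e l i t) l′) x ≡ x) ×
          (∀ x → applyAll (Φ e l i t) x ≡ ρ (τ e i x))
        common t h s = p , su , λ x → trans (prod-upd t l e i (tail-e t h s) (tp-Inj t l (Sys.perm s)) x) (Sys.prod s _)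
          where
          p : ∀ l′ → IsPerm (lookup (Φ e l i t) l′)
          p l′ with l′ ≟ l
          ... | yes refl = subst IsPerm (sym (Φ-lookup e l i t)) (comp-Perm (lookup t l) e _ (Sys.perm s l))
          ... | no q = subst IsPerm (sym (Φ-other e l l′ i t q)) (Sys.perm s l′)
          su : ∀ l′ x → x ∉ S → lookup (lookup (Φ e l i t) l′) x ≡ x
          su l′ x x∉ with l′ ≟ l
          ... | yes refl = trans (lk t x) (trans (cong (lookup (lookup t l)) (τ-other e _ x (λ { refl → x∉ e∈S })
                (λ { refl → x∉ (tail∈ t s) }))) (Sys.supp s l x x∉))
          ... | no q = trans (lk′ t l′ q x) (Sys.supp s l′ x x∉)

      -- The hypothesis says that i reaches e through the factor at l, so the changed factor fixes
      -- e. Transitivity may be lost, but the edge from e to i makes up for it: the tail joins i to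
      -- the other transposed point, and with these joined every old edge can be recovered.
      forward : ∀ {ρ} (t : Tuple n m) → Sys (suc k) e S ρ [] t → lookup (lookup t l) (tp t l i) ≡ e →
                Sys k e S (λ x → ρ (τ e i x)) ((e , i) ∷ []) (Φ e l i t)
      forward t s I with common t ℕP.≤-refl s
      ... | p , su , pr = record
        { perm = p ; supp = su ; prod = pr
        ; conn-S = λ x x∈ → conn-min E′ (edgesOf t) edge (Sys.conn-S s x x∈)
        ; fixe = fx }
        where
        t′ = Φ e l i t
        j = tp t l i
        es = (e , i) ∷ edgesOf t′
        E′ = conn-Equiv es
        R = conn es
        step : ∀ l′ x → R x (lookup (lookup t′ l′) x)
        step l′ x = conn-edge es (there (edge∈ t′ l′ x))
        ei : R e i
        ei = conn-edge es (here refl)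
        ij : R i j
        ij = tp-rel E′ t l (λ l′ q x → subst (R x) (lk′ t l′ (λ { refl → ℕP.<-irrefl refl q }) x) (step l′ x)) i
        ej : R e j
        ej = Equiv.tr E′ ei ij
        σ-rel : ∀ x → R x (lookup (lookup t l) x)
        σ-rel x with pos e j x
        ... | at-e refl = Equiv.tr E′ ej (subst (R j) (trans (lk t j) (cong (lookup (lookup t l)) (τ-j e j))) (step l j))
        ... | at-j refl = subst (R j) (sym I) (Equiv.sm E′ ej)
        ... | off p q = subst (R x) (trans (lk t x) (cong (lookup (lookup t l)) (τ-other e j x p q))) (step l x)
        edge : ∀ {a b} → (a , b) ∈ edgesOf t → R a b
        edge h with edge-inv t h
        ... | l′ , refl with l′ ≟ l
        ... | yes refl = σ-rel _
        ... | no q = subst (R _) (lk′ t l′ q _) (step l′ _)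
        fx : ∀ l′ → k ≤ toℕ l′ → lookup (lookup t′ l′) e ≡ e
        fx l′ h with l′ ≟ l
        ... | yes refl = trans (lk t e) (trans (cong (lookup (lookup t l)) (τ-e e j)) I)
        ... | no q = trans (lk′ t l′ q e) (Sys.fixe s l′ (ℕP.≤∧≢⇒< h λ r → q (FP.toℕ-injective (trans (sym r) (sym l≡k)))))

      backward : ∀ {ρ} (t : Tuple n m) → Sys k e S (λ x → ρ (τ e i x)) ((e , i) ∷ []) t →
        Sys (suc k) e S ρ [] (Φ e l i t) × lookup (lookup (Φ e l i t) l) (tp (Φ e l i t) l i) ≡ e
      backward {ρ} t s with common t (ℕP.n≤1+n _) s
      ... | p , su , pr = record
        { perm = p ; supp = su ; prod = λ x → trans (pr x) (cong ρ (τ-inv e i x))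
        ; conn-S = λ x x∈ → conn-min E′ ((e , i) ∷ edgesOf t) edge (Sys.conn-S s x x∈)
        ; fixe = λ l′ h → trans (lk′ t l′ (λ { refl → ℕP.<-irrefl l≡k′ h }) e) (Sys.fixe s l′ (ℕP.≤-trans (ℕP.n≤1+n k) h)) }
        , I
        where
        l≡k′ = sym l≡k
        t′ = Φ e l i t
        j = tp t l i
        es = edgesOf t′
        E′ = conn-Equiv es
        R = conn es
        σe : lookup (lookup t l) e ≡ e
        σe = Sys.fixe s l (ℕP.≤-reflexive (sym l≡k))
        I : lookup (lookup t′ l) (tp t′ l i) ≡ e
        I = trans (cong (lookup (lookup t′ l)) (tp-upd t l _ i)) (trans (lk t j) (trans (cong (lookup (lookup t l)) (τ-j e j)) σe))
        step : ∀ l′ x → R x (lookup (lookup t′ l′) x)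
        step l′ x = conn-edge es (edge∈ t′ l′ x)
        ij : R i j
        ij = tp-rel E′ t l (λ l′ q x → subst (R x) (lk′ t l′ (λ { refl → ℕP.<-irrefl refl q }) x) (step l′ x)) i
        je : R j e
        je = subst (R j) (trans (lk t j) (trans (cong (lookup (lookup t l)) (τ-j e j)) σe)) (step l j)
        σ-rel : ∀ x → R x (lookup (lookup t l) x)
        σ-rel x with pos e j x
        ... | at-e refl = subst (R e) (sym σe) (Equiv.rfl E′)
        ... | at-j refl = Equiv.tr E′ je (subst (R e) (trans (lk t e) (cong (lookup (lookup t l)) (τ-e e j))) (step l e))
        ... | off p q = subst (R x) (trans (lk t x) (cong (lookup (lookup t l)) (τ-other e j x p q))) (step l x)
        edge : ∀ {a b} → (a , b) ∈ (e , i) ∷ edgesOf t → R a b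
        edge (here refl) = Equiv.sm E′ (Equiv.tr E′ ij je)
        edge (there h) with edge-inv t h
        ... | l′ , refl with l′ ≟ l
        ... | yes refl = σ-rel _
        ... | no q = subst (R _) (lk′ t l′ q _) (step l′ _)

      cycles-step : ∀ {ρ} (t : Tuple n m) → i ≢ e → Sys k e S ρ ((e , i) ∷ []) t → suc (totalCycles (Φ e l i t)) ≡ totalCycles t
      cycles-step t i≢e s = ℕP.+-cancelʳ-≡ (ncycles (lookup t l)) _ _ (trans (cong suc (totalCycles-upd t l _))
        (trans (sym (ℕP.+-suc (totalCycles t) _)) (cong (totalCycles t +_) (sym (ncycles-comp (lookup t l) e (tp t l i)
          (Sys.perm s l) (Sys.fixe s l (ℕP.≤-reflexive (sym l≡k)))
          λ q → i≢e (tp-Inj t l (Sys.perm s) i e (trans q (sym (tail-e t (ℕP.n≤1+n _) s)))))))))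

-- Factorizations that fall apart into two components.

module TwoComponents where

  open import Defs
  open import Data.Nat using (ℕ; zero; suc; _+_; _*_)
  import Data.Nat.Properties as ℕP
  open import Data.Nat.Solver using (module +-*-Solver)
  open import Data.Fin using (Fin; zero; suc)
  import Data.Fin.Properties as FP
  open import Data.Fin.Properties using (_≟_)
  open import Data.Vec as Vec using (Vec; []; _∷_; lookup; tabulate; zipWith)
  import Data.Vec.Properties as VP
  open import Data.List using (List; []; _∷_; _++_; length; concat; map)
  import Data.List.Properties as LP
  open import Data.List.Membership.Propositional using (_∈_; _∉_)
  open import Data.List.Membership.Propositional.Properties using (∈-++⁺ˡ; ∈-++⁺ʳ; ∈-++⁻)
  open import Data.List.Membership.DecPropositional using () renaming (_∈?_ to mem?)
  open import Data.List.Relation.Unary.Any using (here; there)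
  open import Data.List.Relation.Unary.All as All using (All; []; _∷_)
  import Data.List.Relation.Unary.All.Properties as AllP
  open import Data.List.Relation.Unary.AllPairs using ([]; _∷_)
  open import Data.List.Relation.Unary.Unique.Propositional using (Unique)
  open import Data.List.Relation.Binary.Permutation.Propositional using (_↭_; prep; ↭-sym) renaming (refl to ↭r; trans to ↭t)
  import Data.List.Relation.Binary.Permutation.Propositional.Properties as ↭P
  open import Data.Product using (∃₂; _×_; _,_; proj₁; proj₂)
  open import Data.Sum using (_⊎_; inj₁; inj₂)
  open import Data.Empty using (⊥; ⊥-elim)
  open import Function using (_∘_; id)
  open import Relation.Nullary using (¬_; yes; no)
  open import Relation.Binary.PropositionalEquality using (_≡_; refl; sym; trans; cong; subst; cong₂; module ≡-Reasoning)
  open CycleDecompositions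
  open GraphsAndCounts
  open CycleCounts
  open Factorizations

  private
    variable
      n m : ℕ

  rf : List (Fin n) → (Fin n → Fin n) → Fin n → Fin n
  rf S f x with mem? _≟_ x S
  ... | yes _ = f x
  ... | no _ = x

  rf-in : ∀ S (f : Fin n → Fin n) x → x ∈ S → rf S f x ≡ f x
  rf-in S f x h with mem? _≟_ x S
  ... | yes _ = refl
  ... | no q = ⊥-elim (q h)

  rf-out : ∀ S (f : Fin n → Fin n) x → x ∉ S → rf S f x ≡ x
  rf-out S f x h with mem? _≟_ x S
  ... | yes q = ⊥-elim (h q)
  ... | no _ = refl

  restr : List (Fin n) → Vec (Fin n) n → Vec (Fin n) n
  restr S f = tabulate (rf S (lookup f))

  restr-in : ∀ S (f : Vec (Fin n) n) x → x ∈ S → lookup (restr S f) x ≡ lookup f x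
  restr-in S f x h = trans (VP.lookup∘tabulate _ x) (rf-in S (lookup f) x h)

  restr-out : ∀ S (f : Vec (Fin n) n) x → x ∉ S → lookup (restr S f) x ≡ x
  restr-out S f x h = trans (VP.lookup∘tabulate _ x) (rf-out S (lookup f) x h)

  comb : Vec (Fin n) n → Vec (Fin n) n → Vec (Fin n) n
  comb f g = tabulate (λ x → lookup f (lookup g x))

  restrT : List (Fin n) → Tuple n m → Tuple n m
  restrT S = Vec.map (restr S)

  combT : Tuple n m → Tuple n m → Tuple n m
  combT = zipWith comb

  Closed : List (Fin n) → Vec (Fin n) n → Set
  Closed S f = ∀ x → x ∈ S → lookup f x ∈ S

  module _ {n : ℕ} (S : List (Fin n)) where

    restr-Perm : ∀ f → IsPerm f → Closed S f → IsPerm (restr S f)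
    restr-Perm f p c x y q with mem? _≟_ x S | mem? _≟_ y S
    ... | yes a | yes b = p x y (trans (sym (restr-in S f x a)) (trans q (restr-in S f y b)))
    ... | no a | no b = trans (sym (restr-out S f x a)) (trans q (restr-out S f y b))
    ... | yes a | no b = ⊥-elim (b (subst (_∈ S) (trans (sym (restr-in S f x a)) (trans q (restr-out S f y b))) (c x a)))
    ... | no a | yes b = ⊥-elim (a (subst (_∈ S) (trans (sym (restr-in S f y b)) (trans (sym q) (restr-out S f x a))) (c y b)))

    applyAll-restr : ∀ {m} (t : Tuple n m) → (∀ l → Closed S (lookup t l)) → ∀ x →
      (x ∈ S → applyAll t x ∈ S × applyAll (restrT S t) x ≡ applyAll t x) × (x ∉ S → applyAll (restrT S t) x ≡ x)
    applyAll-restr [] c x = (λ h → h , refl) , λ _ → refl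
    applyAll-restr (σ ∷ t) c x with applyAll-restr t (λ l → c (suc l)) x
    ... | a , b = (λ h → c zero _ (proj₁ (a h)) , trans (cong (lookup (restr S σ)) (proj₂ (a h))) (restr-in S σ _ (proj₁ (a h))))
                , λ h → trans (cong (lookup (restr S σ)) (b h)) (restr-out S σ x h)

    conn-restr : ∀ {m} (t : Tuple n m) → (∀ l x → lookup (lookup t l) x ∈ S → x ∈ S) → (∀ l → Closed S (lookup t l)) →
      ∀ u v → u ∈ S → conn (edgesOf t) u v → conn (edgesOf (restrT S t)) u v
    conn-restr t c′ c u v u∈ p = proj₁ (conn-min E (edgesOf t) edge p) u∈
      where
      es = edgesOf (restrT S t)
      R : Fin n → Fin n → Set
      R u v = (u ∈ S → conn es u v) × (u ∈ S → v ∈ S) × (v ∈ S → u ∈ S)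
      E : Equiv R
      E = record { rfl = (λ _ → conn-refl es) , id , id
        ; sm = λ (a , b , d) → (λ h → conn-sym es (a (d h))) , d , b
        ; tr = λ (a , b , d) (a′ , b′ , d′) → (λ h → conn-trans es (a h) (a′ (b h))) , b′ ∘ b , d ∘ d′ }
      edge : ∀ {a b} → (a , b) ∈ edgesOf t → R a b
      edge {a} h with edge-inv t h
      ... | l , refl = (λ a∈ → subst (conn es a) (trans (cong (λ f → lookup f a) (VP.lookup-map l (restr S) t)) (restr-in S (lookup t l) a a∈))
            (conn-edge es (edge∈ (restrT S t) l a))) , c l a , c′ l a

  record Parted (S₁ S₂ : List (Fin n)) (f : Vec (Fin n) n) : Set where
    field
      perm : IsPerm f
      closed₁ : Closed S₁ f
      closed₂ : Closed S₂ f
      fixed : ∀ x → x ∉ S₁ → x ∉ S₂ → lookup f x ≡ x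

  module _ {n : ℕ} {S₁ S₂ : List (Fin n)} (disj : ∀ {x} → x ∈ S₁ → x ∉ S₂) where

    private
      disj′ : ∀ {x} → x ∈ S₂ → x ∉ S₁
      disj′ a b = disj b a

    comb-restr : ∀ f → Parted S₁ S₂ f → comb (restr S₁ f) (restr S₂ f) ≡ f
    comb-restr f p = vec-ext λ x → trans (VP.lookup∘tabulate _ x) (go x)
      where
      open Parted p
      go : ∀ x → lookup (restr S₁ f) (lookup (restr S₂ f) x) ≡ lookup f x
      go x with mem? _≟_ x S₁ | mem? _≟_ x S₂
      ... | yes a | yes b = ⊥-elim (disj a b)
      ... | yes a | no b = trans (cong (lookup (restr S₁ f)) (restr-out S₂ f x b)) (restr-in S₁ f x a)
      ... | no a | yes b = trans (cong (lookup (restr S₁ f)) (restr-in S₂ f x b)) (restr-out S₁ f _ (disj′ (closed₂ x b)))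
      ... | no a | no b = trans (cong (lookup (restr S₁ f)) (restr-out S₂ f x b)) (trans (restr-out S₁ f x a) (sym (fixed x a b)))

    module _ (f g : Vec (Fin n) n) (pf : IsPerm f) (pg : IsPerm g)
             (sf : ∀ x → x ∉ S₁ → lookup f x ≡ x) (sg : ∀ x → x ∉ S₂ → lookup g x ≡ x) where

      comb₁ : ∀ x → x ∈ S₁ → lookup (comb f g) x ≡ lookup f x
      comb₁ x h = trans (VP.lookup∘tabulate _ x) (cong (lookup f) (sg x (disj h)))

      comb₂ : ∀ x → x ∈ S₂ → lookup (comb f g) x ≡ lookup g x
      comb₂ x h = trans (VP.lookup∘tabulate _ x) (sf _ (disj′ (stays g S₂ pg sg x h)))

      comb₀ : ∀ x → x ∉ S₁ → x ∉ S₂ → lookup (comb f g) x ≡ x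
      comb₀ x h k = trans (VP.lookup∘tabulate _ x) (trans (cong (lookup f) (sg x k)) (sf x h))

      comb-Parted : Parted S₁ S₂ (comb f g)
      comb-Parted = record
        { perm = λ x y q → pg x y (pf _ _ (trans (sym (VP.lookup∘tabulate _ x)) (trans q (VP.lookup∘tabulate _ y))))
        ; closed₁ = λ x h → subst (_∈ S₁) (sym (comb₁ x h)) (stays f S₁ pf sf x h)
        ; closed₂ = λ x h → subst (_∈ S₂) (sym (comb₂ x h)) (stays g S₂ pg sg x h)
        ; fixed = comb₀ }

      restr-comb₁ : restr S₁ (comb f g) ≡ f
      restr-comb₁ = vec-ext go
        where
        go : ∀ x → lookup (restr S₁ (comb f g)) x ≡ lookup f x
        go x with mem? _≟_ x S₁
        ... | yes a = trans (restr-in S₁ (comb f g) x a) (comb₁ x a)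
        ... | no a = trans (restr-out S₁ (comb f g) x a) (sym (sf x a))

      restr-comb₂ : restr S₂ (comb f g) ≡ g
      restr-comb₂ = vec-ext go
        where
        go : ∀ x → lookup (restr S₂ (comb f g)) x ≡ lookup g x
        go x with mem? _≟_ x S₂
        ... | yes a = trans (restr-in S₂ (comb f g) x a) (comb₂ x a)
        ... | no a = trans (restr-out S₂ (comb f g) x a) (sym (sg x a))

    -- Each restriction fixes every point outside its own part. These additional fixed points
    -- account for the summand n.
    ncycles-parts : Unique S₁ → Unique S₂ → ∀ f → Parted S₁ S₂ f →
      ncycles f + n ≡ ncycles (restr S₁ f) + ncycles (restr S₂ f)
    ncycles-parts u₁ u₂ f p
      with decomposition S₁ u₁ (lookup (restr S₁ f)) (restr-Perm S₁ f perm closed₁) (restr-out S₁ f)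
         | decomposition S₂ u₂ (lookup (restr S₂ f)) (restr-Perm S₂ f perm closed₂) (restr-out S₂ f)
      where open Parted p
    ... | cs₁ , dec₁@(decomp y₁ w₁ x₁) , p₁ | cs₂ , dec₂@(decomp y₂ w₂ x₂) , p₂ =
      ℕP.+-cancelʳ-≡ (A + B) _ _ (begin
        (ncycles f + n) + (A + B)                 ≡⟨ solve 3 (λ a n c → (a :+ n) :+ c := (a :+ c) :+ n) refl (ncycles f) n (A + B) ⟩
        (ncycles f + (A + B)) + n                 ≡⟨ cong (_+ n) (trans (cong (ncycles f +_) (sym len)) (ncycles-Decomp f _ dec)) ⟩
        (length (cs₁ ++ cs₂) + n) + n             ≡⟨ cong (λ l → l + n + n) (LP.length-++ cs₁) ⟩
        (length cs₁ + length cs₂ + n) + n         ≡⟨ solve 3 (λ a b n → ((a :+ b) :+ n) :+ n := (a :+ n) :+ (b :+ n)) refl (length cs₁) (length cs₂) n ⟩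
        (length cs₁ + n) + (length cs₂ + n)       ≡⟨ cong₂ _+_ (sym (ncycles-Decomp (restr S₁ f) cs₁ dec₁)) (sym (ncycles-Decomp (restr S₂ f) cs₂ dec₂)) ⟩
        (ncycles (restr S₁ f) + A) + (ncycles (restr S₂ f) + B) ≡⟨ solve 4 (λ a b c d → (a :+ b) :+ (c :+ d) := (a :+ c) :+ (b :+ d)) refl (ncycles (restr S₁ f)) A (ncycles (restr S₂ f)) B ⟩
        (ncycles (restr S₁ f) + ncycles (restr S₂ f)) + (A + B) ∎)
      where
      open Parted p
      open ≡-Reasoning
      open +-*-Solver
      A = length (concat cs₁)
      B = length (concat cs₂)
      len : length (concat (cs₁ ++ cs₂)) ≡ A + B
      len = trans (cong length (sym (LP.concat-++ cs₁ cs₂))) (LP.length-++ (concat cs₁))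
      agree : ∀ S (cs : List (List (Fin n))) → (∀ {x} → x ∈ concat cs → x ∈ S) → All (Cyc (lookup (restr S f))) cs → All (Cyc (lookup f)) cs
      agree S [] inc [] = []
      agree S ((x ∷ xs) ∷ cs) inc (q ∷ qs) =
        Path-cong x xs (λ u m → sym (restr-in S f u (inc (∈-++⁺ˡ m)))) q ∷ agree S cs (λ m → inc (∈-++⁺ʳ (x ∷ xs) m)) qs
      dec : Decomp (lookup f) (cs₁ ++ cs₂)
      dec = decomp (AllP.++⁺ (agree S₁ cs₁ (↭P.∈-resp-↭ p₁) y₁) (agree S₂ cs₂ (↭P.∈-resp-↭ p₂) y₂))
        (subst Unique (LP.concat-++ cs₁ cs₂) (++-Unique (concat cs₁) w₁ w₂ λ a b → disj (↭P.∈-resp-↭ p₁ a) (↭P.∈-resp-↭ p₂ b)))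
        λ x h → fixed x
          (λ a → h (subst (x ∈_) (LP.concat-++ cs₁ cs₂) (∈-++⁺ˡ (↭P.∈-resp-↭ (↭-sym p₁) a))))
          (λ a → h (subst (x ∈_) (LP.concat-++ cs₁ cs₂) (∈-++⁺ʳ (concat cs₁) (↭P.∈-resp-↭ (↭-sym p₂) a))))

    totalCycles-parts : Unique S₁ → Unique S₂ → ∀ {m} (t : Tuple n m) → (∀ l → Parted S₁ S₂ (lookup t l)) →
      totalCycles t + m * n ≡ totalCycles (restrT S₁ t) + totalCycles (restrT S₂ t)
    totalCycles-parts u₁ u₂ [] h = refl
    totalCycles-parts u₁ u₂ {suc m} (σ ∷ t) h = begin
      (ncycles σ + totalCycles t) + (n + m * n)  ≡⟨ solve 4 (λ a b c d → (a :+ b) :+ (c :+ d) := (a :+ c) :+ (b :+ d)) refl (ncycles σ) (totalCycles t) n (m * n) ⟩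
      (ncycles σ + n) + (totalCycles t + m * n)  ≡⟨ cong₂ _+_ (ncycles-parts u₁ u₂ σ (h zero)) (totalCycles-parts u₁ u₂ t (λ l → h (suc l))) ⟩
      (ncycles (restr S₁ σ) + ncycles (restr S₂ σ)) + (totalCycles (restrT S₁ t) + totalCycles (restrT S₂ t))
        ≡⟨ solve 4 (λ a b c d → (a :+ b) :+ (c :+ d) := (a :+ c) :+ (b :+ d)) refl (ncycles (restr S₁ σ)) (ncycles (restr S₂ σ)) _ _ ⟩
      _ ∎
      where
      open ≡-Reasoning
      open +-*-Solver

    applyAll-comb : ∀ {m} (t u : Tuple n m) → (∀ l → IsPerm (lookup t l)) → (∀ l → IsPerm (lookup u l)) →
      (∀ l x → x ∉ S₁ → lookup (lookup t l) x ≡ x) → (∀ l x → x ∉ S₂ → lookup (lookup u l) x ≡ x) → ∀ x →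
      (x ∈ S₁ → applyAll t x ∈ S₁ × applyAll (combT t u) x ≡ applyAll t x) ×
      (x ∈ S₂ → applyAll u x ∈ S₂ × applyAll (combT t u) x ≡ applyAll u x) ×
      (x ∉ S₁ → x ∉ S₂ → applyAll (combT t u) x ≡ x)
    applyAll-comb [] [] pt pu st su x = (λ h → h , refl) , (λ h → h , refl) , λ _ _ → refl
    applyAll-comb (f ∷ t) (g ∷ u) pt pu st su x with applyAll-comb t u (λ l → pt (suc l)) (λ l → pu (suc l)) (λ l → st (suc l)) (λ l → su (suc l)) x
    ... | a , b , c =
      (λ h → stays f S₁ (pt zero) (st zero) _ (proj₁ (a h)) , trans (cong (lookup (comb f g)) (proj₂ (a h))) (comb₁ f g (pt zero) (pu zero) (st zero) (su zero) _ (proj₁ (a h)))) ,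
      (λ h → stays g S₂ (pu zero) (su zero) _ (proj₁ (b h)) , trans (cong (lookup (comb f g)) (proj₂ (b h))) (comb₂ f g (pt zero) (pu zero) (st zero) (su zero) _ (proj₁ (b h)))) ,
      λ h k → trans (cong (lookup (comb f g)) (c h k)) (comb₀ f g (pt zero) (pu zero) (st zero) (su zero) x h k)

  module _ {n m : ℕ} (ρ : Fin n → Fin n) (t : Tuple n m) (prod : ∀ x → applyAll t x ≡ ρ x) where

    private
      es = edgesOf t

    conn-ρ : ∀ x → conn es x (ρ x)
    conn-ρ x = subst (conn es x) (prod x) (applyAll-rel (conn-Equiv es) t (λ l y → conn-edge es (edge∈ t l y)) x)

    conn-path : ∀ x xs {z} → Path ρ x xs z → ∀ y → y ∈ x ∷ xs → conn es x y
    conn-path x xs p y (here refl) = conn-refl es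
    conn-path x (w ∷ xs) (refl , p) y (there m) = conn-trans es (conn-ρ x) (conn-path w xs p y m)

    -- The product moves points only within components, so each of its cycles belongs as a whole to
    -- the component of e or to that of i.
    classify : ∀ e i → (∀ cs → All (Cyc ρ) cs → (∀ x → x ∈ concat cs → conn es e x ⊎ conn es i x) →
      ∃₂ λ cs₁ cs₂ → cs ↭ cs₁ ++ cs₂ × (∀ x → x ∈ concat cs₁ → conn es e x) × (∀ x → x ∈ concat cs₂ → conn es i x))
    classify e i [] [] h = [] , [] , ↭r , (λ _ ()) , λ _ ()
    classify e i ((x ∷ xs) ∷ cs) (p ∷ ps) h with classify e i cs ps (λ y m → h y (∈-++⁺ʳ (x ∷ xs) m)) | h x (here refl)
    ... | cs₁ , cs₂ , q , a , b | inj₁ ex = (x ∷ xs) ∷ cs₁ , cs₂ , prep _ q ,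
      (λ y m → case y (∈-++⁻ (x ∷ xs) m)) , b
      where
      case : ∀ y → y ∈ x ∷ xs ⊎ y ∈ concat cs₁ → conn es e y
      case y (inj₁ m) = conn-trans es ex (conn-path x xs p y m)
      case y (inj₂ m) = a y m
    ... | cs₁ , cs₂ , q , a , b | inj₂ ix = cs₁ , (x ∷ xs) ∷ cs₂ , ↭t (prep _ q) (↭-sym (↭P.shift (x ∷ xs) cs₁ cs₂)) , a ,
      (λ y m → case y (∈-++⁻ (x ∷ xs) m))
      where
      case : ∀ y → y ∈ x ∷ xs ⊎ y ∈ concat cs₂ → conn es i y
      case y (inj₁ m) = conn-trans es ix (conn-path x xs p y m)
      case y (inj₂ m) = b y m

  Decomp-rf : ∀ {ρ : Fin n → Fin n} cs₁ cs₂ → Decomp ρ (cs₁ ++ cs₂) → Decomp (rf (concat cs₁) ρ) cs₁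
  Decomp-rf {ρ = ρ} cs₁ cs₂ (decomp c u f) = decomp (go cs₁ id (AllP.++⁻ˡ cs₁ c))
    (proj₁ (Unique-++ (concat cs₁) (subst Unique (sym (LP.concat-++ cs₁ cs₂)) u))) (rf-out (concat cs₁) ρ)
    where
    go : ∀ cs → (∀ {x} → x ∈ concat cs → x ∈ concat cs₁) → All (Cyc ρ) cs → All (Cyc (rf (concat cs₁) ρ)) cs
    go [] inc [] = []
    go ((x ∷ xs) ∷ cs) inc (p ∷ ps) = Path-cong x xs (λ u m → rf-in (concat cs₁) ρ u (inc (∈-++⁺ˡ m))) p ∷ go cs (λ m → inc (∈-++⁺ʳ (x ∷ xs) m)) ps

  -- S₁ and S₂ are the two components of a tuple that becomes transitive by the extra edge e - i.
  module Components {n m : ℕ} {k : ℕ} {ρ : Fin n → Fin n} {e i : Fin n} {zs ys : List (Fin n)} {cs₁ cs₂ : List (List (Fin n))}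
      (dec : Decomp ρ (((e ∷ zs) ∷ cs₁) ++ ((i ∷ ys) ∷ cs₂))) where
    S₁ S₂ : List (Fin n)
    S₁ = concat ((e ∷ zs) ∷ cs₁)
    S₂ = concat ((i ∷ ys) ∷ cs₂)

    private
      uniq : Unique (S₁ ++ S₂)
      uniq = subst Unique (sym (LP.concat-++ ((e ∷ zs) ∷ cs₁) ((i ∷ ys) ∷ cs₂))) (Decomp.unique dec)

    u₁ : Unique S₁
    u₁ = proj₁ (Unique-++ S₁ uniq)

    u₂ : Unique S₂
    u₂ = proj₁ (proj₂ (Unique-++ S₁ uniq))

    disj : ∀ {x} → x ∈ S₁ → x ∉ S₂
    disj = proj₂ (proj₂ (Unique-++ S₁ uniq))

    dec₁ : Decomp (rf S₁ ρ) ((e ∷ zs) ∷ cs₁)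
    dec₁ = Decomp-rf ((e ∷ zs) ∷ cs₁) ((i ∷ ys) ∷ cs₂) dec

    dec₂ : Decomp (rf S₂ ρ) ((i ∷ ys) ∷ cs₂)
    dec₂ = Decomp-rf ((i ∷ ys) ∷ cs₂) ((e ∷ zs) ∷ cs₁) (Decomp-↭ (↭P.++-comm ((e ∷ zs) ∷ cs₁) ((i ∷ ys) ∷ cs₂)) dec)

    module Split (S : List (Fin n)) (S↭ : S ↭ S₁ ++ S₂) (t : Tuple n m) (s : Sys k e S ρ ((e , i) ∷ []) t)
                 (sep : ¬ conn (edgesOf t) e i)
                 (h₁ : ∀ x → x ∈ concat cs₁ → conn (edgesOf t) e x) (h₂ : ∀ x → x ∈ concat cs₂ → conn (edgesOf t) i x) where
      open Sys s
      private
        es = edgesOf t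

      c₁ : ∀ x → x ∈ S₁ → conn es e x
      c₁ x m with ∈-++⁻ (e ∷ zs) m
      ... | inj₁ a = conn-path ρ t prod e zs (All.head (Decomp.cycles dec)) x a
      ... | inj₂ b = h₁ x b

      c₂ : ∀ x → x ∈ S₂ → conn es i x
      c₂ x m with ∈-++⁻ (i ∷ ys) m
      ... | inj₁ a = conn-path ρ t prod i ys (All.head (AllP.++⁻ʳ ((e ∷ zs) ∷ cs₁) (Decomp.cycles dec))) x a
      ... | inj₂ b = h₂ x b

      private
        in-S : ∀ l x → x ∈ S → lookup (lookup t l) x ∈ S₁ ⊎ lookup (lookup t l) x ∈ S₂
        in-S l x m = ∈-++⁻ S₁ (↭P.∈-resp-↭ S↭ (stays (lookup t l) S (perm l) (supp l) x m))

        back : ∀ {x} → x ∈ S₁ ++ S₂ → x ∈ S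
        back = ↭P.∈-resp-↭ (↭-sym S↭)

        cl₁ : ∀ l → Closed S₁ (lookup t l)
        cl₁ l x m with in-S l x (back (∈-++⁺ˡ m))
        ... | inj₁ a = a
        ... | inj₂ b = ⊥-elim (sep (conn-trans es (c₁ x m) (conn-trans es (conn-edge es (edge∈ t l x)) (conn-sym es (c₂ _ b)))))

        cl₂ : ∀ l → Closed S₂ (lookup t l)
        cl₂ l x m with in-S l x (back (∈-++⁺ʳ S₁ m))
        ... | inj₂ a = a
        ... | inj₁ b = ⊥-elim (sep (conn-trans es (c₁ _ b) (conn-trans es (conn-sym es (conn-edge es (edge∈ t l x))) (conn-sym es (c₂ x m)))))

      parted : ∀ l → Parted S₁ S₂ (lookup t l)
      parted l = record { perm = perm l ; closed₁ = cl₁ l ; closed₂ = cl₂ l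
        ; fixed = λ x a b → supp l x λ m → case (∈-++⁻ S₁ (↭P.∈-resp-↭ S↭ m)) a b }
        where
        case : ∀ {x} → x ∈ S₁ ⊎ x ∈ S₂ → x ∉ S₁ → x ∉ S₂ → ⊥
        case (inj₁ m) a b = a m
        case (inj₂ m) a b = b m

      private
        lk : ∀ A l x → lookup (lookup (restrT A t) l) x ≡ lookup (restr A (lookup t l)) x
        lk A l x = cong (λ f → lookup f x) (VP.lookup-map l (restr A) t)

        inv₁ : ∀ l x → lookup (lookup t l) x ∈ S₁ → x ∈ S₁
        inv₁ l x m with mem? _≟_ x S
        ... | no q = subst (_∈ S₁) (supp l x q) m
        ... | yes q with ∈-++⁻ S₁ (↭P.∈-resp-↭ S↭ q)
        ... | inj₁ a = a
        ... | inj₂ b = ⊥-elim (disj m (cl₂ l x b))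

        inv₂ : ∀ l x → lookup (lookup t l) x ∈ S₂ → x ∈ S₂
        inv₂ l x m with mem? _≟_ x S
        ... | no q = subst (_∈ S₂) (supp l x q) m
        ... | yes q with ∈-++⁻ S₁ (↭P.∈-resp-↭ S↭ q)
        ... | inj₂ a = a
        ... | inj₁ b = ⊥-elim (disj (cl₁ l x b) m)

        product : ∀ A → (∀ l → Closed A (lookup t l)) → ∀ x → applyAll (restrT A t) x ≡ rf A ρ x
        product A cl x with mem? _≟_ x A
        ... | yes m = trans (proj₂ (proj₁ (applyAll-restr A t cl x) m)) (prod x)
        ... | no m = proj₂ (applyAll-restr A t cl x) m

      sys₁ : Sys k e S₁ (rf S₁ ρ) [] (restrT S₁ t)
      sys₁ = record
        { perm = λ l → subst IsPerm (sym (VP.lookup-map l (restr S₁) t)) (restr-Perm S₁ (lookup t l) (perm l) (cl₁ l))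
        ; supp = λ l x m → trans (lk S₁ l x) (restr-out S₁ (lookup t l) x m)
        ; prod = product S₁ cl₁
        ; conn-S = λ x m → conn-restr S₁ t inv₁ cl₁ e x (here refl) (c₁ x m)
        ; fixe = λ l h → trans (lk S₁ l e) (trans (restr-in S₁ (lookup t l) e (here refl)) (fixe l h)) }

      -- Nothing has to be fixed in the component that does not contain e. It is therefore an
      -- arbitrary factorization with base point i, which is level m, where `fixe` is vacuous.
      sys₂ : Sys m i S₂ (rf S₂ ρ) [] (restrT S₂ t)
      sys₂ = record
        { perm = λ l → subst IsPerm (sym (VP.lookup-map l (restr S₂) t)) (restr-Perm S₂ (lookup t l) (perm l) (cl₂ l))
        ; supp = λ l x m → trans (lk S₂ l x) (restr-out S₂ (lookup t l) x m)
        ; prod = product S₂ cl₂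
        ; conn-S = λ x m → conn-restr S₂ t inv₂ cl₂ i x (here refl) (c₂ x m)
        ; fixe = λ l h → ⊥-elim (ℕP.<⇒≱ (FP.toℕ<n l) h) }

      cycles : totalCycles t + m * n ≡ totalCycles (restrT S₁ t) + totalCycles (restrT S₂ t)
      cycles = totalCycles-parts disj u₁ u₂ t parted

      recombine : combT (restrT S₁ t) (restrT S₂ t) ≡ t
      recombine = go t parted
        where
        go : ∀ {m} (t : Tuple n m) → (∀ l → Parted S₁ S₂ (lookup t l)) → combT (restrT S₁ t) (restrT S₂ t) ≡ t
        go [] h = refl
        go (σ ∷ t) h = cong₂ _∷_ (comb-restr disj σ (h zero)) (go t λ l → h (suc l))

    module Join (S : List (Fin n)) (S↭ : S ↭ S₁ ++ S₂) (t u : Tuple n m)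
                (s₁ : Sys k e S₁ (rf S₁ ρ) [] t) (s₂ : Sys m i S₂ (rf S₂ ρ) [] u) where
      private
        module A = Sys s₁
        module B = Sys s₂
        v = combT t u
        es = edgesOf v
        lk : ∀ l x → lookup (lookup v l) x ≡ lookup (comb (lookup t l) (lookup u l)) x
        lk l x = cong (λ f → lookup f x) (VP.lookup-zipWith comb l t u)
        in₁ : ∀ l x → x ∈ S₁ → lookup (lookup v l) x ≡ lookup (lookup t l) x
        in₁ l x m = trans (lk l x) (comb₁ disj (lookup t l) (lookup u l) (A.perm l) (B.perm l) (A.supp l) (B.supp l) x m)
        in₂ : ∀ l x → x ∈ S₂ → lookup (lookup v l) x ≡ lookup (lookup u l) x
        in₂ l x m = trans (lk l x) (comb₂ disj (lookup t l) (lookup u l) (A.perm l) (B.perm l) (A.supp l) (B.supp l) x m)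
        in₀ : ∀ l x → x ∉ S₁ → x ∉ S₂ → lookup (lookup v l) x ≡ x
        in₀ l x a b = trans (lk l x) (comb₀ disj (lookup t l) (lookup u l) (A.perm l) (B.perm l) (A.supp l) (B.supp l) x a b)

      part : ∀ l → Parted S₁ S₂ (lookup v l)
      part l = subst (Parted S₁ S₂) (sym (VP.lookup-zipWith comb l t u))
        (comb-Parted disj (lookup t l) (lookup u l) (A.perm l) (B.perm l) (A.supp l) (B.supp l))

      d₁ : ∀ x → x ∈ S₁ → conn es e x
      d₁ x m = conn-min (conn-Equiv es) (edgesOf t) edge (A.conn-S x m)
        where
        edge : ∀ {a b} → (a , b) ∈ edgesOf t → conn es a b
        edge {a} h with edge-inv t h
        ... | l , refl with mem? _≟_ a S₁
        ... | yes a∈ = subst (conn es a) (in₁ l a a∈) (conn-edge es (edge∈ v l a))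
        ... | no a∉ = subst (conn es a) (sym (A.supp l a a∉)) (conn-refl es)

      d₂ : ∀ x → x ∈ S₂ → conn es i x
      d₂ x m = conn-min (conn-Equiv es) (edgesOf u) edge (B.conn-S x m)
        where
        edge : ∀ {a b} → (a , b) ∈ edgesOf u → conn es a b
        edge {a} h with edge-inv u h
        ... | l , refl with mem? _≟_ a S₂
        ... | yes a∈ = subst (conn es a) (in₂ l a a∈) (conn-edge es (edge∈ v l a))
        ... | no a∉ = subst (conn es a) (sym (B.supp l a a∉)) (conn-refl es)

      sep : ¬ conn es e i
      sep q = disj (proj₁ (conn-min E es edge q) (here refl)) (here refl)
        where
        R : Fin n → Fin n → Set
        R x y = (x ∈ S₁ → y ∈ S₁) × (y ∈ S₁ → x ∈ S₁)
        E : Equiv R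
        E = record { rfl = id , id ; sm = λ (a , b) → b , a ; tr = λ (a , b) (c , d) → c ∘ a , b ∘ d }
        edge : ∀ {a b} → (a , b) ∈ es → R a b
        edge {a} h with edge-inv v h
        ... | l , refl = Parted.closed₁ (part l) a , bk
          where
          bk : lookup (lookup v l) a ∈ S₁ → a ∈ S₁
          bk m with mem? _≟_ a S₁ | mem? _≟_ a S₂
          ... | yes p | _ = p
          ... | no p | yes r = ⊥-elim (disj m (Parted.closed₂ (part l) a r))
          ... | no p | no r = subst (_∈ S₁) (in₀ l a p r) m

      sys : Sys k e S ρ ((e , i) ∷ []) v
      sys = record
        { perm = λ l → Parted.perm (part l)
        ; supp = λ l x m → in₀ l x (λ a → m (↭P.∈-resp-↭ (↭-sym S↭) (∈-++⁺ˡ a))) (λ b → m (↭P.∈-resp-↭ (↭-sym S↭) (∈-++⁺ʳ S₁ b)))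
        ; prod = pr
        ; conn-S = λ x m → case x (∈-++⁻ S₁ (↭P.∈-resp-↭ S↭ m))
        ; fixe = λ l h → trans (in₁ l e (here refl)) (A.fixe l h) }
        where
        case : ∀ x → x ∈ S₁ ⊎ x ∈ S₂ → conn ((e , i) ∷ es) e x
        case x (inj₁ m) = inj₁ (d₁ x m)
        case x (inj₂ m) = inj₂ (inj₁ (conn-refl es , d₂ x m))
        pr : ∀ x → applyAll v x ≡ ρ x
        pr x with mem? _≟_ x S₁ | mem? _≟_ x S₂ | applyAll-comb disj t u A.perm B.perm A.supp B.supp x
        ... | yes m | _ | a , b , c = trans (proj₂ (a m)) (trans (A.prod x) (rf-in S₁ ρ x m))
        ... | no _ | yes m | a , b , c = trans (proj₂ (b m)) (trans (B.prod x) (rf-in S₂ ρ x m))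
        ... | no p | no r | a , b , c = trans (c p r) (sym (Decomp.fixed dec x λ m →
                out (∈-++⁻ S₁ (subst (x ∈_) (sym (LP.concat-++ ((e ∷ zs) ∷ cs₁) ((i ∷ ys) ∷ cs₂))) m))))
          where
          out : x ∈ S₁ ⊎ x ∈ S₂ → ⊥
          out (inj₁ m) = p m
          out (inj₂ m) = r m

      restrict₁ : restrT S₁ v ≡ t
      restrict₁ = go t u A.perm B.perm A.supp B.supp
        where
        go : ∀ {m} (t u : Tuple n m) → (∀ l → IsPerm (lookup t l)) → (∀ l → IsPerm (lookup u l)) →
          (∀ l x → x ∉ S₁ → lookup (lookup t l) x ≡ x) → (∀ l x → x ∉ S₂ → lookup (lookup u l) x ≡ x) → restrT S₁ (combT t u) ≡ t
        go [] [] _ _ _ _ = refl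
        go (f ∷ t) (g ∷ u) pt pu st su = cong₂ _∷_ (restr-comb₁ disj f g (pt zero) (pu zero) (st zero) (su zero))
          (go t u (λ l → pt (suc l)) (λ l → pu (suc l)) (λ l → st (suc l)) (λ l → su (suc l)))

      restrict₂ : restrT S₂ v ≡ u
      restrict₂ = go t u A.perm B.perm A.supp B.supp
        where
        go : ∀ {m} (t u : Tuple n m) → (∀ l → IsPerm (lookup t l)) → (∀ l → IsPerm (lookup u l)) →
          (∀ l x → x ∉ S₁ → lookup (lookup t l) x ≡ x) → (∀ l x → x ∉ S₂ → lookup (lookup u l) x ≡ x) → restrT S₂ (combT t u) ≡ u
        go [] [] _ _ _ _ = refl
        go (f ∷ t) (g ∷ u) pt pu st su = cong₂ _∷_ (restr-comb₂ disj f g (pt zero) (pu zero) (st zero) (su zero))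
          (go t u (λ l → pt (suc l)) (λ l → pu (suc l)) (λ l → st (suc l)) (λ l → su (suc l)))

      cycles : totalCycles v + m * n ≡ totalCycles t + totalCycles u
      cycles = trans (totalCycles-parts disj u₁ u₂ v part) (cong₂ _+_ (cong totalCycles restrict₁) (cong totalCycles restrict₂))

-- The genus bound.

module GenusBound where

  open import Defs
  open import Data.Nat using (ℕ; zero; suc; _≤_; z≤n; s≤s; _+_; _*_)
  import Data.Nat.Properties as ℕP
  open import Data.Nat.Solver using (module +-*-Solver)
  open import Data.Fin using (Fin; toℕ; zero; suc; fromℕ<)
  import Data.Fin.Properties as FP
  open import Data.Fin.Properties using (_≟_)
  open import Data.Vec using ([]; _∷_; lookup)
  open import Data.List using (List; []; _∷_; _++_; length; concat)
  import Data.List.Properties as LP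
  open import Data.List.Membership.Propositional using (_∈_)
  open import Data.List.Membership.Propositional.Properties using (∈-++⁺ˡ; ∈-++⁺ʳ; ∈-++⁻; ∈-∃++)
  open import Data.List.Membership.DecPropositional using () renaming (_∈?_ to mem?)
  open import Data.List.Relation.Unary.Any using (here; there)
  open import Data.List.Relation.Unary.All as All using (All; []; _∷_)
  open import Data.List.Relation.Unary.AllPairs using ([]; _∷_)
  open import Data.List.Relation.Binary.Permutation.Propositional using (_↭_; prep; ↭-sym; ↭-reflexive) renaming (refl to ↭r; trans to ↭t)
  import Data.List.Relation.Binary.Permutation.Propositional.Properties as ↭P
  open import Data.Product using (∃; _×_; _,_)
  open import Data.Sum using (_⊎_; inj₁; inj₂)
  open import Data.Empty using (⊥-elim)
  open import Function using (_∘_; id)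
  open import Relation.Nullary using (yes; no)
  open import Relation.Binary.PropositionalEquality using (_≡_; refl; sym; trans; cong; subst; cong₂)
  open Rings
  open CycleDecompositions
  open GraphsAndCounts
  open CycleCounts
  open Factorizations
  open TwoComponents

  private
    variable
      n m : ℕ

  drop-edge : ∀ {k e i S ρ} {t : Tuple n m} → conn (edgesOf t) e i → Sys k e S ρ ((e , i) ∷ []) t → Sys k e S ρ [] t
  drop-edge {e = e} {i} {t = t} h s = record { perm = perm ; supp = supp ; prod = prod ; fixe = fixe
    ; conn-S = λ x m → case (conn-S x m) }
    where
    open Sys s
    es = edgesOf t
    case : ∀ {x} → conn ((e , i) ∷ es) e x → conn es e x
    case (inj₁ p) = p
    case (inj₂ (inj₁ (_ , q))) = conn-trans es h q
    case (inj₂ (inj₂ (_ , q))) = q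

  add-edge : ∀ {k e i S ρ} {t : Tuple n m} → Sys k e S ρ [] t → Sys k e S ρ ((e , i) ∷ []) t
  add-edge s = record { perm = perm ; supp = supp ; prod = prod ; fixe = fixe ; conn-S = λ x m → inj₁ (conn-S x m) }
    where open Sys s

  -- The case i = e of the index: as the tail fixes e, the factor at l fixes it as well.
  lower : ∀ {k e S ρ ex} {t : Tuple n m} (l : Fin m) → toℕ l ≡ k → lookup (lookup t l) (tp t l e) ≡ e →
          Sys (suc k) e S ρ ex t → Sys k e S ρ ex t
  lower {e = e} {t = t} l refl I s = record { perm = perm ; supp = supp ; prod = prod ; conn-S = conn-S ; fixe = fx }
    where
    open Sys s
    fx : ∀ l′ → toℕ l ≤ toℕ l′ → lookup (lookup t l′) e ≡ e
    fx l′ h with l′ ≟ l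
    ... | yes refl = trans (cong (lookup (lookup t l)) (sym (tp-fix t l e fixe))) I
    ... | no q = fixe l′ (ℕP.≤∧≢⇒< h λ r → q (FP.toℕ-injective (sym r)))

  raise : ∀ {k e S ρ ex} {t : Tuple n m} (l : Fin m) → toℕ l ≡ k → Sys k e S ρ ex t →
          Sys (suc k) e S ρ ex t × lookup (lookup t l) (tp t l e) ≡ e
  raise {e = e} {t = t} l refl s = record { perm = perm ; supp = supp ; prod = prod ; conn-S = conn-S
    ; fixe = λ l′ h → fixe l′ (ℕP.≤-trans (ℕP.n≤1+n _) h) }
    , trans (cong (lookup (lookup t l)) (tp-fix t l e λ l′ h → fixe l′ (ℕP.≤-trans (ℕP.n≤1+n _) h))) (fixe l ℕP.≤-refl)
    where open Sys s

  index : ∀ {k e S ρ ex} (t : Tuple n m) (l : Fin m) → e ∈ S → Sys k e S ρ ex t →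
          ∃ λ i → i ∈ S × lookup (lookup t l) (tp t l i) ≡ e
  index {e = e} {S} t l e∈ s with surjective (λ x → lookup (lookup t l) (tp t l x))
      (λ x y q → tp-Inj t l (Sys.perm s) x y (Sys.perm s l _ _ q)) e
  ... | i , h with mem? _≟_ i S
  ... | yes q = i , q , h
  ... | no q = ⊥-elim (q (subst (_∈ S) (sym (trans (sym (trans (cong (lookup (lookup t l)) (tp-fix t l i λ l′ _ → Sys.supp s l′ i q)) (Sys.supp s l i q))) h)) e∈))

  index-unique : ∀ {k e S ρ ex} (t : Tuple n m) (l : Fin m) → Sys k e S ρ ex t → ∀ i j →
          lookup (lookup t l) (tp t l i) ≡ e → lookup (lookup t l) (tp t l j) ≡ e → i ≡ j
  index-unique t l s i j p q = tp-Inj t l (Sys.perm s) i j (Sys.perm s l _ _ (trans p (sym q)))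

  -- At level 0 every factor fixes e, so e is a component by itself and connectivity leaves no other
  -- point.
  Sys0-single : ∀ {e S ρ} (t : Tuple n m) → Sys 0 e S ρ [] t → ∀ x → x ∈ S → x ≡ e
  Sys0-single {n} {e = e} t s x m = case (conn-min E (edgesOf t) edge (Sys.conn-S s x m))
    where
    R : Fin n → Fin n → Set
    R x y = (x ≡ e → y ≡ e) × (y ≡ e → x ≡ e)
    E : Equiv R
    E = record { rfl = id , id ; sm = λ (a , b) → b , a ; tr = λ (a , b) (c , d) → c ∘ a , b ∘ d }
    edge : ∀ {a b} → (a , b) ∈ edgesOf t → R a b
    edge {a} h with edge-inv t h
    ... | l , refl = (λ { refl → Sys.fixe s l z≤n }) , λ q → Sys.perm s l a e (trans q (sym (Sys.fixe s l z≤n)))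
    case : R e x → x ≡ e
    case (a , _) = a refl

  Sys0-trivial : ∀ {e xs cs ρ S} (t : Tuple n m) → S ↭ concat ((e ∷ xs) ∷ cs) → Decomp ρ ((e ∷ xs) ∷ cs) → Sys 0 e S ρ [] t →
    xs ≡ [] × cs ≡ [] × (∀ l x → lookup (lookup t l) x ≡ x)
  Sys0-trivial {n} {e = e} {xs} {cs} {ρ} {S} t p (decomp cy u _) s = nil-xs xs refl , nil-cs cs refl cy , ident
    where
    single : ∀ x → x ∈ concat ((e ∷ xs) ∷ cs) → x ≡ e
    single x m = Sys0-single t s x (↭P.∈-resp-↭ (↭-sym p) m)
    nil-xs : ∀ ys → ys ≡ xs → xs ≡ []
    nil-xs [] q = sym q
    nil-xs (y ∷ ys) refl = ⊥-elim (∉-head u (∈-++⁺ˡ {xs = y ∷ ys} (here (sym (single y (there (here refl)))))))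
    nil-cs : ∀ ds → ds ≡ cs → All (Cyc ρ) ((e ∷ xs) ∷ ds) → cs ≡ []
    nil-cs [] q _ = sym q
    nil-cs ([] ∷ ds) q (_ ∷ () ∷ _)
    nil-cs ((y ∷ ys) ∷ ds) refl _ = ⊥-elim (∉-head u (∈-++⁺ʳ xs (here (sym (single y (there (∈-++⁺ʳ xs (here refl))))))))
    ident : ∀ l x → lookup (lookup t l) x ≡ x
    ident l x with mem? _≟_ x S
    ... | no q = Sys.supp s l x q
    ... | yes q with Sys0-single t s x q
    ... | refl = Sys.fixe s l z≤n

  totalCycles-id : ∀ {m} (t : Tuple n m) → (∀ l x → lookup (lookup t l) x ≡ x) → totalCycles t ≡ m * n
  totalCycles-id [] h = refl
  totalCycles-id {n} (σ ∷ t) h = cong₂ _+_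
    (trans (sym (ℕP.+-identityʳ _)) (ncycles-Decomp σ [] (decomp [] [] (λ x _ → h zero x))))
    (totalCycles-id t (λ l → h (suc l)))

  merge-front : ∀ {ρ : Fin n → Fin n} {c d : List (Fin n)} pre suf → Decomp ρ (d ∷ pre ++ c ∷ suf) → Decomp ρ (d ∷ c ∷ pre ++ suf)
  merge-front {c = c} pre suf = Decomp-↭ (prep _ (↭P.shift c pre suf))

  -- All factors fix the n - |S| points outside S, which adds m (n - |S|) cycles. Without them the
  -- inequality is the familiar T + l ≤ (m - 1) |S| + 2; in this form it can be added up over
  -- components within the same n points.
  Bound : (n m N k : ℕ) → Set
  Bound n m N k = ∀ e xs cs (ρ : Fin n → Fin n) S (t : Tuple n m) → length S ≤ N → k ≤ m → S ↭ concat ((e ∷ xs) ∷ cs) →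
    Decomp ρ ((e ∷ xs) ∷ cs) → Sys k e S ρ [] t → totalCycles t + suc (length cs) + length S ≤ m * n + 2

  -- Passing to level k adds one cycle to the factors. If i lies in another cycle of the product,
  -- merging compensates for it. If i lies in the cycle of e, splitting adds one more: either the
  -- tuple is still transitive and the bound holds with room to spare, or the bounds of its two
  -- smaller components add up.
  bound-step : ∀ {N k} → Bound n m (suc N) k → (∀ k → Bound n m N k) → Bound n m (suc N) (suc k)
  bound-step {n} {m} {N} {k} IHk IHN e xs cs ρ S t l≤ k<m p dec s with index t (fromℕ< k<m) (↭P.∈-resp-↭ (↭-sym p) (here refl)) s
  ... | i , i∈ , I with i ≟ e
  ... | yes refl = IHk e xs cs ρ S t l≤ (ℕP.<⇒≤ k<m) p dec (lower (fromℕ< k<m) (FP.toℕ-fromℕ< k<m) I s)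
  ... | no i≢e = cases (∈-++⁻ xs (tail∈ (↭P.∈-resp-↭ p i∈)))
    where
    tail∈ : i ∈ concat ((e ∷ xs) ∷ cs) → i ∈ xs ++ concat cs
    tail∈ (here q) = ⊥-elim (i≢e q)
    tail∈ (there q) = q
    l = fromℕ< k<m
    l≡k = FP.toℕ-fromℕ< k<m
    e∈ = ↭P.∈-resp-↭ (↭-sym p) (here refl)
    module St = Step e l i S e∈ i∈
    t′ = Φ e l i t
    s′ = St.forward l≡k t s I
    ρ′ : Fin n → Fin n
    ρ′ x = ρ (τ e i x)
    tot : suc (totalCycles t) ≡ totalCycles t′
    tot = trans (cong (suc ∘ totalCycles) (sym (Φ-inv e l i t))) (St.cycles-step l≡k t′ i≢e s′)
    k≤ = ℕP.<⇒≤ k<m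
    open +-*-Solver
    cases : i ∈ xs ⊎ i ∈ concat cs → totalCycles t + suc (length cs) + length S ≤ m * n + 2
    cases (inj₂ q) with find-cycle cs q
    ... | d₁ , d₂ , c₁ , c₂ , refl = subst (λ a → a + length S ≤ m * n + 2) eq
        (IHk e ((c₂ ++ c₁) ++ i ∷ xs) (d₁ ++ d₂) ρ′ S t′ l≤ k≤ p′ dec′ (drop-edge conn-i s′))
      where
      front = merge-front {c = c₁ ++ i ∷ c₂} d₁ d₂ dec
      dec′ = merge c₁ i c₂ front
      p′ : S ↭ concat ((e ∷ (c₂ ++ c₁) ++ i ∷ xs) ∷ d₁ ++ d₂)
      p′ = ↭t p (↭t (concat-↭ (prep (e ∷ xs) (↭P.shift (c₁ ++ i ∷ c₂) d₁ d₂))) (merge-↭ {f = ρ} e xs c₁ i c₂ (d₁ ++ d₂)))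
      conn-i : conn (edgesOf t′) e i
      conn-i = conn-path ρ′ t′ (Sys.prod s′) e ((c₂ ++ c₁) ++ i ∷ xs) (All.head (Decomp.cycles dec′)) i (there (∈-++⁺ʳ (c₂ ++ c₁) (here refl)))
      eq : totalCycles t′ + suc (length (d₁ ++ d₂)) ≡ totalCycles t + suc (length (d₁ ++ (c₁ ++ i ∷ c₂) ∷ d₂))
      eq = trans (cong (_+ suc (length (d₁ ++ d₂))) (sym tot)) (trans (sym (ℕP.+-suc (totalCycles t) _))
        (cong (λ a → totalCycles t + suc a) (sym (↭P.↭-length (↭P.shift (c₁ ++ i ∷ c₂) d₁ d₂)))))
    cases (inj₁ q) with ∈-∃++ q
    ... | ys , zs , refl with conn? (edgesOf t′) e i
    ... | yes c = ℕP.≤-trans (ℕP.+-monoˡ-≤ (length S) (ℕP.≤-trans (ℕP.m≤n⇒m≤1+n (ℕP.n≤1+n _)) (ℕP.≤-reflexive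
          (trans (solve 2 (λ a b → con 2 :+ (a :+ b) := (con 1 :+ a) :+ (con 1 :+ b)) refl (totalCycles t) (suc (length cs)))
            (cong (_+ suc (suc (length cs))) tot)))))
        (IHk e zs ((i ∷ ys) ∷ cs) ρ′ S t′ l≤ k≤ (↭t p (split-↭ {f = ρ} e ys i zs cs)) (split ys i zs dec) (drop-edge c s′))
    ... | no c with classify ρ′ t′ (Sys.prod s′) e i cs (All.tail (All.tail (Decomp.cycles (split ys i zs dec)))) near
      where
      near : ∀ x → x ∈ concat cs → conn (edgesOf t′) e x ⊎ conn (edgesOf t′) i x
      near x m = case (Sys.conn-S s′ x (↭P.∈-resp-↭ (↭-sym p) (∈-++⁺ʳ (e ∷ ys ++ i ∷ zs) m)))
        where
        case : conn ((e , i) ∷ edgesOf t′) e x → conn (edgesOf t′) e x ⊎ conn (edgesOf t′) i x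
        case (inj₁ h) = inj₁ h
        case (inj₂ (inj₁ (_ , h))) = inj₂ h
        case (inj₂ (inj₂ (h , _))) = ⊥-elim (c h)
    -- The added m n accounts for the fixed points counted twice when both components live on all n
    -- points, and the added 2 for the cycle gained by the factors and the one gained by the
    -- product.
    ... | cs₁ , cs₂ , cs↭ , h₁ , h₂ = ℕP.+-cancelʳ-≤ (suc (suc (m * n))) _ _ (begin
        (totalCycles t + suc (length cs) + length S) + suc (suc (m * n))
          ≡⟨ solve 4 (λ a b s x → ((a :+ (con 1 :+ b)) :+ s) :+ (con 2 :+ x) := (((con 1 :+ a) :+ x) :+ (con 2 :+ b)) :+ s) refl (totalCycles t) (length cs) (length S) (m * n) ⟩
        ((suc (totalCycles t) + m * n) + suc (suc (length cs))) + length S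
          ≡⟨ cong₂ (λ a b → (a + suc (suc b)) + length S) (trans (cong (_+ m * n) tot) Sp.cycles) (trans (↭P.↭-length cs↭) (LP.length-++ cs₁)) ⟩
        ((T₁ + T₂) + suc (suc (length cs₁ + length cs₂))) + length S
          ≡⟨ cong (((T₁ + T₂) + suc (suc (length cs₁ + length cs₂))) +_) (trans (↭P.↭-length S↭) (LP.length-++ C.S₁)) ⟩
        ((T₁ + T₂) + suc (suc (length cs₁ + length cs₂))) + (length C.S₁ + length C.S₂)
          ≡⟨ solve 6 (λ a b c d s t → ((a :+ b) :+ (con 2 :+ (c :+ d))) :+ (s :+ t) := ((a :+ (con 1 :+ c)) :+ s) :+ ((b :+ (con 1 :+ d)) :+ t)) refl
               T₁ T₂ (length cs₁) (length cs₂) (length C.S₁) (length C.S₂) ⟩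
        (T₁ + suc (length cs₁) + length C.S₁) + (T₂ + suc (length cs₂) + length C.S₂)
          ≤⟨ ℕP.+-mono-≤ (IHN k e zs cs₁ (rf C.S₁ ρ′) C.S₁ (restrT C.S₁ t′) small₁ k≤ ↭r C.dec₁ Sp.sys₁)
               (IHN m i ys cs₂ (rf C.S₂ ρ′) C.S₂ (restrT C.S₂ t′) small₂ ℕP.≤-refl ↭r C.dec₂ Sp.sys₂) ⟩
        (m * n + 2) + (m * n + 2)
          ≡⟨ solve 1 (λ x → (x :+ con 2) :+ (x :+ con 2) := (x :+ con 2) :+ (con 2 :+ x)) refl (m * n) ⟩
        (m * n + 2) + suc (suc (m * n)) ∎)
      where
      open ℕP.≤-Reasoning
      arrange : (e ∷ zs) ∷ (i ∷ ys) ∷ cs ↭ ((e ∷ zs) ∷ cs₁) ++ ((i ∷ ys) ∷ cs₂)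
      arrange = prep (e ∷ zs) (↭t (prep (i ∷ ys) cs↭) (↭-sym (↭P.shift (i ∷ ys) cs₁ cs₂)))
      module C = Components {m = m} {k = k} {cs₁ = cs₁} {cs₂ = cs₂} (Decomp-↭ arrange (split ys i zs dec))
      S↭ : S ↭ C.S₁ ++ C.S₂
      S↭ = ↭t p (↭t (split-↭ {f = ρ} e ys i zs cs) (↭t (concat-↭ arrange) (↭-reflexive (sym (LP.concat-++ ((e ∷ zs) ∷ cs₁) ((i ∷ ys) ∷ cs₂))))))
      module Sp = C.Split S S↭ t′ s′ c h₁ h₂
      T₁ = totalCycles (restrT C.S₁ t′)
      T₂ = totalCycles (restrT C.S₂ t′)
      sum≤ : length C.S₁ + length C.S₂ ≤ suc N
      sum≤ = subst (_≤ suc N) (trans (↭P.↭-length S↭) (LP.length-++ C.S₁)) l≤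
      small₁ : length C.S₁ ≤ N
      small₁ = ℕP.≤-pred (ℕP.≤-trans (ℕP.≤-trans (ℕP.≤-reflexive (ℕP.+-comm 1 _)) (ℕP.+-monoʳ-≤ (length C.S₁) (s≤s z≤n))) sum≤)
      small₂ : length C.S₂ ≤ N
      small₂ = ℕP.≤-pred (ℕP.≤-trans (ℕP.+-monoˡ-≤ (length C.S₂) {1} {length C.S₁} (s≤s z≤n)) sum≤)

  -- The Riemann–Hurwitz bound; equality means genus 0.
  bound : ∀ N k → Bound n m N k
  bound N zero e xs cs ρ S t _ _ p dec s with Sys0-trivial t p dec s
  ... | refl , refl , h = ℕP.≤-reflexive (trans (cong₂ (λ a b → a + 1 + b) (totalCycles-id t h) (↭P.↭-length p))
    (ℕP.+-assoc _ 1 1))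
  bound zero (suc k) e xs cs ρ S t l≤ _ p dec s = ⊥-elim (ℕP.<⇒≱ (s≤s z≤n) (subst (_≤ 0) (↭P.↭-length p) l≤))
  bound (suc N) (suc k) = bound-step (bound (suc N) k) (bound N)

-- The recurrence for planar factorizations.

module RecursiveCount where

  open import Defs
  open import Data.Nat using (ℕ; zero; suc; _≤_; z≤n; s≤s; _+_; _*_)
  import Data.Nat.Properties as ℕP
  open import Data.Nat.Solver using (module +-*-Solver)
  open import Data.Rational as ℚ using (ℚ; 0ℚ; 1ℚ)
  import Data.Rational.Properties as ℚP
  open import Data.Fin using (Fin; zero; suc; fromℕ<)
  import Data.Fin.Properties as FP
  open import Data.Fin.Properties using (_≟_)
  open import Data.Vec as Vec using (Vec; []; _∷_; lookup; tabulate)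
  import Data.Vec.Properties as VP
  open import Data.List using (List; []; _∷_; _++_; length; concat; map)
  import Data.List.Properties as LP
  open import Data.List.Membership.Propositional using (_∈_; _∉_)
  open import Data.List.Membership.Propositional.Properties using (∈-++⁺ˡ; ∈-++⁺ʳ; ∈-++⁻)
  open import Data.List.Relation.Unary.Any using (here; there)
  open import Data.List.Relation.Unary.All as All using (All; []; _∷_)
  import Data.List.Relation.Unary.All.Properties as AllP
  open import Data.List.Relation.Unary.AllPairs using ([]; _∷_)
  open import Data.List.Relation.Unary.Unique.Propositional using (Unique)
  open import Data.List.Relation.Binary.Permutation.Propositional using (_↭_; prep; ↭-sym; ↭-reflexive) renaming (refl to ↭r; trans to ↭t)
  import Data.List.Relation.Binary.Permutation.Propositional.Properties as ↭P
  open import Data.Product using (Σ; ∃; _×_; _,_; proj₁; proj₂)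
  open import Data.Sum using (_⊎_; inj₁; inj₂)
  open import Data.Empty using (⊥; ⊥-elim)
  open import Function using (_∘_; id)
  open import Relation.Nullary using (¬_; yes; no)
  open import Relation.Binary.PropositionalEquality using (_≡_; _≢_; refl; sym; trans; cong; subst; cong₂)
  open Rings
  open CycleDecompositions
  open GraphsAndCounts
  open CycleCounts
  open Factorizations
  open TwoComponents
  open GenusBound

  open Shuffle ℚP.+-*-commutativeRing using (_⊠_; Sh)

  -- The element Σ_b p_b f(b) of the shuffle ring, written as a sum over the positions of the list.
  -- The weight b counts the points of a cycle at which another cycle can be attached.
  posSum : (ℕ → Sh) → Sh
  posSum f [] = 0ℚ
  posSum f (b ∷ β) = ℕtoℚ b ℚ.* f b β ℚ.+ posSum (λ b′ γ → f b′ (b ∷ γ)) β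

  posSum-cong : ∀ {f g : ℕ → Sh} → (∀ b γ → f b γ ≡ g b γ) → ∀ β → posSum f β ≡ posSum g β
  posSum-cong h [] = refl
  posSum-cong h (b ∷ β) = cong₂ ℚ._+_ (cong (ℕtoℚ b ℚ.*_) (h b β)) (posSum-cong (λ b′ γ → h b′ (b ∷ γ)) β)

  ⊠-cong : ∀ {f f′ g g′ : Sh} → (∀ β → f β ≡ f′ β) → (∀ β → g β ≡ g′ β) → ∀ β → (f ⊠ g) β ≡ (f′ ⊠ g′) β
  ⊠-cong p q [] = cong₂ ℚ._*_ (p []) (q [])
  ⊠-cong p q (b ∷ β) = cong₂ ℚ._+_ (⊠-cong (λ γ → p (b ∷ γ)) q β) (⊠-cong p (λ γ → q (b ∷ γ)) β)

  count-≡ : {A : Set} {P : A → Set} {q r : ℚ} → q ≡ r → Count P q → Count P r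
  count-≡ refl c = c

  ℕtoℚ-suc* : ∀ k h → ℕtoℚ (suc k) ℚ.* h ≡ h ℚ.+ ℕtoℚ k ℚ.* h
  ℕtoℚ-suc* k h = trans (cong (ℚ._* h) (ℕtoℚ-+ 1 k)) (trans (ℚP.*-distribʳ-+ h 1ℚ (ℕtoℚ k)) (cong (ℚ._+ ℕtoℚ k ℚ.* h) (ℚP.*-identityˡ h)))

  module Counting (n m : ℕ) (H : ℕ → ℕ → Sh) (OK : ℕ → Set) where

    -- `o` counts the points between e and the place of the cut. They stay with the component that
    -- loses e, which explains the factor `H m o`; the points after the cut stay with e.
    convQ : ℕ → ℕ → ℕ → Sh
    convQ k o zero β = 0ℚ
    convQ k o (suc a) β = (H k a ⊠ H m o) β ℚ.+ convQ k (suc o) a β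

    -- Genus 0 as equality in the bound, on an arbitrary support so that components are of the same
    -- kind.
    Planar : ℕ → Fin n → List (List (Fin n)) → List (Fin n) → (Fin n → Fin n) → Tuple n m → Set
    Planar k e cs S ρ t = Sys k e S ρ [] t × totalCycles t + suc (length cs) + length S ≡ m * n + 2

    CountIH : ℕ → ℕ → Set
    CountIH N k = ∀ e xs cs ρ S → length S ≤ N → k ≤ m → S ↭ concat ((e ∷ xs) ∷ cs) →
      Decomp ρ ((e ∷ xs) ∷ cs) → All OK (map length cs) → Count (Planar k e cs S ρ) (H k (length xs) (map length cs))

    map-++-∷ʳ : (A : List (List (Fin n))) (c : List (Fin n)) (γ : List ℕ) → map length A ++ length c ∷ γ ≡ map length (A ++ c ∷ []) ++ γ
    map-++-∷ʳ A c γ = trans (sym (LP.++-assoc (map length A) (length c ∷ []) γ)) (cong (_++ γ) (sym (LP.map-++ length A (c ∷ []))))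

    OK-↭ : ∀ {as bs : List (List (Fin n))} → as ↭ bs → All OK (map length as) → All OK (map length bs)
    OK-↭ p = ↭P.All-resp-↭ (↭P.map⁺ length p)

    -- The cycles of cs are distributed over the two components one at a time; A₁ and A₂ are already assigned.
    module SplitCount {N k : ℕ} (IHN : ∀ k → CountIH N k) (k≤m : k ≤ m) (e i : Fin n) (zs ys : List (Fin n))
                      (ρ : Fin n → Fin n) (S : List (Fin n)) (S≤ : length S ≤ suc N) (L : ℕ) where

      -- Splitting raises the planar sum by 2. Two planar components give the same value: 2 (m n +
      -- 2), minus the m n fixed points that are counted twice.
      Q : List (List (Fin n)) → List (List (Fin n)) → Tuple n m → Set
      Q A₁ A₂ t = Sys k e S ρ ((e , i) ∷ []) t × (totalCycles t + L + length S ≡ (m * n + 2) + 2) ×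
        ¬ conn (edgesOf t) e i × (∀ x → x ∈ concat A₁ → conn (edgesOf t) e x) × (∀ x → x ∈ concat A₂ → conn (edgesOf t) i x)

      private
        Hyp : List (List (Fin n)) → List (List (Fin n)) → List (List (Fin n)) → Set
        Hyp A₁ A₂ cs = Decomp ρ (((e ∷ zs) ∷ A₁) ++ ((i ∷ ys) ∷ A₂) ++ cs) × S ↭ concat (((e ∷ zs) ∷ A₁) ++ ((i ∷ ys) ∷ A₂) ++ cs) ×
          All OK (map length (A₁ ++ A₂ ++ cs)) × length (((e ∷ zs) ∷ A₁) ++ ((i ∷ ys) ∷ A₂) ++ cs) ≡ L

        base : ∀ A₁ A₂ → Hyp A₁ A₂ [] → Count (Q A₁ A₂) (H k (length zs) (map length A₁) ℚ.* H m (length ys) (map length A₂))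
        base A₁ A₂ (dec₀ , S↭₀ , ok , len) = count-map (λ { (t , u) → combT t u }) inj to from
            (count-× (IHN k e zs A₁ (rf C.S₁ ρ) C.S₁ small₁ k≤m ↭r C.dec₁ (AllP.++⁻ˡ (map length A₁) ok′))
                     (IHN m i ys A₂ (rf C.S₂ ρ) C.S₂ small₂ ℕP.≤-refl ↭r C.dec₂ (AllP.++⁻ʳ (map length A₁) ok′)))
          where
          open +-*-Solver
          nil : ((e ∷ zs) ∷ A₁) ++ ((i ∷ ys) ∷ A₂) ++ [] ≡ ((e ∷ zs) ∷ A₁) ++ ((i ∷ ys) ∷ A₂)
          nil = cong (((e ∷ zs) ∷ A₁) ++_) (LP.++-identityʳ ((i ∷ ys) ∷ A₂))
          ok′ : All OK (map length A₁ ++ map length A₂)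
          ok′ = subst (All OK) (trans (cong (λ l → map length (A₁ ++ l)) (LP.++-identityʳ A₂)) (LP.map-++ length A₁ A₂)) ok
          module C = Components {m = m} {k = k} {cs₁ = A₁} {cs₂ = A₂} (subst (Decomp ρ) nil dec₀)
          S↭ : S ↭ C.S₁ ++ C.S₂
          S↭ = ↭t S↭₀ (↭-reflexive (trans (cong concat nil) (sym (LP.concat-++ ((e ∷ zs) ∷ A₁) ((i ∷ ys) ∷ A₂)))))
          lenS : length S ≡ length C.S₁ + length C.S₂
          lenS = trans (↭P.↭-length S↭) (LP.length-++ C.S₁)
          L≡ : L ≡ suc (length A₁) + suc (length A₂)
          L≡ = trans (sym len) (trans (cong length nil) (LP.length-++ ((e ∷ zs) ∷ A₁)))
          sum≤ : length C.S₁ + length C.S₂ ≤ suc N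
          sum≤ = subst (_≤ suc N) lenS S≤
          small₁ : length C.S₁ ≤ N
          small₁ = ℕP.≤-pred (ℕP.≤-trans (ℕP.≤-trans (ℕP.≤-reflexive (ℕP.+-comm 1 _)) (ℕP.+-monoʳ-≤ (length C.S₁) (s≤s z≤n))) sum≤)
          small₂ : length C.S₂ ≤ N
          small₂ = ℕP.≤-pred (ℕP.≤-trans (ℕP.+-monoˡ-≤ (length C.S₂) {1} {length C.S₁} (s≤s z≤n)) sum≤)
          P₁ = Planar k e A₁ C.S₁ (rf C.S₁ ρ)
          P₂ = Planar m i A₂ C.S₂ (rf C.S₂ ρ)
          inj : ∀ a b → P₁ (proj₁ a) × P₂ (proj₂ a) → P₁ (proj₁ b) × P₂ (proj₂ b) → combT (proj₁ a) (proj₂ a) ≡ combT (proj₁ b) (proj₂ b) → a ≡ b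
          inj (t , u) (t′ , u′) ((a , _) , (b , _)) ((a′ , _) , (b′ , _)) q = cong₂ _,_
            (trans (sym (C.Join.restrict₁ S S↭ t u a b)) (trans (cong (restrT C.S₁) q) (C.Join.restrict₁ S S↭ t′ u′ a′ b′)))
            (trans (sym (C.Join.restrict₂ S S↭ t u a b)) (trans (cong (restrT C.S₂) q) (C.Join.restrict₂ S S↭ t′ u′ a′ b′)))
          rearr : ∀ a b → (a + b) + L + length S ≡ (a + suc (length A₁) + length C.S₁) + (b + suc (length A₂) + length C.S₂)
          rearr a b = trans (cong₂ (λ x y → (a + b) + x + y) L≡ lenS)
            (solve 6 (λ a b c d s t → ((a :+ b) :+ ((con 1 :+ c) :+ (con 1 :+ d))) :+ (s :+ t) := ((a :+ (con 1 :+ c)) :+ s) :+ ((b :+ (con 1 :+ d)) :+ t)) refl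
              a b (length A₁) (length A₂) (length C.S₁) (length C.S₂))
          shift : ∀ t T U → t + m * n ≡ T + U → (t + L + length S) + m * n ≡ (T + U) + L + length S
          shift t T U q = trans (solve 4 (λ t L S x → ((t :+ L) :+ S) :+ x := ((t :+ x) :+ L) :+ S) refl t L (length S) (m * n)) (cong (λ z → z + L + length S) q)
          to : ∀ a → P₁ (proj₁ a) × P₂ (proj₂ a) → Q A₁ A₂ (combT (proj₁ a) (proj₂ a))
          to (t , u) ((a , qa) , (b , qb)) = J.sys , ℕP.+-cancelʳ-≡ (m * n) _ _ (trans (shift (totalCycles (combT t u)) (totalCycles t) (totalCycles u) J.cycles) (trans (rearr (totalCycles t) (totalCycles u)) (trans (cong₂ _+_ qa qb)
              (solve 1 (λ x → (x :+ con 2) :+ (x :+ con 2) := ((x :+ con 2) :+ con 2) :+ x) refl (m * n))))) , J.sep ,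
            (λ x h → J.d₁ x (∈-++⁺ʳ (e ∷ zs) h)) , (λ x h → J.d₂ x (∈-++⁺ʳ (i ∷ ys) h))
            where module J = C.Join S S↭ t u a b
          from : ∀ v → Q A₁ A₂ v → Σ (Tuple n m × Tuple n m) λ a → (P₁ (proj₁ a) × P₂ (proj₂ a)) × combT (proj₁ a) (proj₂ a) ≡ v
          from v (s , q , ne , h₁ , h₂) = (restrT C.S₁ v , restrT C.S₂ v) , ((Sp.sys₁ , eq₁) , (Sp.sys₂ , eq₂)) , Sp.recombine
            where
            module Sp = C.Split S S↭ v s ne h₁ h₂
            X = totalCycles (restrT C.S₁ v) + suc (length A₁) + length C.S₁
            Y = totalCycles (restrT C.S₂ v) + suc (length A₂) + length C.S₂
            b₁ : X ≤ m * n + 2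
            b₁ = bound N k e zs A₁ (rf C.S₁ ρ) C.S₁ (restrT C.S₁ v) small₁ k≤m ↭r C.dec₁ Sp.sys₁
            b₂ : Y ≤ m * n + 2
            b₂ = bound N m i ys A₂ (rf C.S₂ ρ) C.S₂ (restrT C.S₂ v) small₂ ℕP.≤-refl ↭r C.dec₂ Sp.sys₂
            X+Y : X + Y ≡ (m * n + 2) + (m * n + 2)
            X+Y = trans (sym (rearr (totalCycles (restrT C.S₁ v)) (totalCycles (restrT C.S₂ v)))) (trans (sym (shift (totalCycles v) (totalCycles (restrT C.S₁ v)) (totalCycles (restrT C.S₂ v)) Sp.cycles)) (trans (cong (_+ m * n) q)
              (solve 1 (λ x → ((x :+ con 2) :+ con 2) :+ x := (x :+ con 2) :+ (x :+ con 2)) refl (m * n))))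
            -- Two bounded quantities whose sum attains the sum of their bounds both attain them, so
            -- both components are planar.
            eq₁ : X ≡ m * n + 2
            eq₁ = ℕP.≤-antisym b₁ (ℕP.+-cancelʳ-≤ (m * n + 2) _ _ (subst (_≤ X + (m * n + 2)) X+Y (ℕP.+-monoʳ-≤ X b₂)))
            eq₂ : Y ≡ m * n + 2
            eq₂ = ℕP.+-cancelˡ-≡ (m * n + 2) _ _ (trans (cong (_+ Y) (sym eq₁)) X+Y)

      -- The next cycle of the product goes to exactly one of the components. This alternative is
      -- the recursive clause of the shuffle product.
      countQ : ∀ cs A₁ A₂ → Hyp A₁ A₂ cs →
        Count (Q A₁ A₂) (((λ γ → H k (length zs) (map length A₁ ++ γ)) ⊠ (λ γ → H m (length ys) (map length A₂ ++ γ))) (map length cs))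
      countQ [] A₁ A₂ hyp = count-≡ (cong₂ ℚ._*_ (cong (H k (length zs)) (sym (LP.++-identityʳ _))) (cong (H m (length ys)) (sym (LP.++-identityʳ _)))) (base A₁ A₂ hyp)
      countQ ([] ∷ cs) A₁ A₂ (dec , _) = ⊥-elim (All.head (AllP.++⁻ʳ ((i ∷ ys) ∷ A₂) (AllP.++⁻ʳ ((e ∷ zs) ∷ A₁) (Decomp.cycles dec))))
      countQ ((x ∷ c) ∷ cs) A₁ A₂ (dec , S↭ , ok , len) = count-resp to from (count-⊎ dis
          (count-≡ (⊠-cong (λ γ → cong (H k (length zs)) (sym (map-++-∷ʳ A₁ (x ∷ c) γ))) (λ γ → refl) (map length cs)) (countQ cs (A₁ ++ (x ∷ c) ∷ []) A₂ hyp₁))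
          (count-≡ (⊠-cong (λ γ → refl) (λ γ → cong (H m (length ys)) (sym (map-++-∷ʳ A₂ (x ∷ c) γ))) (map length cs)) (countQ cs A₁ (A₂ ++ (x ∷ c) ∷ []) hyp₂)))
        where
        all = ((e ∷ zs) ∷ A₁) ++ ((i ∷ ys) ∷ A₂) ++ (x ∷ c) ∷ cs
        perm₁ : ∀ {X : Set} (a : X) as bs ds → as ++ bs ++ a ∷ ds ↭ (as ++ a ∷ []) ++ bs ++ ds
        perm₁ a as bs ds = ↭t (↭P.++⁺ˡ as (↭P.shift a bs ds)) (↭-reflexive (sym (LP.++-assoc as (a ∷ []) (bs ++ ds))))
        perm₂ : ∀ {X : Set} (a : X) as bs ds → as ++ bs ++ a ∷ ds ↭ as ++ (bs ++ a ∷ []) ++ ds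
        perm₂ a as bs ds = ↭-reflexive (cong (as ++_) (sym (LP.++-assoc bs (a ∷ []) ds)))
        hyp₁ : Hyp (A₁ ++ (x ∷ c) ∷ []) A₂ cs
        hyp₁ = Decomp-↭ q dec , ↭t S↭ (concat-↭ q) , OK-↭ (perm₁ (x ∷ c) A₁ A₂ cs) ok , trans (sym (↭P.↭-length q)) len
          where q = perm₁ (x ∷ c) ((e ∷ zs) ∷ A₁) ((i ∷ ys) ∷ A₂) cs
        hyp₂ : Hyp A₁ (A₂ ++ (x ∷ c) ∷ []) cs
        hyp₂ = Decomp-↭ q dec , ↭t S↭ (concat-↭ q) , OK-↭ (perm₂ (x ∷ c) A₁ A₂ cs) ok , trans (sym (↭P.↭-length q)) len
          where q = perm₂ (x ∷ c) ((e ∷ zs) ∷ A₁) ((i ∷ ys) ∷ A₂) cs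
        cyc-x : Path ρ x c x
        cyc-x = All.head (AllP.++⁻ʳ ((i ∷ ys) ∷ A₂) (AllP.++⁻ʳ ((e ∷ zs) ∷ A₁) (Decomp.cycles dec)))
        x∈S : x ∈ S
        x∈S = ↭P.∈-resp-↭ (↭-sym (↭t S↭ (concat-↭ (perm₁ (x ∷ c) ((e ∷ zs) ∷ A₁) ((i ∷ ys) ∷ A₂) cs))))
          (subst (x ∈_) (LP.concat-++ (((e ∷ zs) ∷ A₁) ++ (x ∷ c) ∷ []) (((i ∷ ys) ∷ A₂) ++ cs))
            (∈-++⁺ˡ (subst (x ∈_) (LP.concat-++ ((e ∷ zs) ∷ A₁) ((x ∷ c) ∷ [])) (∈-++⁺ʳ (concat ((e ∷ zs) ∷ A₁)) (here refl)))))
        last∈ : ∀ A → x ∈ concat (A ++ (x ∷ c) ∷ [])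
        last∈ A = subst (x ∈_) (LP.concat-++ A ((x ∷ c) ∷ [])) (∈-++⁺ʳ (concat A) (here refl))
        shrink : ∀ A {z} → z ∈ concat A → z ∈ concat (A ++ (x ∷ c) ∷ [])
        shrink A h = subst (_ ∈_) (LP.concat-++ A ((x ∷ c) ∷ [])) (∈-++⁺ˡ h)
        dis : ∀ t → Q (A₁ ++ (x ∷ c) ∷ []) A₂ t → ¬ Q A₁ (A₂ ++ (x ∷ c) ∷ []) t
        dis t (_ , _ , ne , h , _) (_ , _ , _ , _ , h′) = ne (conn-trans (edgesOf t) (h x (last∈ A₁)) (conn-sym (edgesOf t) (h′ x (last∈ A₂))))
        to : ∀ t → Q (A₁ ++ (x ∷ c) ∷ []) A₂ t ⊎ Q A₁ (A₂ ++ (x ∷ c) ∷ []) t → Q A₁ A₂ t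
        to t (inj₁ (s , q , ne , h , h′)) = s , q , ne , (λ z m → h z (shrink A₁ m)) , h′
        to t (inj₂ (s , q , ne , h , h′)) = s , q , ne , h , λ z m → h′ z (shrink A₂ m)
        from : ∀ t → Q A₁ A₂ t → Q (A₁ ++ (x ∷ c) ∷ []) A₂ t ⊎ Q A₁ (A₂ ++ (x ∷ c) ∷ []) t
        from t (s , q , ne , h , h′) = case (Sys.conn-S s x x∈S)
          where
          es = edgesOf t
          ext : ∀ A a → (∀ z → z ∈ concat A → conn es a z) → conn es a x → ∀ z → z ∈ concat (A ++ (x ∷ c) ∷ []) → conn es a z
          ext A a h ax z m with ∈-++⁻ (concat A) (subst (z ∈_) (sym (LP.concat-++ A ((x ∷ c) ∷ []))) m)
          ... | inj₁ m′ = h z m′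
          ... | inj₂ m′ = conn-trans es ax (conn-path ρ t (Sys.prod s) x c cyc-x z (subst (z ∈_) (LP.++-identityʳ (x ∷ c)) m′))
          case : conn ((e , i) ∷ es) e x → Q (A₁ ++ (x ∷ c) ∷ []) A₂ t ⊎ Q A₁ (A₂ ++ (x ∷ c) ∷ []) t
          case (inj₁ ex) = inj₁ (s , q , ne , ext A₁ e h ex , h′)
          case (inj₂ (inj₁ (_ , ix))) = inj₂ (s , q , ne , h , ext A₂ i h′ ix)
          case (inj₂ (inj₂ (ei , _))) = ⊥-elim (ne ei)

    module CountStep {N k : ℕ} (IHk : CountIH (suc N) k) (IHN : ∀ k → CountIH N k)
        (e : Fin n) (xs : List (Fin n)) (cs : List (List (Fin n))) (ρ : Fin n → Fin n) (S : List (Fin n))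
        (S≤ : length S ≤ suc N) (k<m : suc k ≤ m) (p : S ↭ concat ((e ∷ xs) ∷ cs)) (dec : Decomp ρ ((e ∷ xs) ∷ cs))
        (ok : All OK (map length cs)) where

      private
        l = fromℕ< k<m
        l≡k = FP.toℕ-fromℕ< k<m
        k≤m = ℕP.<⇒≤ k<m
        in-S : ∀ {x} → x ∈ concat ((e ∷ xs) ∷ cs) → x ∈ S
        in-S = ↭P.∈-resp-↭ (↭-sym p)
        e∈ = in-S (here refl)
        uniq = Decomp.unique dec

      I : Tuple n m → Fin n → Set
      I t i = lookup (lookup t l) (tp t l i) ≡ e

      P : Tuple n m → Set
      P = Planar (suc k) e cs S ρ

      At : List (Fin n) → Tuple n m → Set
      At A t = P t × ∃ λ i → i ∈ A × I t i

      private
        Φ-inj : ∀ i (a b : Tuple n m) → Φ e l i a ≡ Φ e l i b → a ≡ b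
        Φ-inj i a b q = trans (sym (Φ-inv e l i a)) (trans (cong (Φ e l i) q) (Φ-inv e l i b))

        count-e : Count (λ t → P t × I t e) (H k (length xs) (map length cs))
        count-e = count-resp (λ t (s , q) → (proj₁ (raise l l≡k s) , q) , proj₂ (raise l l≡k s))
          (λ t ((s , q) , h) → lower l l≡k h s , q) (IHk e xs cs ρ S S≤ k≤m p dec ok)

        count-merge : ∀ c₁ j c₂ pre suf → cs ≡ pre ++ (c₁ ++ j ∷ c₂) ∷ suf →
          Count (λ t → P t × I t j) (H k (length xs + length (c₁ ++ j ∷ c₂)) (map length (pre ++ suf)))
        count-merge c₁ j c₂ pre suf refl = count-map (Φ e l j) (λ a b _ _ → Φ-inj j a b) to from
            (count-≡ (cong (λ a → H k a (map length (pre ++ suf))) len)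
              (IHk e ((c₂ ++ c₁) ++ j ∷ xs) (pre ++ suf) ρ′ S S≤ k≤m p′ dec′ (All.tail (OK-↭ (↭P.shift (c₁ ++ j ∷ c₂) pre suf) ok))))
          where
          ρ′ : Fin n → Fin n
          ρ′ x = ρ (τ e j x)
          front = merge-front {c = c₁ ++ j ∷ c₂} pre suf dec
          dec′ = merge c₁ j c₂ front
          p′ : S ↭ concat ((e ∷ (c₂ ++ c₁) ++ j ∷ xs) ∷ pre ++ suf)
          p′ = ↭t p (↭t (concat-↭ (prep (e ∷ xs) (↭P.shift (c₁ ++ j ∷ c₂) pre suf))) (merge-↭ {f = ρ} e xs c₁ j c₂ (pre ++ suf)))
          j∈′ : j ∈ xs ++ concat ((c₁ ++ j ∷ c₂) ∷ pre ++ suf)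
          j∈′ = ∈-++⁺ʳ xs (∈-++⁺ˡ (∈-++⁺ʳ c₁ (here refl)))
          j≢e : j ≢ e
          j≢e refl = ∉-head (Decomp.unique front) j∈′
          j∈ : j ∈ S
          j∈ = in-S (↭P.∈-resp-↭ (concat-↭ (↭-sym (prep (e ∷ xs) (↭P.shift (c₁ ++ j ∷ c₂) pre suf)))) (there j∈′))
          module St = Step e l j S e∈ j∈
          len : length ((c₂ ++ c₁) ++ j ∷ xs) ≡ length xs + length (c₁ ++ j ∷ c₂)
          len = trans (LP.length-++ (c₂ ++ c₁)) (trans (cong₂ _+_ (LP.length-++ c₂) refl) (sym (trans (cong (length xs +_) (LP.length-++ c₁))
            (solve 3 (λ x a b → x :+ (a :+ (con 1 :+ b)) := (b :+ a) :+ (con 1 :+ x)) refl (length xs) (length c₁) (length c₂)))))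
            where open +-*-Solver
          arith : ∀ T T′ → suc T ≡ T′ → T + suc (length (pre ++ (c₁ ++ j ∷ c₂) ∷ suf)) + length S ≡ T′ + suc (length (pre ++ suf)) + length S
          arith T _ refl = cong (_+ length S) (trans (cong (λ a → T + suc a) (↭P.↭-length (↭P.shift (c₁ ++ j ∷ c₂) pre suf))) (ℕP.+-suc T _))
          to : ∀ t → Planar k e (pre ++ suf) S ρ′ t → P (Φ e l j t) × I (Φ e l j t) j
          to t (s , q) = (proj₁ b , trans (arith _ _ (St.cycles-step l≡k t j≢e (add-edge s))) q) , proj₂ b
            where b = St.backward l≡k {ρ} t (add-edge s)
          from : ∀ t → P t × I t j → Σ (Tuple n m) λ a → Planar k e (pre ++ suf) S ρ′ a × Φ e l j a ≡ t
          from t ((s , q) , h) = Φ e l j t , (drop-edge conn-j f ,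
              trans (sym (arith _ _ (trans (cong (suc ∘ totalCycles) (sym (Φ-inv e l j t))) (St.cycles-step l≡k (Φ e l j t) j≢e f)))) q) , Φ-inv e l j t
            where
            f = St.forward l≡k t s h
            conn-j : conn (edgesOf (Φ e l j t)) e j
            conn-j = conn-path ρ′ (Φ e l j t) (Sys.prod f) e ((c₂ ++ c₁) ++ j ∷ xs) (All.head (Decomp.cycles dec′)) j (there (∈-++⁺ʳ (c₂ ++ c₁) (here refl)))

        -- If e and j were still connected after the cut, the tuple would exceed the genus bound by
        -- 2. Hence a cut of a planar factorization always yields two components, and these are
        -- counted by the shuffle product.
        count-split : ∀ ys j zs → xs ≡ ys ++ j ∷ zs → Count (λ t → P t × I t j) ((H k (length zs) ⊠ H m (length ys)) (map length cs))
        count-split ys j zs refl = count-map (Φ e l j) (λ a b _ _ → Φ-inj j a b) to from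
            (SC.countQ cs [] [] (dec′ , p′ , ok , refl))
          where
          ρ′ : Fin n → Fin n
          ρ′ x = ρ (τ e j x)
          dec′ = split ys j zs dec
          p′ = ↭t p (split-↭ {f = ρ} e ys j zs cs)
          j≢e : j ≢ e
          j≢e refl = ∉-head uniq (∈-++⁺ˡ (∈-++⁺ʳ ys (here refl)))
          j∈ : j ∈ S
          j∈ = in-S (there (∈-++⁺ˡ (∈-++⁺ʳ ys (here refl))))
          module St = Step e l j S e∈ j∈
          module SC = SplitCount {N} {k} IHN k≤m e j zs ys ρ′ S S≤ (suc (suc (length cs)))
          arith : ∀ T T′ → suc T ≡ T′ → T′ + suc (suc (length cs)) + length S ≡ (T + suc (length cs) + length S) + 2
          arith T _ refl = solve 3 (λ t c s → ((con 1 :+ t) :+ (con 2 :+ c)) :+ s := ((t :+ (con 1 :+ c)) :+ s) :+ con 2) refl T (length cs) (length S)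
            where open +-*-Solver
          to : ∀ t → SC.Q [] [] t → P (Φ e l j t) × I (Φ e l j t) j
          to t (s , q , _) = (proj₁ b , ℕP.+-cancelʳ-≡ 2 _ _ (trans (sym (arith _ _ (St.cycles-step l≡k t j≢e s))) q)) , proj₂ b
            where b = St.backward l≡k {ρ} t s
          from : ∀ t → P t × I t j → Σ (Tuple n m) λ a → SC.Q [] [] a × Φ e l j a ≡ t
          from t ((s , q) , h) = Φ e l j t , (f , q′ , ne , (λ _ ()) , (λ _ ())) , Φ-inv e l j t
            where
            f = St.forward l≡k t s h
            q′ = trans (arith _ _ (trans (cong (suc ∘ totalCycles) (sym (Φ-inv e l j t))) (St.cycles-step l≡k (Φ e l j t) j≢e f))) (cong (_+ 2) q)
            ne : ¬ conn (edgesOf (Φ e l j t)) e j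
            ne c = ℕP.<⇒≱ (ℕP.m<m+n (m * n + 2) {2} (s≤s z≤n)) (subst (_≤ m * n + 2) q′
              (bound (suc N) k e zs ((j ∷ ys) ∷ cs) ρ′ S (Φ e l j t) S≤ k≤m p′ dec′ (drop-edge c f)))

        at-cons : ∀ {x A q r} → x ∉ A → Count (λ t → P t × I t x) q → Count (At A) r → Count (At (x ∷ A)) (q ℚ.+ r)
        at-cons {x} {A} x∉ c d = count-resp to from (count-⊎ (λ t (s , h) (_ , i , m , h′) →
            x∉ (subst (_∈ A) (index-unique t l (proj₁ s) i x h′ h) m)) c d)
          where
          to : ∀ t → P t × I t x ⊎ At A t → At (x ∷ A) t
          to t (inj₁ (s , h)) = s , x , here refl , h
          to t (inj₂ (s , i , m , h)) = s , i , there m , h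
          from : ∀ t → At (x ∷ A) t → P t × I t x ⊎ At A t
          from t (s , i , here refl , h) = inj₁ (s , h)
          from t (s , i , there m , h) = inj₂ (s , i , m , h)

        at-++ : ∀ {A B q r} → (∀ {z} → z ∈ A → z ∉ B) → Count (At A) q → Count (At B) r → Count (At (A ++ B)) (q ℚ.+ r)
        at-++ {A} {B} dj c d = count-resp to from (count-⊎ (λ t (s , i , m , h) (_ , j , m′ , h′) →
            dj m (subst (_∈ B) (index-unique t l (proj₁ s) j i h′ h) m′)) c d)
          where
          to : ∀ t → At A t ⊎ At B t → At (A ++ B) t
          to t (inj₁ (s , i , m , h)) = s , i , ∈-++⁺ˡ m , h
          to t (inj₂ (s , i , m , h)) = s , i , ∈-++⁺ʳ A m , h
          from : ∀ t → At (A ++ B) t → At A t ⊎ At B t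
          from t (s , i , m , h) with ∈-++⁻ A m
          ... | inj₁ m′ = inj₁ (s , i , m′ , h)
          ... | inj₂ m′ = inj₂ (s , i , m′ , h)

        at-[] : Count (At []) 0ℚ
        at-[] = count-none λ { t (_ , _ , () , _) }

        count-c : ∀ c₁ c₂ pre suf → cs ≡ pre ++ (c₁ ++ c₂) ∷ suf → Unique c₂ →
          Count (At c₂) (ℕtoℚ (length c₂) ℚ.* H k (length xs + length (c₁ ++ c₂)) (map length (pre ++ suf)))
        count-c c₁ [] pre suf eq u = count-≡ (sym (ℚP.*-zeroˡ (H k (length xs + length (c₁ ++ [])) (map length (pre ++ suf))))) at-[]
        count-c c₁ (j ∷ c₂) pre suf eq (a ∷ u) = count-≡ (sym (ℕtoℚ-suc* (length c₂) _))
          (at-cons (∉-head (a ∷ u)) (count-merge c₁ j c₂ pre suf eq)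
            (count-≡ (cong (λ c → ℕtoℚ (length c₂) ℚ.* H k (length xs + length c) (map length (pre ++ suf))) (LP.++-assoc c₁ (j ∷ []) c₂))
              (count-c (c₁ ++ j ∷ []) c₂ pre suf (trans eq (cong (λ c → pre ++ c ∷ suf) (sym (LP.++-assoc c₁ (j ∷ []) c₂)))) u)))

        count-cs : ∀ pre suf → cs ≡ pre ++ suf → Unique (concat suf) →
          Count (At (concat suf)) (posSum (λ b γ → H k (length xs + b) (map length pre ++ γ)) (map length suf))
        count-cs pre [] eq u = at-[]
        count-cs pre (c ∷ suf) eq u = at-++ (proj₂ (proj₂ (Unique-++ c u)))
          (count-≡ (cong (λ β → ℕtoℚ (length c) ℚ.* H k (length xs + length c) β) (LP.map-++ length pre suf))
            (count-c [] c pre suf eq (proj₁ (Unique-++ c u))))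
          (count-≡ (posSum-cong (λ b γ → cong (H k (length xs + b)) (sym (map-++-∷ʳ pre c γ))) (map length suf))
            (count-cs (pre ++ c ∷ []) suf (trans eq (sym (LP.++-assoc pre (c ∷ []) suf))) (proj₁ (proj₂ (Unique-++ c u)))))

        count-xs : ∀ ys zs → xs ≡ ys ++ zs → Unique zs → Count (At zs) (convQ k (length ys) (length zs) (map length cs))
        count-xs ys [] eq u = at-[]
        count-xs ys (j ∷ zs) eq (a ∷ u) = at-cons (∉-head (a ∷ u)) (count-split ys j zs eq)
          (count-≡ (cong (λ o → convQ k o (length zs) (map length cs)) (trans (LP.length-++ ys) (ℕP.+-comm (length ys) 1)))
            (count-xs (ys ++ j ∷ []) zs (trans eq (sym (LP.++-assoc ys (j ∷ []) zs))) u))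

      result : Count P ((H k (length xs) (map length cs) ℚ.+ posSum (λ b γ → H k (length xs + b) γ) (map length cs)) ℚ.+ convQ k 0 (length xs) (map length cs))
      result = count-resp to from (count-⊎ dis₂ (count-⊎ dis₁ count-e (count-cs [] cs refl ucs)) (count-xs [] xs refl uxs))
        where
        u′ : Unique (xs ++ concat cs)
        u′ with uniq
        ... | _ ∷ u = u
        uxs = proj₁ (Unique-++ xs u′)
        ucs = proj₁ (proj₂ (Unique-++ xs u′))
        dis₁ : ∀ t → P t × I t e → ¬ At (concat cs) t
        dis₁ t (s , h) (_ , i , m , h′) = ∉-head uniq (∈-++⁺ʳ xs (subst (_∈ concat cs) (index-unique t l (proj₁ s) i e h′ h) m))
        dis₂ : ∀ t → P t × I t e ⊎ At (concat cs) t → ¬ At xs t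
        dis₂ t (inj₁ (s , h)) (_ , i , m , h′) = ∉-head uniq (∈-++⁺ˡ (subst (_∈ xs) (index-unique t l (proj₁ s) i e h′ h) m))
        dis₂ t (inj₂ (s , j , m′ , h)) (_ , i , m , h′) = proj₂ (proj₂ (Unique-++ xs u′)) m (subst (_∈ concat cs) (index-unique t l (proj₁ s) j i h h′) m′)
        to : ∀ t → (P t × I t e ⊎ At (concat cs) t) ⊎ At xs t → P t
        to t (inj₁ (inj₁ (s , _))) = s
        to t (inj₁ (inj₂ (s , _))) = s
        to t (inj₂ (s , _)) = s
        from : ∀ t → P t → (P t × I t e ⊎ At (concat cs) t) ⊎ At xs t
        from t s with index t l e∈ (proj₁ s)
        ... | i , i∈ , h with ↭P.∈-resp-↭ p i∈
        ... | here refl = inj₁ (inj₁ (s , h))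
        ... | there m with ∈-++⁻ xs m
        ... | inj₁ m′ = inj₂ (s , i , m′ , h)
        ... | inj₂ m′ = inj₁ (inj₂ (s , i , m′ , h))

    module Main (H-00 : ∀ a β → H 0 a β ≡ 0ℚ ⊎ (a ≡ 0 × β ≡ [])) (H-1 : H 0 0 [] ≡ 1ℚ)
                (H-suc : ∀ k a β → All OK β → H (suc k) a β ≡ (H k a β ℚ.+ posSum (λ b γ → H k (a + b) γ) β) ℚ.+ convQ k 0 a β) where

      private
        idT : ∀ m → Tuple n m
        idT m = Vec.replicate m (tabulate id)

        idT-lookup : ∀ {m} l x → lookup (lookup (idT m) l) x ≡ x
        idT-lookup l x = trans (cong (λ f → lookup f x) (VP.lookup-replicate l (tabulate id))) (VP.lookup∘tabulate id x)

        tuple-ext : ∀ {m} (t u : Tuple n m) → (∀ l x → lookup (lookup t l) x ≡ lookup (lookup u l) x) → t ≡ u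
        tuple-ext [] [] h = refl
        tuple-ext (f ∷ t) (g ∷ u) h = cong₂ _∷_ (vec-ext (h zero)) (tuple-ext t u λ l → h (suc l))

        ident-Sys : ∀ {e ρ S} → S ↭ e ∷ [] → Decomp ρ ((e ∷ []) ∷ []) → Sys 0 e S ρ [] (idT m)
        ident-Sys {e} {ρ} p (decomp (q ∷ []) _ fx) = record
          { perm = λ l x y h → trans (sym (idT-lookup l x)) (trans h (idT-lookup l y))
          ; supp = λ l x _ → idT-lookup l x
          ; prod = λ x → trans (applyAll-fix (idT m) x (λ l → idT-lookup l x)) (sym (pr x))
          ; conn-S = λ x h → case x (↭P.∈-resp-↭ p h)
          ; fixe = λ l _ → idT-lookup l e }
          where
          pr : ∀ x → ρ x ≡ x
          pr x with x ≟ e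
          ... | yes refl = q
          ... | no ne = fx x λ { (here r) → ne r }
          case : ∀ x → x ∈ e ∷ [] → conn (edgesOf (idT m)) e x
          case x (here refl) = conn-refl (edgesOf (idT m))

      -- Recursion on the size and, within it, on the level: a cut leads to smaller supports at any
      -- level, the other cases to the same support at a lower level.
      count : ∀ N k → CountIH N k
      count N zero e (x ∷ xs) cs ρ S _ _ p dec ok with H-00 (suc (length xs)) (map length cs)
      ... | inj₁ z = count-≡ (sym z) (count-none λ t (s , _) → bad (proj₁ (Sys0-trivial t p dec s)))
        where
        bad : x ∷ xs ≡ [] → ⊥
        bad ()
      count N zero e [] (c ∷ cs) ρ S _ _ p dec ok with H-00 0 (map length (c ∷ cs))
      ... | inj₁ z = count-≡ (sym z) (count-none λ t (s , _) → bad (proj₁ (proj₂ (Sys0-trivial t p dec s))))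
        where
        bad : c ∷ cs ≡ [] → ⊥
        bad ()
      count N zero e [] [] ρ S _ _ p dec ok = count-≡ (sym H-1) (count-one (idT m)
        (ident-Sys p dec , trans (cong₂ (λ a b → a + 1 + b) (totalCycles-id (idT m) idT-lookup) (↭P.↭-length p)) (ℕP.+-assoc _ 1 1))
        λ t (s , _) → tuple-ext t (idT m) λ l x → trans (proj₂ (proj₂ (Sys0-trivial t p dec s)) l x) (sym (idT-lookup l x)))
      count zero (suc k) e xs cs ρ S l≤ _ p dec ok = ⊥-elim (ℕP.<⇒≱ (s≤s z≤n) (subst (_≤ 0) (↭P.↭-length p) l≤))
      count (suc N) (suc k) e xs cs ρ S l≤ k<m p dec ok = count-≡ (sym (H-suc k (length xs) (map length cs) ok))
        (CountStep.result (count (suc N) k) (count N) e xs cs ρ S l≤ k<m p dec ok)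

-- Identification of the counts with the algebraic solution.

module RationalModel where

  open import Defs
  open import Level using (0ℓ)
  open import Algebra.Bundles using (CommutativeRing; CommutativeMonoid)
  open import Data.Bool as B using (true; false; if_then_else_)
  open import Data.Nat as ℕ using (ℕ; zero; suc; _≤_; _<_; _≡ᵇ_)
  import Data.Nat.Properties as ℕP
  open import Data.Integer using (+_)
  open import Data.Rational as ℚ using (ℚ; 0ℚ; 1ℚ)
  import Data.Rational.Properties as ℚP
  open import Data.List using ([]; _∷_)
  open import Data.List.Relation.Unary.All using (All; []; _∷_)
  open import Data.Product using (_×_; _,_)
  open import Data.Sum using (_⊎_; inj₁; inj₂)
  open import Data.Empty using (⊥-elim)
  open import Relation.Nullary using (yes; no)
  open import Relation.Binary.PropositionalEquality using (_≡_; _≢_; refl; sym; trans; cong; cong₂; subst)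
  open Rings
  open Filtrations
  open Shifts
  open ShuffleAlgebra
  open RecurrenceModel
  open GraphsAndCounts
  open RecursiveCount

  open import Algebra.Properties.CommutativeSemigroup (CommutativeMonoid.commutativeSemigroup ℚP.+-0-commutativeMonoid) using (interchange; x∙yz≈y∙xz)

  ℚR : CommutativeRing 0ℓ 0ℓ
  ℚR = ℚP.+-*-commutativeRing

  ≡ᵇ-≢ : ∀ {a b} → a ≢ b → (a ≡ᵇ b) ≡ false
  ≡ᵇ-≢ {a} {b} ne with a ≡ᵇ b in eq
  ... | false = refl
  ... | true = ⊥-elim (ne (ℕP.≡ᵇ⇒≡ a b (subst B.T (sym eq) _)))

  module AtℚQ (N′ D : ℕ) where
    module M = Model ℚR N′ D
    open M using (Sh; _⊠_; _⊞_; H; T; τR; p; N; natK)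
    open Shift M.R N using (∑R; ∑R-cong)

    natK-ℚ : ∀ n → natK n ≡ ℕtoℚ n
    natK-ℚ zero = refl
    natK-ℚ (suc n) = trans (cong (1ℚ ℚ.+_) (natK-ℚ n)) (sym (ℕtoℚ-+ 1 n))

    -- The algebraic recurrence knows the variables p_1, ..., p_D only, so it agrees with the
    -- combinatorial one on lists without larger parts.
    Admissible : ℕ → Set
    Admissible b = 1 ≤ b × b ≤ D

    private
      ∑R-zero : ∀ n (f : ℕ → Sh) β → (∀ j → j < n → f j β ≡ 0ℚ) → ∑R n f β ≡ 0ℚ
      ∑R-zero zero f β h = refl
      ∑R-zero (suc n) f β h = cong₂ ℚ._+_ (h n ℕP.≤-refl) (∑R-zero n f β λ j l → h j (ℕP.m≤n⇒m≤1+n l))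

      ∑R-pick : ∀ n (f : ℕ → Sh) β b → b < n → (∀ j → (j ≡ᵇ b) ≡ false → f j β ≡ 0ℚ) → ∑R n f β ≡ f b β
      ∑R-pick (suc n) f β b l z with b ℕ.≟ n
      ... | yes refl = trans (cong (f n β ℚ.+_) (∑R-zero n f β λ j l → z j (≡ᵇ-≢ (ℕP.<⇒≢ l)))) (ℚP.+-identityʳ _)
      ... | no ne = trans (cong₂ ℚ._+_ (z n (≡ᵇ-≢ (λ q → ne (sym q)))) (∑R-pick n f β b (ℕP.≤∧≢⇒< (ℕP.≤-pred l) ne) z)) (ℚP.+-identityˡ _)

      ≡ᵇ-comm : ∀ a b → (a ≡ᵇ b) ≡ (b ≡ᵇ a)
      ≡ᵇ-comm zero zero = refl
      ≡ᵇ-comm zero (suc b) = refl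
      ≡ᵇ-comm (suc a) zero = refl
      ≡ᵇ-comm (suc a) (suc b) = ≡ᵇ-comm a b

      ≡ᵇ-refl : ∀ a → (a ≡ᵇ a) ≡ true
      ≡ᵇ-refl zero = refl
      ≡ᵇ-refl (suc a) = ≡ᵇ-refl a

    ∂p : ℕ → ℕ → Sh
    ∂p j b γ = p j (b ∷ γ)

    ∂p-≢ : ∀ j b → (b ≡ᵇ suc j) ≡ false → ∀ γ → ∂p j b γ ≡ 0ℚ
    ∂p-≢ j b e [] = cong (if_then natK (suc j) else 0ℚ) e
    ∂p-≢ j b e (_ ∷ _) = refl

    ∂p-≡ : ∀ j γ → ∂p j (suc j) γ ≡ M.sc (natK (suc j)) γ
    ∂p-≡ j [] = cong (if_then natK (suc j) else 0ℚ) (≡ᵇ-refl (suc j))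
    ∂p-≡ j (_ ∷ _) = refl

    -- By the Leibniz rule: the derivation for a part b sends p_b to the constant b and every other
    -- variable to 0.
    ∑p-posSum : ∀ (f : ℕ → Sh) β → All Admissible β → ∑R D (λ j → p j ⊠ f (suc j)) β ≡ posSum f β
    ∑p-posSum f [] [] = ∑R-zero D _ [] λ j _ → ℚP.*-zeroˡ (f (suc j) [])
    ∑p-posSum f (zero ∷ β) ((() , _) ∷ _)
    ∑p-posSum f (suc b ∷ β) ((_ , b≤) ∷ ad) = trans (split D) (cong₂ ℚ._+_
        (trans (∑R-pick D (λ j → ∂p j (suc b) ⊠ f (suc j)) β b b≤
            λ j e → trans (M.R.*-cong {u = f (suc j)} {v = f (suc j)} (∂p-≢ j (suc b) (trans (≡ᵇ-comm b j) e)) (λ _ → refl) β) (M.zero-⊠ (f (suc j)) β))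
          (trans (M.R.*-cong {u = f (suc b)} {v = f (suc b)} (∂p-≡ b) (λ _ → refl) β)
            (trans (M.sc-⊠ (natK (suc b)) (f (suc b)) β) (cong (ℚ._* f (suc b) β) (natK-ℚ (suc b))))))
        (∑p-posSum (λ b′ γ → f b′ (suc b ∷ γ)) β ad))
      where
      split : ∀ n → ∑R n (λ j → p j ⊠ f (suc j)) (suc b ∷ β) ≡
        ∑R n (λ j → ∂p j (suc b) ⊠ f (suc j)) β ℚ.+ ∑R n (λ j → p j ⊠ (λ γ → f (suc j) (suc b ∷ γ))) β
      split zero = refl
      split (suc n) = trans (cong ((p n ⊠ f (suc n)) (suc b ∷ β) ℚ.+_) (split n))
        (interchange ((∂p n (suc b) ⊠ f (suc n)) β) ((p n ⊠ (λ γ → f (suc n) (suc b ∷ γ))) β)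
          (∑R n (λ j → ∂p j (suc b) ⊠ f (suc j)) β) (∑R n (λ j → p j ⊠ (λ γ → f (suc j) (suc b ∷ γ))) β))

    private
      -- Mediates between `conv`, which runs upwards in its first factor, and `convQ`, which runs
      -- upwards in its second. The closing condition has already replaced the kernel by the row H
      -- m, which shifts its index by one.
      conv′ : (ℕ → Sh) → (ℕ → Sh) → ℕ → ℕ → Sh
      conv′ z t o zero = M.zer
      conv′ z t o (suc a) = z 0 ⊠ t (o ℕ.+ a) ⊞ conv′ (λ i → z (suc i)) t o a

      conv′-last : ∀ z t o a β → conv′ z t o (suc a) β ≡ (z a ⊠ t o ⊞ conv′ z t (suc o) a) β
      conv′-last z t o zero β = cong (λ o → (z 0 ⊠ t o) β ℚ.+ 0ℚ) (ℕP.+-identityʳ o)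
      conv′-last z t o (suc a) β = trans (cong₂ ℚ._+_ (cong (λ l → (z 0 ⊠ t l) β) (ℕP.+-suc o a)) (conv′-last (λ i → z (suc i)) t o a β))
        (x∙yz≈y∙xz ((z 0 ⊠ t (suc o ℕ.+ a)) β) ((z (suc a) ⊠ t o) β) (conv′ (λ i → z (suc i)) t (suc o) a β))

      conv-conv′ : ∀ z a β → M.conv z T a β ≡ conv′ z (H (suc N)) 0 a β
      conv-conv′ z zero β = refl
      conv-conv′ z (suc a) β = cong₂ ℚ._+_ (sym (M.R.*-cong {x = z 0} {y = z 0} (λ _ → refl) (M.H-m a) β)) (conv-conv′ (λ i → z (suc i)) a β)

    module Cnt (n : ℕ) = Counting n (suc N) H Admissible

    private
      conv-convQ : ∀ n k a β → M.conv (H k) T a β ≡ Cnt.convQ n k 0 a β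
      conv-convQ n k a β = trans (conv-conv′ (H k) a β) (go 0 a)
        where
        go : ∀ o a → conv′ (H k) (H (suc N)) o a β ≡ Cnt.convQ n k o a β
        go o zero = refl
        go o (suc a) = trans (conv′-last (H k) (H (suc N)) o a β) (cong ((H k a ⊠ H (suc N) o) β ℚ.+_) (go (suc o) a))

      H-suc-ℚ : ∀ n k a β → All Admissible β →
        H (suc k) a β ≡ (H k a β ℚ.+ posSum (λ b γ → H k (a ℕ.+ b) γ) β) ℚ.+ Cnt.convQ n k 0 a β
      H-suc-ℚ n k a β ad = trans (M.H-suc k a β) (cong₂ (λ x y → (H k a β ℚ.+ x) ℚ.+ y)
        (∑p-posSum (λ b → H k (a ℕ.+ b)) β ad) (conv-convQ n k a β))

      H-00-ℚ : ∀ a β → H 0 a β ≡ 0ℚ ⊎ (a ≡ 0 × β ≡ [])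
      H-00-ℚ zero [] = inj₂ (refl , refl)
      H-00-ℚ zero (b ∷ β) = inj₁ (M.H-00 (b ∷ β))
      H-00-ℚ (suc a) β = inj₁ (M.H-0 a β)

    count : ∀ n L k → Cnt.CountIH n L k
    count n = Counting.Main.count n (suc N) H Admissible H-00-ℚ (M.H-00 []) (H-suc-ℚ n)

    τR-posSum : ∀ β → All Admissible β → τR β ≡ posSum T β
    τR-posSum = ∑p-posSum T

-- From planar factorizations to the numbers of the theorem.

module GenusZeroCount where

  open import Defs
  open import Data.Bool using (Bool; true; false)
  open import Data.Nat using (ℕ; zero; suc; _≤_; _<_; z≤n; s≤s; _+_; _*_; _∸_; _≡ᵇ_)
  import Data.Nat.Properties as ℕP
  open import Data.Nat.Solver using (module +-*-Solver)
  open import Data.Rational as ℚ using (ℚ)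
  import Data.Rational.Properties as ℚP
  open import Data.Fin using (Fin; zero; suc)
  import Data.Fin.Properties as FP
  open import Data.Vec using (Vec; []; _∷_; lookup; tabulate)
  import Data.Vec.Properties as VP
  open import Data.List using (List; []; _∷_; _++_; length; concat; map; allFin; replicate)
  open import Data.Nat.ListAction using (sum)
  import Data.Nat.ListAction.Properties as SP
  import Data.List.Properties as LP
  open import Data.List.Membership.Propositional using (_∈_; _∉_)
  open import Data.List.Membership.Propositional.Properties using (∈-allFin)
  open import Data.List.Relation.Unary.Any using (here; there)
  open import Data.List.Relation.Unary.All as All using (All; []; _∷_)
  import Data.List.Relation.Unary.All.Properties as AllP
  open import Data.List.Relation.Unary.AllPairs using ([]; _∷_)
  open import Data.List.Relation.Unary.Unique.Propositional using (Unique)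
  import Data.List.Relation.Unary.Unique.Propositional.Properties as UP
  open import Data.List.Relation.Binary.Permutation.Propositional using (_↭_; prep; ↭-sym; ↭-reflexive) renaming (refl to ↭r; trans to ↭t)
  import Data.List.Relation.Binary.Permutation.Propositional.Properties as ↭P
  open import Data.Product using (∃; ∃₂; _×_; _,_; proj₁; proj₂)
  open import Data.Empty using (⊥-elim)
  open import Function using (_∘_; id)
  open import Relation.Binary.PropositionalEquality using (_≡_; refl; sym; trans; cong; subst; cong₂)
  open Rings
  open CycleDecompositions
  open GraphsAndCounts
  open CycleCounts
  open Factorizations
  open RecursiveCount
  open RationalModel

  partsFrom : ℕ → List ℕ → List ℕ
  partsFrom i [] = []
  partsFrom i (k ∷ d) = replicate k i ++ partsFrom (suc i) d

  parts : List ℕ → List ℕ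
  parts = partsFrom 1

  length-partsFrom : ∀ i d → length (partsFrom i d) ≡ nparts d
  length-partsFrom i [] = refl
  length-partsFrom i (k ∷ d) = trans (LP.length-++ (replicate k i)) (cong₂ _+_ (LP.length-replicate k) (length-partsFrom (suc i) d))

  sum-replicate : ∀ k i → sum (replicate k i) ≡ i * k
  sum-replicate zero i = sym (ℕP.*-zeroʳ i)
  sum-replicate (suc k) i = trans (cong (i +_) (sum-replicate k i)) (sym (ℕP.*-suc i k))

  sum-partsFrom : ∀ i d → sum (partsFrom i d) ≡ weightFrom i d
  sum-partsFrom i [] = refl
  sum-partsFrom i (k ∷ d) = trans (SP.sum-++ (replicate k i) (partsFrom (suc i) d)) (cong₂ _+_ (sum-replicate k i) (sum-partsFrom (suc i) d))

  parts-range : ∀ i d → All (λ b → i ≤ b × b < i + length d) (partsFrom i d)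
  parts-range i [] = []
  parts-range i (k ∷ d) = AllP.++⁺ (rep k)
    (All.map (λ {b} (p , q) → ℕP.<⇒≤ p , subst (b <_) (sym (ℕP.+-suc i (length d))) q) (parts-range (suc i) d))
    where
    rep : ∀ k → All (λ b → i ≤ b × b < i + suc (length d)) (replicate k i)
    rep zero = []
    rep (suc k) = (ℕP.≤-refl , ℕP.m<m+n i (s≤s z≤n)) ∷ rep k

  cnt-parts : ∀ i d j → cnt (_≡ᵇ i + j) (partsFrom i d) ≡ mult d j
  cnt-parts i [] j = refl
  cnt-parts i (k ∷ d) zero = trans (cnt-++ (_≡ᵇ i + 0) (replicate k i) (partsFrom (suc i) d)) (trans (cong₂ _+_
      (trans (cnt-all (_≡ᵇ i + 0) (replicate k i) (λ b m → trans (cong (λ c → c ≡ᵇ i + 0) (rep k m)) (eqb i))) (LP.length-replicate k))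
      (cnt-none (_≡ᵇ i + 0) (partsFrom (suc i) d) λ b m → gt b (subst (_< b) (sym (ℕP.+-identityʳ i)) (proj₁ (All.lookup (parts-range (suc i) d) m)))))
    (ℕP.+-identityʳ k))
    where
    rep : ∀ k {b} → b ∈ replicate k i → b ≡ i
    rep (suc k) (here q) = q
    rep (suc k) (there m) = rep k m
    eqb : ∀ i → (i ≡ᵇ i + 0) ≡ true
    eqb zero = refl
    eqb (suc i) = eqb i
    gt : ∀ {a} b → a < b → (b ≡ᵇ a) ≡ false
    gt {zero} (suc b) _ = refl
    gt {suc a} (suc b) (s≤s l) = gt b l
  cnt-parts i (k ∷ d) (suc j) = trans (cnt-++ (_≡ᵇ i + suc j) (replicate k i) (partsFrom (suc i) d)) (cong₂ _+_
      (cnt-none (_≡ᵇ i + suc j) (replicate k i) λ b m → trans (cong (λ c → c ≡ᵇ i + suc j) (rep k m)) (neq i))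
      (trans (cong (λ l → cnt (_≡ᵇ l) (partsFrom (suc i) d)) (ℕP.+-suc i j)) (cnt-parts (suc i) d j)))
    where
    rep : ∀ k {b} → b ∈ replicate k i → b ≡ i
    rep (suc k) (here q) = q
    rep (suc k) (there m) = rep k m
    neq : ∀ i → (i ≡ᵇ i + suc j) ≡ false
    neq zero = refl
    neq (suc i) = neq i

  -- A permutation with prescribed cycle lengths arises from shorter cycles by merging one fixed point at a time.
  prescribed : ∀ {n} (L : List (Fin n)) → Unique L → ∀ β → All (1 ≤_) β → sum β ≡ length L →
    ∃₂ λ f cs → Decomp f cs × concat cs ↭ L × map length cs ≡ β × Inj f
  prescribed [] u [] _ _ = id , [] , decomp [] [] (λ _ _ → refl) , ↭r , refl , λ _ _ p → p
  prescribed [] u (zero ∷ β) (() ∷ _) _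
  prescribed [] u (suc b ∷ β) _ ()
  prescribed (e ∷ L) u [] _ ()
  prescribed (e ∷ L) u (zero ∷ β) (() ∷ _) _
  prescribed (e ∷ L) (a ∷ u) (suc zero ∷ β) (_ ∷ h) s with prescribed L u β h (ℕP.suc-injective s)
  ... | f , cs , decomp cy un fx , p , l , inj = f , (e ∷ []) ∷ cs ,
    decomp (fx e (λ m → ∉-head (a ∷ u) (↭P.∈-resp-↭ p m)) ∷ cy) (All.tabulate (λ m q → All.lookup a (↭P.∈-resp-↭ p m) q) ∷ un)
      (λ x n → fx x (λ m → n (there m))) , prep e p , cong (1 ∷_) l , inj
  prescribed (e ∷ L) (a ∷ u) (suc (suc b) ∷ β) (_ ∷ h) s with prescribed L u (suc b ∷ β) (s≤s z≤n ∷ h) (ℕP.suc-injective s)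
  ... | f , ((j ∷ xs) ∷ cs) , dec , p , l , inj = (λ x → f (τ e j x)) , (e ∷ (xs ++ []) ++ j ∷ []) ∷ cs ,
    merge [] j xs dec′ , ↭t (↭-sym (merge-↭ {f = f} e [] [] j xs cs)) (prep e p) ,
    cong₂ _∷_ (trans (cong suc (trans (LP.length-++ (xs ++ [])) (trans (cong (λ l → length l + 1) (LP.++-identityʳ xs)) (ℕP.+-comm (length xs) 1))))
        (cong suc (LP.∷-injectiveˡ l))) (LP.∷-injectiveʳ l) ,
    τ-Inj inj e j
    where
    e∉ : e ∉ concat ((j ∷ xs) ∷ cs)
    e∉ m = ∉-head (a ∷ u) (↭P.∈-resp-↭ p m)
    dec′ : Decomp f ((e ∷ []) ∷ (j ∷ xs) ∷ cs)
    dec′ = decomp (Decomp.fixed dec e e∉ ∷ Decomp.cycles dec) (All.tabulate (λ m q → All.lookup a (↭P.∈-resp-↭ p m) q) ∷ Decomp.unique dec)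
      (λ x n → Decomp.fixed dec x (λ m → n (there m)))

  module _ {n m : ℕ} where

    -- Inverses are not available in words, but x is reached from its image by iterating the permutation.
    word-step : ∀ (t : Tuple n m) → (∀ l → IsPerm (lookup t l)) → ∀ {x y} → conn (edgesOf t) x y → ∃ λ ws → applyWord t ws x ≡ y
    word-step t p = proj₁ ∘ conn-min E (edgesOf t) edge
      where
      R : Fin n → Fin n → Set
      R x y = (∃ λ ws → applyWord t ws x ≡ y) × (∃ λ ws → applyWord t ws y ≡ x)
      word-++ : ∀ us vs x → applyWord t (us ++ vs) x ≡ applyWord t us (applyWord t vs x)
      word-++ [] vs x = refl
      word-++ (l ∷ us) vs x = cong (lookup (lookup t l)) (word-++ us vs x)
      E : Equiv R
      E = record { rfl = ([] , refl) , ([] , refl) ; sm = λ (a , b) → b , a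
        ; tr = λ { ((us , refl) , (us′ , a)) ((vs , refl) , (vs′ , b)) →
            (vs ++ us , word-++ vs us _) , (us′ ++ vs′ , trans (word-++ us′ vs′ _) (trans (cong (applyWord t us′) b) a)) } }
      word-iter : ∀ l k x → applyWord t (replicate k l) x ≡ iter (lookup t l) k x
      word-iter l zero x = refl
      word-iter l (suc k) x = cong (lookup (lookup t l)) (word-iter l k x)
      edge : ∀ {a b} → (a , b) ∈ edgesOf t → R a b
      edge {a} h with edge-inv t h
      ... | l , refl with decomposition (allFin n) (UP.allFin⁺ n) (lookup (lookup t l)) (p l) (λ x q → ⊥-elim (q (∈-allFin x)))
      ... | cs , dec , cs↭ with find-cycle cs (↭P.∈-resp-↭ (↭-sym cs↭) (∈-allFin a))
      ... | d₁ , d₂ , c₁ , c₂ , refl = (l ∷ [] , refl) , back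
        where
        f = lookup t l
        cyc : Path (lookup f) a (c₂ ++ c₁) a
        cyc = Cyc-rotate c₁ a c₂ (All.head (AllP.++⁻ʳ d₁ (Decomp.cycles dec)))
        back : ∃ λ ws → applyWord t ws (lookup f a) ≡ a
        back = replicate (length (c₂ ++ c₁)) l , trans (word-iter l (length (c₂ ++ c₁)) (lookup f a))
          (trans (sym (iter-shift f (length (c₂ ++ c₁)) a)) (proj₂ (path-iter f a (c₂ ++ c₁) cyc)))

    word-conn : ∀ (t : Tuple n m) ws x → conn (edgesOf t) x (applyWord t ws x)
    word-conn t [] x = conn-refl (edgesOf t)
    word-conn t (l ∷ ws) x = conn-trans (edgesOf t) (word-conn t ws x) (conn-edge (edgesOf t) (edge∈ t l _))

  count-value : {A : Set} {P Q : A → Set} {k : ℕ} {q : ℚ} → (∀ t → P t → Q t) → (∀ t → Q t → P t) →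
    IsCount Q k → Count P q → ℕtoℚ k ≡ q
  count-value f g ic c with count-resp f g c
  ... | k′ , ic′ , e = trans (cong ℕtoℚ (IsCount-unique ic ic′)) e

  -- The support is the whole set and the level is m, so no point has to be fixed. `small` makes the
  -- truncated subtraction in `Good` exact.
  module Genus0 (N n : ℕ) (d : List ℕ) (f : Fin n → Fin n) (e : Fin n) (cs : List (List (Fin n)))
                (len : suc (length cs) ≡ nparts d) (small : nparts d ≤ N * n) where

    π : Vec (Fin n) n
    π = tabulate f

    Planar′ : Tuple n (suc N) → Set
    Planar′ t = Sys (suc N) e (allFin n) f [] t × totalCycles t + suc (length cs) + length (allFin n) ≡ suc N * n + 2

    to-Good : ∀ t → Planar′ t → Good (suc N) n π d t
    to-Good t (s , q) = perm , (λ x → trans (prod x) (sym (VP.lookup∘tabulate f x))) ,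
        (λ x y → word-step t perm (conn-trans (edgesOf t) (conn-sym (edgesOf t) (conn-S x (∈-allFin x))) (conn-S y (∈-allFin y)))) ,
        ℕP.+-cancelʳ-≡ (nparts d + n) _ _ (trans (trans (sym (ℕP.+-assoc T (nparts d) n))
          (trans (cong₂ (λ a b → T + a + b) (sym len) (sym (LP.length-tabulate {n = n} id))) q))
          (trans (solve 2 (λ n x → n :+ x :+ con 2 := x :+ (con 2 :+ n)) refl n (N * n))
            (trans (cong (_+ (2 + n)) (sym (ℕP.m∸n+n≡m small)))
              (solve 3 (λ a l n → a :+ l :+ (con 2 :+ n) := a :+ con 2 :+ (l :+ n)) refl (N * n ∸ nparts d) (nparts d) n))))
      where
      open Sys s
      open +-*-Solver
      T = totalCycles t

    from-Good : ∀ t → Good (suc N) n π d t → Planar′ t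
    from-Good t (perm , prod , trn , q) = record
      { perm = perm ; supp = λ l x m → ⊥-elim (m (∈-allFin x)) ; prod = λ x → trans (prod x) (VP.lookup∘tabulate f x)
      ; conn-S = λ x _ → subst (conn (edgesOf t) e) (proj₂ (trn e x)) (word-conn t (proj₁ (trn e x)) e)
      ; fixe = λ l h → ⊥-elim (ℕP.<⇒≱ (FP.toℕ<n l) h) } ,
      trans (cong₂ (λ a b → T + a + b) len (LP.length-tabulate {n = n} id)) (trans (cong (λ a → a + nparts d + n) q)
        (trans (solve 3 (λ a l n → a :+ con 2 :+ l :+ n := n :+ (a :+ l) :+ con 2) refl (N * n ∸ nparts d) (nparts d) n)
          (cong (λ x → n + x + 2) (ℕP.m∸n+n≡m small))))
      where
      open +-*-Solver
      T = totalCycles t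

  length≤sum : ∀ β → All (1 ≤_) β → length β ≤ sum β
  length≤sum [] [] = z≤n
  length≤sum (b ∷ β) (p ∷ ps) = ℕP.+-mono-≤ p (length≤sum β ps)

  cnt-map : {A C : Set} (p : C → Bool) (f : A → C) (xs : List A) → cnt (p ∘ f) xs ≡ cnt p (map f xs)
  cnt-map p f [] = refl
  cnt-map p f (x ∷ xs) with p (f x)
  ... | true = cong suc (cnt-map p f xs)
  ... | false = cnt-map p f xs

  module Planarity (N′ D : ℕ) (g : ℕ → List ℕ → ℕ) (hg : GCounts (suc (suc N′)) g) where
    open AtℚQ N′ D
    open M using (Sh; H; T; τR; N)

    private
      of-permutation : ∀ b γ d → All Admissible (suc b ∷ γ) → suc b ∷ γ ↭ parts d →
        (∃₂ λ (f : Fin (weight d) → Fin (weight d)) cs → Decomp f cs × concat cs ↭ allFin (weight d) × map length cs ≡ suc b ∷ γ × Inj f) →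
        ℕtoℚ (g (weight d) d) ≡ T (suc b) γ
      of-permutation b γ d ad q (f , ((e ∷ xs) ∷ cs) , dec , p , l , inj) = value
        where
        n : ℕ
        n = weight d
        lens : suc (length cs) ≡ nparts d
        lens = trans (trans (sym (LP.length-map length ((e ∷ xs) ∷ cs))) (cong length l)) (trans (↭P.↭-length q) (length-partsFrom 1 d))
        small : nparts d ≤ N * n
        small = ℕP.≤-trans (subst (_≤ n) (trans (↭P.↭-length q) (length-partsFrom 1 d)) (subst (length (suc b ∷ γ) ≤_)
            (trans (SP.sum-↭ q) (sum-partsFrom 1 d)) (length≤sum (suc b ∷ γ) (All.map proj₁ ad)))) (ℕP.m≤m+n n _)
        open Genus0 N n d f e cs lens small
        1≤n : 1 ≤ n
        1≤n = ℕP.≤-trans (s≤s z≤n) (FP.toℕ<n e)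
        π-perm : IsPerm π
        π-perm x y h = inj x y (trans (sym (VP.lookup∘tabulate f x)) (trans h (VP.lookup∘tabulate f y)))
        π-type : CycleType π d
        π-type i = trans (cyclesOfLen-Decomp π ((e ∷ xs) ∷ cs) (Decomp-cong (VP.lookup∘tabulate f) dec) p (suc i))
          (trans (cnt-map (_≡ᵇ suc i) length ((e ∷ xs) ∷ cs)) (trans (cong (cnt (_≡ᵇ suc i)) l)
            (trans (cnt-↭ (_≡ᵇ suc i) q) (cnt-parts 1 d i))))
        arg : H (suc N) (length xs) (map length cs) ≡ T (suc b) γ
        arg = trans (cong₂ (H (suc N)) (ℕP.suc-injective (LP.∷-injectiveˡ l)) (LP.∷-injectiveʳ l)) (M.H-m b γ)
        value : ℕtoℚ (g n d) ≡ T (suc b) γ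
        value = trans (count-value {Q = Good (suc N) n π d} to-Good from-Good (hg n d π 1≤n π-perm π-type)
          (count n n (suc N) e xs cs f (allFin n) (ℕP.≤-reflexive (LP.length-tabulate id)) ℕP.≤-refl (↭-sym p) dec
            (subst (All Admissible) (sym (LP.∷-injectiveʳ l)) (All.tail ad)))) arg

    -- The base point may lie in a cycle of any length that occurs. All these choices count the same
    -- factorizations, so the value does not depend on the distinguished part.
    T-g : ∀ b γ d → All Admissible (b ∷ γ) → b ∷ γ ↭ parts d → ℕtoℚ (g (weight d) d) ≡ T b γ
    T-g zero γ d ((() , _) ∷ _) q
    T-g (suc b) γ d ad q = of-permutation b γ d ad q
      (prescribed (allFin (weight d)) (UP.allFin⁺ (weight d)) (suc b ∷ γ) (All.map proj₁ ad)
        (trans (SP.sum-↭ q) (trans (sum-partsFrom 1 d) (sym (LP.length-tabulate {n = weight d} id)))))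

    posSum-const : ∀ (f : ℕ → Sh) v β pre → (∀ b γ → b ∷ γ ↭ pre ++ β → f b γ ≡ v) →
      posSum (λ b γ → f b (pre ++ γ)) β ≡ ℕtoℚ (sum β) ℚ.* v
    posSum-const f v [] pre h = sym (ℚP.*-zeroˡ v)
    posSum-const f v (b ∷ β) pre h = trans (cong₂ ℚ._+_
        (cong (ℕtoℚ b ℚ.*_) (h b (pre ++ β) (↭-sym (↭P.shift b pre β))))
        (trans (posSum-cong (λ b′ γ → cong (f b′) (sym (LP.++-assoc pre (b ∷ []) γ))) β)
          (posSum-const f v β (pre ++ b ∷ []) λ b′ γ p → h b′ γ (↭t p (↭-reflexive (LP.++-assoc pre (b ∷ []) β))))))
      (trans (sym (ℚP.*-distribʳ-+ v (ℕtoℚ b) (ℕtoℚ (sum β)))) (cong (ℚ._* v) (sym (ℕtoℚ-+ b (sum β)))))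

    -- Marking one of the n points: a part b offers b base points, all with the same count, and the
    -- parts add up to n. This is where θ_z comes from.
    τR-g : ∀ d → length d ≤ D → τR (parts d) ≡ ℕtoℚ (weight d) ℚ.* ℕtoℚ (g (weight d) d)
    τR-g d h = trans (τR-posSum (parts d) adm)
      (trans (posSum-const T (ℕtoℚ (g (weight d) d)) (parts d) [] (λ b γ p → sym (T-g b γ d (↭P.All-resp-↭ (↭-sym p) adm) p)))
        (cong (λ s → ℕtoℚ s ℚ.* ℕtoℚ (g (weight d) d)) (sum-partsFrom 1 d)))
      where
      adm : All Admissible (parts d)
      adm = All.map (λ (p , q) → p , ℕP.≤-trans (ℕP.≤-pred q) h) (parts-range 1 d)

-- Coefficient extraction turns shuffle products into products of series.

module PowerSumProducts where

  open import Defs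
  open import Data.Nat as ℕ using (ℕ; zero; suc; _≤_; z≤n; s≤s; _+_; _*_; _∸_; _^_; _!; NonZero)
  import Data.Nat.Properties as ℕP
  open import Data.Integer using (+_)
  open import Data.Rational as ℚ using (ℚ; 0ℚ)
  import Data.Rational.Properties as ℚP
  import Data.Rational.Unnormalised as ℚᵘ
  import Data.Rational.Unnormalised.Properties as ℚᵘP
  open import Data.List using (List; []; _∷_; _++_; map; concatMap; upTo; replicate)
  import Data.List.Properties as LP
  open import Data.List.Membership.Propositional using (_∈_)
  open import Data.List.Relation.Unary.Any using (here; there)
  open import Data.Product using (_×_; _,_; proj₁; proj₂)
  open import Function using (_∘_)
  open import Relation.Binary.PropositionalEquality using (_≡_; refl; sym; trans; cong; cong₂)
  open Rings
  open GraphsAndCounts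
  open RecursiveCount
  open RationalModel
  open GenusZeroCount

  open Shuffle ℚR using (Sh; _⊠_; _⊞_; one)
  open IntegerSolver ℚR

  frac-* : ∀ a b → 1 ≤ b → ℕtoℚ b ℚ.* frac a b ≡ ℕtoℚ a
  frac-* a (suc b) _ = ℚP.toℚᵘ-injective (ℚᵘP.≃-trans (ℚP.toℚᵘ-homo-* (ℕtoℚ (suc b)) (frac a (suc b)))
    (ℚᵘP.≃-trans (ℚᵘP.*-cong (ℚP.toℚᵘ-fromℚᵘ (ℚᵘ.mkℚᵘ (+ suc b) 0)) (ℚP.toℚᵘ-fromℚᵘ (ℚᵘ.mkℚᵘ (+ a) b)))
      (ℚᵘP.≃-trans (ℚᵘ.*≡* (trans (ℤP.*-identityʳ _) (trans (ℤP.*-comm (+ suc b) (+ a)) (cong (λ x → + a ℤ.* + suc x) (sym (ℕP.+-identityʳ b))))))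
        (ℚᵘP.≃-sym (ℚP.toℚᵘ-fromℚᵘ (ℚᵘ.mkℚᵘ (+ a) 0))))))
    where
    import Data.Integer as ℤ
    import Data.Integer.Properties as ℤP

  ℕtoℚ-cancel : ∀ b {x y} → 1 ≤ b → ℕtoℚ b ℚ.* x ≡ ℕtoℚ b ℚ.* y → x ≡ y
  ℕtoℚ-cancel b {x} {y} h e = trans (sym (undo x)) (trans (cong (frac 1 b ℚ.*_) e) (undo y))
    where
    undo : ∀ x → frac 1 b ℚ.* (ℕtoℚ b ℚ.* x) ≡ x
    undo x = trans (solve 3 (λ f n x → f :* (n :* x) := (n :* f) :* x) refl (frac 1 b) (ℕtoℚ b) x)
      (trans (cong (ℚ._* x) (frac-* 1 b h)) (ℚP.*-identityˡ x))

  recip : ℕ → ℚ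
  recip = frac 1

  recip-* : ∀ a b → 1 ≤ a → 1 ≤ b → recip (a * b) ≡ recip a ℚ.* recip b
  recip-* a b ha hb = ℕtoℚ-cancel (a * b) (ℕP.*-mono-≤ ha hb) (trans (frac-* 1 (a * b) (ℕP.*-mono-≤ ha hb))
    (sym (trans (cong (ℚ._* (recip a ℚ.* recip b)) (ℕtoℚ-* a b))
      (trans (solve 4 (λ a b c d → (a :* b) :* (c :* d) := (a :* c) :* (b :* d)) refl (ℕtoℚ a) (ℕtoℚ b) (recip a) (recip b))
        (cong₂ ℚ._*_ (frac-* 1 a ha) (frac-* 1 b hb))))))

  module _ {A : Set} where

    ∑ : List A → (A → ℚ) → ℚ
    ∑ xs f = sumℚ (map f xs)

    ∑-cong : ∀ xs {f g : A → ℚ} → (∀ x → x ∈ xs → f x ≡ g x) → ∑ xs f ≡ ∑ xs g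
    ∑-cong [] h = refl
    ∑-cong (x ∷ xs) h = cong₂ ℚ._+_ (h x (here refl)) (∑-cong xs λ y m → h y (there m))

    ∑-zero : ∀ xs {f : A → ℚ} → (∀ x → x ∈ xs → f x ≡ 0ℚ) → ∑ xs f ≡ 0ℚ
    ∑-zero [] h = refl
    ∑-zero (x ∷ xs) h = cong₂ ℚ._+_ (h x (here refl)) (∑-zero xs λ y m → h y (there m))

    ∑-++ : ∀ xs ys (f : A → ℚ) → ∑ (xs ++ ys) f ≡ ∑ xs f ℚ.+ ∑ ys f
    ∑-++ [] ys f = sym (ℚP.+-identityˡ _)
    ∑-++ (x ∷ xs) ys f = trans (cong (f x ℚ.+_) (∑-++ xs ys f)) (sym (ℚP.+-assoc (f x) (∑ xs f) (∑ ys f)))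

    ∑-+ : ∀ xs (f g : A → ℚ) → ∑ xs (λ x → f x ℚ.+ g x) ≡ ∑ xs f ℚ.+ ∑ xs g
    ∑-+ [] f g = refl
    ∑-+ (x ∷ xs) f g = trans (cong (f x ℚ.+ g x ℚ.+_) (∑-+ xs f g))
      (solve 4 (λ a b c d → (a :+ b) :+ (c :+ d) := (a :+ c) :+ (b :+ d)) refl (f x) (g x) (∑ xs f) (∑ xs g))

    ∑-*ˡ : ∀ xs a (f : A → ℚ) → ∑ xs (λ x → a ℚ.* f x) ≡ a ℚ.* ∑ xs f
    ∑-*ˡ [] a f = sym (ℚP.*-zeroʳ a)
    ∑-*ˡ (x ∷ xs) a f = trans (cong (a ℚ.* f x ℚ.+_) (∑-*ˡ xs a f)) (sym (ℚP.*-distribˡ-+ a (f x) (∑ xs f)))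

    ∑-*ʳ : ∀ xs a (f : A → ℚ) → ∑ xs (λ x → f x ℚ.* a) ≡ ∑ xs f ℚ.* a
    ∑-*ʳ xs a f = trans (∑-cong xs λ x _ → ℚP.*-comm (f x) a) (trans (∑-*ˡ xs a f) (ℚP.*-comm a (∑ xs f)))

  ∑-swap : ∀ {A B : Set} (xs : List A) (ys : List B) (f : A → B → ℚ) → ∑ xs (λ x → ∑ ys (f x)) ≡ ∑ ys (λ y → ∑ xs (λ x → f x y))
  ∑-swap [] ys f = sym (∑-zero ys λ _ _ → refl)
  ∑-swap (x ∷ xs) ys f = trans (cong (∑ ys (f x) ℚ.+_) (∑-swap xs ys f)) (sym (∑-+ ys (f x) (λ y → ∑ xs (λ x → f x y))))

  ∑-map : ∀ {A B : Set} (xs : List A) (h : A → B) (f : B → ℚ) → ∑ (map h xs) f ≡ ∑ xs (f ∘ h)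
  ∑-map xs h f = cong sumℚ (sym (LP.map-∘ xs))

  ∑-concatMap : ∀ {A B : Set} (xs : List A) (h : A → List B) (f : B → ℚ) → ∑ (concatMap h xs) f ≡ ∑ xs (λ x → ∑ (h x) f)
  ∑-concatMap [] h f = refl
  ∑-concatMap (x ∷ xs) h f = trans (∑-++ (h x) (concatMap h xs) f) (cong (∑ (h x) f ℚ.+_) (∑-concatMap xs h f))

  ∑-upTo-suc : ∀ n (f : ℕ → ℚ) → ∑ (upTo (suc n)) f ≡ f 0 ℚ.+ ∑ (upTo n) (f ∘ suc)
  ∑-upTo-suc n f = cong (f 0 ℚ.+_) (cong sumℚ (trans (LP.map-applyUpTo suc f n) (sym (LP.map-upTo (f ∘ suc) n))))

  AD : ℕ → (ℕ → ℕ → ℚ) → ℚ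
  AD zero X = X 0 0
  AD (suc k) X = X 0 (suc k) ℚ.+ AD k (λ a → X (suc a))

  AD-∑ : ∀ k X → ∑ (upTo (suc k)) (λ j → X j (k ∸ j)) ≡ AD k X
  AD-∑ zero X = ℚP.+-identityʳ (X 0 0)
  AD-∑ (suc k) X = trans (∑-upTo-suc (suc k) (λ j → X j (suc k ∸ j))) (cong (X 0 (suc k) ℚ.+_) (AD-∑ k (λ a → X (suc a))))

  AD-cong : ∀ k {X Y : ℕ → ℕ → ℚ} → (∀ a b → a + b ≡ k → X a b ≡ Y a b) → AD k X ≡ AD k Y
  AD-cong zero h = h 0 0 refl
  AD-cong (suc k) h = cong₂ ℚ._+_ (h 0 (suc k) refl) (AD-cong k λ a b e → h (suc a) b (cong suc e))

  AD-+ : ∀ k X Y → AD k (λ a b → X a b ℚ.+ Y a b) ≡ AD k X ℚ.+ AD k Y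
  AD-+ zero X Y = refl
  AD-+ (suc k) X Y = trans (cong (X 0 (suc k) ℚ.+ Y 0 (suc k) ℚ.+_) (AD-+ k (λ a → X (suc a)) (λ a → Y (suc a))))
    (solve 4 (λ a b c d → (a :+ b) :+ (c :+ d) := (a :+ c) :+ (b :+ d)) refl (X 0 (suc k)) (Y 0 (suc k)) (AD k (λ a → X (suc a))) (AD k (λ a → Y (suc a))))

  AD-*ˡ : ∀ k q X → AD k (λ a b → q ℚ.* X a b) ≡ q ℚ.* AD k X
  AD-*ˡ zero q X = refl
  AD-*ˡ (suc k) q X = trans (cong (q ℚ.* X 0 (suc k) ℚ.+_) (AD-*ˡ k q (λ a → X (suc a)))) (sym (ℚP.*-distribˡ-+ q (X 0 (suc k)) (AD k (λ a → X (suc a)))))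

  AD-left : ∀ k (X : ℕ → ℕ → ℚ) → AD (suc k) (λ a b → ℕtoℚ a ℚ.* X a b) ≡ AD k (λ a b → ℕtoℚ (suc a) ℚ.* X (suc a) b)
  AD-left k X = trans (cong (ℚ._+ AD k (λ a b → ℕtoℚ (suc a) ℚ.* X (suc a) b)) (ℚP.*-zeroˡ (X 0 (suc k)))) (ℚP.+-identityˡ _)

  AD-right : ∀ k (X : ℕ → ℕ → ℚ) → AD (suc k) (λ a b → ℕtoℚ b ℚ.* X a b) ≡ AD k (λ a b → ℕtoℚ (suc b) ℚ.* X a (suc b))
  AD-right zero X = trans (cong (ℕtoℚ 1 ℚ.* X 0 1 ℚ.+_) (ℚP.*-zeroˡ (X 1 0))) (ℚP.+-identityʳ _)
  AD-right (suc k) X = cong (ℕtoℚ (suc (suc k)) ℚ.* X 0 (suc (suc k)) ℚ.+_) (AD-right k (λ a → X (suc a)))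

  AD-total : ∀ k (X : ℕ → ℕ → ℚ) → ℕtoℚ (suc k) ℚ.* AD (suc k) X ≡
    AD k (λ a b → ℕtoℚ (suc a) ℚ.* X (suc a) b) ℚ.+ AD k (λ a b → ℕtoℚ (suc b) ℚ.* X a (suc b))
  AD-total k X = trans (sym (AD-*ˡ (suc k) (ℕtoℚ (suc k)) X)) (trans
    (AD-cong (suc k) λ a b e → trans (cong (λ n → ℕtoℚ n ℚ.* X a b) (sym e)) (trans (cong (ℚ._* X a b) (ℕtoℚ-+ a b)) (ℚP.*-distribʳ-+ (X a b) (ℕtoℚ a) (ℕtoℚ b))))
    (trans (AD-+ (suc k) (λ a b → ℕtoℚ a ℚ.* X a b) (λ a b → ℕtoℚ b ℚ.* X a b)) (cong₂ ℚ._+_ (AD-left k X) (AD-right k X))))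

  zf : ℕ → ℕ → ℕ
  zf i k = i ^ k * k !

  -- The k-th divided power of the derivation ∂ / ∂(p_i / i).
  φ : ℕ → ℕ → Sh → Sh
  φ i k f β = recip (zf i k) ℚ.* f (replicate k i ++ β)

  module _ (i : ℕ) (1≤i : 1 ≤ i) where

    private
      instance
        i≢0 : NonZero i
        i≢0 = ℕ.>-nonZero 1≤i

    zf-pos : ∀ k → 1 ≤ zf i k
    zf-pos k = ℕP.*-mono-≤ (ℕP.m^n>0 i k) (ℕP.1≤n! k)

    zf-suc : ∀ k → zf i (suc k) ≡ (i * suc k) * zf i k
    zf-suc k = ℕP.[m*n]*[o*p]≡[m*o]*[n*p] i (i ^ k) (suc k) (k !)

    φ-suc : ∀ k f β → φ i k (λ γ → f (i ∷ γ)) β ≡ ℕtoℚ (i * suc k) ℚ.* φ i (suc k) f β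
    φ-suc k f β = sym (trans (cong (λ r → ℕtoℚ (i * suc k) ℚ.* (r ℚ.* F))
        (trans (cong recip (zf-suc k)) (recip-* (i * suc k) (zf i k) pos (zf-pos k))))
      (trans (solve 4 (λ n r s f → n :* ((r :* s) :* f) := (n :* r) :* (s :* f)) refl (ℕtoℚ (i * suc k)) (recip (i * suc k)) (recip (zf i k)) F)
        (trans (cong (ℚ._* (recip (zf i k) ℚ.* F)) (frac-* 1 (i * suc k) pos)) (ℚP.*-identityˡ _))))
      where
      F = f (i ∷ (replicate k i ++ β))
      pos : 1 ≤ i * suc k
      pos = ℕP.*-mono-≤ 1≤i (s≤s z≤n)

    ⊠-scaleˡ : ∀ q f g β → ((λ γ → q ℚ.* f γ) ⊠ g) β ≡ q ℚ.* (f ⊠ g) β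
    ⊠-scaleˡ q f g [] = ℚP.*-assoc q (f []) (g [])
    ⊠-scaleˡ q f g (b ∷ β) = trans (cong₂ ℚ._+_ (⊠-scaleˡ q (λ γ → f (b ∷ γ)) g β) (⊠-scaleˡ q f (λ γ → g (b ∷ γ)) β))
      (sym (ℚP.*-distribˡ-+ q (((λ γ → f (b ∷ γ)) ⊠ g) β) ((f ⊠ (λ γ → g (b ∷ γ))) β)))

    ⊠-scaleʳ : ∀ q f g β → (f ⊠ (λ γ → q ℚ.* g γ)) β ≡ q ℚ.* (f ⊠ g) β
    ⊠-scaleʳ q f g [] = solve 3 (λ q f g → f :* (q :* g) := q :* (f :* g)) refl q (f []) (g [])
    ⊠-scaleʳ q f g (b ∷ β) = trans (cong₂ ℚ._+_ (⊠-scaleʳ q (λ γ → f (b ∷ γ)) g β) (⊠-scaleʳ q f (λ γ → g (b ∷ γ)) β))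
      (sym (ℚP.*-distribˡ-+ q (((λ γ → f (b ∷ γ)) ⊠ g) β) ((f ⊠ (λ γ → g (b ∷ γ))) β)))

    -- For divided powers the Leibniz rule has no binomial coefficients. The induction step is
    -- proved after multiplication by i (k + 1), where AD-total distributes the factor k + 1 over
    -- the two indices.
    φ-⊠ : ∀ k f g β → φ i k (f ⊠ g) β ≡ AD k (λ a b → (φ i a f ⊠ φ i b g) β)
    φ-⊠ zero f g β = trans (ℚP.*-identityˡ ((f ⊠ g) β)) (⊠-cong {f} {φ i 0 f} {g} {φ i 0 g} (λ γ → sym (ℚP.*-identityˡ (f γ))) (λ γ → sym (ℚP.*-identityˡ (g γ))) β)
    φ-⊠ (suc k) f g β = ℕtoℚ-cancel (i * suc k) (ℕP.*-mono-≤ 1≤i (s≤s z≤n)) (trans (sym (φ-suc k (f ⊠ g) β))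
      (trans (ℚP.*-distribˡ-+ (recip (zf i k)) ((f′ ⊠ g) R) ((f ⊠ g′) R))
      (trans (cong₂ ℚ._+_ (trans (φ-⊠ k f′ g β) (AD-cong k λ a b _ → left a b)) (trans (φ-⊠ k f g′ β) (AD-cong k λ a b _ → right a b)))
      (trans (cong₂ ℚ._+_ (AD-*ˡ k (ℕtoℚ i) (λ a b → ℕtoℚ (suc a) ℚ.* X (suc a) b)) (AD-*ˡ k (ℕtoℚ i) (λ a b → ℕtoℚ (suc b) ℚ.* X a (suc b))))
      (trans (sym (ℚP.*-distribˡ-+ (ℕtoℚ i) (AD k (λ a b → ℕtoℚ (suc a) ℚ.* X (suc a) b)) (AD k (λ a b → ℕtoℚ (suc b) ℚ.* X a (suc b)))))
      (trans (cong (ℕtoℚ i ℚ.*_) (sym (AD-total k X))) (trans (sym (ℚP.*-assoc (ℕtoℚ i) (ℕtoℚ (suc k)) (AD (suc k) X)))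
        (cong (ℚ._* AD (suc k) X) (sym (ℕtoℚ-* i (suc k)))))))))))
      where
      f′ g′ : Sh
      f′ γ = f (i ∷ γ)
      g′ γ = g (i ∷ γ)
      R = replicate k i ++ β
      X : ℕ → ℕ → ℚ
      X a b = (φ i a f ⊠ φ i b g) β
      pull : ∀ a Y → ℕtoℚ (i * suc a) ℚ.* Y ≡ ℕtoℚ i ℚ.* (ℕtoℚ (suc a) ℚ.* Y)
      pull a Y = trans (cong (ℚ._* Y) (ℕtoℚ-* i (suc a))) (ℚP.*-assoc (ℕtoℚ i) (ℕtoℚ (suc a)) Y)
      left : ∀ a b → (φ i a f′ ⊠ φ i b g) β ≡ ℕtoℚ i ℚ.* (ℕtoℚ (suc a) ℚ.* X (suc a) b)
      left a b = trans (⊠-cong {φ i a f′} {λ γ → ℕtoℚ (i * suc a) ℚ.* φ i (suc a) f γ} {φ i b g} (φ-suc a f) (λ _ → refl) β)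
        (trans (⊠-scaleˡ (ℕtoℚ (i * suc a)) (φ i (suc a) f) (φ i b g) β) (pull a (X (suc a) b)))
      right : ∀ a b → (φ i a f ⊠ φ i b g′) β ≡ ℕtoℚ i ℚ.* (ℕtoℚ (suc b) ℚ.* X a (suc b))
      right a b = trans (⊠-cong {φ i a f} {φ i a f} {φ i b g′} {λ γ → ℕtoℚ (i * suc b) ℚ.* φ i (suc b) g γ} (λ _ → refl) (φ-suc b g) β)
        (trans (⊠-scaleʳ (ℕtoℚ (i * suc b)) (φ i a f) (φ i (suc b) g) β) (pull b (X a (suc b))))

  -- The coefficient of Π_i p_i^{d_i} in the series encoded by f.
  Ψ : ℕ → Sh → List ℕ → ℚ
  Ψ i f d = recip (zαFrom i d) ℚ.* f (partsFrom i d)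

  zα-pos : ∀ i d → 1 ≤ i → 1 ≤ zαFrom i d
  zα-pos i [] h = s≤s z≤n
  zα-pos i (k ∷ d) h = ℕP.*-mono-≤ (zf-pos i h k) (zα-pos (suc i) d (s≤s z≤n))

  Ψ-cons : ∀ i k d f → 1 ≤ i → Ψ i f (k ∷ d) ≡ Ψ (suc i) (φ i k f) d
  Ψ-cons i k d f h = trans (cong₂ ℚ._*_ (recip-* (zf i k) (zαFrom (suc i) d) (zf-pos i h k) (zα-pos (suc i) d (s≤s z≤n))) refl)
    (solve 3 (λ a b c → (a :* b) :* c := b :* (a :* c)) refl (recip (zf i k)) (recip (zαFrom (suc i) d)) (f (replicate k i ++ partsFrom (suc i) d)))

  Ψ-cong : ∀ i d {f g : Sh} → (∀ β → f β ≡ g β) → Ψ i f d ≡ Ψ i g d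
  Ψ-cong i d h = cong (recip (zαFrom i d) ℚ.*_) (h (partsFrom i d))

  Ψ-+ : ∀ i f g d → Ψ i (f ⊞ g) d ≡ Ψ i f d ℚ.+ Ψ i g d
  Ψ-+ i f g d = ℚP.*-distribˡ-+ (recip (zαFrom i d)) (f (partsFrom i d)) (g (partsFrom i d))

  Ψ-AD : ∀ i d k (X : ℕ → ℕ → Sh) → Ψ i (λ β → AD k (λ a b → X a b β)) d ≡ AD k (λ a b → Ψ i (X a b) d)
  Ψ-AD i d k X = sym (AD-*ˡ k (recip (zαFrom i d)) (λ a b → X a b (partsFrom i d)))

  private
    ∑-pairs : ∀ {A : Set} {l : ℕ → A → A} k (xs : List A) (f : A → ℚ) →
      ∑ (concatMap (λ j → map (l j) xs) (upTo (suc k))) f ≡ ∑ (upTo (suc k)) (λ j → ∑ xs (λ x → f (l j x)))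
    ∑-pairs {l = l} k xs f = trans (∑-concatMap (upTo (suc k)) (λ j → map (l j) xs) f) (∑-cong (upTo (suc k)) λ j _ → ∑-map xs (l j) f)

  ∑-splits : ∀ k d (f : List ℕ × List ℕ → ℚ) →
    ∑ (splits (k ∷ d)) f ≡ ∑ (upTo (suc k)) (λ j → ∑ (splits d) (λ s → f (j ∷ proj₁ s , (k ∸ j) ∷ proj₂ s)))
  ∑-splits k d f = ∑-pairs k (splits d) f

  -- The multiplicity of the smallest part size is split by `φ-⊠`, after which the next size is
  -- treated with the divided powers as the new functions.
  Ψ-⊠ : ∀ i f g d → 1 ≤ i → ∑ (splits d) (λ s → Ψ i f (proj₁ s) ℚ.* Ψ i g (proj₂ s)) ≡ Ψ i (f ⊠ g) d
  Ψ-⊠ i f g [] h = trans (ℚP.+-identityʳ _) (trans (cong₂ ℚ._*_ (ℚP.*-identityˡ (f [])) (ℚP.*-identityˡ (g []))) (sym (ℚP.*-identityˡ (f [] ℚ.* g []))))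
  Ψ-⊠ i f g (k ∷ d) h = trans (∑-splits k d term)
    (trans (∑-cong (upTo (suc k)) λ j _ →
        trans (∑-cong (splits d) λ s _ → cong₂ ℚ._*_ (Ψ-cons i j (proj₁ s) f h) (Ψ-cons i (k ∸ j) (proj₂ s) g h))
          (Ψ-⊠ (suc i) (φ i j f) (φ i (k ∸ j) g) d (s≤s z≤n)))
    (trans (AD-∑ k (λ a b → Ψ (suc i) (φ i a f ⊠ φ i b g) d))
    (trans (sym (Ψ-AD (suc i) d k (λ a b → φ i a f ⊠ φ i b g)))
    (trans (Ψ-cong (suc i) d (λ β → sym (φ-⊠ i h k f g β))) (sym (Ψ-cons i k d (f ⊠ g) h))))))
    where
    term : List ℕ × List ℕ → ℚ
    term s = Ψ i f (proj₁ s) ℚ.* Ψ i g (proj₂ s)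

-- Series whose degrees in z, x and u are determined by the monomial in the p_i.

module GradedSeries where

  open import Defs
  open import Data.Nat using (ℕ; zero; suc; z≤n; s≤s; _+_; _*_; _∸_)
  import Data.Nat.Properties as ℕP
  open import Data.Rational as ℚ using (ℚ; 0ℚ; 1ℚ)
  import Data.Rational.Properties as ℚP
  open import Data.List using (List; []; _∷_; length; upTo)
  open import Data.List.Membership.Propositional.Properties using (∈-upTo⁻)
  open import Data.Nat.Solver using (module +-*-Solver)
  open import Data.Product using (_×_; _,_; proj₁; proj₂)
  open import Data.Sum using (_⊎_; inj₁; inj₂)
  open import Function using (_∘_)
  open import Relation.Binary.PropositionalEquality using (_≡_; _≢_; refl; sym; trans; cong; cong₂)
  open Rings
  open GenusZeroCount
  open RationalModel
  open PowerSumProducts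

  open Shuffle ℚR using (Sh; _⊠_; _⊞_; one)
  open IntegerSolver ℚR

  data Split : List ℕ → List ℕ → List ℕ → Set where
    [] : Split [] [] []
    _∷_ : ∀ {j l k d d₁ d₂} → j + l ≡ k → Split d d₁ d₂ → Split (k ∷ d) (j ∷ d₁) (l ∷ d₂)

  ∑-splits-cong : ∀ d {f g : List ℕ × List ℕ → ℚ} → (∀ d₁ d₂ → Split d d₁ d₂ → f (d₁ , d₂) ≡ g (d₁ , d₂)) → ∑ (splits d) f ≡ ∑ (splits d) g
  ∑-splits-cong [] h = cong (ℚ._+ 0ℚ) (h [] [] [])
  ∑-splits-cong (k ∷ d) {f} {g} h = trans (∑-splits k d f) (trans
    (∑-cong (upTo (suc k)) λ j m → ∑-splits-cong d λ d₁ d₂ s → h (j ∷ d₁) ((k ∸ j) ∷ d₂) (ℕP.m+[n∸m]≡n (ℕP.≤-pred (∈-upTo⁻ m)) ∷ s))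
    (sym (∑-splits k d g)))

  split-length : ∀ {d d₁ d₂} → Split d d₁ d₂ → length d₁ ≡ length d × length d₂ ≡ length d
  split-length [] = refl , refl
  split-length (_ ∷ s) = cong suc (proj₁ (split-length s)) , cong suc (proj₂ (split-length s))

  split-nparts : ∀ {d d₁ d₂} → Split d d₁ d₂ → nparts d₁ + nparts d₂ ≡ nparts d
  split-nparts [] = refl
  split-nparts {d₁ = j ∷ d₁} {l ∷ d₂} (refl ∷ s) = trans (solve′ j (nparts d₁) l (nparts d₂)) (cong (j + l +_) (split-nparts s))
    where
    solve′ : ∀ a b c d → a + b + (c + d) ≡ a + c + (b + d)
    solve′ = +-*-Solver.solve 4 (λ a b c d → a N.:+ b N.:+ (c N.:+ d) N.:= a N.:+ c N.:+ (b N.:+ d)) refl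
      where module N = +-*-Solver

  split-weight : ∀ {d d₁ d₂} i → Split d d₁ d₂ → weightFrom i d₁ + weightFrom i d₂ ≡ weightFrom i d
  split-weight i [] = refl
  split-weight {d₁ = j ∷ d₁} {l ∷ d₂} i (refl ∷ s) = trans (solve′ i j l (weightFrom (suc i) d₁) (weightFrom (suc i) d₂))
      (cong (i * (j + l) +_) (split-weight (suc i) s))
    where
    solve′ : ∀ i a c b d → i * a + b + (i * c + d) ≡ i * (a + c) + (b + d)
    solve′ = +-*-Solver.solve 5 (λ i a c b d → i N.:* a N.:+ b N.:+ (i N.:* c N.:+ d) N.:= i N.:* (a N.:+ c) N.:+ (b N.:+ d)) refl
      where module N = +-*-Solver

  δ : ℕ → ℕ → ℚ
  δ zero zero = 1ℚ
  δ zero (suc j) = 0ℚ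
  δ (suc i) zero = 0ℚ
  δ (suc i) (suc j) = δ i j

  δ-≢ : ∀ {i j} → i ≢ j → δ i j ≡ 0ℚ
  δ-≢ {zero} {zero} h with () ← h refl
  δ-≢ {zero} {suc j} h = refl
  δ-≢ {suc i} {zero} h = refl
  δ-≢ {suc i} {suc j} h = δ-≢ {i} {j} (h ∘ cong suc)

  ∑-δδ : ∀ n u v → ∑ (upTo (suc n)) (λ i → δ i u ℚ.* δ (n ∸ i) v) ≡ δ n (u + v)
  ∑-δδ n zero v = trans (∑-upTo-suc n (λ i → δ i 0 ℚ.* δ (n ∸ i) v)) (trans
    (cong₂ ℚ._+_ (ℚP.*-identityˡ (δ n v)) (∑-zero (upTo n) {λ i → δ (suc i) 0 ℚ.* δ (n ∸ suc i) v} (λ i _ → ℚP.*-zeroˡ (δ (n ∸ suc i) v)))) (ℚP.+-identityʳ (δ n v)))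
  ∑-δδ zero (suc u) v = trans (ℚP.+-identityʳ (0ℚ ℚ.* δ 0 v)) (ℚP.*-zeroˡ (δ 0 v))
  ∑-δδ (suc n) (suc u) v = trans (∑-upTo-suc (suc n) (λ i → δ i (suc u) ℚ.* δ (suc n ∸ i) v))
    (trans (cong₂ ℚ._+_ (ℚP.*-zeroˡ (δ (suc n) v)) (∑-δδ n u v)) (ℚP.+-identityˡ (δ n (u + v))))

  ∑-level : ∀ {S : Set} n (ss : List S) (u v : S → ℕ) (R : S → ℚ) →
    ∑ (upTo (suc n)) (λ i → ∑ ss (λ s → (δ i (u s) ℚ.* δ (n ∸ i) (v s)) ℚ.* R s)) ≡ ∑ ss (λ s → δ n (u s + v s) ℚ.* R s)
  ∑-level n ss u v R = trans (∑-swap (upTo (suc n)) ss (λ i s → (δ i (u s) ℚ.* δ (n ∸ i) (v s)) ℚ.* R s))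
    (∑-cong ss λ s _ → trans (∑-*ʳ (upTo (suc n)) (R s) (λ i → δ i (u s) ℚ.* δ (n ∸ i) (v s))) (cong (ℚ._* R s) (∑-δδ n (u s) (v s))))

  -- The series encoded by f, with each monomial p^d multiplied by z^{u d} x^{v d} u^{y d}.
  L : (u v y : List ℕ → ℕ) → Sh → Series
  L u v y f n a b d = δ n (u d) ℚ.* (δ a (v d) ℚ.* (δ b (y d) ℚ.* Ψ 1 f d))

  private
    ∑⁴-cong : ∀ {S : Set} {l g : ℕ → ℕ → ℕ → S → ℚ} n a b (ss : List S) → (∀ i j k s → l i j k s ≡ g i j k s) →
      ∑ (upTo n) (λ i → ∑ (upTo a) (λ j → ∑ (upTo b) (λ k → ∑ ss (l i j k)))) ≡ ∑ (upTo n) (λ i → ∑ (upTo a) (λ j → ∑ (upTo b) (λ k → ∑ ss (g i j k))))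
    ∑⁴-cong n a b ss h = ∑-cong (upTo n) λ i _ → ∑-cong (upTo a) λ j _ → ∑-cong (upTo b) λ k _ → ∑-cong ss λ s _ → h i j k s

  ⊛-∑ : ∀ (F H : Series) n a b d → (F ⊛ H) n a b d ≡
    ∑ (upTo (suc n)) (λ i → ∑ (upTo (suc a)) (λ j → ∑ (upTo (suc b)) (λ k → ∑ (splits d) (λ s →
      F i j k (proj₁ s) ℚ.* H (n ∸ i) (a ∸ j) (b ∸ k) (proj₂ s)))))
  ⊛-∑ F H n a b d = ∑⁴-cong (suc n) (suc a) (suc b) (splits d) λ i j k s → refl

  module _ (u₁ v₁ y₁ : List ℕ → ℕ) (f : Sh) (u₂ v₂ y₂ : List ℕ → ℕ) (g : Sh) (u v y : List ℕ → ℕ) where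

    -- Additivity of the degrees is asked only where the left factor has a nonzero coefficient. This
    -- admits left factors with another grading, such as u p_b, which has degree 0 in z and x.
    Graded : List ℕ → Set
    Graded d = ∀ d₁ d₂ → Split d d₁ d₂ → Ψ 1 f d₁ ≡ 0ℚ ⊎ (u₁ d₁ + u₂ d₂ ≡ u d × v₁ d₁ + v₂ d₂ ≡ v d × y₁ d₁ + y₂ d₂ ≡ y d)

    L-⊛ : ∀ n a b d → Graded d → (L u₁ v₁ y₁ f ⊛ L u₂ v₂ y₂ g) n a b d ≡ L u v y (f ⊠ g) n a b d
    L-⊛ n a b d gr = trans (⊛-∑ (L u₁ v₁ y₁ f) (L u₂ v₂ y₂ g) n a b d) (trans
      (∑-cong (upTo (suc n)) λ i _ → trans (∑-cong (upTo (suc a)) λ j _ → trans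
          (∑-cong (upTo (suc b)) λ k _ → ∑-cong ss λ s _ → r₁ (δ i (U s)) (δ j (V s)) (δ k (Y s)) (P s) (δ (n ∸ i) (U′ s)) (δ (a ∸ j) (V′ s)) (δ (b ∸ k) (Y′ s)) (Q s))
          (trans (∑-level b ss Y Y′ (λ s → (δ j (V s) ℚ.* δ (a ∸ j) (V′ s)) ℚ.* ((δ i (U s) ℚ.* δ (n ∸ i) (U′ s)) ℚ.* (P s ℚ.* Q s))))
            (∑-cong ss λ s _ → r₂ (δ b (Y s + Y′ s)) (δ j (V s) ℚ.* δ (a ∸ j) (V′ s)) ((δ i (U s) ℚ.* δ (n ∸ i) (U′ s))) (P s ℚ.* Q s))))
        (trans (∑-level a ss V V′ (λ s → (δ i (U s) ℚ.* δ (n ∸ i) (U′ s)) ℚ.* (δ b (Y s + Y′ s) ℚ.* (P s ℚ.* Q s))))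
          (∑-cong ss λ s _ → r₃ (δ a (V s + V′ s)) (δ i (U s) ℚ.* δ (n ∸ i) (U′ s)) (δ b (Y s + Y′ s) ℚ.* (P s ℚ.* Q s)))))
      (trans (∑-level n ss U U′ (λ s → δ a (V s + V′ s) ℚ.* (δ b (Y s + Y′ s) ℚ.* (P s ℚ.* Q s))))
        (trans (∑-splits-cong d λ d₁ d₂ sp → fin d₁ d₂ (gr d₁ d₂ sp))
          (trans (∑-*ˡ ss (δ n (u d)) (λ s → δ a (v d) ℚ.* (δ b (y d) ℚ.* (P s ℚ.* Q s)))) (cong (δ n (u d) ℚ.*_)
            (trans (∑-*ˡ ss (δ a (v d)) (λ s → δ b (y d) ℚ.* (P s ℚ.* Q s))) (cong (δ a (v d) ℚ.*_)
              (trans (∑-*ˡ ss (δ b (y d)) (λ s → P s ℚ.* Q s)) (cong (δ b (y d) ℚ.*_) (Ψ-⊠ 1 f g d (s≤s z≤n)))))))))))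
      where
      ss = splits d
      U V Y U′ V′ Y′ : List ℕ × List ℕ → ℕ
      U = u₁ ∘ proj₁
      V = v₁ ∘ proj₁
      Y = y₁ ∘ proj₁
      U′ = u₂ ∘ proj₂
      V′ = v₂ ∘ proj₂
      Y′ = y₂ ∘ proj₂
      P Q : List ℕ × List ℕ → ℚ
      P s = Ψ 1 f (proj₁ s)
      Q s = Ψ 1 g (proj₂ s)
      r₁ : ∀ a b c p a′ b′ c′ q → (a ℚ.* (b ℚ.* (c ℚ.* p))) ℚ.* (a′ ℚ.* (b′ ℚ.* (c′ ℚ.* q))) ≡ (c ℚ.* c′) ℚ.* ((b ℚ.* b′) ℚ.* ((a ℚ.* a′) ℚ.* (p ℚ.* q)))
      r₁ = solve 8 (λ a b c p a′ b′ c′ q → (a :* (b :* (c :* p))) :* (a′ :* (b′ :* (c′ :* q))) := (c :* c′) :* ((b :* b′) :* ((a :* a′) :* (p :* q)))) refl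
      r₂ : ∀ a b c p → a ℚ.* (b ℚ.* (c ℚ.* p)) ≡ b ℚ.* (c ℚ.* (a ℚ.* p))
      r₂ = solve 4 (λ a b c p → a :* (b :* (c :* p)) := b :* (c :* (a :* p))) refl
      r₃ : ∀ a b c → a ℚ.* (b ℚ.* c) ≡ b ℚ.* (a ℚ.* c)
      r₃ = solve 3 (λ a b c → a :* (b :* c) := b :* (a :* c)) refl
      zero³ : ∀ a b c q → a ℚ.* (b ℚ.* (c ℚ.* (0ℚ ℚ.* q))) ≡ 0ℚ
      zero³ a b c q = trans (cong (λ z → a ℚ.* (b ℚ.* (c ℚ.* z))) (ℚP.*-zeroˡ q)) (trans (cong (λ z → a ℚ.* (b ℚ.* z)) (ℚP.*-zeroʳ c))
        (trans (cong (a ℚ.*_) (ℚP.*-zeroʳ b)) (ℚP.*-zeroʳ a)))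
      fin : ∀ d₁ d₂ → Ψ 1 f d₁ ≡ 0ℚ ⊎ (u₁ d₁ + u₂ d₂ ≡ u d × v₁ d₁ + v₂ d₂ ≡ v d × y₁ d₁ + y₂ d₂ ≡ y d) →
        δ n (u₁ d₁ + u₂ d₂) ℚ.* (δ a (v₁ d₁ + v₂ d₂) ℚ.* (δ b (y₁ d₁ + y₂ d₂) ℚ.* (P (d₁ , d₂) ℚ.* Q (d₁ , d₂)))) ≡
        δ n (u d) ℚ.* (δ a (v d) ℚ.* (δ b (y d) ℚ.* (P (d₁ , d₂) ℚ.* Q (d₁ , d₂))))
      fin d₁ d₂ (inj₁ z) = trans (cong (λ p → δ n (u₁ d₁ + u₂ d₂) ℚ.* (δ a (v₁ d₁ + v₂ d₂) ℚ.* (δ b (y₁ d₁ + y₂ d₂) ℚ.* (p ℚ.* Q (d₁ , d₂))))) z)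
        (trans (zero³ (δ n (u₁ d₁ + u₂ d₂)) (δ a (v₁ d₁ + v₂ d₂)) (δ b (y₁ d₁ + y₂ d₂)) (Q (d₁ , d₂)))
          (trans (sym (zero³ (δ n (u d)) (δ a (v d)) (δ b (y d)) (Q (d₁ , d₂))))
            (cong (λ p → δ n (u d) ℚ.* (δ a (v d) ℚ.* (δ b (y d) ℚ.* (p ℚ.* Q (d₁ , d₂))))) (sym z))))
      fin d₁ d₂ (inj₂ (p , q , r)) = cong₂ (λ α β → δ n α ℚ.* β) p (cong₂ (λ α β → δ a α ℚ.* β) q (cong (λ α → δ b α ℚ.* (P (d₁ , d₂) ℚ.* Q (d₁ , d₂))) r))

-- Uniqueness of the solution w.

module UniqueSolution where

  open import Defs
  open import Data.Nat using (ℕ; zero; suc; _≤_; _<_; z≤n; s≤s; _+_; _*_; _∸_)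
  import Data.Nat.Properties as ℕP
  open import Data.Nat.Combinatorics using (_C_)
  open import Data.Rational as ℚ using (ℚ)
  import Data.Rational.Properties as ℚP
  open import Data.List using (length; upTo)
  open import Data.List.Membership.Propositional.Properties using (∈-upTo⁻)
  open import Data.Product using (proj₁; proj₂)
  open import Relation.Binary.PropositionalEquality using (_≡_; refl; sym; trans; cong; cong₂; subst)
  open PowerSumProducts
  open GradedSeries

  -- The bound D on the length of exponent vectors is needed because the explicit solution involves
  -- p_1, ..., p_D only. Splitting a vector preserves its length, so products respect the bound.
  EqOn : ℕ → ℕ → Series → Series → Set
  EqOn D k F G = ∀ n a b d → n < k → length d ≤ D → F n a b d ≡ G n a b d

  module _ {D : ℕ} where

    EqOn-refl : ∀ {k} F → EqOn D k F F
    EqOn-refl F n a b d _ _ = refl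

    EqOn-trans : ∀ {k F G H} → EqOn D k F G → EqOn D k G H → EqOn D k F H
    EqOn-trans p q n a b d h l = trans (p n a b d h l) (q n a b d h l)

    ⊕-cong : ∀ {k F F′ H H′} → EqOn D k F F′ → EqOn D k H H′ → EqOn D k (F ⊕ H) (F′ ⊕ H′)
    ⊕-cong p q n a b d h l = cong₂ ℚ._+_ (p n a b d h l) (q n a b d h l)

    ⊛-cong : ∀ {k F F′ H H′} → EqOn D k F F′ → EqOn D k H H′ → EqOn D k (F ⊛ H) (F′ ⊛ H′)
    ⊛-cong {k} {F} {F′} {H} {H′} p q n a b d h l = trans (⊛-∑ F H n a b d) (trans
      (∑-cong (upTo (suc n)) λ i m → ∑-cong (upTo (suc a)) λ j _ → ∑-cong (upTo (suc b)) λ c _ → ∑-splits-cong d λ d₁ d₂ s →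
        cong₂ ℚ._*_ (p i j c d₁ (ℕP.≤-<-trans (ℕP.≤-pred (∈-upTo⁻ m)) h) (subst (_≤ D) (sym (proj₁ (split-length s))) l))
          (q (n ∸ i) (a ∸ j) (b ∸ c) d₂ (ℕP.≤-<-trans (ℕP.m∸n≤m n i) h) (subst (_≤ D) (sym (proj₂ (split-length s))) l)))
      (sym (⊛-∑ F′ H′ n a b d)))

    -- The factor z gains one order, which makes the equation for w contracting.
    zS-⊛-cong : ∀ {k H H′} → EqOn D k H H′ → EqOn D (suc k) (zS ⊛ H) (zS ⊛ H′)
    zS-⊛-cong {k} {H} {H′} q n a b d h l = trans (⊛-∑ zS H n a b d) (trans
      (∑-cong (upTo (suc n)) λ i m → ∑-cong (upTo (suc a)) λ j _ → ∑-cong (upTo (suc b)) λ c _ → ∑-splits-cong d λ d₁ d₂ s →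
        term i j c d₁ d₂ (∈-upTo⁻ m) (subst (_≤ D) (sym (proj₂ (split-length s))) l))
      (sym (⊛-∑ zS H′ n a b d)))
      where
      term : ∀ i j c d₁ d₂ → i < suc n → length d₂ ≤ D → zS i j c d₁ ℚ.* H (n ∸ i) (a ∸ j) (b ∸ c) d₂ ≡ zS i j c d₁ ℚ.* H′ (n ∸ i) (a ∸ j) (b ∸ c) d₂
      term zero j c d₁ d₂ _ _ = trans (ℚP.*-zeroˡ (H n (a ∸ j) (b ∸ c) d₂)) (sym (ℚP.*-zeroˡ (H′ n (a ∸ j) (b ∸ c) d₂)))
      term (suc i) j c d₁ d₂ (s≤s i<n) l′ = cong (zS (suc i) j c d₁ ℚ.*_)
        (q (n ∸ suc i) (a ∸ j) (b ∸ c) d₂ (ℕP.<-≤-trans (ℕP.∸-monoʳ-< {n} (s≤s z≤n) i<n) (ℕP.≤-pred h)) l′)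

    powS-cong : ∀ {k F F′} j → EqOn D k F F′ → EqOn D k (powS F j) (powS F′ j)
    powS-cong zero p = EqOn-refl oneS
    powS-cong (suc j) p = ⊛-cong p (powS-cong j p)

    Aof-cong : ∀ {k F F′} m → EqOn D k F F′ → EqOn D k (Aof m F) (Aof m F′)
    Aof-cong {k} {F} {F′} m p n a b d h l = ∑-cong (upTo n) {λ j → ℕtoℚ ((m * suc j ∸ 1) C suc j) ℚ.* (uS ⊛ pS j ⊛ powS F (suc j)) n a b d}
      λ j _ → cong (ℕtoℚ ((m * suc j ∸ 1) C suc j) ℚ.*_) (⊛-cong {F = uS ⊛ pS j} {uS ⊛ pS j} {powS F (suc j)} {powS F′ (suc j)} (EqOn-refl (uS ⊛ pS j)) (powS-cong (suc j) p) n a b d h l)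

  record Solves (D N : ℕ) (F : Series) : Set where
    constructor solves
    field
      equation : ∀ k → EqOn D k F (zS ⊛ powS (xS ⊕ Aof (suc N) F) N)

  solution-unique : ∀ {D N F F′} → Solves D N F → Solves D N F′ → ∀ k → EqOn D k F F′
  solution-unique p q zero n a b d ()
  solution-unique {D} {N} {F} {F′} p q (suc k) n a b d n< l = trans (Solves.equation p (suc k) n a b d n< l) (trans
    (zS-⊛-cong {H = powS (xS ⊕ Aof (suc N) F) N} {powS (xS ⊕ Aof (suc N) F′) N}
      (powS-cong {F = xS ⊕ Aof (suc N) F} {xS ⊕ Aof (suc N) F′} N (⊕-cong {F = xS} {xS} {Aof (suc N) F} {Aof (suc N) F′} (EqOn-refl xS)
        (Aof-cong {F = F} {F′} (suc N) (solution-unique p q k)))) n a b d n< l)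
    (sym (Solves.equation q (suc k) n a b d n< l)))

-- Homogeneity in z, x and u.

module HomogeneousSeries where

  open import Defs
  open import Algebra.Bundles using (CommutativeRing)
  import Algebra.Properties.Semiring.Exp as Exp
  open import Data.Bool as B using (true; false; if_then_else_; _∧_)
  open import Data.Nat using (ℕ; zero; suc; _≤_; z≤n; _+_; _*_; _∸_; _≡ᵇ_)
  import Data.Nat.Properties as ℕP
  open import Data.Nat.Solver using (module +-*-Solver)
  open import Data.Rational as ℚ using (ℚ; 0ℚ; 1ℚ)
  import Data.Rational.Properties as ℚP
  open import Data.List using (List; []; _∷_)
  open import Data.Product using (_×_; _,_)
  open import Data.Sum using (_⊎_; inj₁; inj₂)
  open import Relation.Binary.PropositionalEquality using (_≡_; _≢_; refl; sym; trans; cong; cong₂; subst)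
  open Rings
  open GenusZeroCount
  open RationalModel
  open PowerSumProducts
  open GradedSeries
  open UniqueSolution

  open Shuffle ℚR using (Sh; _⊠_; _⊞_; one)
  open Exp (CommutativeRing.semiring (Shuffle.ring ℚR)) public using () renaming (_^_ to _^⊠_)

  ∧-true : ∀ {a b} → (a ∧ b) ≡ true → a ≡ true × b ≡ true
  ∧-true {true} {true} _ = refl , refl

  ≡ᵇ-true : ∀ {a b} → (a ≡ᵇ b) ≡ true → a ≡ b
  ≡ᵇ-true {a} {b} h = ℕP.≡ᵇ⇒≡ a b (subst B.T (sym h) _)

  δ-∧ : ∀ {q} n i t (X : ℚ) → (if t then q else 0ℚ) ≡ X → (if (n ≡ᵇ i) ∧ t then q else 0ℚ) ≡ δ n i ℚ.* X
  δ-∧ zero zero t X h = trans h (sym (ℚP.*-identityˡ X))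
  δ-∧ zero (suc i) t X h = sym (ℚP.*-zeroˡ X)
  δ-∧ (suc n) zero t X h = sym (ℚP.*-zeroˡ X)
  δ-∧ (suc n) (suc i) t X h = δ-∧ n i t X h

  allZero-facts : ∀ i d → allZero d ≡ true → partsFrom i d ≡ [] × nparts d ≡ 0 × weightFrom i d ≡ 0 × zαFrom i d ≡ 1
  allZero-facts i [] h = refl , refl , refl , refl
  allZero-facts i (zero ∷ d) h with allZero-facts (suc i) d h
  ... | p , q , r , s = p , q , trans (cong (_+ weightFrom (suc i) d) (ℕP.*-zeroʳ i)) r , trans (ℕP.+-identityʳ _) s

  allZero-nil : ∀ i d → partsFrom i d ≡ [] → allZero d ≡ true
  allZero-nil i [] h = refl
  allZero-nil i (zero ∷ d) h = allZero-nil (suc i) d h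

  Ψ-one : ∀ d → (if allZero d then 1ℚ else 0ℚ) ≡ Ψ 1 one d
  Ψ-one d with allZero d in eq
  ... | true with p , _ , _ , z ← allZero-facts 1 d eq = trans (sym (ℚP.*-identityˡ 1ℚ)) (cong₂ (λ a β → recip a ℚ.* one β) (sym z) (sym p))
  ... | false = sym (trans (cong (recip (zα d) ℚ.*_) (nonempty (parts d) λ e → false≢true (trans (sym eq) (allZero-nil 1 d e)))) (ℚP.*-zeroʳ (recip (zα d))))
    where
    false≢true : false ≢ true
    false≢true ()
    nonempty : ∀ β → β ≢ [] → one β ≡ 0ℚ
    nonempty [] h with () ← h refl
    nonempty (_ ∷ _) h = refl

  Ψ-one-support : ∀ d → Ψ 1 one d ≡ 0ℚ ⊎ (weight d ≡ 0 × nparts d ≡ 0)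
  Ψ-one-support d with allZero d in eq
  ... | true with _ , q , r , _ ← allZero-facts 1 d eq = inj₂ (r , q)
  ... | false = inj₁ (trans (sym (Ψ-one d)) (cong (if_then 1ℚ else 0ℚ) eq))

  L-support : ∀ {u v y u′ v′ y′ f} n a b d → Ψ 1 f d ≡ 0ℚ ⊎ (u d ≡ u′ d × v d ≡ v′ d × y d ≡ y′ d) → L u v y f n a b d ≡ L u′ v′ y′ f n a b d
  L-support {u} {v} {y} {u′} {v′} {y′} {f} n a b d (inj₁ z) = trans (zero³ (u d) (v d) (y d)) (sym (zero³ (u′ d) (v′ d) (y′ d)))
    where
    zero³ : ∀ i j k → δ n i ℚ.* (δ a j ℚ.* (δ b k ℚ.* Ψ 1 f d)) ≡ 0ℚ
    zero³ i j k = trans (cong (λ q → δ n i ℚ.* (δ a j ℚ.* (δ b k ℚ.* q))) z) (trans (cong (λ q → δ n i ℚ.* (δ a j ℚ.* q)) (ℚP.*-zeroʳ (δ b k)))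
      (trans (cong (δ n i ℚ.*_) (ℚP.*-zeroʳ (δ a j))) (ℚP.*-zeroʳ (δ n i))))
  L-support {f = f} n a b d (inj₂ (p , q , r)) = cong₂ (λ i x → δ n i ℚ.* x) p (cong₂ (λ j x → δ a j ℚ.* x) q (cong (λ k → δ b k ℚ.* Ψ 1 f d) r))

  L-cong : ∀ {u v y f g} n a b d → (∀ β → f β ≡ g β) → L u v y f n a b d ≡ L u v y g n a b d
  L-cong {u} {v} {y} n a b d h = cong (λ q → δ n (u d) ℚ.* (δ a (v d) ℚ.* (δ b (y d) ℚ.* q))) (Ψ-cong 1 d h)

  -- With p_b of z-degree b, x-degree N b - 1 and u-degree 1 all series below are homogeneous, so z, x and u may be set to 1.
  module Homogeneous (N′ : ℕ) where

    N : ℕ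
    N = suc N′

    xdeg : List ℕ → ℕ
    xdeg d = N * weight d ∸ nparts d

    nparts≤weight : ∀ i d → nparts d ≤ weightFrom (suc i) d
    nparts≤weight i [] = z≤n
    nparts≤weight i (k ∷ d) = ℕP.+-mono-≤ (ℕP.m≤m+n k (i * k)) (nparts≤weight (suc i) d)

    nparts≤ : ∀ d → nparts d ≤ N * weight d
    nparts≤ d = ℕP.≤-trans (nparts≤weight 0 d) (ℕP.m≤m+n (weight d) _)

    xdeg+nparts : ∀ d → xdeg d + nparts d ≡ N * weight d
    xdeg+nparts d = ℕP.m∸n+n≡m (nparts≤ d)

    split-xdeg : ∀ {d d₁ d₂} → Split d d₁ d₂ → xdeg d₁ + xdeg d₂ ≡ xdeg d
    split-xdeg {d} {d₁} {d₂} s = ℕP.+-cancelʳ-≡ (nparts d) _ _ (trans (cong (xdeg d₁ + xdeg d₂ +_) (sym (split-nparts s)))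
      (trans (solve 4 (λ a b c e → a :+ b :+ (c :+ e) := a :+ c :+ (b :+ e)) refl (xdeg d₁) (xdeg d₂) (nparts d₁) (nparts d₂))
      (trans (cong₂ _+_ (xdeg+nparts d₁) (xdeg+nparts d₂)) (trans (sym (ℕP.*-distribˡ-+ N (weight d₁) (weight d₂)))
        (trans (cong (N *_) (split-weight 1 s)) (sym (xdeg+nparts d)))))))
      where open +-*-Solver

    -- `i` and `j` are the degrees in z and x belonging to the empty monomial. They are 1 and N for
    -- w, which starts with z x^(m-1), then 0 and 1 for A(w), and 0 and 2 for θ_z G.
    Lift : ℕ → ℕ → Sh → Series
    Lift i j = L (λ d → weight d + i) (λ d → xdeg d + j) nparts

    Lift-⊛ : ∀ i j f i′ j′ g n a b d → (Lift i j f ⊛ Lift i′ j′ g) n a b d ≡ Lift (i + i′) (j + j′) (f ⊠ g) n a b d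
    Lift-⊛ i j f i′ j′ g n a b d = L-⊛ (λ d → weight d + i) (λ d → xdeg d + j) nparts f (λ d → weight d + i′) (λ d → xdeg d + j′) nparts g
        (λ d → weight d + (i + i′)) (λ d → xdeg d + (j + j′)) nparts n a b d
      λ d₁ d₂ s → inj₂ (trans (rearr (weight d₁) i (weight d₂) i′) (cong (_+ (i + i′)) (split-weight 1 s)) ,
        trans (rearr (xdeg d₁) j (xdeg d₂) j′) (cong (_+ (j + j′)) (split-xdeg s)) , split-nparts s)
      where
      open +-*-Solver
      rearr : ∀ a b c e → a + b + (c + e) ≡ a + c + (b + e)
      rearr = solve 4 (λ a b c e → a :+ b :+ (c :+ e) := a :+ c :+ (b :+ e)) refl

    Lift-one : ∀ i j n a b d → (if (n ≡ᵇ i) ∧ (a ≡ᵇ j) ∧ (b ≡ᵇ 0) ∧ allZero d then 1ℚ else 0ℚ) ≡ Lift i j one n a b d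
    Lift-one i j n a b d = trans
      (δ-∧ n i ((a ≡ᵇ j) ∧ (b ≡ᵇ 0) ∧ allZero d) (δ a j ℚ.* (δ b 0 ℚ.* Ψ 1 one d))
        (δ-∧ a j ((b ≡ᵇ 0) ∧ allZero d) (δ b 0 ℚ.* Ψ 1 one d) (δ-∧ b 0 (allZero d) (Ψ 1 one d) (Ψ-one d))))
      (L-support {λ _ → i} {λ _ → j} {λ _ → 0} {λ d → weight d + i} {λ d → xdeg d + j} {nparts} {one} n a b d (case (Ψ-one-support d)))
      where
      case : Ψ 1 one d ≡ 0ℚ ⊎ (weight d ≡ 0 × nparts d ≡ 0) → Ψ 1 one d ≡ 0ℚ ⊎ (i ≡ weight d + i × j ≡ xdeg d + j × 0 ≡ nparts d)
      case (inj₁ z) = inj₁ z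
      case (inj₂ (p , q)) = inj₂ (cong (_+ i) (sym p) , cong (_+ j) (sym xdeg0) , sym q)
        where
        xdeg0 : xdeg d ≡ 0
        xdeg0 = trans (cong₂ _∸_ (trans (cong (N *_) p) (ℕP.*-zeroʳ N)) q) refl

    Lift-pow : ∀ {D k} i j f F → EqOn D k F (Lift i j f) → ∀ l → EqOn D k (powS F l) (Lift (l * i) (l * j) (f ^⊠ l))
    Lift-pow i j f F h zero n a b d _ _ = Lift-one 0 0 n a b d
    Lift-pow i j f F h (suc l) n a b d p q = trans (⊛-cong {H = powS F l} {Lift (l * i) (l * j) (f ^⊠ l)} h (Lift-pow i j f F h l) n a b d p q)
      (Lift-⊛ i j f (l * i) (l * j) (f ^⊠ l) n a b d)

    Lift-+ : ∀ i j f g n a b d → Lift i j (f ⊞ g) n a b d ≡ Lift i j f n a b d ℚ.+ Lift i j g n a b d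
    Lift-+ i j f g n a b d = trans (cong (λ q → x ℚ.* (y ℚ.* (z ℚ.* q))) (Ψ-+ 1 f g d)) (lemma x y z (Ψ 1 f d) (Ψ 1 g d))
      where
      open IntegerSolver ℚR
      x = δ n (weight d + i)
      y = δ a (xdeg d + j)
      z = δ b (nparts d)
      lemma : ∀ x y z f g → x ℚ.* (y ℚ.* (z ℚ.* (f ℚ.+ g))) ≡ x ℚ.* (y ℚ.* (z ℚ.* f)) ℚ.+ x ℚ.* (y ℚ.* (z ℚ.* g))
      lemma = solve 5 (λ x y z f g → x :* (y :* (z :* (f :+ g))) := x :* (y :* (z :* f)) :+ x :* (y :* (z :* g))) refl

    Lift-scale : ∀ i j q f n a b d → Lift i j (λ β → q ℚ.* f β) n a b d ≡ q ℚ.* Lift i j f n a b d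
    Lift-scale i j q f n a b d = lemma (δ n (weight d + i)) (δ a (xdeg d + j)) (δ b (nparts d)) (recip (zα d)) q (f (parts d))
      where
      open IntegerSolver ℚR
      lemma : ∀ x y z r q f → x ℚ.* (y ℚ.* (z ℚ.* (r ℚ.* (q ℚ.* f)))) ≡ q ℚ.* (x ℚ.* (y ℚ.* (z ℚ.* (r ℚ.* f))))
      lemma = solve 6 (λ x y z r q f → x :* (y :* (z :* (r :* (q :* f)))) := q :* (x :* (y :* (z :* (r :* f))))) refl

    Lift-zero : ∀ i j f n a b d → f (parts d) ≡ 0ℚ → Lift i j f n a b d ≡ 0ℚ
    Lift-zero i j f n a b d h = trans (cong (λ q → δ n (weight d + i) ℚ.* (δ a (xdeg d + j) ℚ.* (δ b (nparts d) ℚ.* q))) z)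
      (trans (cong (λ q → δ n (weight d + i) ℚ.* (δ a (xdeg d + j) ℚ.* q)) (ℚP.*-zeroʳ (δ b (nparts d))))
        (trans (cong (δ n (weight d + i) ℚ.*_) (ℚP.*-zeroʳ (δ a (xdeg d + j)))) (ℚP.*-zeroʳ (δ n (weight d + i)))))
      where
      z : Ψ 1 f d ≡ 0ℚ
      z = trans (cong (recip (zα d) ℚ.*_) h) (ℚP.*-zeroʳ (recip (zα d)))

    Lift-solves : ∀ {D} c α → (∀ β → c β ≡ (one ⊞ α) β) →
      (∀ k → EqOn D k (Aof (suc N) (Lift 1 N (c ^⊠ N))) (Lift 0 1 α)) → Solves D N (Lift 1 N (c ^⊠ N))
    Lift-solves {D} c α c-α A-eq = solves λ k n a b d n< l →
      sym (trans (⊛-cong {D} {k} {zS} {Lift 1 0 one} {powS (xS ⊕ Aof (suc N) (Lift 1 N (c ^⊠ N))) N} {Lift 0 N (c ^⊠ N)} (λ n a b d _ _ → Lift-one 1 0 n a b d) (pow {k}) n a b d n< l)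
        (trans (Lift-⊛ 1 0 one 0 N (c ^⊠ N) n a b d) (L-cong {λ d → weight d + 1} {λ d → xdeg d + N} {nparts} {one ⊠ (c ^⊠ N)} {c ^⊠ N} n a b d (*-identityˡ (c ^⊠ N)))))
      where
      open CommutativeRing (Shuffle.ring ℚR) using (*-identityˡ)
      X-eq : ∀ {k} → EqOn D k (xS ⊕ Aof (suc N) (Lift 1 N (c ^⊠ N))) (Lift 0 1 c)
      X-eq {k} n a b d n< l = trans (cong₂ ℚ._+_ (Lift-one 0 1 n a b d) (A-eq k n a b d n< l))
        (trans (sym (Lift-+ 0 1 one α n a b d)) (L-cong {λ d → weight d + 0} {λ d → xdeg d + 1} {nparts} {one ⊞ α} {c} n a b d λ β → sym (c-α β)))
      pow : ∀ {k} → EqOn D k (powS (xS ⊕ Aof (suc N) (Lift 1 N (c ^⊠ N))) N) (Lift 0 N (c ^⊠ N))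
      pow {k} = subst (λ i → EqOn D k (powS (xS ⊕ Aof (suc N) (Lift 1 N (c ^⊠ N))) N) (Lift i N (c ^⊠ N))) (ℕP.*-zeroʳ N)
        (subst (λ i → EqOn D k (powS (xS ⊕ Aof (suc N) (Lift 1 N (c ^⊠ N))) N) (Lift (N * 0) i (c ^⊠ N))) (ℕP.*-identityʳ N) (Lift-pow {D} {k} 0 1 c (xS ⊕ Aof (suc N) (Lift 1 N (c ^⊠ N))) (X-eq {k}) N))

-- The explicit series w and A(w).

module ExplicitSolution where

  open import Defs
  open import Data.Bool using (true; false; if_then_else_; _∧_)
  open import Data.Nat as ℕ using (ℕ; zero; suc; _≤_; _<_; z≤n; s≤s; _+_; _*_; _∸_; _≡ᵇ_)
  import Data.Nat.Properties as ℕP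
  open import Data.Nat.Combinatorics using (_C_)
  open import Data.Nat.Solver using (module +-*-Solver)
  open import Data.Rational as ℚ using (ℚ; 0ℚ; 1ℚ)
  import Data.Rational.Properties as ℚP
  open import Data.List using (List; []; _∷_; length; upTo)
  import Data.List.Properties as LP
  open import Data.List.Relation.Unary.All as All using (All; []; _∷_)
  open import Data.List.Relation.Unary.Any using (here)
  open import Data.Product using (_×_; _,_)
  open import Data.Sum using (_⊎_; inj₁; inj₂)
  open import Data.Empty using (⊥-elim)
  open import Function using (_∘_)
  open import Relation.Nullary using (yes; no)
  open import Relation.Binary.PropositionalEquality using (_≡_; _≢_; refl; sym; trans; cong; cong₂; subst)
  open Rings
  open Filtrations
  open Shifts
  open RecurrenceModel
  open GraphsAndCounts
  open RecursiveCount
  open GenusZeroCount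
  open RationalModel
  open PowerSumProducts
  open GradedSeries
  open UniqueSolution
  open HomogeneousSeries

  open Shuffle ℚR using (Sh; _⊠_; _⊞_; one)

  isE-facts : ∀ i j d → isE j d ≡ true → partsFrom i d ≡ (i + j) ∷ [] × nparts d ≡ 1 × weightFrom i d ≡ i + j × zαFrom i d ≡ i + j
  isE-facts i zero (k ∷ d) h with ∧-true {k ≡ᵇ 1} h
  ... | p , q with ≡ᵇ-true {k} {1} p | allZero-facts (suc i) d q
  ... | refl | a , b , c , e = cong₂ _∷_ (sym (ℕP.+-identityʳ i)) a , cong suc b , cong₂ _+_ (ℕP.*-identityʳ i) c ,
    trans (cong₂ _*_ (trans (ℕP.*-identityʳ _) (ℕP.*-identityʳ i)) e) (trans (ℕP.*-identityʳ i) (sym (ℕP.+-identityʳ i)))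
  isE-facts i (suc j) (k ∷ d) h with ∧-true {k ≡ᵇ 0} h
  ... | p , q with ≡ᵇ-true {k} {0} p | isE-facts (suc i) j d q
  ... | refl | a , b , c , e = trans a (cong (_∷ []) (sym (ℕP.+-suc i j))) , b ,
    trans (cong (_+ weightFrom (suc i) d) (ℕP.*-zeroʳ i)) (trans c (sym (ℕP.+-suc i j))) ,
    trans (ℕP.+-identityʳ _) (trans e (sym (ℕP.+-suc i j)))

  isE-single : ∀ i j d → partsFrom i d ≡ (i + j) ∷ [] → isE j d ≡ true
  isE-single i zero (zero ∷ d) h = ⊥-elim (ℕP.<⇒≢ (head (parts-range (suc i) d) h) (sym (ℕP.+-identityʳ i)))
    where
    head : ∀ {β} → All (λ b → suc i ≤ b × b < suc i + length d) β → β ≡ (i + 0) ∷ [] → i < i + 0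
    head ((p , _) ∷ _) refl = p
  isE-single i zero (suc zero ∷ d) h = allZero-nil (suc i) d (LP.∷-injectiveʳ h)
  isE-single i zero (suc (suc k) ∷ d) h with () ← LP.∷-injectiveʳ h
  isE-single i (suc j) (zero ∷ d) h = isE-single (suc i) j d (trans h (cong (_∷ []) (ℕP.+-suc i j)))
  isE-single i (suc j) (suc k ∷ d) h = ⊥-elim (ℕP.m≢1+m+n i (trans (LP.∷-injectiveˡ h) (ℕP.+-suc i j)))

  ∑-upTo-stable : ∀ n k (X : ℕ → ℚ) → (∀ j → n ≤ j → X j ≡ 0ℚ) → ∑ (upTo (n + k)) X ≡ ∑ (upTo n) X
  ∑-upTo-stable zero k X h = ∑-zero (upTo k) λ j _ → h j z≤n
  ∑-upTo-stable (suc n) k X h = trans (∑-upTo-suc (n + k) X) (trans (cong (X 0 ℚ.+_) (∑-upTo-stable n k (X ∘ suc) λ j l → h (suc j) (s≤s l))) (sym (∑-upTo-suc n X)))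

  ∑-upTo-same : ∀ n D (X : ℕ → ℚ) → (∀ j → n ≤ j ⊎ D ≤ j → X j ≡ 0ℚ) → ∑ (upTo n) X ≡ ∑ (upTo D) X
  ∑-upTo-same n D X h = trans (sym (∑-upTo-stable n D X λ j l → h j (inj₁ l)))
    (trans (cong (λ k → ∑ (upTo k) X) (ℕP.+-comm n D)) (∑-upTo-stable D n X λ j l → h j (inj₂ l)))

  ∑-upTo-last : ∀ n (X : ℕ → ℚ) → ∑ (upTo (suc n)) X ≡ X n ℚ.+ ∑ (upTo n) X
  ∑-upTo-last zero X = refl
  ∑-upTo-last (suc n) X = trans (∑-upTo-suc (suc n) X) (trans (cong (X 0 ℚ.+_) (∑-upTo-last n (X ∘ suc)))
    (trans (x∙yz≈y∙xz (X 0) (X (suc n)) (∑ (upTo n) (X ∘ suc))) (cong (X (suc n) ℚ.+_) (sym (∑-upTo-suc n X)))))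
    where
    open import Algebra.Bundles using (CommutativeMonoid)
    open import Algebra.Properties.CommutativeSemigroup (CommutativeMonoid.commutativeSemigroup ℚP.+-0-commutativeMonoid) using (x∙yz≈y∙xz)

  module Explicit (N′ D : ℕ) where
    open AtℚQ N′ D
    open M using (p; nat-⊠; fC; natK)
    open Homogeneous N′
    open Shift M.R N using (∑R)

    p-Ψ : ∀ j d → (if isE j d then 1ℚ else 0ℚ) ≡ Ψ 1 (p j) d
    p-Ψ j d with isE j d in eq
    ... | true with q , _ , _ , z ← isE-facts 1 j d eq = sym (trans (cong₂ (λ a β → recip a ℚ.* p j β) z q)
      (trans (cong (recip (suc j) ℚ.*_) (trans (∂p-≡ j []) (natK-ℚ (suc j)))) (trans (ℚP.*-comm (recip (suc j)) (ℕtoℚ (suc j))) (frac-* 1 (suc j) (s≤s z≤n)))))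
    ... | false = sym (trans (cong (recip (zα d) ℚ.*_) (off (parts d) λ e → false≢true (trans (sym eq) (isE-single 1 j d e)))) (ℚP.*-zeroʳ (recip (zα d))))
      where
      false≢true : false ≢ true
      false≢true ()
      off : ∀ β → β ≢ suc j ∷ [] → p j β ≡ 0ℚ
      off [] h = refl
      off (b ∷ []) h with b ≡ᵇ suc j in e
      ... | false = refl
      ... | true = ⊥-elim (h (cong (_∷ []) (≡ᵇ-true {b} {suc j} e)))
      off (_ ∷ _ ∷ _) h = refl

    p-support : ∀ j d → Ψ 1 (p j) d ≡ 0ℚ ⊎ (nparts d ≡ 1 × weight d ≡ suc j)
    p-support j d with isE j d in eq
    ... | true with _ , q , r , _ ← isE-facts 1 j d eq = inj₂ (q , r)
    ... | false = inj₁ (trans (sym (p-Ψ j d)) (cong (if_then 1ℚ else 0ℚ) eq))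

    p-⊠-zero : ∀ j h β → All (_≢ suc j) β → (p j ⊠ h) β ≡ 0ℚ
    p-⊠-zero j h [] [] = ℚP.*-zeroˡ (h [])
    p-⊠-zero j h (b ∷ β) (ne ∷ nes) = cong₂ ℚ._+_
      (trans (⊠-cong {∂p j b} {M.zer} {h} {h} (∂p-≢ j b (≡ᵇ-≢ ne)) (λ _ → refl) β) (M.zero-⊠ h β)) (p-⊠-zero j (λ γ → h (b ∷ γ)) β nes)

    uS-L : ∀ n a b d → uS n a b d ≡ L (λ _ → 0) (λ _ → 0) (λ _ → 1) one n a b d
    uS-L n a b d = δ-∧ n 0 ((a ≡ᵇ 0) ∧ (b ≡ᵇ 1) ∧ allZero d) (δ a 0 ℚ.* (δ b 1 ℚ.* Ψ 1 one d))
      (δ-∧ a 0 ((b ≡ᵇ 1) ∧ allZero d) (δ b 1 ℚ.* Ψ 1 one d) (δ-∧ b 1 (allZero d) (Ψ 1 one d) (Ψ-one d)))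

    pS-L : ∀ j n a b d → pS j n a b d ≡ L (λ _ → 0) (λ _ → 0) (λ _ → 0) (p j) n a b d
    pS-L j n a b d = δ-∧ n 0 ((a ≡ᵇ 0) ∧ (b ≡ᵇ 0) ∧ isE j d) (δ a 0 ℚ.* (δ b 0 ℚ.* Ψ 1 (p j) d))
      (δ-∧ a 0 ((b ≡ᵇ 0) ∧ isE j d) (δ b 0 ℚ.* Ψ 1 (p j) d) (δ-∧ b 0 (isE j d) (Ψ 1 (p j) d) (p-Ψ j d)))

    -- With b = j + 1, the factor u p_b brings no z and no x, but w^b brings z^b x^(N b). This is
    -- the degree b of p_b in z, and its degree N b - 1 in x together with the offset 1.
    term-Lift : ∀ {k} j h F → EqOn D k F (Lift (suc j) (suc j * N) h) → EqOn D k (uS ⊛ pS j ⊛ F) (Lift 0 1 (p j ⊠ h))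
    term-Lift {k} j h F hF = EqOn-trans {F = uS ⊛ pS j ⊛ F} {up ⊛ Lift (suc j) (suc j * N) h} (⊛-cong {F = uS ⊛ pS j} {up} {F} {Lift (suc j) (suc j * N) h} up-eq hF) prod
      where
      zz : List ℕ → ℕ
      zz _ = 0
      oo : List ℕ → ℕ
      oo _ = 1
      up : Series
      up = L zz zz oo (p j)
      up-eq : EqOn D k (uS ⊛ pS j) up
      up-eq n a b d l l′ = trans (⊛-cong {F = uS} {L zz zz oo one} {pS j} {L zz zz zz (p j)} (λ n a b d _ _ → uS-L n a b d) (λ n a b d _ _ → pS-L j n a b d) n a b d l l′)
        (trans (L-⊛ zz zz oo one zz zz zz (p j) zz zz oo n a b d λ d₁ d₂ s → inj₂ (refl , refl , refl))
          (L-cong {zz} {zz} {oo} {one ⊠ p j} {p j} n a b d (M.R.*-identityˡ (p j))))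
      prod : EqOn D k (up ⊛ Lift (suc j) (suc j * N) h) (Lift 0 1 (p j ⊠ h))
      prod n a b d _ _ = L-⊛ zz zz oo (p j) (λ d → weight d + suc j) (λ d → xdeg d + suc j * N) nparts h
          (λ d → weight d + 0) (λ d → xdeg d + 1) nparts n a b d λ d₁ d₂ s → grade d₁ d₂ s (p-support j d₁)
        where
        open +-*-Solver
        grade : ∀ d₁ d₂ → Split d d₁ d₂ → Ψ 1 (p j) d₁ ≡ 0ℚ ⊎ (nparts d₁ ≡ 1 × weight d₁ ≡ suc j) →
          Ψ 1 (p j) d₁ ≡ 0ℚ ⊎ (weight d₂ + suc j ≡ weight d + 0 × xdeg d₂ + suc j * N ≡ xdeg d + 1 × 1 + nparts d₂ ≡ nparts d)
        grade d₁ d₂ s (inj₁ z) = inj₁ z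
        grade d₁ d₂ s (inj₂ (q , r)) = inj₂ (
          trans (cong (weight d₂ +_) (sym r)) (trans (ℕP.+-comm (weight d₂) (weight d₁)) (trans (split-weight 1 s) (sym (ℕP.+-identityʳ _)))) ,
          trans (cong (xdeg d₂ +_) (trans (ℕP.*-comm (suc j) N) (trans (cong (N *_) (sym r)) (sym (xdeg+nparts d₁)))))
            (trans (solve 3 (λ x y z → x :+ (y :+ z) := (y :+ x) :+ z) refl (xdeg d₂) (xdeg d₁) (nparts d₁)) (cong₂ _+_ (split-xdeg s) q)) ,
          trans (cong (_+ nparts d₂) (sym q)) (split-nparts s))

    w : Sh
    w = M.c ^⊠ N

    Ã-term : ℕ → Sh
    Ã-term j = (p j ⊠ (w ^⊠ suc j)) ⊠ M.B.nat (fC j)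

    Ã : Sh
    Ã = ∑R D Ã-term

    Lift-∑ : ∀ i j D f n a b d → Lift i j (∑R D f) n a b d ≡ ∑ (upTo D) (λ l → Lift i j (f l) n a b d)
    Lift-∑ i j zero f n a b d = Lift-zero i j M.zer n a b d refl
    Lift-∑ i j (suc D) f n a b d = trans (Lift-+ i j (f D) (∑R D f) n a b d)
      (trans (cong (Lift i j (f D) n a b d ℚ.+_) (Lift-∑ i j D f n a b d)) (sym (∑-upTo-last D (λ l → Lift i j (f l) n a b d))))

    Ã-term-Lift : ∀ j n a b d → Lift 0 1 (Ã-term j) n a b d ≡ ℕtoℚ (fC j) ℚ.* Lift 0 1 (p j ⊠ (w ^⊠ suc j)) n a b d
    Ã-term-Lift j n a b d = trans (L-cong {λ d → weight d + 0} {λ d → xdeg d + 1} {nparts} {Ã-term j} {λ β → ℕtoℚ (fC j) ℚ.* X β} n a b d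
        λ β → trans (M.R.*-comm X (M.B.nat (fC j)) β) (trans (nat-⊠ (fC j) X β) (cong (ℚ._* X β) (natK-ℚ (fC j)))))
      (Lift-scale 0 1 (ℕtoℚ (fC j)) X n a b d)
      where
      X : Sh
      X = p j ⊠ (w ^⊠ suc j)

    -- Reconciles the ranges of two sums: one stops at the degree n in z, the other at the number D
    -- of variables. Beyond either of them p_(j+1) does not occur, since a part exceeds neither the
    -- weight nor the length of `d`.
    vanish : ∀ j h n a b d → length d ≤ D → n ≤ j ⊎ D ≤ j → Lift 0 1 (p j ⊠ h) n a b d ≡ 0ℚ
    vanish j h n a b d l (inj₂ D≤) = Lift-zero 0 1 (p j ⊠ h) n a b d (p-⊠-zero j h (parts d)
      (All.map (λ (_ , q) e → ℕP.<⇒≱ q (ℕP.≤-trans (s≤s (ℕP.≤-trans l D≤)) (ℕP.≤-reflexive (sym e)))) (parts-range 1 d)))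
    vanish j h n a b d l (inj₁ n≤) with n ℕ.≟ weight d + 0
    ... | no ne = trans (cong (ℚ._* (δ a (xdeg d + 1) ℚ.* (δ b (nparts d) ℚ.* Ψ 1 (p j ⊠ h) d))) (δ-≢ ne)) (ℚP.*-zeroˡ (δ a (xdeg d + 1) ℚ.* (δ b (nparts d) ℚ.* Ψ 1 (p j ⊠ h) d)))
    ... | yes e = Lift-zero 0 1 (p j ⊠ h) n a b d (p-⊠-zero j h (parts d) (All.tabulate λ {x} m q →
        ℕP.<⇒≱ (s≤s (ℕP.≤-trans (ℕP.≤-reflexive (trans (sym (ℕP.+-identityʳ (weight d))) (sym e))) n≤))
          (subst (_≤ weight d) q (subst (x ≤_) (sum-partsFrom 1 d) (∈⇒≤sum m)))))
      where
      open import Data.List.Membership.Propositional using (_∈_)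
      open import Data.Nat.ListAction using (sum)
      open import Data.List.Relation.Unary.Any using (there)
      ∈⇒≤sum : ∀ {x β} → x ∈ β → x ≤ sum β
      ∈⇒≤sum {β = b ∷ β} (here refl) = ℕP.m≤m+n b (sum β)
      ∈⇒≤sum {β = b ∷ β} (there m) = ℕP.≤-trans (∈⇒≤sum m) (ℕP.m≤n+m (sum β) b)

    binom : ∀ j → (suc N * suc j ∸ 1) C suc j ≡ fC j
    binom j = cong (λ k → (j + k) C suc j) (ℕP.*-comm N (suc j))

    Aof-Lift : ∀ F → (∀ k → EqOn D k F (Lift 1 N w)) → ∀ k → EqOn D k (Aof (suc N) F) (Lift 0 1 Ã)
    Aof-Lift F h k n a b d n< l = trans
      (∑-cong (upTo n) {λ j → ℕtoℚ ((suc N * suc j ∸ 1) C suc j) ℚ.* (uS ⊛ pS j ⊛ powS F (suc j)) n a b d} {X} λ j _ →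
        cong₂ ℚ._*_ (cong ℕtoℚ (binom j)) (term-Lift j (w ^⊠ suc j) (powS F (suc j)) (pow j) n a b d n< l))
      (trans (∑-upTo-same n D X λ j c → trans (cong (ℕtoℚ (fC j) ℚ.*_) (vanish j (w ^⊠ suc j) n a b d l c)) (ℚP.*-zeroʳ (ℕtoℚ (fC j))))
        (trans (∑-cong (upTo D) {X} {λ j → Lift 0 1 (Ã-term j) n a b d} λ j _ → sym (Ã-term-Lift j n a b d)) (sym (Lift-∑ 0 1 D Ã-term n a b d))))
      where
      X : ℕ → ℚ
      X j = ℕtoℚ (fC j) ℚ.* Lift 0 1 (p j ⊠ (w ^⊠ suc j)) n a b d
      pow : ∀ j → EqOn D k (powS F (suc j)) (Lift (suc j) (suc j * N) (w ^⊠ suc j))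
      pow j = subst (λ i → EqOn D k (powS F (suc j)) (Lift i (suc j * N) (w ^⊠ suc j))) (ℕP.*-identityʳ (suc j)) (Lift-pow 1 N w F (h k) (suc j))

    c-Ã : ∀ β → M.c β ≡ (one ⊞ Ã) β
    c-Ã = M.c-eq

    solution : Solves D N (Lift 1 N w)
    solution = Lift-solves M.c Ã c-Ã (Aof-Lift (Lift 1 N w) (λ k → EqOn-refl (Lift 1 N w)))

    A-Lift : ∀ F → F ≈S zS ⊛ powS (xS ⊕ Aof (suc N) F) N → ∀ k → EqOn D k (Aof (suc N) F) (Lift 0 1 Ã)
    A-Lift F eq = Aof-Lift F (solution-unique (solves λ k n a b d _ _ → eq n a b d) solution)

-- The two identities at x = z = u = 1 over the rationals.

module ScalarEquations where

  open import Defs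
  open import Data.Nat as ℕ using (ℕ; suc; _≤_; z≤n; s≤s; _+_; _*_)
  open import Data.Integer using (+_)
  open import Data.Rational as ℚ using (ℚ; 1ℚ)
  import Data.Rational.Properties as ℚP
  open import Data.List using ([]; _∷_; length)
  open import Data.Nat.ListAction using (sum)
  open import Relation.Nullary using (Dec; yes; no)
  open import Relation.Binary.PropositionalEquality using (_≡_; refl; sym; trans; cong; cong₂)
  open Rings
  open ShuffleAlgebra
  open RecurrenceModel
  open GraphsAndCounts
  open GenusZeroCount
  open RationalModel
  open PowerSumProducts
  open GradedSeries
  open UniqueSolution
  open HomogeneousSeries
  open ExplicitSolution

  open Shuffle ℚR using (Sh; _⊠_; _⊞_; one)
  private
    module Z = IntegerSolver ℚR

  frac-scale : ∀ a k b → 1 ≤ b → ℕtoℚ (k * b) ℚ.* frac a b ≡ ℕtoℚ k ℚ.* ℕtoℚ a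
  frac-scale a k b h = trans (cong (ℚ._* frac a b) (ℕtoℚ-* k b)) (trans (ℚP.*-assoc (ℕtoℚ k) (ℕtoℚ b) (frac a b)) (cong (ℕtoℚ k ℚ.*_) (frac-* a b h)))

  δ-subst : ∀ n k → ℕtoℚ n ℚ.* δ n k ≡ ℕtoℚ k ℚ.* δ n k
  δ-subst n k = case (n ℕ.≟ k)
    where
    case : Dec (n ≡ k) → ℕtoℚ n ℚ.* δ n k ≡ ℕtoℚ k ℚ.* δ n k
    case (yes e) = cong (λ l → ℕtoℚ l ℚ.* δ n k) e
    case (no ne) = trans (cong (ℕtoℚ n ℚ.*_) (δ-≢ ne)) (trans (ℚP.*-zeroʳ (ℕtoℚ n)) (sym (trans (cong (ℕtoℚ k ℚ.*_) (δ-≢ ne)) (ℚP.*-zeroʳ (ℕtoℚ k)))))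

  module Equations (N′ D : ℕ) where
    open AtℚQ N′ D
    open Explicit N′ D using (Ã; c-Ã)
    open Homogeneous N′ using (N; xdeg; xdeg+nparts)
    open M using (τR; r1; two; nat-⊠; natK; ωs; ωx; ωz)
    private
      module R = M.R
      module S = IntegerSolver M.R
      nat = M.B.nat

    -- Both sides are c - 1, one by the equation that defines c, the other by the generating
    -- function identity.
    Ã-r1 : ∀ β → Ã β ≡ (nat N ⊠ r1) β
    Ã-r1 β = ℚG.∙-cancelˡ (one β) (Ã β) ((nat N ⊠ r1) β) (trans (sym (c-Ã β)) (M.c-r1′ β))
      where
      module ℚG where
        open import Algebra.Properties.Group ℚP.+-0-group public using (∙-cancelˡ)

    private
      two-⊠ : ∀ f β → (two ⊠ f) β ≡ ℕtoℚ 2 ℚ.* f β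
      two-⊠ f β = trans (R.distribʳ f R.1# R.1# β) (trans (cong₂ ℚ._+_ (R.*-identityˡ f β) (R.*-identityˡ f β)) (dbl (f β)))
        where
        dbl : ∀ x → x ℚ.+ x ≡ ℕtoℚ 2 ℚ.* x
        dbl x = trans (cong₂ ℚ._+_ (sym (ℚP.*-identityˡ x)) (sym (ℚP.*-identityˡ x))) (sym (ℚP.*-distribʳ-+ x 1ℚ 1ℚ))

      nat-ℚ : ∀ n f β → (nat n ⊠ f) β ≡ ℕtoℚ n ℚ.* f β
      nat-ℚ n f β = trans (nat-⊠ n f β) (cong (ℚ._* f β) (natK-ℚ n))

    x-relation : ∀ β → ℕtoℚ N ℚ.* ((ωs ωx β ℚ.+ ℕtoℚ 2) ℚ.* τR β) ≡ ℕtoℚ (suc N) ℚ.* Ã β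
    x-relation β = ℕtoℚ-cancel 2 (s≤s z≤n) (trans (lhs (ℕtoℚ 2) (ℕtoℚ N) (ωs ωx β) (τR β)) (trans (cong (ℕtoℚ N ℚ.*_) pointwise)
        (trans (rhs (ℕtoℚ 2) (ℕtoℚ N) (ℕtoℚ (suc N)) (r1 β)) (cong (λ q → ℕtoℚ 2 ℚ.* (ℕtoℚ (suc N) ℚ.* q)) (sym (trans (Ã-r1 β) (nat-ℚ N r1 β)))))))
      where
      open Z
      lhs : ∀ t n v τ → t ℚ.* (n ℚ.* ((v ℚ.+ t) ℚ.* τ)) ≡ n ℚ.* (v ℚ.* (t ℚ.* τ) ℚ.+ t ℚ.* (t ℚ.* τ))
      lhs = solve 4 (λ t n v τ → t :* (n :* ((v :+ t) :* τ)) := n :* (v :* (t :* τ) :+ t :* (t :* τ))) refl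
      rhs : ∀ t n m r → n ℚ.* (t ℚ.* (m ℚ.* r)) ≡ t ℚ.* (m ℚ.* (n ℚ.* r))
      rhs = solve 4 (λ t n m r → n :* (t :* (m :* r)) := t :* (m :* (n :* r))) refl
      pointwise : ωs ωx β ℚ.* (ℕtoℚ 2 ℚ.* τR β) ℚ.+ ℕtoℚ 2 ℚ.* (ℕtoℚ 2 ℚ.* τR β) ≡ ℕtoℚ 2 ℚ.* (ℕtoℚ (suc N) ℚ.* r1 β)
      pointwise = trans (cong₂ ℚ._+_ (cong (ωs ωx β ℚ.*_) (sym (two-⊠ τR β)))
          (sym (trans (two-⊠ (two ⊠ τR) β) (cong (ℕtoℚ 2 ℚ.*_) (two-⊠ τR β)))))
        (trans (M.x-equation β) (trans (two-⊠ (nat (suc N) ⊠ r1) β) (cong (ℕtoℚ 2 ℚ.*_) (nat-ℚ (suc N) r1 β))))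

    z-relation : ∀ β → ℕtoℚ 2 ℚ.* (ℕtoℚ N ℚ.* ((ℕtoℚ N ℚ.* ωs ωz β ℚ.+ 1ℚ) ℚ.* τR β)) ≡
      ℕtoℚ (suc N) ℚ.* (ℕtoℚ 2 ℚ.* Ã β ℚ.+ (Ã ⊠ Ã) β)
    z-relation β = trans (lhs (ℕtoℚ 2) (ℕtoℚ N) (ωs ωz β) (τR β)) (trans (cong (ℕtoℚ N ℚ.*_) pointwise)
        (trans (rhs (ℕtoℚ 2) (ℕtoℚ N) (ℕtoℚ (suc N)) (r1 β) ((r1 ⊠ r1) β)) (cong₂ (λ q s → ℕtoℚ (suc N) ℚ.* (ℕtoℚ 2 ℚ.* q ℚ.+ s))
          (sym (trans (Ã-r1 β) (nat-ℚ N r1 β))) (sym square))))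
      where
      open Z
      lhs : ∀ t n v τ → t ℚ.* (n ℚ.* ((n ℚ.* v ℚ.+ 1ℚ) ℚ.* τ)) ≡ n ℚ.* (n ℚ.* (v ℚ.* (t ℚ.* τ)) ℚ.+ t ℚ.* τ)
      lhs = solve 4 (λ t n v τ → t :* (n :* ((n :* v :+ con (+ 1)) :* τ)) := n :* (n :* (v :* (t :* τ)) :+ t :* τ)) refl
      rhs : ∀ t n m r s → n ℚ.* (m ℚ.* (t ℚ.* r ℚ.+ n ℚ.* s)) ≡ m ℚ.* (t ℚ.* (n ℚ.* r) ℚ.+ n ℚ.* (n ℚ.* s))
      rhs = solve 5 (λ t n m r s → n :* (m :* (t :* r :+ n :* s)) := m :* (t :* (n :* r) :+ n :* (n :* s))) refl
      square : (Ã ⊠ Ã) β ≡ ℕtoℚ N ℚ.* (ℕtoℚ N ℚ.* (r1 ⊠ r1) β)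
      square = trans (R.*-cong {x = Ã} {y = nat N ⊠ r1} {u = Ã} {v = nat N ⊠ r1} Ã-r1 Ã-r1 β)
        (trans (S.solve 2 (λ n r → (n S.:* r) S.:* (n S.:* r) S.:= n S.:* (n S.:* (r S.:* r))) R.refl (nat N) r1 β)
          (trans (nat-ℚ N (nat N ⊠ (r1 ⊠ r1)) β) (cong (ℕtoℚ N ℚ.*_) (nat-ℚ N (r1 ⊠ r1) β))))
      pointwise : ℕtoℚ N ℚ.* (ωs ωz β ℚ.* (ℕtoℚ 2 ℚ.* τR β)) ℚ.+ ℕtoℚ 2 ℚ.* τR β ≡ ℕtoℚ (suc N) ℚ.* (ℕtoℚ 2 ℚ.* r1 β ℚ.+ ℕtoℚ N ℚ.* (r1 ⊠ r1) β)
      pointwise = trans (cong₂ ℚ._+_ (sym (trans (nat-ℚ N (M.Der ωz (two ⊠ τR)) β) (cong (λ q → ℕtoℚ N ℚ.* (ωs ωz β ℚ.* q)) (two-⊠ τR β)))) (sym (two-⊠ τR β)))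
        (trans (M.z-equation β) (trans (nat-ℚ (suc N) ((two ⊠ r1) ⊞ (nat N ⊠ (r1 ⊠ r1))) β)
          (cong₂ (λ q s → ℕtoℚ (suc N) ℚ.* (q ℚ.+ s)) (two-⊠ r1 β) (nat-ℚ N (r1 ⊠ r1) β))))

    ωz-sum : ∀ β → ωs ωz β ≡ ℕtoℚ (sum β)
    ωz-sum [] = refl
    ωz-sum (b ∷ β) = trans (cong₂ ℚ._+_ (natK-ℚ b) (ωz-sum β)) (sym (ℕtoℚ-+ b (sum β)))

    ωx-sum : ∀ β → ωs ωx β ℚ.+ ℕtoℚ (length β) ≡ ℕtoℚ N ℚ.* ℕtoℚ (sum β)
    ωx-sum [] = sym (ℚP.*-zeroʳ (ℕtoℚ N))
    ωx-sum (b ∷ β) = trans (cong₂ ℚ._+_ (cong (ℚ._+ ωs ωx β) (cong₂ (λ x y → x ℚ.* y ℚ.- 1ℚ) (natK-ℚ N) (natK-ℚ b))) (ℕtoℚ-+ 1 (length β)))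
      (trans (step (ℕtoℚ N) (ℕtoℚ b) (ωs ωx β) (ℕtoℚ (length β))) (trans (cong (ℕtoℚ N ℚ.* ℕtoℚ b ℚ.+_) (ωx-sum β))
        (trans (sym (ℚP.*-distribˡ-+ (ℕtoℚ N) (ℕtoℚ b) (ℕtoℚ (sum β)))) (cong (ℕtoℚ N ℚ.*_) (sym (ℕtoℚ-+ b (sum β)))))))
      where
      open Z
      step : ∀ n b w l → ((n ℚ.* b ℚ.- 1ℚ) ℚ.+ w) ℚ.+ (1ℚ ℚ.+ l) ≡ n ℚ.* b ℚ.+ (w ℚ.+ l)
      step = solve 4 (λ n b w l → ((n :* b :- con (+ 1)) :+ w) :+ (con (+ 1) :+ l) := n :* b :+ (w :+ l)) refl

    -- The weights N b - 1 add up to N n - l, so this derivation multiplies by the x-degree. The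
    -- offset 2 of θ_z G enters in `x-relation`.
    ωx-parts : ∀ d → ωs ωx (parts d) ≡ ℕtoℚ (xdeg d)
    ωx-parts d = ℚG.∙-cancelʳ (ℕtoℚ (nparts d)) (ωs ωx (parts d)) (ℕtoℚ (xdeg d)) (trans (cong (λ l → ωs ωx (parts d) ℚ.+ ℕtoℚ l) (sym (length-partsFrom 1 d)))
      (trans (ωx-sum (parts d)) (trans (sym (ℕtoℚ-* N (sum (parts d)))) (trans (cong ℕtoℚ (trans (cong (N *_) (sum-partsFrom 1 d)) (sym (xdeg+nparts d))))
        (ℕtoℚ-+ (xdeg d) (nparts d))))))
      where
      module ℚG where
        open import Algebra.Properties.Group ℚP.+-0-group public using (∙-cancelʳ)

    x-parts : ∀ d → ℕtoℚ (xdeg d + 2) ℚ.* τR (parts d) ≡ frac (suc N) N ℚ.* Ã (parts d)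
    x-parts d = ℕtoℚ-cancel N (s≤s z≤n) (trans (cong (λ q → ℕtoℚ N ℚ.* (q ℚ.* τR (parts d))) (trans (ℕtoℚ-+ (xdeg d) 2) (cong (ℚ._+ ℕtoℚ 2) (sym (ωx-parts d)))))
      (trans (x-relation (parts d)) (trans (cong (ℚ._* Ã (parts d)) (sym (frac-* (suc N) N (s≤s z≤n)))) (ℚP.*-assoc (ℕtoℚ N) (frac (suc N) N) (Ã (parts d))))))

    z-parts : ∀ d → (ℕtoℚ N ℚ.* ℕtoℚ (weight d) ℚ.+ 1ℚ) ℚ.* τR (parts d) ≡
      frac (suc N) N ℚ.* Ã (parts d) ℚ.+ frac (suc N) (2 * N) ℚ.* (Ã ⊠ Ã) (parts d)
    z-parts d = ℕtoℚ-cancel (2 * N) (s≤s z≤n) (trans (cong₂ ℚ._*_ (ℕtoℚ-* 2 N) (cong (λ q → (ℕtoℚ N ℚ.* q ℚ.+ 1ℚ) ℚ.* τR β) (sym (trans (ωz-sum β) (cong ℕtoℚ (sum-partsFrom 1 d))))))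
      (trans (ℚP.*-assoc (ℕtoℚ 2) (ℕtoℚ N) ((ℕtoℚ N ℚ.* ωs ωz β ℚ.+ 1ℚ) ℚ.* τR β)) (trans (z-relation β)
        (trans (lhs (ℕtoℚ (suc N)) (ℕtoℚ 2) (Ã β) ((Ã ⊠ Ã) β)) (trans (cong₂ (λ q s → q ℚ.* Ã β ℚ.+ s ℚ.* (Ã ⊠ Ã) β)
            (sym (frac-scale (suc N) 2 N (s≤s z≤n))) (sym (frac-* (suc N) (2 * N) (s≤s z≤n))))
          (rhs (ℕtoℚ (2 * N)) (frac (suc N) N) (frac (suc N) (2 * N)) (Ã β) ((Ã ⊠ Ã) β)))))))
      where
      open Z
      β = parts d
      lhs : ∀ m t a s → m ℚ.* (t ℚ.* a ℚ.+ s) ≡ (t ℚ.* m) ℚ.* a ℚ.+ m ℚ.* s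
      lhs = solve 4 (λ m t a s → m :* (t :* a :+ s) := (t :* m) :* a :+ m :* s) refl
      rhs : ∀ k f g a s → (k ℚ.* f) ℚ.* a ℚ.+ (k ℚ.* g) ℚ.* s ≡ k ℚ.* (f ℚ.* a ℚ.+ g ℚ.* s)
      rhs = solve 5 (λ k f g a s → (k :* f) :* a :+ (k :* g) :* s := k :* (f :* a :+ g :* s)) refl

-- From scalar identities to identities of coefficients.

module CoefficientEquations where

  open import Defs
  open import Algebra.Bundles using (CommutativeRing)
  open import Data.Bool using (true; if_then_else_; _∧_)
  import Data.Bool.Properties as BP
  open import Data.Nat as ℕ using (ℕ; zero; suc; _≤_; _+_; _*_; _∸_; _≡ᵇ_)
  import Data.Nat.Properties as ℕP
  open import Data.Integer using (+_)
  open import Data.Rational as ℚ using (ℚ; 0ℚ; 1ℚ)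
  import Data.Rational.Properties as ℚP
  open import Data.List using (List; length)
  open import Relation.Nullary using (Dec; yes; no)
  open import Relation.Binary.PropositionalEquality using (_≡_; refl; sym; trans; cong; cong₂)
  open Rings
  open GenusZeroCount
  open RationalModel
  open PowerSumProducts
  open GradedSeries
  open UniqueSolution
  open HomogeneousSeries
  open ScalarEquations

  open Shuffle ℚR using (Sh; _⊠_; _⊞_; one)
  open IntegerSolver ℚR

  δ-sym : ∀ i j → δ i j ≡ δ j i
  δ-sym zero zero = refl
  δ-sym zero (suc j) = refl
  δ-sym (suc i) zero = refl
  δ-sym (suc i) (suc j) = δ-sym i j

  module Coefficients (N′ : ℕ) (g : ℕ → List ℕ → ℕ) (d : List ℕ) (τ α : Sh)
      (τ-g : τ (parts d) ≡ ℕtoℚ (weight d) ℚ.* ℕtoℚ (g (weight d) d)) where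
    open Homogeneous N′

    private
      m : ℕ
      m = suc N
      xexp : ℕ → ℕ
      xexp n = N * n ∸ nparts d + 2
      coeff : ℕ → ℚ
      coeff n = ℕtoℚ (g n d) ℚ.* frac 1 (zα d)

    GS-δ : ∀ n a b → GS m g (suc n) a b d ≡ δ (suc n) (weight d) ℚ.* (δ b (nparts d) ℚ.* (δ a (xexp (suc n)) ℚ.* coeff (suc n)))
    GS-δ n a b = trans
      (δ-∧ (weight d) (suc n) ((b ≡ᵇ nparts d) ∧ (a ≡ᵇ xexp (suc n))) (δ b (nparts d) ℚ.* (δ a (xexp (suc n)) ℚ.* coeff (suc n)))
        (δ-∧ b (nparts d) (a ≡ᵇ xexp (suc n)) (δ a (xexp (suc n)) ℚ.* coeff (suc n))
          (trans (cong (if_then coeff (suc n) else 0ℚ) (sym (BP.∧-identityʳ (a ≡ᵇ xexp (suc n)))))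
            (δ-∧ a (xexp (suc n)) true (coeff (suc n)) refl))))
      (cong (ℚ._* (δ b (nparts d) ℚ.* (δ a (xexp (suc n)) ℚ.* coeff (suc n)))) (δ-sym (weight d) (suc n)))

    -- For n equal to the weight the factor n meets the count and gives τ by `τ-g`. At n = 0 the
    -- series G has no term, and τ vanishes there by the same hypothesis.
    θz-GS : ∀ n a b → ℕtoℚ n ℚ.* GS m g n a b d ≡ Lift 0 2 τ n a b d
    θz-GS n a b = case n (n ℕ.≟ weight d)
      where
      rest : ℚ
      rest = δ a (xdeg d + 2) ℚ.* (δ b (nparts d) ℚ.* Ψ 1 τ d)
      case : ∀ n → Dec (n ≡ weight d) → ℕtoℚ n ℚ.* GS m g n a b d ≡ δ n (weight d + 0) ℚ.* rest
      case zero (yes e) = trans (ℚP.*-zeroˡ 0ℚ) (sym (Lift-zero 0 2 τ zero a b d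
        (trans τ-g (trans (cong (λ k → ℕtoℚ k ℚ.* ℕtoℚ (g (weight d) d)) (sym e)) (ℚP.*-zeroˡ (ℕtoℚ (g (weight d) d)))))))
      case zero (no ne) = trans (ℚP.*-zeroˡ 0ℚ) (sym (trans (cong (ℚ._* rest) (trans (cong (δ 0) (ℕP.+-identityʳ (weight d))) (δ-≢ ne))) (ℚP.*-zeroˡ rest)))
      case (suc n) (no ne) = trans (cong (ℕtoℚ (suc n) ℚ.*_) (trans (GS-δ n a b) (trans (cong (ℚ._* inner) (δ-≢ ne)) (ℚP.*-zeroˡ inner))))
        (trans (ℚP.*-zeroʳ (ℕtoℚ (suc n))) (sym (trans (cong (ℚ._* rest) (trans (cong (δ (suc n)) (ℕP.+-identityʳ (weight d))) (δ-≢ ne))) (ℚP.*-zeroˡ rest))))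
        where
        inner = δ b (nparts d) ℚ.* (δ a (xexp (suc n)) ℚ.* coeff (suc n))
      case (suc n) (yes e) = trans (cong (ℕtoℚ (suc n) ℚ.*_) (GS-δ n a b))
        (trans (rearr (ℕtoℚ (suc n)) (δ (suc n) (weight d)) (δ b (nparts d)) (δ a (xexp (suc n))) (ℕtoℚ (g (suc n) d)) (frac 1 (zα d)))
          (cong₂ ℚ._*_ (cong (δ (suc n)) (sym (ℕP.+-identityʳ (weight d))))
            (cong₂ ℚ._*_ (cong (λ k → δ a (xexp k)) e) (cong (λ q → δ b (nparts d) ℚ.* (recip (zα d) ℚ.* q))
              (trans (cong (λ k → ℕtoℚ k ℚ.* ℕtoℚ (g k d)) e) (sym τ-g))))))
        where
        rearr : ∀ n x y z q r → n ℚ.* (x ℚ.* (y ℚ.* (z ℚ.* (q ℚ.* r)))) ≡ x ℚ.* (z ℚ.* (y ℚ.* (r ℚ.* (n ℚ.* q))))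
        rearr = solve 6 (λ n x y z q r → n :* (x :* (y :* (z :* (q :* r)))) := x :* (z :* (y :* (r :* (n :* q))))) refl

    module _ {D : ℕ} (l : length d ≤ D) (A : Series) (A-Lift : ∀ k → EqOn D k A (Lift 0 1 α)) where

      first : (ℕtoℚ N ℚ.* ℕtoℚ (weight d) ℚ.+ 1ℚ) ℚ.* τ (parts d) ≡ frac m N ℚ.* α (parts d) ℚ.+ frac m (2 * N) ℚ.* (α ⊠ α) (parts d) →
        ∀ n a b → θz (scale (ℕtoℚ N) (θz (GS m g)) ⊕ GS m g) n a b d ≡ (scale (frac m N) (xS ⊛ A) ⊕ scale (frac m (2 * N)) (A ⊛ A)) n a b d
      first z-eq n a b = trans (rearr (ℕtoℚ n) (ℕtoℚ N) (GS m g n a b d)) (trans (cong ((ℕtoℚ N ℚ.* ℕtoℚ n ℚ.+ 1ℚ) ℚ.*_) (θz-GS n a b))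
        (trans (pull (ℕtoℚ N) (ℕtoℚ n) x y z r (τ (parts d))) (trans (cong (λ q → (ℕtoℚ N ℚ.* q ℚ.+ x) ℚ.* (y ℚ.* (z ℚ.* (r ℚ.* τ (parts d)))))
            (trans (δ-subst n (weight d + 0)) (cong (λ k → ℕtoℚ k ℚ.* x) (ℕP.+-identityʳ (weight d)))))
          (trans (push (ℕtoℚ N) (ℕtoℚ (weight d)) x y z r (τ (parts d))) (trans (cong (λ q → x ℚ.* (y ℚ.* (z ℚ.* (r ℚ.* q)))) z-eq)
            (trans (expand x y z r (frac m N) (α (parts d)) (frac m (2 * N)) ((α ⊠ α) (parts d)))
              (sym (cong₂ (λ p q → frac m N ℚ.* p ℚ.+ frac m (2 * N) ℚ.* q) xA AA))))))))
        where
        x = δ n (weight d + 0)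
        y = δ a (xdeg d + 2)
        z = δ b (nparts d)
        r = recip (zα d)
        xA : (xS ⊛ A) n a b d ≡ Lift 0 2 α n a b d
        xA = trans (⊛-cong {D} {suc n} {F = xS} {Lift 0 1 one} {A} {Lift 0 1 α} (λ n a b d _ _ → Lift-one 0 1 n a b d) (A-Lift (suc n)) n a b d ℕP.≤-refl l)
          (trans (Lift-⊛ 0 1 one 0 1 α n a b d) (L-cong {λ d → weight d + 0} {λ d → xdeg d + 2} {nparts} {one ⊠ α} {α} n a b d (*-identityˡ α)))
          where open CommutativeRing (Shuffle.ring ℚR) using (*-identityˡ)
        AA : (A ⊛ A) n a b d ≡ Lift 0 2 (α ⊠ α) n a b d
        AA = trans (⊛-cong {D} {suc n} {F = A} {Lift 0 1 α} {A} {Lift 0 1 α} (A-Lift (suc n)) (A-Lift (suc n)) n a b d ℕP.≤-refl l) (Lift-⊛ 0 1 α 0 1 α n a b d)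
        rearr : ∀ n N x → n ℚ.* (N ℚ.* (n ℚ.* x) ℚ.+ x) ≡ (N ℚ.* n ℚ.+ 1ℚ) ℚ.* (n ℚ.* x)
        rearr = solve 3 (λ n N x → n :* (N :* (n :* x) :+ x) := (N :* n :+ con (+ 1)) :* (n :* x)) refl
        pull : ∀ N n x y z r t → (N ℚ.* n ℚ.+ 1ℚ) ℚ.* (x ℚ.* (y ℚ.* (z ℚ.* (r ℚ.* t)))) ≡ (N ℚ.* (n ℚ.* x) ℚ.+ x) ℚ.* (y ℚ.* (z ℚ.* (r ℚ.* t)))
        pull = solve 7 (λ N n x y z r t → (N :* n :+ con (+ 1)) :* (x :* (y :* (z :* (r :* t)))) := (N :* (n :* x) :+ x) :* (y :* (z :* (r :* t)))) refl
        push : ∀ N n x y z r t → (N ℚ.* (n ℚ.* x) ℚ.+ x) ℚ.* (y ℚ.* (z ℚ.* (r ℚ.* t))) ≡ x ℚ.* (y ℚ.* (z ℚ.* (r ℚ.* ((N ℚ.* n ℚ.+ 1ℚ) ℚ.* t))))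
        push = solve 7 (λ N n x y z r t → (N :* (n :* x) :+ x) :* (y :* (z :* (r :* t))) := x :* (y :* (z :* (r :* ((N :* n :+ con (+ 1)) :* t))))) refl
        expand : ∀ x y z r f p h q → x ℚ.* (y ℚ.* (z ℚ.* (r ℚ.* (f ℚ.* p ℚ.+ h ℚ.* q)))) ≡
          f ℚ.* (x ℚ.* (y ℚ.* (z ℚ.* (r ℚ.* p)))) ℚ.+ h ℚ.* (x ℚ.* (y ℚ.* (z ℚ.* (r ℚ.* q))))
        expand = solve 8 (λ x y z r f p h q → x :* (y :* (z :* (r :* (f :* p :+ h :* q)))) :=
          f :* (x :* (y :* (z :* (r :* p)))) :+ h :* (x :* (y :* (z :* (r :* q))))) refl

      second : ℕtoℚ (xdeg d + 2) ℚ.* τ (parts d) ≡ frac m N ℚ.* α (parts d) →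
        ∀ n a b → θz (∂x (GS m g)) n a b d ≡ scale (frac m N) A n a b d
      second x-eq n a b = trans (comm (ℕtoℚ n) (ℕtoℚ (suc a)) (GS m g n (suc a) b d)) (trans (cong (ℕtoℚ (suc a) ℚ.*_) (θz-GS n (suc a) b))
        (trans (pull (ℕtoℚ (suc a)) x (δ (suc a) (xdeg d + 2)) z r (τ (parts d))) (trans (cong (λ q → q ℚ.* (x ℚ.* (z ℚ.* (r ℚ.* τ (parts d))))) (δ-subst (suc a) (xdeg d + 2)))
          (trans (push (ℕtoℚ (xdeg d + 2)) (δ (suc a) (xdeg d + 2)) x z r (τ (parts d)))
            -- The derivative in x lowers the offset from 2, that of θ_z G, to 1, that of A(w).
            (trans (cong₂ (λ e q → x ℚ.* (e ℚ.* (z ℚ.* (r ℚ.* q)))) (cong (δ (suc a)) (ℕP.+-suc (xdeg d) 1)) x-eq)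
              (trans (expand x (δ a (xdeg d + 1)) z r (frac m N) (α (parts d))) (cong (frac m N ℚ.*_) (sym (A-Lift (suc n) n a b d ℕP.≤-refl l)))))))))
        where
        x = δ n (weight d + 0)
        z = δ b (nparts d)
        r = recip (zα d)
        comm : ∀ n a q → n ℚ.* (a ℚ.* q) ≡ a ℚ.* (n ℚ.* q)
        comm = solve 3 (λ n a q → n :* (a :* q) := a :* (n :* q)) refl
        pull : ∀ a x y z r t → a ℚ.* (x ℚ.* (y ℚ.* (z ℚ.* (r ℚ.* t)))) ≡ (a ℚ.* y) ℚ.* (x ℚ.* (z ℚ.* (r ℚ.* t)))
        pull = solve 6 (λ a x y z r t → a :* (x :* (y :* (z :* (r :* t)))) := (a :* y) :* (x :* (z :* (r :* t)))) refl
        push : ∀ k y x z r t → (k ℚ.* y) ℚ.* (x ℚ.* (z ℚ.* (r ℚ.* t))) ≡ x ℚ.* (y ℚ.* (z ℚ.* (r ℚ.* (k ℚ.* t))))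
        push = solve 6 (λ k y x z r t → (k :* y) :* (x :* (z :* (r :* t))) := x :* (y :* (z :* (r :* (k :* t))))) refl
        expand : ∀ x y z r f p → x ℚ.* (y ℚ.* (z ℚ.* (r ℚ.* (f ℚ.* p)))) ≡ f ℚ.* (x ℚ.* (y ℚ.* (z ℚ.* (r ℚ.* p))))
        expand = solve 6 (λ x y z r f p → x :* (y :* (z :* (r :* (f :* p)))) := f :* (x :* (y :* (z :* (r :* p))))) refl

-- Assembly of the theorem, one monomial at a time.

open import Defs
import Data.Nat.Properties as ℕP
open import Data.Nat using (ℕ; _≤_; _∸_; _*_)
open import Data.Nat using (suc; s≤s)
open import Data.List using (List)
open import Data.List using (length)
open import Data.Rational using (0ℚ)
open import Data.Rational using (ℚ)
open import Data.Product using (_×_)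
open import Data.Product using (_,_)
open import Relation.Binary.PropositionalEquality using (_≡_)

theorem2 : (m : ℕ) → 2 ≤ m → (g : ℕ → List ℕ → ℕ) → GCounts m g →
    (w : Series) → (∀ a b d → w 0 a b d ≡ 0ℚ) →
    w ≈S zS ⊛ powS (xS ⊕ Aof m w) (m ∸ 1) →
    (θz (scale (ℕtoℚ (m ∸ 1)) (θz (GS m g)) ⊕ GS m g)
    ≈S scale (frac m (m ∸ 1)) (xS ⊛ Aof m w)
    ⊕ scale (frac m (2 * (m ∸ 1))) (Aof m w ⊛ Aof m w))
    × (θz (∂x (GS m g)) ≈S scale (frac m (m ∸ 1)) (Aof m w))
theorem2 (suc ℕ.zero) (s≤s ())
theorem2 (suc (suc N′)) _ g hg w _ w-eq =
  (λ n a b d → C.first g d (τR d) (Ã d) (τ-g d) ℕP.≤-refl A (A-Lift d) (E.z-parts (length d) d) n a b) ,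
  (λ n a b d → C.second g d (τR d) (Ã d) (τ-g d) ℕP.≤-refl A (A-Lift d) (E.x-parts (length d) d) n a b)
  where
  module C = CoefficientEquations.Coefficients N′
  module E = ScalarEquations.Equations N′
  A = Aof (suc (suc N′)) w
  -- Each monomial uses its own algebraic model, with as many variables as its exponent vector has
  -- entries. This includes all variables that can occur, and so no model in infinitely many
  -- variables is needed.
  τR Ã : List ℕ → List ℕ → ℚ
  τR d = RationalModel.AtℚQ.M.τR N′ (length d)
  Ã d = ExplicitSolution.Explicit.Ã N′ (length d)
  τ-g = λ d → GenusZeroCount.Planarity.τR-g N′ (length d) g hg d ℕP.≤-refl
  A-Lift = λ d → ExplicitSolution.Explicit.A-Lift N′ (length d) w w-eq
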